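{- Let $(N_n)_{n\ge 0}$ be the Narayana sequence. Consider the Diophantine equation \[ N_n + N_m = a\left(\frac{b^\ell-1}{b-1}\right) \] in integers $n,m,\ell,a,b$ with $0\le m\le n$, $2\le b\le 100$, $1\le a\le b-1$ and $\ell\ge 3$. This equation has only finitely many solutions, and its solutions $(n,m,\ell,a,b)$ are exactly the following 37 tuples: $(6,5,3,1,2)$, $(7,1,3,1,2)$, $(7,2,3,1,2)$, $(7,3,3,1,2)$, $(8,6,3,1,3)$, $(8,7,4,1,2)$, $(9,0,3,1,3)$, $(9,4,4,1,2)$, $(9,9,3,2,3)$, $(10,4,3,1,4)$, $(11,5,5,1,2)$, $(11,5,3,1,5)$, $(12,1,3,2,4)$, $(12,2,3,2,4)$, $(12,3,3,2,4)$, $(12,4,3,1,6)$, $(13,4,3,2,5)$, $(13,5,6,1,2)$, $(13,5,3,3,4)$, $(13,9,3,1,8)$, $(14,5,3,1,9)$, $(14,12,3,3,6)$, $(15,0,3,3,6)$, $(15,6,3,1,11)$, $(15,11,3,1,12)$, $(15,12,4,2,4)$, $(17,14,3,5,8)$, $(19,7,3,1,24)$, $(19,10,3,2,17)$, $(21,5,3,7,13)$, $(21,15,3,1,37)$, $(21,17,5,1,6)$, $(21,18,3,4,20)$, $(26,20,3,9,32)$, $(26,22,3,2,72)$, $(28,13,3,20,30)$, $(30,18,3,11,60)$. In particular, the equation has no solutions with $\ell\ge 7$.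
   Context: The Narayana sequence $(N_n)_{n\ge0}$ is defined by $N_0=0$, $N_1=N_2=1$ and $N_n=N_{n-1}+N_{n-3}$ for $n\ge 3$ (so it begins $0,1,1,1,2,3,4,6,9,13,19,28,41,60,88,129,\dots$). The right-hand side $a(b^\ell-1)/(b-1)$ is the number whose base-$b$ representation consists of the digit $a$ repeated $\ell$ times. -}

module Defs where

open import Data.Nat using (ℕ; zero; suc; _+_; _*_; _∸_; _^_; _/_; _≤_; NonZero)
open import Data.Product using (_×_; _,_)
open import Data.List using (List; []; _∷_)
open import Relation.Binary.PropositionalEquality using (_≡_; _≢_)

N : ℕ → ℕ
N zero = 0
N (suc zero) = 1
N (suc (suc zero)) = 1
N (suc (suc (suc n))) = N (suc (suc n)) + N n

repdigit : (a b ℓ : ℕ) → .{{NonZero (b ∸ 1)}} → ℕ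
repdigit a b ℓ = a * ((b ^ ℓ ∸ 1) / (b ∸ 1))

Tuple : Set
Tuple = ℕ × ℕ × ℕ × ℕ × ℕ

IsSolution : Tuple → Set
IsSolution (n , m , ℓ , a , b) =
  m ≤ n × 2 ≤ b × b ≤ 100 × 1 ≤ a × a ≤ b ∸ 1 × 3 ≤ ℓ ×
  ((b1 : NonZero (b ∸ 1)) → N n + N m ≡ repdigit a b ℓ {{b1}})

solutions : List Tuple
solutions =
  (6 , 5 , 3 , 1 , 2) ∷ (7 , 1 , 3 , 1 , 2) ∷ (7 , 2 , 3 , 1 , 2) ∷
  (7 , 3 , 3 , 1 , 2) ∷ (8 , 6 , 3 , 1 , 3) ∷ (8 , 7 , 4 , 1 , 2) ∷
  (9 , 0 , 3 , 1 , 3) ∷ (9 , 4 , 4 , 1 , 2) ∷ (9 , 9 , 3 , 2 , 3) ∷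
  (10 , 4 , 3 , 1 , 4) ∷ (11 , 5 , 5 , 1 , 2) ∷ (11 , 5 , 3 , 1 , 5) ∷
  (12 , 1 , 3 , 2 , 4) ∷ (12 , 2 , 3 , 2 , 4) ∷ (12 , 3 , 3 , 2 , 4) ∷
  (12 , 4 , 3 , 1 , 6) ∷ (13 , 4 , 3 , 2 , 5) ∷ (13 , 5 , 6 , 1 , 2) ∷
  (13 , 5 , 3 , 3 , 4) ∷ (13 , 9 , 3 , 1 , 8) ∷ (14 , 5 , 3 , 1 , 9) ∷
  (14 , 12 , 3 , 3 , 6) ∷ (15 , 0 , 3 , 3 , 6) ∷ (15 , 6 , 3 , 1 , 11) ∷
  (15 , 11 , 3 , 1 , 12) ∷ (15 , 12 , 4 , 2 , 4) ∷ (17 , 14 , 3 , 5 , 8) ∷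
  (19 , 7 , 3 , 1 , 24) ∷ (19 , 10 , 3 , 2 , 17) ∷ (21 , 5 , 3 , 7 , 13) ∷
  (21 , 15 , 3 , 1 , 37) ∷ (21 , 17 , 5 , 1 , 6) ∷ (21 , 18 , 3 , 4 , 20) ∷
  (26 , 20 , 3 , 9 , 32) ∷ (26 , 22 , 3 , 2 , 72) ∷ (28 , 13 , 3 , 20 , 30) ∷
  (30 , 18 , 3 , 11 , 60) ∷ []

-- Let α be the real root of x³ = x² + 1. A solution makes (b-1)(αⁿ + αᵐ) and a(3α-2)bˡ relatively close. The proof is
-- elementary throughout: α lives in ℚ(α), ordered by the sign of the norm, so no real numbers are needed.
--
-- Two multiplicatively related powers G₀ μʳ and G₁ νʳ cannot be very close: Siegel's lemma gives an auxiliary function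
-- Σ p(k,l) zᵏ Xˡ in z = i + r j and X = (μ/ν)ⁱ (G₁/G₀)ʲ which is small on a grid, because closeness makes X nearly
-- equal to (μ/ν)ᶻ and the binomial series applies; Liouville's inequality makes it vanish there, and a zero
-- estimate then makes all p(k,l) zero. Dirichlet's theorem on n/ℓ reduces three logarithms to two. Used first with the
-- exponent n (bounding n - m) and then with the exponent m, this gives n < 2⁶⁴⁸.
--
-- Two rounds of Baker-Davenport reduction, with logarithms to base 2 certified by repeated squaring in integer
-- arithmetic, bring this down to n < 1482 and n < 140, where all cases are enumerated.

module Submission where

import Defs
open import Data.Nat as ℕ using (ℕ; zero; suc)
import Data.Nat.Properties as ℕP
import Data.Nat.DivMod as DM
open import Data.Nat.Tactic.RingSolver using () renaming (solve-∀ to ℕsolve-∀)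
open import Data.Integer as ℤ using (ℤ)
import Data.Integer.Properties as ℤP
open import Data.Product using (∃; ∃₂; _×_; _,_; proj₁; proj₂)
open import Data.Sum using (_⊎_; inj₁; inj₂)
open import Data.Empty using (⊥; ⊥-elim)
open import Data.Unit using (tt)
open import Relation.Nullary using (¬_; Dec; yes; no)
open import Relation.Binary.PropositionalEquality hiding (J)
open import Data.Maybe using (Maybe; just; nothing)
open import Algebra.Structures using (IsCommutativeRing)
open import Algebra.Bundles using (CommutativeRing; RawRing)
open import Algebra.Solver.Ring.AlmostCommutativeRing using (_-Raw-AlmostCommutative⟶_; fromCommutativeRing)
import Algebra.Solver.Ring as RS
open import Level using (0ℓ)

-- Siegel's lemma is applied to the binomial coefficients of the auxiliary function, not to its
-- values on the grid. With η = μ/ν each z^k η^(lz) is a combination of binomials of z of which only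
-- the first K + M matter, far fewer than the L K unknowns.
--
-- Two facts about x³ - x² - 1 carry the arithmetic. It has a single real root, so a norm is the
-- value at α times the squared modulus of a conjugate, and its sign is that of the real embedding.
-- It is irreducible modulo 2, so a vanishing norm forces even coordinates; descent makes the norm
-- anisotropic, which gives inverses, Liouville's inequality and α^s ≠ b^t.
--
-- The bound for n - m must leave room for the second use, where n - m enters the height. With n
-- about y⁹, denominators up to y³ and then up to y in Dirichlet's theorem give about y⁶ and y⁸;
-- 2⁶⁴⁸ is y⁹ for y = 2⁷².

-- Ordered fields and inequalities in them

numeral : {A : Set} → (A → A → A) → A → A → ℕ → A
numeral _⊕_ z o zero = z
-- A separate case, so that the numeral 1 is `1#` by definition, as `1-homo` of the ring solver
-- requires.
numeral _⊕_ z o (suc zero) = o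
numeral _⊕_ z o (suc (suc n)) = o ⊕ numeral _⊕_ z o (suc n)

-- The order is given by its positive cone, since in ℚ(α) positivity is a condition on the norm and
-- comparison is derived from it. Propositional equality suits both instances, whose elements have
-- canonical coordinates. The estimates hold in any such field with a root of x³ = x² + 1; ℚ(α) is
-- built only to supply one.
record OrderedField : Set₁ where
  infixl 6 _+_
  infixl 7 _*_
  infix 8 -_
  field
    Carrier : Set
    _+_ _*_ : Carrier → Carrier → Carrier
    -_ : Carrier → Carrier
    0# 1# : Carrier
    isCommutativeRing : IsCommutativeRing _≡_ _+_ _*_ -_ 0# 1#
    Pos : Carrier → Set
    ¬Pos0 : ¬ Pos 0#
    Pos-1 : Pos 1#
    Pos-+ : ∀ {x y} → Pos x → Pos y → Pos (x + y)
    Pos-* : ∀ {x y} → Pos x → Pos y → Pos (x * y)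
    trichotomy : ∀ x → Pos x ⊎ (x ≡ 0# ⊎ Pos (- x))
    inverse : ∀ x → x ≢ 0# → ∃ λ y → x * y ≡ 1#

    archimedean : ∀ x → ∃ λ n → Pos (numeral _+_ 0# 1# n + - x)

  commutativeRing : CommutativeRing 0ℓ 0ℓ
  commutativeRing = record { isCommutativeRing = isCommutativeRing }

  fromℕ : ℕ → Carrier
  fromℕ = numeral _+_ 0# 1#

record NarayanaField : Set₁ where
  field
    orderedField : OrderedField
  open OrderedField orderedField public
  field
    α : Carrier
    α-root : α * α * α ≡ α * α + 1#

module OrderedFieldTheory (F : OrderedField) where
  open import Data.Integer using (+_; -[1+_])
  open OrderedField F public
  open CommutativeRing commutativeRing public
    using (+-comm; +-assoc; *-comm; *-assoc; +-identityˡ; +-identityʳ; *-identityˡ; *-identityʳ; zeroˡ; zeroʳ; distribˡ; distribʳ; -‿inverseʳ; -‿inverseˡ)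
  open import Algebra.Properties.Ring (CommutativeRing.ring commutativeRing) using (-‿distribˡ-*; -‿distribʳ-*; -‿involutive; -0#≈0#; -‿+-comm)

  infixl 6 _-_

  _-_ : Carrier → Carrier → Carrier
  x - y = x + - y

  ι : ℤ → Carrier
  ι (+ n) = fromℕ n
  ι -[1+ n ] = - fromℕ (suc n)

  fromℕ-suc : ∀ n → fromℕ (suc n) ≡ 1# + fromℕ n
  fromℕ-suc zero = sym (+-identityʳ 1#)
  fromℕ-suc (suc n) = refl

  fromℕ-+ : ∀ m n → fromℕ (m ℕ.+ n) ≡ fromℕ m + fromℕ n
  fromℕ-+ zero n = sym (+-identityˡ _)
  fromℕ-+ (suc m) n = trans (fromℕ-suc (m ℕ.+ n)) (trans (cong (λ z → 1# + z) (fromℕ-+ m n)) (trans (sym (+-assoc _ _ _)) (cong (λ z → z + fromℕ n) (sym (fromℕ-suc m)))))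

  fromℕ-* : ∀ m n → fromℕ (m ℕ.* n) ≡ fromℕ m * fromℕ n
  fromℕ-* zero n = sym (zeroˡ _)
  fromℕ-* (suc m) n = trans (fromℕ-+ n (m ℕ.* n)) (trans (cong₂ _+_ (sym (*-identityˡ _)) (fromℕ-* m n)) (trans (sym (distribʳ _ _ _)) (cong (λ z → z * fromℕ n) (sym (fromℕ-suc m)))))

  private
    cancel1 : ∀ x y → x - y ≡ (1# + x) - (1# + y)
    cancel1 x y = sym (trans (cong (λ z → (1# + x) + z) (sym (-‿+-comm 1# y)))
      (trans (cong (λ z → z + (- 1# + - y)) (+-comm 1# x))
      (trans (+-assoc x 1# _) (cong (λ z → x + z)
      (trans (sym (+-assoc 1# _ _)) (trans (cong (λ z → z + - y) (-‿inverseʳ 1#)) (+-identityˡ _)))))))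

  ι-⊖ : ∀ m n → ι (m ℤ.⊖ n) ≡ fromℕ m - fromℕ n
  ι-⊖ zero zero = sym (-‿inverseʳ _)
  ι-⊖ zero (suc n) = sym (+-identityˡ _)
  ι-⊖ (suc m) zero = sym (trans (cong (λ z → fromℕ (suc m) + z) -0#≈0#) (+-identityʳ _))
  ι-⊖ (suc m) (suc n) = trans (cong ι (ℤP.[1+m]⊖[1+n]≡m⊖n m n)) (trans (ι-⊖ m n) (trans (cancel1 _ _) (cong₂ (λ u v → u - v) (sym (fromℕ-suc m)) (sym (fromℕ-suc n)))))

  ι-+ : ∀ x y → ι (x ℤ.+ y) ≡ ι x + ι y
  ι-+ (+ m) (+ n) = fromℕ-+ m n
  ι-+ (+ m) -[1+ n ] = ι-⊖ m (suc n)
  ι-+ -[1+ m ] (+ n) = trans (ι-⊖ n (suc m)) (+-comm _ _)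
  ι-+ -[1+ m ] -[1+ n ] = trans (cong (λ k → - fromℕ (suc k)) (sym (ℕP.+-suc m n)))
    (trans (cong -_ (fromℕ-+ (suc m) (suc n))) (sym (-‿+-comm _ _)))

  ι-neg : ∀ x → ι (ℤ.- x) ≡ - ι x
  ι-neg (+ zero) = sym -0#≈0#
  ι-neg (+ suc n) = refl
  ι-neg -[1+ n ] = sym (-‿involutive _)

  private
    ι+* : ∀ m y → ι (+ m ℤ.* y) ≡ fromℕ m * ι y
    ι+* m (+ n) = trans (cong ι (sym (ℤP.pos-* m n))) (fromℕ-* m n)
    ι+* m -[1+ n ] = trans (cong ι (sym (ℤP.neg-distribʳ-* (+ m) (+ suc n))))
      (trans (ι-neg (+ m ℤ.* + suc n)) (trans (cong -_ (ι+* m (+ suc n))) (-‿distribʳ-* _ _)))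

  ι-* : ∀ x y → ι (x ℤ.* y) ≡ ι x * ι y
  ι-* (+ m) y = ι+* m y
  ι-* -[1+ m ] y = trans (cong ι (sym (ℤP.neg-distribˡ-* (+ suc m) y)))
      (trans (ι-neg (+ suc m ℤ.* y)) (trans (cong -_ (ι+* (suc m) y)) (-‿distribˡ-* _ _)))

  private
    ℤraw : RawRing 0ℓ 0ℓ
    ℤraw = CommutativeRing.rawRing ℤP.+-*-commutativeRing

    ACR = fromCommutativeRing commutativeRing

    ιhom : ℤraw -Raw-AlmostCommutative⟶ ACR
    ιhom = record { ⟦_⟧ = ι ; +-homo = ι-+ ; *-homo = ι-* ; -‿homo = ι-neg ; 0-homo = refl ; 1-homo = refl }

    coeffEq : ∀ x y → Maybe (ι x ≡ ι y)
    coeffEq x y with x ℤP.≟ y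
    ... | yes p = just (cong ι p)
    ... | no _ = nothing

  open RS ℤraw ACR ιhom coeffEq public using (solve; _:=_; _:+_; _:*_; _:-_; :-_; con; Polynomial)

  #_ : ∀ {n} → ℕ → Polynomial n
  # k = con (+ k)

  NonNeg : Carrier → Set
  NonNeg x = Pos x ⊎ x ≡ 0#

  infix 4 _≤_ _<_
  _≤_ _<_ : Carrier → Carrier → Set
  x ≤ y = NonNeg (y - x)
  x < y = Pos (y - x)

  Pos-resp : ∀ {x y} → x ≡ y → Pos x → Pos y
  Pos-resp = subst Pos

  NonNeg-resp : ∀ {x y} → x ≡ y → NonNeg x → NonNeg y
  NonNeg-resp = subst NonNeg

  nn-0 : NonNeg 0#
  nn-0 = inj₂ refl

  nn-1 : NonNeg 1#
  nn-1 = inj₁ Pos-1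

  pn-+ : ∀ {x y} → Pos x → NonNeg y → Pos (x + y)
  pn-+ p (inj₁ q) = Pos-+ p q
  pn-+ {x} p (inj₂ refl) = Pos-resp (sym (+-identityʳ x)) p

  np-+ : ∀ {x y} → NonNeg x → Pos y → Pos (x + y)
  np-+ p q = Pos-resp (+-comm _ _) (pn-+ q p)

  nn-+ : ∀ {x y} → NonNeg x → NonNeg y → NonNeg (x + y)
  nn-+ (inj₁ p) q = inj₁ (pn-+ p q)
  nn-+ {_} {y} (inj₂ refl) q = NonNeg-resp (sym (+-identityˡ y)) q

  nn-* : ∀ {x y} → NonNeg x → NonNeg y → NonNeg (x * y)
  nn-* (inj₁ p) (inj₁ q) = inj₁ (Pos-* p q)
  nn-* {x} (inj₁ p) (inj₂ refl) = inj₂ (zeroʳ x)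
  nn-* {_} {y} (inj₂ refl) q = inj₂ (zeroˡ y)

  nn-neg⇒0 : ∀ {x} → NonNeg x → NonNeg (- x) → x ≡ 0#
  nn-neg⇒0 (inj₂ e) _ = e
  nn-neg⇒0 {x} (inj₁ p) q = ⊥-elim (¬Pos0 (Pos-resp (-‿inverseʳ x) (pn-+ p q)))

  ¬Pos-neg : ∀ {x} → NonNeg x → ¬ Pos (- x)
  ¬Pos-neg {x} p q = ¬Pos0 (Pos-resp (-‿inverseʳ x) (np-+ p q))

  nn-sq : ∀ x → NonNeg (x * x)
  nn-sq x with trichotomy x
  ... | inj₁ p = inj₁ (Pos-* p p)
  ... | inj₂ (inj₁ refl) = inj₂ (zeroʳ _)
  ... | inj₂ (inj₂ n) = inj₁ (Pos-resp (solve 1 (λ x → (:- x) :* (:- x) := x :* x) refl x) (Pos-* n n))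

  nn-fromℕ : ∀ n → NonNeg (fromℕ n)
  nn-fromℕ zero = nn-0
  nn-fromℕ (suc n) = NonNeg-resp (sym (fromℕ-suc n)) (nn-+ nn-1 (nn-fromℕ n))

  Pos-suc : ∀ n → Pos (fromℕ (suc n))
  Pos-suc n = Pos-resp (sym (fromℕ-suc n)) (pn-+ Pos-1 (nn-fromℕ n))

  Pos-fromℕ : ∀ {n} → 1 ℕ.≤ n → Pos (fromℕ n)
  Pos-fromℕ {suc n} _ = Pos-suc n

  ≤-by : ∀ {e x y} → e ≡ y - x → NonNeg e → x ≤ y
  ≤-by = NonNeg-resp

  <-by : ∀ {e x y} → e ≡ y - x → Pos e → x < y
  <-by = Pos-resp

  0≤⇒nn : ∀ {x} → 0# ≤ x → NonNeg x
  0≤⇒nn {x} = NonNeg-resp (solve 1 (λ x → x :- # 0 := x) refl x)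

  nn⇒0≤ : ∀ {x} → NonNeg x → 0# ≤ x
  nn⇒0≤ {x} = NonNeg-resp (solve 1 (λ x → x := x :- # 0) refl x)

  ≤-refl : ∀ {x} → x ≤ x
  ≤-refl {x} = inj₂ (-‿inverseʳ x)

  ≤-reflexive : ∀ {x y} → x ≡ y → x ≤ y
  ≤-reflexive refl = ≤-refl

  <⇒≤ : ∀ {x y} → x < y → x ≤ y
  <⇒≤ = inj₁

  private
    transEq : ∀ x y z → (y - x) + (z - y) ≡ z - x
    transEq = solve 3 (λ x y z → (y :- x) :+ (z :- y) := z :- x) refl

  ≤-trans : ∀ {x y z} → x ≤ y → y ≤ z → x ≤ z
  ≤-trans {x} {y} {z} p q = ≤-by (transEq x y z) (nn-+ p q)

  ≤-<-trans : ∀ {x y z} → x ≤ y → y < z → x < z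
  ≤-<-trans {x} {y} {z} p q = <-by (transEq x y z) (np-+ p q)

  <-≤-trans : ∀ {x y z} → x < y → y ≤ z → x < z
  <-≤-trans {x} {y} {z} p q = <-by (transEq x y z) (pn-+ p q)

  <-irrefl : ∀ {x} → ¬ x < x
  <-irrefl {x} p = ¬Pos0 (Pos-resp (-‿inverseʳ x) p)

  ≤⇒≯ : ∀ {x y} → x ≤ y → ¬ y < x
  ≤⇒≯ p q = <-irrefl (≤-<-trans p q)

  ≤-or-> : ∀ x y → x ≤ y ⊎ y < x
  ≤-or-> x y with trichotomy (y - x)
  ... | inj₁ p = inj₁ (inj₁ p)
  ... | inj₂ (inj₁ e) = inj₁ (inj₂ e)
  ... | inj₂ (inj₂ n) = inj₂ (Pos-resp (solve 2 (λ x y → :- (y :- x) := x :- y) refl x y) n)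

  ≤-antisym : ∀ {x y} → x ≤ y → y ≤ x → x ≡ y
  ≤-antisym {x} {y} p q = trans (solve 2 (λ x y → x := y :- (y :- x)) refl x y)
    (trans (cong (λ z → y - z) (nn-neg⇒0 p (NonNeg-resp (solve 2 (λ x y → x :- y := :- (y :- x)) refl x y) q)))
      (solve 1 (λ y → y :- # 0 := y) refl y))

  +-mono-≤ : ∀ {a b c d} → a ≤ b → c ≤ d → a + c ≤ b + d
  +-mono-≤ {a} {b} {c} {d} p q = ≤-by (solve 4 (λ a b c d → (b :- a) :+ (d :- c) := (b :+ d) :- (a :+ c)) refl a b c d) (nn-+ p q)

  -- b d - a c = (b - a) d + a (d - c)
  *-mono-≤ : ∀ {a b c d} → NonNeg a → a ≤ b → NonNeg d → c ≤ d → a * c ≤ b * d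
  *-mono-≤ {a} {b} {c} {d} na p nd q = ≤-by (solve 4 (λ a b c d → (b :- a) :* d :+ a :* (d :- c) := b :* d :- a :* c) refl a b c d)
    (nn-+ (nn-* p nd) (nn-* na q))

  *-monoˡ-≤ : ∀ {a b c} → NonNeg a → b ≤ c → a * b ≤ a * c
  *-monoˡ-≤ {a} {b} {c} na p = ≤-by (solve 3 (λ a b c → a :* (c :- b) := a :* c :- a :* b) refl a b c) (nn-* na p)

  *-monoʳ-≤ : ∀ {a b c} → NonNeg a → b ≤ c → b * a ≤ c * a
  *-monoʳ-≤ {a} {b} {c} na p = ≤-by (solve 3 (λ a b c → a :* (c :- b) := c :* a :- b :* a) refl a b c) (nn-* na p)

  *-monoˡ-< : ∀ {a b c} → Pos a → b < c → a * b < a * c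
  *-monoˡ-< {a} {b} {c} na p = <-by (solve 3 (λ a b c → a :* (c :- b) := a :* c :- a :* b) refl a b c) (Pos-* na p)

  *-cancelˡ-≤ : ∀ {a b c} → Pos a → a * b ≤ a * c → b ≤ c
  *-cancelˡ-≤ {a} {b} {c} p q with ≤-or-> b c
  ... | inj₁ r = r
  ... | inj₂ r = ⊥-elim (≤⇒≯ q (*-monoˡ-< p r))

  ≢0⇒ : ∀ {x} → x ≢ 0# → Pos x ⊎ Pos (- x)
  ≢0⇒ {x} n with trichotomy x
  ... | inj₁ p = inj₁ p
  ... | inj₂ (inj₁ e) = ⊥-elim (n e)
  ... | inj₂ (inj₂ p) = inj₂ p

  ≡0? : ∀ x → Dec (x ≡ 0#)
  ≡0? x with trichotomy x
  ... | inj₁ p = no λ e → ¬Pos0 (Pos-resp e p)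
  ... | inj₂ (inj₁ e) = yes e
  ... | inj₂ (inj₂ n) = no λ e → ¬Pos0 (Pos-resp (trans (cong -_ e) -0#≈0#) n)

  Pos⇒≢0 : ∀ {x} → Pos x → x ≢ 0#
  Pos⇒≢0 p refl = ¬Pos0 p

  *-cancel-0 : ∀ {x y} → x * y ≡ 0# → x ≢ 0# → y ≡ 0#
  *-cancel-0 {x} {y} e n = trans (solve 3 (λ x i y → y := x :* y :* i :+ y :* (# 1 :- x :* i)) refl x i y)
    (trans (cong₂ (λ u v → u * i + y * (1# - v)) e (proj₂ (inverse x n)))
      (solve 2 (λ i y → # 0 :* i :+ y :* (# 1 :- # 1) := # 0) refl i y))
    where
      i = proj₁ (inverse x n)

  *-≢0 : ∀ {x y} → x ≢ 0# → y ≢ 0# → x * y ≢ 0#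
  *-≢0 p q e = q (*-cancel-0 e p)

  infix 9 _⁻¹
  -- Total, with the value 0 at 0, so that quotients can be written without carrying a proof about
  -- the denominator.
  _⁻¹ : Carrier → Carrier
  x ⁻¹ with ≡0? x
  ... | yes _ = 0#
  ... | no n = proj₁ (inverse x n)

  *-⁻¹ : ∀ {x} → x ≢ 0# → x * x ⁻¹ ≡ 1#
  *-⁻¹ {x} n with ≡0? x
  ... | yes e = ⊥-elim (n e)
  ... | no m = proj₂ (inverse x m)

  Pos-⁻¹ : ∀ {x} → Pos x → Pos (x ⁻¹)
  Pos-⁻¹ {x} p with ≢0⇒ {x ⁻¹} (λ e → ¬Pos0 (Pos-resp (trans (sym (*-⁻¹ (Pos⇒≢0 p))) (trans (cong (λ z → x * z) e) (zeroʳ x))) Pos-1))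
  ... | inj₁ q = q
  ... | inj₂ q = ⊥-elim (¬Pos-neg nn-1 (Pos-resp (trans (solve 2 (λ x y → x :* (:- y) := :- (x :* y)) refl x (x ⁻¹)) (cong -_ (*-⁻¹ (Pos⇒≢0 p)))) (Pos-* p q)))

  infixr 9 _^_
  _^_ : Carrier → ℕ → Carrier
  x ^ zero = 1#
  x ^ suc n = x * x ^ n

  ^-+ : ∀ x m n → x ^ (m ℕ.+ n) ≡ x ^ m * x ^ n
  ^-+ x zero n = sym (*-identityˡ _)
  ^-+ x (suc m) n = trans (cong (λ z → x * z) (^-+ x m n)) (sym (*-assoc _ _ _))

  ^-*ˡ : ∀ x y n → (x * y) ^ n ≡ x ^ n * y ^ n
  ^-*ˡ x y zero = sym (*-identityˡ _)
  ^-*ˡ x y (suc n) = trans (cong (λ z → x * y * z) (^-*ˡ x y n))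
    (solve 4 (λ x y a b → x :* y :* (a :* b) := x :* a :* (y :* b)) refl x y (x ^ n) (y ^ n))

  1^ : ∀ n → 1# ^ n ≡ 1#
  1^ zero = refl
  1^ (suc n) = trans (*-identityˡ _) (1^ n)

  ^-* : ∀ x m n → x ^ (m ℕ.* n) ≡ (x ^ m) ^ n
  ^-* x zero n = sym (1^ n)
  ^-* x (suc m) n = trans (^-+ x n (m ℕ.* n)) (trans (cong (λ z → x ^ n * z) (^-* x m n)) (sym (^-*ˡ x (x ^ m) n)))

  fromℕ-^ : ∀ m n → fromℕ (m ℕ.^ n) ≡ fromℕ m ^ n
  fromℕ-^ m zero = refl
  fromℕ-^ m (suc n) = trans (fromℕ-* m (m ℕ.^ n)) (cong (λ z → fromℕ m * z) (fromℕ-^ m n))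

  Pos-^ : ∀ {x} n → Pos x → Pos (x ^ n)
  Pos-^ zero p = Pos-1
  Pos-^ (suc n) p = Pos-* p (Pos-^ n p)

  nn-^ : ∀ {x} n → NonNeg x → NonNeg (x ^ n)
  nn-^ zero p = nn-1
  nn-^ (suc n) p = nn-* p (nn-^ n p)

  ^-≢0 : ∀ {x} n → x ≢ 0# → x ^ n ≢ 0#
  ^-≢0 zero p = Pos⇒≢0 Pos-1
  ^-≢0 (suc n) p = *-≢0 p (^-≢0 n p)

  ^-mono-≤ : ∀ {x y} n → NonNeg x → x ≤ y → x ^ n ≤ y ^ n
  ^-mono-≤ zero p q = ≤-refl
  ^-mono-≤ {x} {y} (suc n) p q = *-mono-≤ p q (nn-^ n (0≤⇒nn (≤-trans (nn⇒0≤ p) q))) (^-mono-≤ n p q)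

  ≤⇒nn : ∀ {x y} → NonNeg x → x ≤ y → NonNeg y
  ≤⇒nn p q = 0≤⇒nn (≤-trans (nn⇒0≤ p) q)

  1≤⇒Pos : ∀ {x} → 1# ≤ x → Pos x
  1≤⇒Pos {x} p = Pos-resp (solve 1 (λ x → # 1 :+ (x :- # 1) := x) refl x) (pn-+ Pos-1 p)

  1≤^ : ∀ {x} n → 1# ≤ x → 1# ≤ x ^ n
  1≤^ {x} n p = ≤-trans (≤-reflexive (sym (1^ n))) (^-mono-≤ n nn-1 p)

  ^-monoʳ-≤ : ∀ {x m n} → 1# ≤ x → m ℕ.≤ n → x ^ m ≤ x ^ n
  ^-monoʳ-≤ {x} {m} {n} p q = ≤-trans (≤-reflexive (sym (*-identityʳ _)))
    (≤-trans (*-monoˡ-≤ (inj₁ (Pos-^ m (1≤⇒Pos p))) (1≤^ (n ℕ.∸ m) p))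
      (≤-reflexive (trans (sym (^-+ x m (n ℕ.∸ m))) (cong (x ^_) (ℕP.m+[n∸m]≡n q)))))

  fromℕ-mono-≤ : ∀ {m n} → m ℕ.≤ n → fromℕ m ≤ fromℕ n
  fromℕ-mono-≤ {m} {n} p = ≤-by (trans (solve 2 (λ a b → b := (a :+ b) :- a) refl (fromℕ m) (fromℕ (n ℕ.∸ m)))
    (cong (λ z → z - fromℕ m) (trans (sym (fromℕ-+ m (n ℕ.∸ m))) (cong fromℕ (ℕP.m+[n∸m]≡n p))))) (nn-fromℕ (n ℕ.∸ m))

  fromℕ-mono-< : ∀ {m n} → m ℕ.< n → fromℕ m < fromℕ n
  fromℕ-mono-< {m} {n} p = <-≤-trans (<-by (trans (solve 1 (λ a → # 1 := (# 1 :+ a) :- a) refl (fromℕ m)) (cong (λ z → z - fromℕ m) (sym (fromℕ-suc m)))) Pos-1) (fromℕ-mono-≤ p)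

  fromℕ-cancel-≤ : ∀ {m n} → fromℕ m ≤ fromℕ n → m ℕ.≤ n
  fromℕ-cancel-≤ {m} {n} p with m ℕP.≤? n
  ... | yes q = q
  ... | no q = ⊥-elim (≤⇒≯ p (fromℕ-mono-< (ℕP.≰⇒> q)))

  fromℕ-injective : ∀ {m n} → fromℕ m ≡ fromℕ n → m ≡ n
  fromℕ-injective e = ℕP.≤-antisym (fromℕ-cancel-≤ (≤-reflexive e)) (fromℕ-cancel-≤ (≤-reflexive (sym e)))

  two : Carrier
  two = fromℕ 2

  1≤fromℕ : ∀ {n} → 1 ℕ.≤ n → 1# ≤ fromℕ n
  1≤fromℕ p = fromℕ-mono-≤ p

  infix 4 _∈±_
  -- This is |x| ≤ b, kept as two sign conditions so that ring identities transport it directly.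
  record _∈±_ (x b : Carrier) : Set where
    constructor _,±_
    field
      ±upper : NonNeg (b - x)
      ±lower : NonNeg (b + x)
  open _∈±_ public

  ±-nn : ∀ {x b} → x ∈± b → NonNeg b
  ±-nn {x} {b} (u ,± l) with ≤-or-> 0# b
  ... | inj₁ p = 0≤⇒nn p
  ... | inj₂ q = ⊥-elim (¬Pos0 (Pos-resp (solve 2 (λ x b → ((b :- x) :+ (b :+ x)) :+ ((# 0 :- b) :+ (# 0 :- b)) := # 0) refl x b)
        (np-+ (nn-+ u l) (Pos-+ q q))))

  ±-of-nn : ∀ {x b} → NonNeg x → x ≤ b → x ∈± b
  ±-of-nn {x} {b} p q = q ,± nn-+ (≤⇒nn p q) p

  ±-+ : ∀ {x y a b} → x ∈± a → y ∈± b → (x + y) ∈± (a + b)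
  ±-+ {x} {y} {a} {b} (u ,± l) (u' ,± l') =
    NonNeg-resp (solve 4 (λ x y a b → (a :- x) :+ (b :- y) := (a :+ b) :- (x :+ y)) refl x y a b) (nn-+ u u') ,±
    NonNeg-resp (solve 4 (λ x y a b → (a :+ x) :+ (b :+ y) := (a :+ b) :+ (x :+ y)) refl x y a b) (nn-+ l l')

  ±-neg : ∀ {x a} → x ∈± a → (- x) ∈± a
  ±-neg {x} {a} (u ,± l) = NonNeg-resp (solve 2 (λ x a → a :+ x := a :- (:- x)) refl x a) l ,± u

  ±-weaken : ∀ {x a b} → x ∈± a → a ≤ b → x ∈± b
  ±-weaken {x} {a} {b} (u ,± l) p =
    NonNeg-resp (solve 3 (λ x a b → (a :- x) :+ (b :- a) := b :- x) refl x a b) (nn-+ u p) ,±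
    NonNeg-resp (solve 3 (λ x a b → (a :+ x) :+ (b :- a) := b :+ x) refl x a b) (nn-+ l p)

  -- With x = ±u, y = ±v and 0 ≤ u ≤ a, 0 ≤ v ≤ b it suffices to bound uv.
  ±-* : ∀ {x y a b} → x ∈± a → y ∈± b → (x * y) ∈± (a * b)
  ±-* {x} {y} {a} {b} p q with ≤-or-> 0# x | ≤-or-> 0# y
  ... | inj₁ i | inj₁ j = ±-of-nn (nn-* (0≤⇒nn i) (0≤⇒nn j)) (*-mono-≤ (0≤⇒nn i) (±upper p) (±-nn q) (±upper q))
  ... | inj₁ i | inj₂ j = subst (_∈± a * b) (solve 2 (λ x y → :- (x :* (:- y)) := x :* y) refl x y)
        (±-neg (±-of-nn (nn-* (0≤⇒nn i) y') (*-mono-≤ (0≤⇒nn i) (±upper p) (±-nn q) (±upper (±-neg q)))))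
    where y' = NonNeg-resp (solve 1 (λ y → # 0 :- y := :- y) refl y) (inj₁ j)
  ... | inj₂ i | inj₁ j = subst (_∈± a * b) (solve 2 (λ x y → :- ((:- x) :* y) := x :* y) refl x y)
        (±-neg (±-of-nn (nn-* x' (0≤⇒nn j)) (*-mono-≤ x' (±upper (±-neg p)) (±-nn q) (±upper q))))
    where x' = NonNeg-resp (solve 1 (λ y → # 0 :- y := :- y) refl x) (inj₁ i)
  ... | inj₂ i | inj₂ j = subst (_∈± a * b) (solve 2 (λ x y → (:- x) :* (:- y) := x :* y) refl x y)
        (±-of-nn (nn-* x' y') (*-mono-≤ x' (±upper (±-neg p)) (±-nn q) (±upper (±-neg q))))
    where x' = NonNeg-resp (solve 1 (λ y → # 0 :- y := :- y) refl x) (inj₁ i)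
          y' = NonNeg-resp (solve 1 (λ y → # 0 :- y := :- y) refl y) (inj₁ j)

  floor : ∀ {x} → NonNeg x → ∃ λ n → (fromℕ n ≤ x) × (x < fromℕ (suc n))
  floor {x} p with archimedean x
  ... | n , q = go n q
    where
      go : ∀ n → x < fromℕ n → ∃ λ n → (fromℕ n ≤ x) × (x < fromℕ (suc n))
      go zero q = ⊥-elim (¬Pos-neg p (Pos-resp (+-identityˡ _) q))
      go (suc n) q with ≤-or-> (fromℕ n) x
      ... | inj₁ r = n , r , q
      ... | inj₂ r = go n r

-- Brings an equation between norms over ℚ down to ℤ, where the norm form is known to be
-- anisotropic.
ClearsDenominators : OrderedField → Set
ClearsDenominators Q = ∀ x → ∃₂ λ n z → 1 ℕ.≤ n × x * fromℕ n ≡ ι z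
  where open OrderedFieldTheory Q

-- The equation without division

module Equation where

  open Defs using (N)

  -- The equation multiplied by b - 1, with `b′` for b - 1, so that neither truncated subtraction
  -- nor division is left.
  record Solution (n m ℓ a b′ : ℕ) : Set where
    field
      m≤n : m ℕ.≤ n
      1≤b′ : 1 ℕ.≤ b′
      b′≤99 : b′ ℕ.≤ 99
      1≤a : 1 ℕ.≤ a
      a≤b′ : a ℕ.≤ b′
      equation : b′ ℕ.* (N n ℕ.+ N m) ℕ.+ a ≡ a ℕ.* suc b′ ℕ.^ ℓ

-- Siegel's lemma

module Siegel where

  open import Data.Nat using (_+_; _*_; _^_; _≤_; _<_; z≤n)
  open import Data.Fin as Fin using (Fin; zero; suc; toℕ; fromℕ<; finToFun; funToFin; combine)
  import Data.Fin.Properties as FinP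
  open import Function using (_∘_)

  ∑ℕ : ∀ {n} → (Fin n → ℕ) → ℕ
  ∑ℕ {zero} f = 0
  ∑ℕ {suc n} f = f zero + ∑ℕ (f ∘ suc)

  ∑ℕ-bound : ∀ {n} (f : Fin n → ℕ) b → (∀ i → f i ≤ b) → ∑ℕ f ≤ n * b
  ∑ℕ-bound {zero} f b p = z≤n
  ∑ℕ-bound {suc n} f b p = ℕP.+-mono-≤ (p zero) (∑ℕ-bound (f ∘ suc) b (p ∘ suc))

  private
    funToFin-cong : ∀ {m n} {f g : Fin m → Fin n} → (∀ i → f i ≡ g i) → funToFin f ≡ funToFin g
    funToFin-cong {zero} e = refl
    funToFin-cong {suc m} e = cong₂ combine (e zero) (funToFin-cong (e ∘ suc))

    differ : ∀ {m n} (f g : Fin m → Fin n) → (∃ λ i → f i ≢ g i) ⊎ (∀ i → f i ≡ g i)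
    differ {zero} f g = inj₂ λ ()
    differ {suc m} f g with f zero FinP.≟ g zero | differ (f ∘ suc) (g ∘ suc)
    ... | no n | _ = inj₁ (zero , n)
    ... | yes _ | inj₁ (i , n) = inj₁ (suc i , n)
    ... | yes e | inj₂ h = inj₂ λ { zero → e ; (suc i) → h i }

  -- The B^N vectors of the box have at most T^M tuples of values, so two of them collide. The pair
  -- is returned instead of its difference, which keeps the entries natural numbers.
  siegel : ∀ {N M B T S} (A : Fin M → Fin N → ℕ) → (∀ u v → A u v ≤ S) → N * (B * S) < T → T ^ M < B ^ N →
    ∃₂ λ (p q : Fin N → Fin B) → (∃ λ v → p v ≢ q v) × (∀ u → ∑ℕ (λ v → toℕ (p v) * A u v) ≡ ∑ℕ (λ v → toℕ (q v) * A u v))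
  siegel {N} {M} {B} {T} {S} A bound T-big count = conclude (FinP.pigeonhole count box)
    where
      form : (Fin N → Fin B) → Fin M → ℕ
      form p u = ∑ℕ (λ v → toℕ (p v) * A u v)
      form<T : ∀ p u → form p u < T
      form<T p u = ℕP.≤-<-trans (∑ℕ-bound _ (B * S) λ v → ℕP.*-mono-≤ (ℕP.<⇒≤ (FinP.toℕ<n (p v))) (bound u v)) T-big
      image : (Fin N → Fin B) → Fin M → Fin T
      image p u = fromℕ< (form<T p u)
      box : Fin (B ^ N) → Fin (T ^ M)
      box k = funToFin (image (finToFun k))
      conclude : ∃₂ (λ i j → i Fin.< j × box i ≡ box j) → _
      conclude (i , j , i<j , e) = p , q , distinct , equal
        where
          p = finToFun i
          q = finToFun j
          -- The collision only says that the codes i and j differ; a place where the vectors differ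
          -- is found by comparing all entries.
          distinct : ∃ λ v → p v ≢ q v
          distinct with differ p q
          ... | inj₁ d = d
          ... | inj₂ h = ⊥-elim (FinP.<⇒≢ i<j (trans (sym (FinP.funToFin-finToFin {N} {B} i)) (trans (funToFin-cong h) (FinP.funToFin-finToFin {N} {B} j))))
          equal : ∀ u → form p u ≡ form q u
          equal u = trans (sym (FinP.toℕ-fromℕ< (form<T p u))) (trans (cong toℕ
            (trans (sym (FinP.finToFun-funToFin (image p) u)) (trans (cong (λ k → finToFun k u) e) (FinP.finToFun-funToFin (image q) u)))) (FinP.toℕ-fromℕ< (form<T q u)))

-- The norm form of ℤ[α] has no nontrivial zero

module NormForm where

  open import Data.Integer using (+_; -[1+_]; ∣_∣)
  open import Data.Integer.Tactic.RingSolver using () renaming (solve-∀ to ℤsolve-∀)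

  -- The norm of a + bα + cα² for α³ = α² + 1.
  norm : ℤ → ℤ → ℤ → ℤ
  norm a b c = a ℤ.* a ℤ.* a ℤ.+ b ℤ.* b ℤ.* b ℤ.+ c ℤ.* c ℤ.* c ℤ.+ a ℤ.* a ℤ.* b ℤ.+ a ℤ.* a ℤ.* c ℤ.+ b ℤ.* b ℤ.* c
    ℤ.- + 3 ℤ.* (a ℤ.* b ℤ.* c) ℤ.- + 2 ℤ.* (a ℤ.* c ℤ.* c)

  private
    data Parity : ℤ → Set where
      even : ∀ z → Parity (z ℤ.+ z)
      odd : ∀ z → Parity (ℤ.suc (z ℤ.+ z))

    parity : ∀ z → Parity z
    parity (+ n) = go n
      where
        go : ∀ n → Parity (+ n)
        go zero = even (+ 0)
        go (suc n) with go n
        ... | p = step (+ n) p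
          where
            step : ∀ z → Parity z → Parity (ℤ.suc z)
            step _ (even z) = odd z
            step _ (odd z) = subst Parity (lem z) (even (ℤ.suc z))
              where lem : ∀ z → (+ 1 ℤ.+ z) ℤ.+ (+ 1 ℤ.+ z) ≡ + 1 ℤ.+ (+ 1 ℤ.+ (z ℤ.+ z))
                    lem = ℤsolve-∀
    parity -[1+ n ] with parity (+ suc n)
    ... | p = flip (+ suc n) p
      where
        flip : ∀ z → Parity z → Parity (ℤ.- z)
        flip _ (even z) = subst Parity (lem z) (even (ℤ.- z))
          where lem : ∀ z → ℤ.- z ℤ.+ ℤ.- z ≡ ℤ.- (z ℤ.+ z)
                lem = ℤsolve-∀
        flip _ (odd z) = subst Parity (lem z) (odd (ℤ.- z ℤ.+ ℤ.- + 1))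
          where lem : ∀ z → + 1 ℤ.+ ((ℤ.- z ℤ.+ ℤ.- + 1) ℤ.+ (ℤ.- z ℤ.+ ℤ.- + 1)) ≡ ℤ.- (+ 1 ℤ.+ (z ℤ.+ z))
                lem = ℤsolve-∀

    1≢double : ∀ z → + 1 ≢ z ℤ.+ z
    1≢double (+ zero) ()
    1≢double (+ suc n) e = absurd (ℤP.+-injective e)
      where absurd : ∀ {n} → 1 ≢ suc n ℕ.+ suc n
            absurd {n} e = ℕP.1+n≢0 (sym (ℕP.suc-injective (trans e (cong suc (ℕP.+-suc n n)))))
    1≢double -[1+ n ] ()

    triangle : ∀ a → ∃ λ t → a ℤ.* a ℤ.- a ≡ t ℤ.+ t
    triangle a with parity a
    ... | even z = (z ℤ.+ z) ℤ.* z ℤ.- z , lem z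
      where lem : ∀ z → (z ℤ.+ z) ℤ.* (z ℤ.+ z) ℤ.- (z ℤ.+ z) ≡ ((z ℤ.+ z) ℤ.* z ℤ.- z) ℤ.+ ((z ℤ.+ z) ℤ.* z ℤ.- z)
            lem = ℤsolve-∀
    ... | odd z = (z ℤ.+ z) ℤ.* z ℤ.+ z , lem z
      where lem : ∀ z → (+ 1 ℤ.+ (z ℤ.+ z)) ℤ.* (+ 1 ℤ.+ (z ℤ.+ z)) ℤ.- (+ 1 ℤ.+ (z ℤ.+ z)) ≡ ((z ℤ.+ z) ℤ.* z ℤ.+ z) ℤ.+ ((z ℤ.+ z) ℤ.* z ℤ.+ z)
            lem = ℤsolve-∀

    -- Modulo 2 the norm form is 1 + (1 + a)(1 + b)(1 + c).
    norm-parity : ∀ a b c → norm a b c ≡ + 0 → ∃ λ q → (+ 1 ℤ.+ a) ℤ.* (+ 1 ℤ.+ b) ℤ.* (+ 1 ℤ.+ c) ℤ.+ (q ℤ.+ q) ≡ + 1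
    norm-parity a b c e with triangle a | triangle b | triangle c
    ... | ta , ea | tb , eb | tc , ec = q , trans (cong (λ z → (+ 1 ℤ.+ a) ℤ.* (+ 1 ℤ.+ b) ℤ.* (+ 1 ℤ.+ c) ℤ.+ z) qq)
          (trans (lem a b c) (cong (λ z → + 1 ℤ.+ z) e))
      where
        q = ta ℤ.* (a ℤ.+ + 1 ℤ.+ b ℤ.+ c) ℤ.+ tb ℤ.* (b ℤ.+ + 1 ℤ.+ c) ℤ.+ tc ℤ.* (c ℤ.+ + 1) ℤ.- + 2 ℤ.* (a ℤ.* b ℤ.* c) ℤ.- a ℤ.* c ℤ.* c
        X : ℤ → ℤ
        X a = a ℤ.* a ℤ.- a
        spread : ∀ ta tb tc a b c → let q = ta ℤ.* (a ℤ.+ + 1 ℤ.+ b ℤ.+ c) ℤ.+ tb ℤ.* (b ℤ.+ + 1 ℤ.+ c) ℤ.+ tc ℤ.* (c ℤ.+ + 1) ℤ.- + 2 ℤ.* (a ℤ.* b ℤ.* c) ℤ.- a ℤ.* c ℤ.* c in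
          q ℤ.+ q ≡ (ta ℤ.+ ta) ℤ.* (a ℤ.+ + 1 ℤ.+ b ℤ.+ c) ℤ.+ (tb ℤ.+ tb) ℤ.* (b ℤ.+ + 1 ℤ.+ c) ℤ.+ (tc ℤ.+ tc) ℤ.* (c ℤ.+ + 1) ℤ.- + 4 ℤ.* (a ℤ.* b ℤ.* c) ℤ.- + 2 ℤ.* (a ℤ.* c ℤ.* c)
        spread = ℤsolve-∀
        cong₃ : ∀ {x y z x' y' z'} → x ≡ x' → y ≡ y' → z ≡ z' → ∀ {f : ℤ → ℤ → ℤ → ℤ} → f x y z ≡ f x' y' z'
        cong₃ refl refl refl = refl
        qq : q ℤ.+ q ≡ X a ℤ.* (a ℤ.+ + 1 ℤ.+ b ℤ.+ c) ℤ.+ X b ℤ.* (b ℤ.+ + 1 ℤ.+ c) ℤ.+ X c ℤ.* (c ℤ.+ + 1) ℤ.- + 4 ℤ.* (a ℤ.* b ℤ.* c) ℤ.- + 2 ℤ.* (a ℤ.* c ℤ.* c)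
        qq = trans (spread ta tb tc a b c) (cong₃ (sym ea) (sym eb) (sym ec) {λ u v w → u ℤ.* (a ℤ.+ + 1 ℤ.+ b ℤ.+ c) ℤ.+ v ℤ.* (b ℤ.+ + 1 ℤ.+ c) ℤ.+ w ℤ.* (c ℤ.+ + 1) ℤ.- + 4 ℤ.* (a ℤ.* b ℤ.* c) ℤ.- + 2 ℤ.* (a ℤ.* c ℤ.* c)})
        lem : ∀ a b c → (+ 1 ℤ.+ a) ℤ.* (+ 1 ℤ.+ b) ℤ.* (+ 1 ℤ.+ c) ℤ.+ ((a ℤ.* a ℤ.- a) ℤ.* (a ℤ.+ + 1 ℤ.+ b ℤ.+ c) ℤ.+ (b ℤ.* b ℤ.- b) ℤ.* (b ℤ.+ + 1 ℤ.+ c) ℤ.+ (c ℤ.* c ℤ.- c) ℤ.* (c ℤ.+ + 1) ℤ.- + 4 ℤ.* (a ℤ.* b ℤ.* c) ℤ.- + 2 ℤ.* (a ℤ.* c ℤ.* c))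
          ≡ + 1 ℤ.+ (a ℤ.* a ℤ.* a ℤ.+ b ℤ.* b ℤ.* b ℤ.+ c ℤ.* c ℤ.* c ℤ.+ a ℤ.* a ℤ.* b ℤ.+ a ℤ.* a ℤ.* c ℤ.+ b ℤ.* b ℤ.* c ℤ.- + 3 ℤ.* (a ℤ.* b ℤ.* c) ℤ.- + 2 ℤ.* (a ℤ.* c ℤ.* c))
        lem = ℤsolve-∀

    doubled : ∀ s u q → s ℤ.* (u ℤ.+ u) ℤ.+ (q ℤ.+ q) ≢ + 1
    doubled s u q e = 1≢double (s ℤ.* u ℤ.+ q) (trans (sym e) (lem s u q))
      where lem : ∀ s u q → s ℤ.* (u ℤ.+ u) ℤ.+ (q ℤ.+ q) ≡ (s ℤ.* u ℤ.+ q) ℤ.+ (s ℤ.* u ℤ.+ q)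
            lem = ℤsolve-∀

    odd-factor : ∀ x s {p q} → p ≡ s ℤ.* (+ 1 ℤ.+ (+ 1 ℤ.+ (x ℤ.+ x))) → p ℤ.+ (q ℤ.+ q) ≢ + 1
    odd-factor x s {p} {q} e r = doubled s (+ 1 ℤ.+ x) q (trans (cong (λ z → z ℤ.+ (q ℤ.+ q)) (trans (cong (s ℤ.*_) (lem x)) (sym e))) r)
      where lem : ∀ x → (+ 1 ℤ.+ x) ℤ.+ (+ 1 ℤ.+ x) ≡ + 1 ℤ.+ (+ 1 ℤ.+ (x ℤ.+ x))
            lem = ℤsolve-∀

    rot : ∀ u v w → u ℤ.* v ℤ.* w ≡ (v ℤ.* w) ℤ.* u
    rot = ℤsolve-∀

    mid : ∀ u v w → u ℤ.* v ℤ.* w ≡ (u ℤ.* w) ℤ.* v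
    mid = ℤsolve-∀

    -- An odd coordinate makes one of the three factors even, and then an even number would equal 1.
    evens : ∀ {a b c} → Parity a → Parity b → Parity c →
      (∃ λ q → (+ 1 ℤ.+ a) ℤ.* (+ 1 ℤ.+ b) ℤ.* (+ 1 ℤ.+ c) ℤ.+ (q ℤ.+ q) ≡ + 1) → ∃ λ x → ∃ λ y → ∃ λ z → a ≡ x ℤ.+ x × b ≡ y ℤ.+ y × c ≡ z ℤ.+ z
    evens (even x) (even y) (even z) e = x , y , z , refl , refl , refl
    evens {a} {b} {c} (odd x) _ _ (q , e) = ⊥-elim (odd-factor x ((+ 1 ℤ.+ b) ℤ.* (+ 1 ℤ.+ c)) {q = q} (rot (+ 1 ℤ.+ a) (+ 1 ℤ.+ b) (+ 1 ℤ.+ c)) e)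
    evens {a} {b} {c} _ (odd x) _ (q , e) = ⊥-elim (odd-factor x ((+ 1 ℤ.+ a) ℤ.* (+ 1 ℤ.+ c)) {q = q} (mid (+ 1 ℤ.+ a) (+ 1 ℤ.+ b) (+ 1 ℤ.+ c)) e)
    evens {a} {b} {c} _ _ (odd x) (q , e) = ⊥-elim (odd-factor x ((+ 1 ℤ.+ a) ℤ.* (+ 1 ℤ.+ b)) {q = q} refl e)

    ∣double∣ : ∀ x → ∣ x ℤ.+ x ∣ ≡ 2 ℕ.* ∣ x ∣
    ∣double∣ x = trans (cong ∣_∣ (lem x)) (ℤP.∣i*j∣≡∣i∣*∣j∣ (+ 2) x)
      where lem : ∀ x → x ℤ.+ x ≡ + 2 ℤ.* x
            lem = ℤsolve-∀

  size : ℤ → ℤ → ℤ → ℕ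
  size a b c = ∣ a ∣ ℕ.+ ∣ b ∣ ℕ.+ ∣ c ∣

  private
    norm-double : ∀ x y z → norm (x ℤ.+ x) (y ℤ.+ y) (z ℤ.+ z) ≡ + 8 ℤ.* norm x y z
    norm-double x y z = double x y z
      where
        double : ∀ a b c → ((a ℤ.+ a) ℤ.* (a ℤ.+ a) ℤ.* (a ℤ.+ a) ℤ.+ (b ℤ.+ b) ℤ.* (b ℤ.+ b) ℤ.* (b ℤ.+ b) ℤ.+ (c ℤ.+ c) ℤ.* (c ℤ.+ c) ℤ.* (c ℤ.+ c) ℤ.+ (a ℤ.+ a) ℤ.* (a ℤ.+ a) ℤ.* (b ℤ.+ b) ℤ.+ (a ℤ.+ a) ℤ.* (a ℤ.+ a) ℤ.* (c ℤ.+ c) ℤ.+ (b ℤ.+ b) ℤ.* (b ℤ.+ b) ℤ.* (c ℤ.+ c) ℤ.- + 3 ℤ.* ((a ℤ.+ a) ℤ.* (b ℤ.+ b) ℤ.* (c ℤ.+ c)) ℤ.- + 2 ℤ.* ((a ℤ.+ a) ℤ.* (c ℤ.+ c) ℤ.* (c ℤ.+ c))) ≡ + 8 ℤ.* (a ℤ.* a ℤ.* a ℤ.+ b ℤ.* b ℤ.* b ℤ.+ c ℤ.* c ℤ.* c ℤ.+ a ℤ.* a ℤ.* b ℤ.+ a ℤ.* a ℤ.* c ℤ.+ b ℤ.* b ℤ.* c ℤ.- + 3 ℤ.* (a ℤ.* b ℤ.* c) ℤ.- + 2 ℤ.* (a ℤ.* c ℤ.* c))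
        double = ℤsolve-∀

    cancel8 : ∀ z → + 8 ℤ.* z ≡ + 0 → z ≡ + 0
    cancel8 z e with ℤP.i*j≡0⇒i≡0∨j≡0 (+ 8) e
    ... | inj₂ r = r

    size-double : ∀ x y z → size (x ℤ.+ x) (y ℤ.+ y) (z ℤ.+ z) ≡ 2 ℕ.* size x y z
    size-double x y z = trans (cong₂ ℕ._+_ (cong₂ ℕ._+_ (∣double∣ x) (∣double∣ y)) (∣double∣ z)) (ar (∣ x ∣) (∣ y ∣) (∣ z ∣))
      where ar : ∀ x y z → 2 ℕ.* x ℕ.+ 2 ℕ.* y ℕ.+ 2 ℕ.* z ≡ 2 ℕ.* (x ℕ.+ y ℕ.+ z)
            ar = ℕsolve-∀

    half-smaller : ∀ n → n ≢ 0 → n ℕ.< 2 ℕ.* n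
    half-smaller zero p = ⊥-elim (p refl)
    half-smaller (suc n) _ = ℕP.m<m+n (suc n) (ℕ.s≤s ℕ.z≤n)

  -- Infinite descent: a zero has even coordinates, and halving them gives a smaller zero because
  -- the form is homogeneous. The recursion runs on the bound `k` for the size.
  norm-anisotropic : ∀ k a b c → size a b c ℕ.≤ k → norm a b c ≡ + 0 → size a b c ≡ 0
  norm-anisotropic zero a b c p e = ℕP.n≤0⇒n≡0 p
  norm-anisotropic (suc k) a b c p e = step (evens (parity a) (parity b) (parity c) (norm-parity a b c e)) p e
    where
      step : ∀ {a b c} → (∃ λ x → ∃ λ y → ∃ λ z → a ≡ x ℤ.+ x × b ≡ y ℤ.+ y × c ≡ z ℤ.+ z) → size a b c ℕ.≤ suc k → norm a b c ≡ + 0 → size a b c ≡ 0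
      step (x , y , z , refl , refl , refl) p e = trans (size-double x y z) (cong (2 ℕ.*_) (halved (size x y z ℕP.≟ 0)))
        where
          halved : Dec (size x y z ≡ 0) → size x y z ≡ 0
          halved (yes q) = q
          halved (no q) = norm-anisotropic k x y z (ℕP.≤-pred (ℕP.≤-trans (half-smaller _ q) (ℕP.≤-trans (ℕP.≤-reflexive (sym (size-double x y z))) p)))
            (cancel8 (norm x y z) (trans (sym (norm-double x y z)) e))

-- Polynomial functions, linear systems and the zero estimate

module ZeroEstimate (F : OrderedField) where

  open import Data.Fin as Fin using (Fin; zero; suc; toℕ; punchIn; punchOut; combine; remQuot)
  import Data.Fin.Properties as FinP
  open import Function using (_∘_)
  open import Algebra.Bundles using (CommutativeRing)
  open OrderedFieldTheory F

  open import Algebra.Properties.Semiring.Sum (CommutativeRing.semiring commutativeRing) public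
    using (sum-cong-≗; ∑-distrib-+; ∑-comm; sum-remove; *-distribˡ-sum; *-distribʳ-sum)
    renaming (sum to ∑)

  drop-right : ∀ {a b} → a + b ≡ 0# → b ≡ 0# → a ≡ 0#
  drop-right {a} {b} e z = trans (sym (+-identityʳ a)) (trans (cong (λ u → a + u) (sym z)) e)

  drop-left : ∀ {a b} → a + b ≡ 0# → a ≡ 0# → b ≡ 0#
  drop-left e z = drop-right (trans (+-comm _ _) e) z

  ∑-0 : ∀ {n} {f : Fin n → Carrier} → (∀ i → f i ≡ 0#) → ∑ f ≡ 0#
  ∑-0 {zero} e = refl
  ∑-0 {suc n} e = trans (cong₂ _+_ (e zero) (∑-0 (e ∘ suc))) (+-identityˡ 0#)

  ∑-neg : ∀ {n} (f : Fin n → Carrier) → ∑ (λ i → - f i) ≡ - ∑ f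
  ∑-neg {zero} f = solve 0 (# 0 := :- # 0) refl
  ∑-neg {suc n} f = trans (cong (λ z → - f zero + z) (∑-neg (f ∘ suc))) (solve 2 (λ a b → :- a :+ :- b := :- (a :+ b)) refl (f zero) (∑ (f ∘ suc)))

  ∑-split : ∀ m {n} (f : Fin (m ℕ.+ n) → Carrier) → ∑ f ≡ ∑ (λ i → f (i Fin.↑ˡ n)) + ∑ (λ j → f (m Fin.↑ʳ j))
  ∑-split zero f = sym (+-identityˡ _)
  ∑-split (suc m) f = trans (cong (λ z → f zero + z) (∑-split m (f ∘ suc))) (sym (+-assoc _ _ _))

  ∑-combine : ∀ m n (f : Fin (m ℕ.* n) → Carrier) → ∑ f ≡ ∑ (λ i → ∑ (λ j → f (combine {m} {n} i j)))
  ∑-combine zero n f = refl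
  ∑-combine (suc m) n f = trans (∑-split n f) (cong (λ z → ∑ (λ i → f (i Fin.↑ˡ (m ℕ.* n))) + z) (∑-combine m n (λ k → f (n Fin.↑ʳ k))))

  -- Lead f d c: f is a polynomial function of degree at most d with x^d-coefficient c, possibly 0.
  Deg< : (Carrier → Carrier) → ℕ → Set
  Lead : (Carrier → Carrier) → ℕ → Carrier → Set
  Deg< f zero = ∀ x → f x ≡ 0#
  Deg< f (suc d) = ∃ λ c → Lead f d c
  Lead f d c = ∃ λ g → Deg< g d × (∀ x → f x ≡ c * x ^ d + g x)

  Deg<-cong : ∀ {f g} d → (∀ x → g x ≡ f x) → Deg< f d → Deg< g d
  Deg<-cong zero e p x = trans (e x) (p x)
  Deg<-cong (suc d) e (c , g , p , q) = c , g , p , λ x → trans (e x) (q x)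

  Lead-cong : ∀ {f g} d {c} → (∀ x → g x ≡ f x) → Lead f d c → Lead g d c
  Lead-cong d e (g , p , q) = g , p , λ x → trans (e x) (q x)

  Lead-≡ : ∀ {f d c c'} → c ≡ c' → Lead f d c → Lead f d c'
  Lead-≡ refl p = p

  Deg<-+ : ∀ {f g} d → Deg< f d → Deg< g d → Deg< (λ x → f x + g x) d
  Deg<-+ zero p q x = trans (cong₂ _+_ (p x) (q x)) (+-identityˡ 0#)
  Deg<-+ (suc d) (c , f' , p , e) (c' , g' , p' , e') = c + c' , (λ x → f' x + g' x) , Deg<-+ d p p' ,
    λ x → trans (cong₂ _+_ (e x) (e' x)) (solve 5 (λ a b c d x → (a :* x :+ b) :+ (c :* x :+ d) := (a :+ c) :* x :+ (b :+ d)) refl c (f' x) c' (g' x) (x ^ d))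

  Lead-+ : ∀ {f g} d {c c'} → Lead f d c → Lead g d c' → Lead (λ x → f x + g x) d (c + c')
  Lead-+ d p q = proj₂ (Deg<-+ (suc d) (_ , p) (_ , q))

  Deg<-scale : ∀ {f} d k → Deg< f d → Deg< (λ x → k * f x) d
  Deg<-scale zero k p x = trans (cong (λ z → k * z) (p x)) (zeroʳ k)
  Deg<-scale (suc d) k (c , g , p , e) = k * c , (λ x → k * g x) , Deg<-scale d k p ,
    λ x → trans (cong (λ z → k * z) (e x)) (solve 4 (λ k c x g → k :* (c :* x :+ g) := k :* c :* x :+ k :* g) refl k c (x ^ d) (g x))

  Lead-scale : ∀ {f} d k {c} → Lead f d c → Lead (λ x → k * f x) d (k * c)
  Lead-scale d k p = proj₂ (Deg<-scale (suc d) k (_ , p))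

  Deg<-zero : ∀ {f} d → (∀ x → f x ≡ 0#) → Deg< f d
  Deg<-zero zero p = p
  Deg<-zero {f} (suc d) p = 0# , f , Deg<-zero d p , λ x → sym (trans (cong (_+ f x) (zeroˡ _)) (+-identityˡ _))

  Deg<-suc : ∀ {f} d → Deg< f d → Deg< f (suc d)
  Deg<-suc zero p = Deg<-zero 1 p
  Deg<-suc {f} (suc d) p = 0# , f , p , λ x → sym (trans (cong (_+ f x) (zeroˡ _)) (+-identityˡ _))

  Deg<-weaken : ∀ {f} k d → Deg< f d → Deg< f (k ℕ.+ d)
  Deg<-weaken zero d p = p
  Deg<-weaken (suc k) d p = Deg<-suc (k ℕ.+ d) (Deg<-weaken k d p)

  Deg<-≤ : ∀ {f d d'} → d ℕ.≤ d' → Deg< f d → Deg< f d'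
  Deg<-≤ {f} {d} {d'} q p = subst (Deg< f) (ℕP.m∸n+n≡m q) (Deg<-weaken (d' ℕ.∸ d) d p)

  Deg<-x* : ∀ {f} d → Deg< f d → Deg< (λ x → x * f x) (suc d)
  Deg<-x* zero p = Deg<-zero 1 λ x → trans (cong (λ z → x * z) (p x)) (zeroʳ x)
  Deg<-x* (suc d) (c , g , p , e) = c , (λ x → x * g x) , Deg<-x* d p ,
    λ x → trans (cong (λ z → x * z) (e x)) (solve 4 (λ x c y g → x :* (c :* y :+ g) := c :* (x :* y) :+ x :* g) refl x c (x ^ d) (g x))

  Lead-x* : ∀ {f} d {c} → Lead f d c → Lead (λ x → x * f x) (suc d) c
  Lead-x* d p = proj₂ (Deg<-x* (suc d) (_ , p))

  Lead-x^* : ∀ {f} k d {c} → Lead f d c → Lead (λ x → x ^ k * f x) (k ℕ.+ d) c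
  Lead-x^* zero d p = Lead-cong d (λ x → *-identityˡ _) p
  Lead-x^* (suc k) d p = Lead-cong (suc k ℕ.+ d) (λ x → *-assoc _ _ _) (Lead-x* (k ℕ.+ d) (Lead-x^* k d p))

  Deg<-* : ∀ {f g} d e → Deg< f d → Deg< g (suc e) → Deg< (λ x → f x * g x) (d ℕ.+ e)
  Deg<-* {f} {g} zero e p q = Deg<-zero e λ x → trans (cong (λ z → z * g x) (p x)) (zeroˡ _)
  Deg<-* {f} {g} (suc d) e (c , h , p , eq) q@(c' , q') = Deg<-cong (suc d ℕ.+ e)
    (λ x → trans (cong (λ z → z * g x) (eq x)) (solve 4 (λ c x h g → (c :* x :+ h) :* g := c :* (x :* g) :+ h :* g) refl c (x ^ d) (h x) (g x)))
    (Deg<-+ (suc (d ℕ.+ e)) (Deg<-scale (suc (d ℕ.+ e)) c (c' , Lead-x^* d e q')) (Deg<-suc (d ℕ.+ e) (Deg<-* d e p q)))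

  Lead-* : ∀ {f g} d e {c c'} → Lead f d c → Lead g e c' → Lead (λ x → f x * g x) (d ℕ.+ e) (c * c')
  Lead-* {f} {g} d e {c} {c'} (h , p , eq) q = Lead-cong (d ℕ.+ e)
    (λ x → trans (cong (λ z → z * g x) (eq x)) (solve 4 (λ c x h g → (c :* x :+ h) :* g := c :* (x :* g) :+ h :* g) refl c (x ^ d) (h x) (g x)))
    (Lead-≡ (+-identityʳ (c * c')) (Lead-+ (d ℕ.+ e) (Lead-scale (d ℕ.+ e) c (Lead-x^* d e q)) lower))
    where
      lower : Lead (λ x → h x * g x) (d ℕ.+ e) 0#
      lower = (λ x → h x * g x) , Deg<-* d e p (c' , q) , λ x → sym (trans (cong (_+ h x * g x) (zeroˡ _)) (+-identityˡ _))

  Deg<-∑ : ∀ {n} (f : Fin n → Carrier → Carrier) d → (∀ i → Deg< (f i) d) → Deg< (λ x → ∑ (λ i → f i x)) d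
  Deg<-∑ {zero} f d p = Deg<-zero d λ x → refl
  Deg<-∑ {suc n} f d p = Deg<-+ d (p zero) (Deg<-∑ (f ∘ suc) d (p ∘ suc))

  Lead-∑ : ∀ {n} (f : Fin n → Carrier → Carrier) d {c : Fin n → Carrier} → (∀ i → Lead (f i) d (c i)) → Lead (λ x → ∑ (λ i → f i x)) d (∑ c)
  Lead-∑ {zero} f d p = (λ x → 0#) , Deg<-zero d (λ x → refl) , λ x → sym (trans (cong (_+ 0#) (zeroˡ _)) (+-identityˡ _))
  Lead-∑ {suc n} f d p = Lead-+ d (p zero) (Lead-∑ (f ∘ suc) d (p ∘ suc))

  Lead-one : Lead (λ x → 1#) 0 1#
  Lead-one = (λ x → 0#) , (λ x → refl) , λ x → solve 0 (# 1 := # 1 :* # 1 :+ # 0) refl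

  Lead-const : ∀ k → Lead (λ x → k) 0 k
  Lead-const k = (λ x → 0#) , (λ x → refl) , λ x → solve 1 (λ k → k := k :* # 1 :+ # 0) refl k

  Lead-x+ : ∀ s → Lead (λ x → x + s) 1 1#
  Lead-x+ s = (λ x → s) , (s , Lead-const s) , λ x → solve 2 (λ x s → x :+ s := # 1 :* (x :* # 1) :+ s) refl x s

  Lead-x+^ : ∀ s d → Lead (λ x → (x + s) ^ d) d 1#
  Lead-x+^ s zero = Lead-one
  Lead-x+^ s (suc d) = Lead-≡ (*-identityˡ 1#) (Lead-* 1 d (Lead-x+ s) (Lead-x+^ s d))

  Deg<-shift : ∀ {f} d s → Deg< f d → Deg< (λ x → f (x + s)) d
  Lead-shift : ∀ {f} d s {c} → Lead f d c → Lead (λ x → f (x + s)) d c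
  Deg<-shift zero s p x = p (x + s)
  Deg<-shift (suc d) s (c , p) = c , Lead-shift d s p
  Lead-shift d s {c} (g , p , e) = Lead-cong d (λ x → e (x + s)) (Lead-≡ (trans (+-identityʳ _) (*-identityʳ c))
    (Lead-+ d (Lead-scale d c (Lead-x+^ s d)) ((λ x → g (x + s)) , Deg<-shift d s p , λ x → sym (trans (cong (_+ g (x + s)) (zeroˡ _)) (+-identityˡ _)))))

  -- Long division by x - x₀. The quotient keeps the coefficient `c`, which lets `Lead-root` induct
  -- on the degree.
  factor : ∀ {f} d {c} x₀ → Lead f (suc d) c → ∃ λ h → Lead h d c × (∀ x → f x ≡ (x - x₀) * h x + f x₀)
  factor {f} d {c} x₀ (g , p , e) = (λ x → c * x ^ d + h₂ x) , (h₂ , deg , λ x → refl) , eq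
    where
      -- What one step of the division leaves, of degree at most `d`.
      f₂ : Carrier → Carrier
      f₂ x = (c * x₀) * x ^ d + g x
      split : ∀ x → f x ≡ (x - x₀) * (c * x ^ d) + f₂ x
      split x = trans (e x) (solve 5 (λ c x y z g → c :* (x :* y) :+ g := (x :- z) :* (c :* y) :+ ((c :* z) :* y :+ g)) refl c x (x ^ d) x₀ (g x))
      f₂deg : Lead f₂ d (c * x₀ + proj₁ p)
      f₂deg = Lead-+ d ((λ x → 0#) , Deg<-zero d (λ x → refl) , λ x → sym (+-identityʳ _)) (proj₂ p)
      rec : ∀ d {f c} → Lead f d c → ∃ λ h → Deg< h d × (∀ x → f x ≡ (x - x₀) * h x + f x₀)
      rec zero {f} {c} (g , p , e) = (λ x → 0#) , (λ x → refl) , λ x → trans (const x) (trans (sym (const x₀)) (solve 2 (λ u v → v := u :* # 0 :+ v) refl (x - x₀) (f x₀)))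
        where const : ∀ x → f x ≡ c * 1#
              const x = trans (e x) (trans (cong (λ z → c * 1# + z) (p x)) (+-identityʳ _))
      rec (suc d) q with factor d x₀ q
      ... | h , l , e = h , (_ , l) , e
      h₂ = proj₁ (rec d f₂deg)
      deg = proj₁ (proj₂ (rec d f₂deg))
      eq : ∀ x → f x ≡ (x - x₀) * (c * x ^ d + h₂ x) + f x₀
      eq x = trans (split x) (trans (cong (λ z → (x - x₀) * (c * x ^ d) + z) (proj₂ (proj₂ (rec d f₂deg)) x))
        (trans (solve 4 (λ u v w z → u :* v :+ (u :* w :+ z) := u :* (v :+ w) :+ z) refl (x - x₀) (c * x ^ d) (h₂ x) (f₂ x₀))
          (cong (λ z → (x - x₀) * (c * x ^ d + h₂ x) + z) (sym (trans (split x₀) (solve 3 (λ x y z → (x :- x) :* y :+ z := z) refl x₀ (c * x₀ ^ d) (f₂ x₀)))))))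

  Injective : ∀ {n} → (Fin n → Carrier) → Set
  Injective f = ∀ {i j} → f i ≡ f j → i ≡ j

  -≢0 : ∀ {x y} → x ≢ y → x - y ≢ 0#
  -≢0 {x} {y} n e = n (trans (solve 2 (λ x y → x := (x :- y) :+ y) refl x y) (trans (cong (_+ y) e) (+-identityˡ y)))

  Lead-root : ∀ d {f c} → Lead f d c → (x : Fin (suc d) → Carrier) → Injective x → (∀ i → f (x i) ≡ 0#) → c ≡ 0#
  Lead-root zero {f} {c} (g , p , e) x inj r = trans (solve 1 (λ c → c := c :* # 1 :+ # 0) refl c)
    (trans (cong (λ z → c * 1# + z) (sym (p (x zero)))) (trans (sym (e (x zero))) (r zero)))
  Lead-root (suc d) {f} l x inj r = Lead-root d (proj₁ (proj₂ fac)) (x ∘ suc) (λ q → FinP.suc-injective (inj q)) roots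
    where
      fac = factor d (x zero) l
      roots : ∀ i → proj₁ fac (x (suc i)) ≡ 0#
      roots i = *-cancel-0 {x (suc i) - x zero} (drop-right (trans (sym (proj₂ (proj₂ fac) (x (suc i)))) (r (suc i))) (r zero))
        (-≢0 (λ q → FinP.0≢1+n (sym (inj q))))

  Deg<-roots : ∀ d {f} → Deg< f d → (x : Fin d → Carrier) → Injective x → (∀ i → f (x i) ≡ 0#) → ∀ y → f y ≡ 0#
  Deg<-roots zero p x inj r y = p y
  Deg<-roots (suc d) {f} (c , l@(g , p , e)) x inj r y = trans (eq y) (Deg<-roots d p (x ∘ suc) (λ q → FinP.suc-injective (inj q)) (λ i → trans (sym (eq _)) (r (suc i))) y)
    where
      c0 = Lead-root d l x inj r
      eq : ∀ y → f y ≡ g y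
      eq y = trans (e y) (trans (cong (λ z → z * y ^ d + g y) c0) (trans (cong (_+ g y) (zeroˡ _)) (+-identityˡ _)))

  naturals-injective : ∀ {n} → Injective {n} (λ i → fromℕ (toℕ i))
  naturals-injective e = FinP.toℕ-injective (fromℕ-injective e)

  -- Characteristic 0 supplies enough distinct points among the natural numbers.
  Lead-vanishing : ∀ d {f c} → Lead f d c → (∀ x → f x ≡ 0#) → c ≡ 0#
  Lead-vanishing d l z = Lead-root d l (λ i → fromℕ (toℕ i)) naturals-injective (λ i → z _)

  expand : ∀ {n} → (Fin n → Carrier) → Carrier → Carrier
  expand u x = ∑ (λ i → u i * x ^ toℕ i)

  expand-suc : ∀ {n} (u : Fin (suc n) → Carrier) x → expand u x ≡ u zero + x * expand (u ∘ suc) x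
  expand-suc u x = cong₂ _+_ (*-identityʳ (u zero)) (trans (sum-cong-≗ λ i → solve 3 (λ u x y → u :* (x :* y) := x :* (u :* y)) refl (u (suc i)) x (x ^ toℕ i)) (sym (*-distribˡ-sum x (λ i → u (suc i) * x ^ toℕ i))))

  expand-Deg< : ∀ {n} (u : Fin n → Carrier) → Deg< (expand u) n
  expand-Deg< {zero} u x = refl
  expand-Deg< {suc n} u = Deg<-cong (suc n) (expand-suc u) (Deg<-+ (suc n) (Deg<-≤ {d = 1} (ℕ.s≤s ℕ.z≤n) (_ , Lead-const (u zero))) (Deg<-x* n (expand-Deg< (u ∘ suc))))

  -- The constant coefficient is the value at 0. In the rest the factor x cancels at the points 1,
  -- 2, ..., which are as many as the degree bound requires.
  expand-vanishing : ∀ {n} (u : Fin n → Carrier) → (∀ x → expand u x ≡ 0#) → ∀ i → u i ≡ 0#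
  expand-vanishing {suc n} u z zero = trans (solve 2 (λ u v → u := u :+ # 0 :* v) refl (u zero) (expand (u ∘ suc) 0#)) (trans (sym (expand-suc u 0#)) (z 0#))
  expand-vanishing {suc n} u z (suc i) = expand-vanishing (u ∘ suc)
    (Deg<-roots n (expand-Deg< (u ∘ suc)) (λ i → fromℕ (suc (toℕ i))) (λ e → FinP.toℕ-injective (ℕP.suc-injective (fromℕ-injective e)))
      λ i → *-cancel-0 (drop-left (trans (sym (expand-suc u (fromℕ (suc (toℕ i))))) (z (fromℕ (suc (toℕ i))))) (expand-vanishing u z zero)) (Pos⇒≢0 (Pos-suc (toℕ i)))) i

  -- This is the invertibility of the Vandermonde matrix of the points `x`.
  expand-roots : ∀ {n} (u x : Fin n → Carrier) → Injective x → (∀ j → expand u (x j) ≡ 0#) → ∀ i → u i ≡ 0#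
  expand-roots {n} u x inj r = expand-vanishing u (Deg<-roots n (expand-Deg< u) x inj r)

  either-all : ∀ {n} {A B : Fin n → Set} → (∀ i → A i ⊎ B i) → (∃ A) ⊎ (∀ i → B i)
  either-all {zero} f = inj₂ λ ()
  either-all {suc n} f with f zero | either-all (f ∘ suc)
  ... | inj₁ a | _ = inj₁ (zero , a)
  ... | inj₂ b | inj₁ (i , a) = inj₁ (suc i , a)
  ... | inj₂ b | inj₂ g = inj₂ λ { zero → b ; (suc i) → g i }

  nonzero? : ∀ x → x ≢ 0# ⊎ x ≡ 0#
  nonzero? x with ≡0? x
  ... | yes e = inj₂ e
  ... | no n = inj₁ n

  HasKernel : ∀ {m n} → (Fin m → Fin n → Carrier) → Set
  HasKernel {m} {n} A = ∃ λ (x : Fin n → Carrier) → (∃ λ j → x j ≢ 0#) × (∀ i → ∑ (λ j → A i j * x j) ≡ 0#)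

  -- Elimination without division: rows are combined by cross-multiplication with the pivot `a`, and
  -- a kernel vector of the smaller matrix, scaled by `a`, leaves the first unknown to be read off
  -- the pivot row.
  module Pivot {m n : ℕ} (A : Fin (suc m) → Fin (suc n) → Carrier) (r : Fin (suc m)) (pivot≢0 : A r zero ≢ 0#) where
    private
      a = A r zero

    reduced : Fin m → Fin n → Carrier
    reduced k j = a * A (punchIn r k) (suc j) - A (punchIn r k) zero * A r (suc j)

    module _ (y : Fin n → Carrier) where
      x : Carrier → Fin (suc n) → Carrier
      x S zero = - S
      x S (suc j) = a * y j

      pull : ∀ i → ∑ (λ j → A i (suc j) * (a * y j)) ≡ a * ∑ (λ j → A i (suc j) * y j)
      pull i = trans (sum-cong-≗ λ j → solve 3 (λ b a y → b :* (a :* y) := a :* (b :* y)) refl (A i (suc j)) a (y j)) (sym (*-distribˡ-sum a (λ j → A i (suc j) * y j)))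

      row : ∀ {S} → S ≡ ∑ (λ j → A r (suc j) * y j) → ∀ k → ∑ (λ j → reduced k j * y j) ≡ 0# → ∑ (λ j → A (punchIn r k) j * x S j) ≡ 0#
      row {S} eS k z = trans (cong (λ z → b * (- S) + z) (pull (punchIn r k)))
        (trans (solve 4 (λ b s a t → b :* (:- s) :+ a :* t := a :* t :+ (:- b) :* s) refl b S a T)
        (trans (cong₂ _+_ (*-distribˡ-sum a t) (trans (cong (λ z → (- b) * z) eS) (*-distribˡ-sum (- b) s)))
        (trans (sym (∑-distrib-+ (λ j → a * t j) (λ j → (- b) * s j))) (trans (sum-cong-≗ each) z))))
        where
          b = A (punchIn r k) zero
          t = λ j → A (punchIn r k) (suc j) * y j
          s = λ j → A r (suc j) * y j
          T = ∑ t
          each : ∀ j → a * t j + (- b) * s j ≡ reduced k j * y j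
          each j = solve 5 (λ a c y b d → a :* (c :* y) :+ (:- b) :* (d :* y) := (a :* c :- b :* d) :* y) refl a (A (punchIn r k) (suc j)) (y j) b (A r (suc j))

      pivot-row : ∀ {S} → S ≡ ∑ (λ j → A r (suc j) * y j) → ∑ (λ j → A r j * x S j) ≡ 0#
      pivot-row {S} eS = trans (cong (λ z → a * (- S) + z) (trans (pull r) (cong (λ z → a * z) (sym eS)))) (solve 2 (λ a s → a :* (:- s) :+ a :* s := # 0) refl a S)

    extend : HasKernel reduced → HasKernel A
    extend (y , (j , nz) , eq) = x y S , (suc j , *-≢0 pivot≢0 nz) , eqs
      where
        S = ∑ (λ j → A r (suc j) * y j)
        eqs : ∀ i → ∑ (λ j → A i j * x y S j) ≡ 0#
        eqs i with r FinP.≟ i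
        ... | yes refl = pivot-row y refl
        ... | no ne = subst (λ i → ∑ (λ j → A i j * x y S j) ≡ 0#) (FinP.punchIn-punchOut ne) (row y refl (punchOut ne) (eq (punchOut ne)))

  -- Each elimination uses up one row and one column. If the first column is zero, the first unit
  -- vector already lies in the kernel.
  kernel : ∀ {m n} → m ℕ.< n → (A : Fin m → Fin n → Carrier) → HasKernel A
  kernel {m} {suc n} m<n A with either-all (λ i → nonzero? (A i zero))
  ... | inj₂ z = (λ { zero → 1# ; (suc j) → 0# }) , (zero , Pos⇒≢0 Pos-1) ,
    λ i → trans (cong₂ _+_ (trans (*-identityʳ _) (z i)) (∑-0 {n} λ j → zeroʳ _)) (+-identityˡ 0#)
  kernel {suc m} {suc n} m<n A | inj₁ (r , nz) = Pivot.extend A r nz (kernel (ℕP.≤-pred m<n) (Pivot.reduced A r nz))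

  -- Coefficients are listed from the top degree down.
  monomial : ∀ {E} → Fin E → Carrier → Carrier
  monomial {suc E} zero x = x ^ E
  monomial {suc E} (suc e) x = monomial e x

  poly : ∀ {E} → (Fin E → Carrier) → Carrier → Carrier
  poly a x = ∑ (λ e → a e * monomial e x)

  poly-Deg< : ∀ {E} (a : Fin E → Carrier) → Deg< (poly a) E
  poly-Deg< {zero} a x = refl
  poly-Deg< {suc E} a = a zero , poly (a ∘ suc) , poly-Deg< (a ∘ suc) , λ x → refl

  poly-Lead : ∀ {E} (a : Fin (suc E) → Carrier) → Lead (poly a) E (a zero)
  poly-Lead a = poly (a ∘ suc) , poly-Deg< (a ∘ suc) , λ x → refl

  Proper : ℕ → (Carrier → Carrier) → Set
  Proper K f = ∃₂ λ d c → d ℕ.< K × c ≢ 0# × Lead f d c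

  poly-Proper : ∀ {E} (a : Fin E → Carrier) → Proper E (poly a) ⊎ (∀ e → a e ≡ 0#)
  poly-Proper {zero} a = inj₂ λ ()
  poly-Proper {suc E} a with nonzero? (a zero) | poly-Proper (a ∘ suc)
  ... | inj₁ n | _ = inj₁ (E , a zero , ℕP.≤-refl , n , poly-Lead a)
  ... | inj₂ z | inj₁ (d , c , lt , n , l) = inj₁ (d , c , ℕP.m≤n⇒m≤1+n lt , n , Lead-cong d (λ x → trans (cong (λ u → u * x ^ E + poly (a ∘ suc) x) z) (trans (cong (_+ poly (a ∘ suc) x) (zeroˡ _)) (+-identityˡ _))) l)
  ... | inj₂ z | inj₂ w = inj₂ λ { zero → z ; (suc e) → w e }

  module Shifts {n K : ℕ} (Λ : Fin n → Carrier) (Λ-inj : Injective Λ) (P : Fin n → Carrier → Carrier)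
                (P-proper : ∀ l → Proper K (P l)) where

    entry : Fin n → Fin n → Carrier → Carrier
    entry l i x = Λ l ^ toℕ i * P l (x + fromℕ (toℕ i))

    -- What remains of the `l`-th component when the shifts i are combined with polynomial
    -- multipliers a_i.
    Q : ∀ {E} → (Fin n → Fin E → Carrier) → Fin n → Carrier → Carrier
    Q a l x = ∑ (λ i → poly (a i) x * entry l i x)

    entry-Lead : ∀ l i → Lead (entry l i) (proj₁ (P-proper l)) (Λ l ^ toℕ i * proj₁ (proj₂ (P-proper l)))
    entry-Lead l i with P-proper l
    ... | d , c , lt , nz , lead = Lead-scale d (Λ l ^ toℕ i) (Lead-shift d (fromℕ (toℕ i)) lead)

    Q-Deg< : ∀ {E} (a : Fin n → Fin E → Carrier) l → Deg< (Q a l) (E ℕ.+ K)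
    Q-Deg< {E} a l = Deg<-∑ _ (E ℕ.+ K) λ i → Deg<-≤ (ℕP.+-monoʳ-≤ E (ℕP.<⇒≤ (proj₁ (proj₂ (proj₂ (P-proper l))))))
      (Deg<-* E (proj₁ (P-proper l)) (poly-Deg< (a i)) (_ , entry-Lead l i))

    -- Up to a nonzero factor the top coefficient of `Q a l` is Σ a_i Λ_l^i over the leading
    -- coefficients a_i. As the Λ_l are distinct, Vandermonde makes these zero, and the degree bound
    -- `E` drops by one.
    Q-independent : ∀ {E} (a : Fin n → Fin E → Carrier) → (∀ l x → Q a l x ≡ 0#) → ∀ i e → a i e ≡ 0#
    Q-independent {suc E} a z = λ { i zero → top i ; i (suc e) → Q-independent (λ i → a i ∘ suc) rest i e }
      where
        top : ∀ i → a i zero ≡ 0#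
        top = expand-roots (λ i → a i zero) Λ Λ-inj λ l →
          *-cancel-0 (trans (*-comm _ _) (trans (*-distribʳ-sum {n} _ (λ i → a i zero * Λ l ^ toℕ i)) (trans (sum-cong-≗ {n} λ i → *-assoc (a i zero) (Λ l ^ toℕ i) (proj₁ (proj₂ (P-proper l))))
            (Lead-vanishing (E ℕ.+ proj₁ (P-proper l)) (Lead-∑ _ (E ℕ.+ proj₁ (P-proper l)) λ i → Lead-* E (proj₁ (P-proper l)) (poly-Lead (a i)) (entry-Lead l i)) (z l))))
            ) (proj₁ (proj₂ (proj₂ (proj₂ (P-proper l)))))
        rest : ∀ l x → Q (λ i → a i ∘ suc) l x ≡ 0#
        rest l x = trans (sum-cong-≗ λ i → cong (_* entry l i x) (sym (trans (cong (λ u → u * x ^ E + poly (a i ∘ suc) x) (top i)) (trans (cong (_+ poly (a i ∘ suc) x) (zeroˡ _)) (+-identityˡ _))))) (z l x)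

    Q-flat : ∀ {E} (v : Fin (n ℕ.* E) → Carrier) l x →
      Q {E} (λ i e → v (combine i e)) l x ≡ ∑ (λ j → (monomial (proj₂ (remQuot {n} E j)) x * entry l (proj₁ (remQuot {n} E j)) x) * v j)
    Q-flat {E} v l x = sym (trans (∑-combine n E _) (sum-cong-≗ {n} λ i → sym (trans (*-distribʳ-sum {E} (entry l i x) (λ e → v (combine i e) * monomial e x)) (sum-cong-≗ {E} λ e →
      trans (solve 3 (λ a m t → a :* m :* t := m :* t :* a) refl (v (combine i e)) (monomial e x) (entry l i x))
        (cong (λ p → monomial (proj₂ p) x * entry l (proj₁ p) x * v (combine i e)) (sym (FinP.remQuot-combine {n} i e)))))))

  -- A nonzero combination of the shifts kills all components but the first, by counting
  -- coefficients. At the points it then shows that `w t zero` times `Q a zero` vanishes, and T such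
  -- zeros kill the first component as well, against `Q-independent`. The weights enter only through
  -- cancellation, so they may depend on the point in any way.
  shift-bound : ∀ {n K T} (Λ : Fin (suc n) → Carrier) → Injective Λ → (P : Fin (suc n) → Carrier → Carrier) → (∀ l → Proper K (P l)) →
    (x : Fin T → Carrier) → Injective x → (w : Fin T → Fin (suc n) → Carrier) → (∀ t l → w t l ≢ 0#) →
    suc n ℕ.* K ℕ.+ K ℕ.≤ T →
    ¬ (∀ t i → ∑ (λ l → w t l * (Λ l ^ toℕ i * P l (x t + fromℕ (toℕ i)))) ≡ 0#)
  shift-bound {n} {K} {T} Λ Λ-inj P proper x x-inj w w≢0 big vanish = contra
    where
      open Shifts {suc n} {K} Λ Λ-inj P proper
      E = suc n ℕ.* K
      1≤K : 1 ℕ.≤ K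
      1≤K = ℕP.≤-trans (ℕ.s≤s ℕ.z≤n) (proj₁ (proj₂ (proj₂ (proper zero))))
      node : Fin (E ℕ.+ K) → Carrier
      node i = fromℕ (toℕ i)
      A : Fin (n ℕ.* (E ℕ.+ K)) → Fin (suc n ℕ.* E) → Carrier
      A k j = monomial (proj₂ (remQuot {suc n} E j)) (node (proj₂ (remQuot {n} (E ℕ.+ K) k)))
        * entry (suc (proj₁ (remQuot {n} (E ℕ.+ K) k))) (proj₁ (remQuot {suc n} E j)) (node (proj₂ (remQuot {n} (E ℕ.+ K) k)))
      -- This amounts to n K < E, which is the reason for taking E = (n + 1) K.
      count : n ℕ.* (E ℕ.+ K) ℕ.< suc n ℕ.* E
      count = subst₂ ℕ._≤_ (ar₁ n K) refl (ℕP.+-monoˡ-≤ (n ℕ.* E) (ℕP.+-monoˡ-≤ (n ℕ.* K) 1≤K))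
        where ar₁ : ∀ n K → 1 ℕ.+ n ℕ.* K ℕ.+ n ℕ.* (suc n ℕ.* K) ≡ suc (n ℕ.* (suc n ℕ.* K ℕ.+ K))
              ar₁ = ℕsolve-∀
      ker = kernel count A
      v = proj₁ ker
      a : Fin (suc n) → Fin E → Carrier
      a i e = v (combine i e)
      others : ∀ l y → Q a (suc l) y ≡ 0#
      others l = Deg<-roots (E ℕ.+ K) (Q-Deg< a (suc l)) node naturals-injective λ t →
        trans (Q-flat v (suc l) (node t)) (trans (sum-cong-≗ λ j → cong (λ p → monomial (proj₂ (remQuot {suc n} E j)) (node (proj₂ p)) * entry (suc (proj₁ p)) (proj₁ (remQuot {suc n} E j)) (node (proj₂ p)) * v j) (sym (FinP.remQuot-combine {n} l t)))
          (proj₂ (proj₂ ker) (combine l t)))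
      inj≤ : Fin (E ℕ.+ K) → Fin T
      inj≤ i = Fin.inject≤ i big
      atPoint : ∀ t → Q a zero (x t) ≡ 0#
      atPoint t = *-cancel-0 (drop-right swapped (∑-0 λ l → trans (cong (λ z → w t (suc l) * z) (others l (x t))) (zeroʳ _))) (w≢0 t zero)
        where
          swapped : ∑ (λ l → w t l * Q a l (x t)) ≡ 0#
          swapped = trans (sum-cong-≗ {suc n} λ l → *-distribˡ-sum {suc n} (w t l) (λ i → poly (a i) (x t) * entry l i (x t))) (trans (∑-comm (λ l i → w t l * (poly (a i) (x t) * entry l i (x t))))
            (∑-0 {suc n} λ i → trans (sum-cong-≗ {suc n} λ l → solve 3 (λ w p e → w :* (p :* e) := p :* (w :* e)) refl (w t l) (poly (a i) (x t)) (entry l i (x t)))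
              (trans (sym (*-distribˡ-sum {suc n} (poly (a i) (x t)) (λ l → w t l * entry l i (x t)))) (trans (cong (λ z → poly (a i) (x t) * z) (vanish t i)) (zeroʳ _)))))
      first : ∀ y → Q a zero y ≡ 0#
      first = Deg<-roots (E ℕ.+ K) (Q-Deg< a zero) (x ∘ inj≤) (λ e → FinP.inject≤-injective big big _ _ (x-inj e)) λ i → atPoint (inj≤ i)
      allZero : ∀ i e → a i e ≡ 0#
      allZero = Q-independent a λ { zero y → first y ; (suc l) y → others l y }
      contra : ⊥
      contra with proj₁ (proj₂ ker)
      ... | j , nz = nz (trans (cong v (sym (FinP.combine-remQuot {suc n} E j))) (allZero (proj₁ (remQuot {suc n} E j)) (proj₂ (remQuot {suc n} E j))))

  -- Induction on the number of components: one whose polynomial is zero is dropped together with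
  -- the last shift, and when all polynomials are nonzero `shift-bound` applies.
  zero-estimate : ∀ {L K T} (Λ : Fin L → Carrier) → Injective Λ → (p : Fin L → Fin K → Carrier) →
    (x : Fin T → Carrier) → Injective x → (w : Fin T → Fin L → Carrier) → (∀ t l → w t l ≢ 0#) →
    L ℕ.* K ℕ.+ K ℕ.≤ T →
    (∀ t i → ∑ (λ l → w t l * (Λ l ^ toℕ i * poly (p l) (x t + fromℕ (toℕ {L} i)))) ≡ 0#) →
    ∀ l k → p l k ≡ 0#
  zero-estimate {zero} Λ inj p x x-inj w w≢0 big vanish ()
  zero-estimate {suc L} {K} {T} Λ inj p x x-inj w w≢0 big vanish with either-all (λ l → swap (poly-Proper (p l)))
    where swap : ∀ {A B : Set} → A ⊎ B → B ⊎ A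
          swap (inj₁ a) = inj₂ a
          swap (inj₂ b) = inj₁ b
  ... | inj₂ proper = ⊥-elim (shift-bound Λ inj (λ l → poly (p l)) proper x x-inj w w≢0 big vanish)
  ... | inj₁ (r , z) = λ l k → go l k
    where
      ih = zero-estimate {L} (Λ ∘ punchIn r) (λ e → FinP.punchIn-injective r _ _ (inj e)) (p ∘ punchIn r) x x-inj (λ t → w t ∘ punchIn r) (λ t l → w≢0 t _)
        (ℕP.≤-trans (ℕP.m≤n+m (L ℕ.* K ℕ.+ K) K) (ℕP.≤-trans (ℕP.≤-reflexive (sym (ℕP.+-assoc K (L ℕ.* K) K))) big))
        λ t i → let g = λ l → w t l * (Λ l ^ toℕ i * poly (p l) (x t + fromℕ (toℕ i))) in
          trans (sym (trans (cong (_+ ∑ (g ∘ punchIn r)) (trans (cong (λ q → w t r * (Λ r ^ toℕ i * q)) (∑-0 λ e → trans (cong (_* _) (z e)) (zeroˡ _))) (solve 2 (λ a b → a :* (b :* # 0) := # 0) refl (w t r) (Λ r ^ toℕ i)))) (+-identityˡ _)))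
            (trans (sym (sum-remove {i = r} g)) (subst (λ j → ∑ (λ l → w t l * (Λ l ^ j * poly (p l) (x t + fromℕ j))) ≡ 0#) (FinP.toℕ-inject₁ i) (vanish t (Fin.inject₁ i))))
      go : ∀ l k → p l k ≡ 0#
      go l k with r FinP.≟ l
      ... | yes refl = z k
      ... | no ne = subst (λ l → p l k ≡ 0#) (FinP.punchIn-punchOut ne) (ih (punchOut ne) k)

-- Binomial expansion of z^k (1 + δ)^z

module BinomialExpansion (F : OrderedField) where

  open import Data.Fin using (Fin; zero; suc; toℕ)
  open import Function using (_∘_)
  open OrderedFieldTheory F
  open ZeroEstimate F

  bin : ℕ → ℕ → ℕ
  bin z zero = 1
  bin zero (suc m) = 0
  bin (suc z) (suc m) = bin z m ℕ.+ bin z (suc m)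

  -- Multiplication by z in the basis of binomials; iterated, it brings in the factor z^k.
  bin-absorb : ∀ z u → z ℕ.* bin z u ≡ u ℕ.* bin z u ℕ.+ suc u ℕ.* bin z (suc u)
  bin-absorb zero zero = refl
  bin-absorb zero (suc u) = sym (trans (cong₂ ℕ._+_ (ℕP.*-zeroʳ (suc u)) (ℕP.*-zeroʳ (suc (suc u)))) refl)
  bin-absorb (suc z) zero = trans (ar₀ z) (trans (cong (1 ℕ.+_) (bin-absorb z zero)) (ar₁ (bin z 1)))
    where ar₀ : ∀ z → (1 ℕ.+ z) ℕ.* 1 ≡ 1 ℕ.+ z ℕ.* 1
          ar₀ = ℕsolve-∀
          ar₁ : ∀ b → 1 ℕ.+ (0 ℕ.* 1 ℕ.+ 1 ℕ.* b) ≡ 0 ℕ.* 1 ℕ.+ 1 ℕ.* (1 ℕ.+ b)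
          ar₁ = ℕsolve-∀
  bin-absorb (suc z) (suc u) = trans (ar₀ z (bin z u) (bin z (suc u)))
    (trans (cong₂ (λ s t → s ℕ.+ t ℕ.+ bin z u ℕ.+ bin z (suc u)) (bin-absorb z u) (bin-absorb z (suc u)))
      (ar₁ u (bin z u) (bin z (suc u)) (bin z (suc (suc u)))))
    where ar₀ : ∀ z a b → (1 ℕ.+ z) ℕ.* (a ℕ.+ b) ≡ z ℕ.* a ℕ.+ z ℕ.* b ℕ.+ a ℕ.+ b
          ar₀ = ℕsolve-∀
          ar₁ : ∀ u a b c → (u ℕ.* a ℕ.+ (1 ℕ.+ u) ℕ.* b) ℕ.+ ((1 ℕ.+ u) ℕ.* b ℕ.+ (1 ℕ.+ (1 ℕ.+ u)) ℕ.* c) ℕ.+ a ℕ.+ b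
                ≡ (1 ℕ.+ u) ℕ.* (a ℕ.+ b) ℕ.+ (1 ℕ.+ (1 ℕ.+ u)) ℕ.* (b ℕ.+ c)
          ar₁ = ℕsolve-∀

  bin-mono : ∀ {z Z} u → z ℕ.≤ Z → bin z u ℕ.≤ bin Z u
  bin-mono zero p = ℕP.≤-refl
  bin-mono (suc u) ℕ.z≤n = ℕ.z≤n
  bin-mono (suc u) (ℕ.s≤s p) = ℕP.+-mono-≤ (bin-mono u p) (bin-mono (suc u) p)

  ∑-snoc : ∀ d (f : ℕ → Carrier) → ∑ {suc d} (f ∘ toℕ) ≡ ∑ {d} (f ∘ toℕ) + f d
  ∑-snoc zero f = trans (+-identityʳ _) (sym (+-identityˡ _))
  ∑-snoc (suc d) f = trans (cong (λ z → f 0 + z) (∑-snoc d (f ∘ suc))) (sym (+-assoc _ _ _))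

  ∑-extend : ∀ {d d'} (f : ℕ → Carrier) → d ℕ.≤ d' → (∀ u → d ℕ.≤ u → f u ≡ 0#) → ∑ {d'} (f ∘ toℕ) ≡ ∑ {d} (f ∘ toℕ)
  ∑-extend {zero} {d'} f p z = ∑-0 {d'} λ i → z (toℕ i) ℕ.z≤n
  ∑-extend {suc d} f (ℕ.s≤s p) z = cong (λ x → f 0 + x) (∑-extend (f ∘ suc) p λ u q → z (suc u) (ℕ.s≤s q))

  ∑-nn : ∀ {n} (f : Fin n → Carrier) → (∀ i → NonNeg (f i)) → NonNeg (∑ f)
  ∑-nn {zero} f p = nn-0
  ∑-nn {suc n} f p = nn-+ (p zero) (∑-nn (f ∘ suc) (p ∘ suc))

  ∑-term : ∀ {n} (f : Fin n → Carrier) → (∀ i → NonNeg (f i)) → ∀ i → f i ≤ ∑ f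
  ∑-term {suc n} f p zero = ≤-by (solve 2 (λ a b → b := (a :+ b) :- a) refl (f zero) (∑ (f ∘ suc))) (∑-nn (f ∘ suc) (p ∘ suc))
  ∑-term {suc n} f p (suc i) = ≤-trans (∑-term (f ∘ suc) (p ∘ suc) i) (≤-by (solve 2 (λ a b → a := (a :+ b) :- b) refl (f zero) (∑ (f ∘ suc))) (p zero))

  ∑-± : ∀ {n} (f : Fin n → Carrier) b → (∀ i → f i ∈± b) → ∑ f ∈± fromℕ n * b
  ∑-± {zero} f b p = subst (0# ∈±_) (sym (zeroˡ b)) (±-of-nn nn-0 ≤-refl)
  ∑-± {suc n} f b p = subst (f zero + ∑ (f ∘ suc) ∈±_) (trans (solve 2 (λ n b → b :+ n :* b := (# 1 :+ n) :* b) refl (fromℕ n) b) (cong (_* b) (sym (fromℕ-suc n))))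
    (±-+ (p zero) (∑-± (f ∘ suc) b (p ∘ suc)))

  module Expansion (δ : Carrier) (nn-δ : NonNeg δ) where

    -- The binomial series of (1 + δ)^z cut at M. Both pieces are defined by Pascal's rule, so
    -- bounds follow by induction and δ need not be small.
    head tail : ℕ → ℕ → Carrier
    head zero z = 0#
    head (suc M) zero = 1#
    head (suc M) (suc z) = head (suc M) z + δ * head M z
    tail zero z = (1# + δ) ^ z
    tail (suc M) zero = 0#
    tail (suc M) (suc z) = tail (suc M) z + δ * tail M z

    head+tail : ∀ M z → head M z + tail M z ≡ (1# + δ) ^ z
    head+tail zero z = +-identityˡ _
    head+tail (suc M) zero = +-identityʳ _
    head+tail (suc M) (suc z) = trans (solve 5 (λ a b c d e → (a :+ e :* b) :+ (c :+ e :* d) := (a :+ c) :+ e :* (b :+ d)) refl (head (suc M) z) (head M z) (tail (suc M) z) (tail M z) δ)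
      (trans (cong₂ (λ u v → u + δ * v) (head+tail (suc M) z) (head+tail M z)) (solve 2 (λ p e → p :+ e :* p := (# 1 :+ e) :* p) refl ((1# + δ) ^ z) δ))

    tail-nn : ∀ M z → NonNeg (tail M z)
    tail-nn zero z = nn-^ z (nn-+ nn-1 nn-δ)
    tail-nn (suc M) zero = nn-0
    tail-nn (suc M) (suc z) = nn-+ (tail-nn (suc M) z) (nn-* nn-δ (tail-nn M z))

    head≤ : ∀ M z → head M z ≤ (1# + δ) ^ z
    head≤ M z = ≤-by (trans (solve 2 (λ h t → t := (h :+ t) :- h) refl (head M z) (tail M z)) (cong (_- head M z) (head+tail M z))) (tail-nn M z)

    -- Replacing δ by 4δ multiplies the m-th term by 4^m.
    private
      scaled : ∀ M z → fromℕ 4 ^ M * tail M z ≤ (1# + fromℕ 4 * δ) ^ z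
      scaled zero z = ≤-trans (≤-reflexive (*-identityˡ _)) (^-mono-≤ z (nn-+ nn-1 nn-δ) (≤-by (solve 1 (λ d → # 3 :* d := (# 1 :+ # 4 :* d) :- (# 1 :+ d)) refl δ) (nn-* (nn-fromℕ 3) nn-δ)))
      scaled (suc M) zero = ≤-trans (≤-reflexive (zeroʳ _)) (nn⇒0≤ nn-1)
      scaled (suc M) (suc z) = ≤-trans (≤-reflexive (solve 4 (λ f d a b → (# 4 :* f) :* (a :+ d :* b) := (# 4 :* f) :* a :+ (# 4 :* d) :* (f :* b)) refl (fromℕ 4 ^ M) δ (tail (suc M) z) (tail M z)))
        (≤-trans (+-mono-≤ (scaled (suc M) z) (*-monoˡ-≤ (nn-* (nn-fromℕ 4) nn-δ) (scaled M z)))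
          (≤-reflexive (solve 2 (λ d p → p :+ (# 4 :* d) :* p := (# 1 :+ # 4 :* d) :* p) refl δ ((1# + fromℕ 4 * δ) ^ z))))

      bernoulli : 1# + fromℕ 4 * δ ≤ (1# + δ) ^ 4
      bernoulli = ≤-by (solve 1 (λ d → # 6 :* (d :* d) :+ # 4 :* (d :* (d :* d)) :+ (d :* d) :* (d :* d) := ((# 1 :+ d) :* ((# 1 :+ d) :* ((# 1 :+ d) :* ((# 1 :+ d) :* # 1)))) :- (# 1 :+ # 4 :* d)) refl δ)
        (nn-+ (nn-+ (nn-* (nn-fromℕ 6) (nn-* nn-δ nn-δ)) (nn-* (nn-fromℕ 4) (nn-* nn-δ (nn-* nn-δ nn-δ)))) (nn-* (nn-* nn-δ nn-δ) (nn-* nn-δ nn-δ)))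

    -- Since 1 + 4δ ≤ (1 + δ)⁴, the gain 4^M is paid for by a fourth power of a quantity that is
    -- bounded anyway.
    tail-bound : ∀ M z → fromℕ 4 ^ M * tail M z ≤ ((1# + δ) ^ 4) ^ z
    tail-bound M z = ≤-trans (scaled M z) (^-mono-≤ z (nn-+ nn-1 (nn-* (nn-fromℕ 4) nn-δ)) bernoulli)

    truncated : ℕ → ℕ → Carrier
    truncated zero u = 0#
    truncated (suc M) zero = 1#
    truncated (suc M) (suc u) = δ * truncated M u

    head-binomial : ∀ M z → head M z ≡ ∑ {M} (λ i → truncated M (toℕ i) * fromℕ (bin z (toℕ i)))
    head-binomial zero z = refl
    head-binomial (suc M) zero = sym (trans (cong₂ _+_ (*-identityˡ 1#) (∑-0 {M} λ i → zeroʳ _)) (+-identityʳ 1#))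
    head-binomial (suc M) (suc z) = trans (cong₂ (λ u v → u + δ * v) (head-binomial (suc M) z) (head-binomial M z))
      (trans (+-assoc (1# * 1#) (∑ g) (δ * ∑ f)) (cong (λ s → 1# * 1# + s)
        (trans (cong (λ s → ∑ g + s) (*-distribˡ-sum {M} δ f)) (trans (sym (∑-distrib-+ {M} g (λ i → δ * f i))) (sum-cong-≗ {M} each)))))
      where
        f g : Fin M → Carrier
        f i = truncated M (toℕ i) * fromℕ (bin z (toℕ i))
        g i = δ * truncated M (toℕ i) * fromℕ (bin z (suc (toℕ i)))
        each : ∀ i → g i + δ * f i ≡ δ * truncated M (toℕ i) * fromℕ (bin z (toℕ i) ℕ.+ bin z (suc (toℕ i)))
        each i = trans (solve 4 (λ d t a b → d :* t :* b :+ d :* (t :* a) := d :* t :* (a :+ b)) refl δ (truncated M (toℕ i)) (fromℕ (bin z (toℕ i))) (fromℕ (bin z (suc (toℕ i)))))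
          (cong (λ s → δ * truncated M (toℕ i) * s) (sym (fromℕ-+ (bin z (toℕ i)) _)))

    -- The coefficients of z^k `head M z` in the basis of binomials of z, computed by `bin-absorb`.
    -- None is negative, so a single term never exceeds the sum.
    coef : ℕ → ℕ → ℕ → Carrier
    coef M zero u = truncated M u
    coef M (suc k) zero = 0#
    coef M (suc k) (suc u) = fromℕ (suc u) * (coef M k (suc u) + coef M k u)

    truncated-nn : ∀ M u → NonNeg (truncated M u)
    truncated-nn zero u = nn-0
    truncated-nn (suc M) zero = nn-1
    truncated-nn (suc M) (suc u) = nn-* nn-δ (truncated-nn M u)

    coef-nn : ∀ M k u → NonNeg (coef M k u)
    coef-nn M zero u = truncated-nn M u
    coef-nn M (suc k) zero = nn-0
    coef-nn M (suc k) (suc u) = nn-* (nn-fromℕ (suc u)) (nn-+ (coef-nn M k (suc u)) (coef-nn M k u))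

    truncated-vanish : ∀ M u → M ℕ.≤ u → truncated M u ≡ 0#
    truncated-vanish zero u p = refl
    truncated-vanish (suc M) (suc u) (ℕ.s≤s p) = trans (cong (λ z → δ * z) (truncated-vanish M u p)) (zeroʳ δ)

    coef-vanish : ∀ M k u → k ℕ.+ M ℕ.≤ u → coef M k u ≡ 0#
    coef-vanish M zero u p = truncated-vanish M u p
    coef-vanish M (suc k) (suc u) (ℕ.s≤s p) = trans (cong (λ z → fromℕ (suc u) * z) (trans (cong₂ _+_ (coef-vanish M k (suc u) (ℕP.m≤n⇒m≤1+n p)) (coef-vanish M k u p)) (+-identityʳ 0#))) (zeroʳ _)

    private
      term : (ℕ → Carrier) → ℕ → ℕ → Carrier
      term a z u = a u * fromℕ (bin z u)

      absorb : ∀ z u → fromℕ z * fromℕ (bin z u) ≡ fromℕ u * fromℕ (bin z u) + fromℕ (suc u) * fromℕ (bin z (suc u))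
      absorb z u = trans (sym (fromℕ-* z (bin z u))) (trans (cong fromℕ (bin-absorb z u)) (trans (fromℕ-+ (u ℕ.* bin z u) (suc u ℕ.* bin z (suc u))) (cong₂ _+_ (fromℕ-* u (bin z u)) (fromℕ-* (suc u) (bin z (suc u))))))

      -- Partial sums need the boundary term at `d` for the induction; it disappears once `d` is
      -- past the last nonzero coefficient.
      raise : ∀ M k z d → fromℕ z * ∑ {d} (term (coef M k) z ∘ toℕ) + fromℕ d * term (coef M k) z d ≡ ∑ {suc d} (term (coef M (suc k)) z ∘ toℕ)
      raise M k z zero = solve 3 (λ z a c → z :* # 0 :+ # 0 :* a := # 0 :* c :+ # 0) refl (fromℕ z) (term (coef M k) z 0) 1#
      raise M k z (suc d) = trans (cong (λ s → fromℕ z * s + fromℕ (suc d) * term (coef M k) z (suc d)) (∑-snoc d (term (coef M k) z)))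
        (trans (solve 6 (λ z s a b n t → z :* (s :+ a :* b) :+ n :* t := z :* s :+ a :* (z :* b) :+ n :* t) refl (fromℕ z) S a b n t)
        (trans (cong (λ s → fromℕ z * S + a * s + n * t) (absorb z d))
        (trans (solve 8 (λ z s a m b n c e → z :* s :+ a :* (m :* b :+ n :* c) :+ n :* (e :* c) := (z :* s :+ m :* (a :* b)) :+ n :* (e :+ a) :* c) refl (fromℕ z) S a (fromℕ d) b n c e)
        (trans (cong (λ s → s + n * (e + a) * c) (raise M k z d)) (sym (∑-snoc (suc d) (term (coef M (suc k)) z)))))))
        where
          S = ∑ {d} (term (coef M k) z ∘ toℕ)
          a = coef M k d
          b = fromℕ (bin z d)
          n = fromℕ (suc d)
          t = term (coef M k) z (suc d)
          c = fromℕ (bin z (suc d))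
          e = coef M k (suc d)

    expansion : ∀ M k z → fromℕ z ^ k * head M z ≡ ∑ {k ℕ.+ M} (λ i → coef M k (toℕ i) * fromℕ (bin z (toℕ i)))
    expansion M zero z = trans (*-identityˡ _) (head-binomial M z)
    expansion M (suc k) z = trans (*-assoc _ _ _) (trans (cong (λ s → fromℕ z * s) (expansion M k z))
      (trans (sym (+-identityʳ _)) (trans (cong (λ s → fromℕ z * ∑ {k ℕ.+ M} (term (coef M k) z ∘ toℕ) + s)
          (sym (trans (cong (λ s → fromℕ (k ℕ.+ M) * (s * fromℕ (bin z (k ℕ.+ M)))) (coef-vanish M k (k ℕ.+ M) ℕP.≤-refl)) (solve 2 (λ a b → a :* (# 0 :* b) := # 0) refl (fromℕ (k ℕ.+ M)) (fromℕ (bin z (k ℕ.+ M)))))))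
        (raise M k z (k ℕ.+ M)))))

    expansion-≤ : ∀ M k z d → k ℕ.+ M ℕ.≤ d → fromℕ z ^ k * head M z ≡ ∑ {d} (λ i → coef M k (toℕ i) * fromℕ (bin z (toℕ i)))
    expansion-≤ M k z d p = trans (expansion M k z) (sym (∑-extend (term (coef M k) z) p λ u q → trans (cong (_* fromℕ (bin z u)) (coef-vanish M k u q)) (zeroˡ _)))

-- Weights of elements of ℤ[α] and Liouville's inequality

module Integrality (F : NarayanaField) where

  open import Data.Integer using (+_; -[1+_]; ∣_∣)
  open import Data.Integer.Tactic.RingSolver using () renaming (solve-∀ to ℤsolve-∀)
  open NarayanaField F using (α; α-root; orderedField)
  open OrderedFieldTheory orderedField
  open NormForm

  -- Otherwise α²(α - 1), which equals 1, would not be positive.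
  α>1 : 1# < α
  α>1 with ≤-or-> α 1#
  ... | inj₂ p = p
  ... | inj₁ q = ⊥-elim (¬Pos-neg (nn-* (nn-sq α) q)
          (Pos-resp (trans (solve 0 (# 1 := # 1) refl) (trans (solve 1 (λ a → # 1 := (a :* a :+ # 1) :- a :* a) refl α) (trans (cong (λ z → z - α * α) (sym α-root)) (solve 1 (λ a → a :* a :* a :- a :* a := :- (a :* a :* (# 1 :- a))) refl α)))) Pos-1))

  α-nn : NonNeg α
  α-nn = inj₁ (1≤⇒Pos (<⇒≤ α>1))

  α<2 : α < two
  α<2 with ≤-or-> two α
  ... | inj₂ p = p
  ... | inj₁ q = ⊥-elim (≤⇒≯ {fromℕ 4} {1#} big (fromℕ-mono-< {1} {4} (ℕ.s≤s (ℕ.s≤s ℕ.z≤n))))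
    where
      big : fromℕ 4 ≤ 1#
      big = ≤-by
        (trans (solve 1 (λ a → (a :- # 2) :* (a :+ # 2) :* (a :- # 1) :+ # 4 :* (a :- # 2) := (a :* a :* a :- (a :* a :+ # 1)) :+ # 1 :- # 4) refl α)
          (trans (cong (λ z → z - (α * α + 1#) + 1# - fromℕ 4) α-root) (solve 1 (λ a → (a :* a :+ # 1) :- (a :* a :+ # 1) :+ # 1 :- # 4 := # 1 :- # 4) refl α)))
        (nn-+ (nn-* (nn-* q (nn-+ α-nn (nn-fromℕ 2))) (<⇒≤ α>1)) (nn-* (nn-fromℕ 4) q))

  embed : ℤ → ℤ → ℤ → Carrier
  embed a b c = ι a + ι b * α + ι c * (α * α)

  weight : ℤ → ℤ → ℤ → ℕ
  weight a b c = ∣ a ∣ ℕ.+ 2 ℕ.* ∣ b ∣ ℕ.+ 4 ℕ.* ∣ c ∣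

  -- Elements a + bα + cα² of ℤ[α] with |a| + 2|b| + 4|c| ≤ W; the weights make the bound submultiplicative.
  IsInt : Carrier → ℕ → Set
  IsInt x W = ∃ λ a → ∃ λ b → ∃ λ c → x ≡ embed a b c × weight a b c ℕ.≤ W

  IsInt-weaken : ∀ {x V W} → V ℕ.≤ W → IsInt x V → IsInt x W
  IsInt-weaken p (a , b , c , e , q) = a , b , c , e , ℕP.≤-trans q p

  IsInt-≡ : ∀ {x y W} → x ≡ y → IsInt x W → IsInt y W
  IsInt-≡ refl p = p

  private
    infix 4 _≼_
    record _≼_ (x : ℤ) (m : ℕ) : Set where
      constructor bound
      field magnitude : ∣ x ∣ ℕ.≤ m

    exact : ∀ x → x ≼ ∣ x ∣
    exact x = bound ℕP.≤-refl

    tri : ∀ {x y m n} → x ≼ m → y ≼ n → x ℤ.+ y ≼ m ℕ.+ n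
    tri {x} {y} (bound p) (bound q) = bound (ℕP.≤-trans (ℤP.∣i+j∣≤∣i∣+∣j∣ x y) (ℕP.+-mono-≤ p q))

    mul : ∀ x y → x ℤ.* y ≼ ∣ x ∣ ℕ.* ∣ y ∣
    mul x y = bound (ℕP.≤-reflexive (ℤP.∣i*j∣≡∣i∣*∣j∣ x y))

    neg : ∀ {x m} → x ≼ m → ℤ.- x ≼ m
    neg {x} (bound p) = bound (ℕP.≤-trans (ℕP.≤-reflexive (ℤP.∣-i∣≡∣i∣ x)) p)

    weigh : ∀ {a b c p q r} → a ≼ p → b ≼ q → c ≼ r → weight a b c ℕ.≤ p ℕ.+ 2 ℕ.* q ℕ.+ 4 ℕ.* r
    weigh (bound x) (bound y) (bound z) = ℕP.+-mono-≤ (ℕP.+-mono-≤ x (ℕP.*-monoʳ-≤ 2 y)) (ℕP.*-monoʳ-≤ 4 z)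

  IsInt-+ : ∀ {x y V W} → IsInt x V → IsInt y W → IsInt (x + y) (V ℕ.+ W)
  IsInt-+ {x} {y} {V} {W} (a , b , c , e , p) (a' , b' , c' , e' , p') = a ℤ.+ a' , b ℤ.+ b' , c ℤ.+ c' ,
    trans (cong₂ _+_ e e') (trans (solve 7 (λ a b c a' b' c' t → (a :+ b :* t :+ c :* (t :* t)) :+ (a' :+ b' :* t :+ c' :* (t :* t)) := (a :+ a') :+ (b :+ b') :* t :+ (c :+ c') :* (t :* t)) refl (ι a) (ι b) (ι c) (ι a') (ι b') (ι c') α)
      (sym (cong₂ _+_ (cong₂ (λ u v → u + v * α) (ι-+ a a') (ι-+ b b')) (cong (_* (α * α)) (ι-+ c c'))))) ,
    ℕP.≤-trans (weigh (tri (exact a) (exact a')) (tri (exact b) (exact b')) (tri (exact c) (exact c')))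
      (ℕP.≤-trans (ℕP.≤-reflexive (ar (∣ a ∣) (∣ b ∣) (∣ c ∣) (∣ a' ∣) (∣ b' ∣) (∣ c' ∣))) (ℕP.+-mono-≤ p p'))
    where
      ar : ∀ a b c a' b' c' → (a ℕ.+ a') ℕ.+ 2 ℕ.* (b ℕ.+ b') ℕ.+ 4 ℕ.* (c ℕ.+ c') ≡ (a ℕ.+ 2 ℕ.* b ℕ.+ 4 ℕ.* c) ℕ.+ (a' ℕ.+ 2 ℕ.* b' ℕ.+ 4 ℕ.* c')
      ar = ℕsolve-∀

  -- α³ = α² + 1 and α⁴ = α² + α + 1.
  private
    module Prod (a b c a' b' c' : ℤ) where
      d₀ = a ℤ.* a'
      d₁ = a ℤ.* b' ℤ.+ b ℤ.* a'
      d₂ = a ℤ.* c' ℤ.+ b ℤ.* b' ℤ.+ c ℤ.* a'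
      d₃ = b ℤ.* c' ℤ.+ c ℤ.* b'
      d₄ = c ℤ.* c'

    reduce : ∀ d₀ d₁ d₂ d₃ d₄ → d₀ + d₁ * α + d₂ * (α * α) + d₃ * (α * α * α) + d₄ * (α * (α * α * α))
      ≡ (d₀ + d₃ + d₄) + (d₁ + d₄) * α + (d₂ + d₃ + d₄) * (α * α)
    reduce d₀ d₁ d₂ d₃ d₄ = trans (cong (λ z → d₀ + d₁ * α + d₂ * (α * α) + d₃ * z + d₄ * (α * z)) α-root)
      (trans (solve 6 (λ p q r s u t → p :+ q :* t :+ r :* (t :* t) :+ s :* (t :* t :+ # 1) :+ u :* (t :* (t :* t :+ # 1))
          := (p :+ s) :+ (q :+ u) :* t :+ (r :+ s) :* (t :* t) :+ u :* (t :* t :* t)) refl d₀ d₁ d₂ d₃ d₄ α)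
      (trans (cong (λ z → (d₀ + d₃) + (d₁ + d₄) * α + (d₂ + d₃) * (α * α) + d₄ * z) α-root)
        (solve 6 (λ p q r s u t → (p :+ s) :+ (q :+ u) :* t :+ (r :+ s) :* (t :* t) :+ u :* (t :* t :+ # 1)
          := (p :+ s :+ u) :+ (q :+ u) :* t :+ (r :+ s :+ u) :* (t :* t)) refl d₀ d₁ d₂ d₃ d₄ α)))

  ι-dot : ∀ a b c d → ι (a ℤ.* b ℤ.+ c ℤ.* d) ≡ ι a * ι b + ι c * ι d
  ι-dot a b c d = trans (ι-+ (a ℤ.* b) (c ℤ.* d)) (cong₂ _+_ (ι-* a b) (ι-* c d))

  embed-* : ∀ a b c a' b' c' → let open Prod a b c a' b' c' in
    embed a b c * embed a' b' c' ≡ embed (d₀ ℤ.+ d₃ ℤ.+ d₄) (d₁ ℤ.+ d₄) (d₂ ℤ.+ d₃ ℤ.+ d₄)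
  embed-* a b c a' b' c' = trans
    (solve 7 (λ a b c a' b' c' t → (a :+ b :* t :+ c :* (t :* t)) :* (a' :+ b' :* t :+ c' :* (t :* t))
      := a :* a' :+ (a :* b' :+ b :* a') :* t :+ (a :* c' :+ b :* b' :+ c :* a') :* (t :* t) :+ (b :* c' :+ c :* b') :* (t :* t :* t) :+ (c :* c') :* (t :* (t :* t :* t)))
      refl (ι a) (ι b) (ι c) (ι a') (ι b') (ι c') α)
    (trans (reduce (ι a * ι a') (ι a * ι b' + ι b * ι a') (ι a * ι c' + ι b * ι b' + ι c * ι a') (ι b * ι c' + ι c * ι b') (ι c * ι c'))
      (sym (cong₂ _+_ (cong₂ (λ u v → u + v * α)
          (trans (ι-+ (d₀ ℤ.+ d₃) d₄) (cong₂ _+_ (trans (ι-+ d₀ d₃) (cong₂ _+_ (ι-* a a') ι3)) (ι-* c c')))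
          (trans (ι-+ d₁ d₄) (cong₂ _+_ (ι-dot a b' b a') (ι-* c c'))))
        (cong (_* (α * α)) (trans (ι-+ (d₂ ℤ.+ d₃) d₄) (cong₂ _+_ (trans (ι-+ d₂ d₃) (cong₂ _+_
          (trans (ι-+ (a ℤ.* c' ℤ.+ b ℤ.* b') (c ℤ.* a')) (cong₂ _+_ (ι-dot a c' b b') (ι-* c a'))) ι3)) (ι-* c c')))))))
    where
      open Prod a b c a' b' c'
      ι3 : ι d₃ ≡ ι b * ι c' + ι c * ι b'
      ι3 = ι-dot b c' c b'

  IsInt-* : ∀ {x y V W} → IsInt x V → IsInt y W → IsInt (x * y) (V ℕ.* W)
  IsInt-* {x} {y} {V} {W} (a , b , c , e , p) (a' , b' , c' , e' , p') = d₀ ℤ.+ d₃ ℤ.+ d₄ , d₁ ℤ.+ d₄ , d₂ ℤ.+ d₃ ℤ.+ d₄ , trans (cong₂ _*_ e e') (embed-* a b c a' b' c') ,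
    ℕP.≤-trans (weigh (tri (tri (mul a a') m3) (mul c c')) (tri (tri (mul a b') (mul b a')) (mul c c'))
        (tri (tri (tri (tri (mul a c') (mul b b')) (mul c a')) m3) (mul c c')))
      (ℕP.≤-trans (ℕP.m≤m+n _ (3 ℕ.* (∣ b ∣ ℕ.* ∣ c' ∣ ℕ.+ ∣ c ∣ ℕ.* ∣ b' ∣) ℕ.+ 9 ℕ.* (∣ c ∣ ℕ.* ∣ c' ∣)))
        (ℕP.≤-trans (ℕP.≤-reflexive (ar (∣ a ∣) (∣ b ∣) (∣ c ∣) (∣ a' ∣) (∣ b' ∣) (∣ c' ∣))) (ℕP.*-mono-≤ p p')))
    where
      open Prod a b c a' b' c'
      m3 = tri (mul b c') (mul c b')
      ar : ∀ a b c a' b' c' → ((a ℕ.* a' ℕ.+ (b ℕ.* c' ℕ.+ c ℕ.* b') ℕ.+ c ℕ.* c') ℕ.+ 2 ℕ.* ((a ℕ.* b' ℕ.+ b ℕ.* a') ℕ.+ c ℕ.* c')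
          ℕ.+ 4 ℕ.* (((a ℕ.* c' ℕ.+ b ℕ.* b') ℕ.+ c ℕ.* a') ℕ.+ (b ℕ.* c' ℕ.+ c ℕ.* b') ℕ.+ c ℕ.* c'))
          ℕ.+ (3 ℕ.* (b ℕ.* c' ℕ.+ c ℕ.* b') ℕ.+ 9 ℕ.* (c ℕ.* c'))
        ≡ (a ℕ.+ 2 ℕ.* b ℕ.+ 4 ℕ.* c) ℕ.* (a' ℕ.+ 2 ℕ.* b' ℕ.+ 4 ℕ.* c')
      ar = ℕsolve-∀

  IsInt-ι : ∀ z → IsInt (ι z) ∣ z ∣
  IsInt-ι z = z , + 0 , + 0 , solve 2 (λ z a → z := z :+ # 0 :* a :+ # 0 :* (a :* a)) refl (ι z) α ,
    ℕP.≤-reflexive (trans (ℕP.+-identityʳ _) (ℕP.+-identityʳ _))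

  IsInt-ℕ : ∀ n → IsInt (fromℕ n) n
  IsInt-ℕ n = IsInt-ι (+ n)

  IsInt-α : IsInt α 2
  IsInt-α = + 0 , + 1 , + 0 , solve 1 (λ a → a := # 0 :+ # 1 :* a :+ # 0 :* (a :* a)) refl α , ℕP.≤-refl

  IsInt-^ : ∀ {x W} n → IsInt x W → IsInt (x ^ n) (W ℕ.^ n)
  IsInt-^ zero p = IsInt-ℕ 1
  IsInt-^ (suc n) p = IsInt-* p (IsInt-^ n p)

  ι-∈± : ∀ z → ι z ∈± fromℕ ∣ z ∣
  ι-∈± (+ n) = ±-of-nn (nn-fromℕ n) ≤-refl
  ι-∈± -[1+ n ] = ±-neg (±-of-nn (nn-fromℕ (suc n)) ≤-refl)

  -- Since α < 2, the weights 1, 2, 4 dominate 1, α, α²; one number thus bounds both the height and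
  -- the absolute value.
  IsInt-∈± : ∀ {x W} → IsInt x W → x ∈± fromℕ W
  IsInt-∈± {x} {W} (a , b , c , refl , p) = ±-weaken (±-+ (±-+ (ι-∈± a) (±-* (ι-∈± b) α±)) (±-* (ι-∈± c) (±-* α± α±)))
    (≤-trans (≤-reflexive (trans (solve 3 (λ a b c → a :+ b :* # 2 :+ c :* (# 2 :* # 2) := a :+ # 2 :* b :+ # 4 :* c) refl (fromℕ ∣ a ∣) (fromℕ ∣ b ∣) (fromℕ ∣ c ∣))
        (sym (trans (fromℕ-+ (∣ a ∣ ℕ.+ 2 ℕ.* ∣ b ∣) (4 ℕ.* ∣ c ∣)) (cong₂ _+_ (trans (fromℕ-+ ∣ a ∣ (2 ℕ.* ∣ b ∣)) (cong (λ z → fromℕ ∣ a ∣ + z) (fromℕ-* 2 ∣ b ∣))) (fromℕ-* 4 ∣ c ∣)))))) (fromℕ-mono-≤ p))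
    where
      α± : α ∈± two
      α± = ±-of-nn α-nn (<⇒≤ α<2)

  module Norm (a b c : ℤ) where
    -- The coordinates of the product of the two complex conjugates of a + bα + cα².
    adj₀ = a ℤ.* a ℤ.+ a ℤ.* b ℤ.+ a ℤ.* c ℤ.+ ℤ.- (b ℤ.* c) ℤ.+ ℤ.- (c ℤ.* c)
    adj₁ = ℤ.- (a ℤ.* b) ℤ.+ ℤ.- (b ℤ.* b) ℤ.+ ℤ.- (b ℤ.* c) ℤ.+ c ℤ.* c
    adj₂ = ℤ.- (a ℤ.* c) ℤ.+ b ℤ.* b ℤ.+ b ℤ.* c

    adj-IsInt : IsInt (embed adj₀ adj₁ adj₂) (2 ℕ.* (weight a b c ℕ.* weight a b c))
    adj-IsInt = adj₀ , adj₁ , adj₂ , refl , ℕP.≤-trans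
      (weigh (tri (tri (tri (tri (mul a a) (mul a b)) (mul a c)) (neg (mul b c))) (neg (mul c c)))
             (tri (tri (tri (neg (mul a b)) (neg (mul b b))) (neg (mul b c))) (mul c c))
             (tri (tri (neg (mul a c)) (mul b b)) (mul b c)))
      (ℕP.≤-trans (ℕP.m≤m+n _ _) (ℕP.≤-reflexive (ar (∣ a ∣) (∣ b ∣) (∣ c ∣))))
      where
        ar : ∀ a b c → (a ℕ.* a ℕ.+ a ℕ.* b ℕ.+ a ℕ.* c ℕ.+ b ℕ.* c ℕ.+ c ℕ.* c) ℕ.+ 2 ℕ.* (a ℕ.* b ℕ.+ b ℕ.* b ℕ.+ b ℕ.* c ℕ.+ c ℕ.* c) ℕ.+ 4 ℕ.* (a ℕ.* c ℕ.+ b ℕ.* b ℕ.+ b ℕ.* c)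
            ℕ.+ (a ℕ.* a ℕ.+ 5 ℕ.* (a ℕ.* b) ℕ.+ 11 ℕ.* (a ℕ.* c) ℕ.+ 25 ℕ.* (b ℕ.* c) ℕ.+ 29 ℕ.* (c ℕ.* c) ℕ.+ 2 ℕ.* (b ℕ.* b))
          ≡ 2 ℕ.* ((a ℕ.+ 2 ℕ.* b ℕ.+ 4 ℕ.* c) ℕ.* (a ℕ.+ 2 ℕ.* b ℕ.+ 4 ℕ.* c))
        ar = ℕsolve-∀

    adj-product : embed a b c * embed adj₀ adj₁ adj₂ ≡ ι (norm a b c)
    adj-product = trans (embed-* a b c adj₀ adj₁ adj₂) (trans (cong₃ (e₀ a b c) (e₁ a b c) (e₂ a b c))
        (solve 2 (λ n t → n :+ # 0 :* t :+ # 0 :* (t :* t) := n) refl (ι (norm a b c)) α))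
      where
        cong₃ : ∀ {x y z x' y' z'} → x ≡ x' → y ≡ y' → z ≡ z' → embed x y z ≡ embed x' y' z'
        cong₃ refl refl refl = refl
        A B C : ℤ → ℤ → ℤ → ℤ
        A a b c = a ℤ.* a ℤ.+ a ℤ.* b ℤ.+ a ℤ.* c ℤ.+ ℤ.- (b ℤ.* c) ℤ.+ ℤ.- (c ℤ.* c)
        B a b c = ℤ.- (a ℤ.* b) ℤ.+ ℤ.- (b ℤ.* b) ℤ.+ ℤ.- (b ℤ.* c) ℤ.+ c ℤ.* c
        C a b c = ℤ.- (a ℤ.* c) ℤ.+ b ℤ.* b ℤ.+ b ℤ.* c
        e₀ : ∀ a b c → a ℤ.* (a ℤ.* a ℤ.+ a ℤ.* b ℤ.+ a ℤ.* c ℤ.+ ℤ.- (b ℤ.* c) ℤ.+ ℤ.- (c ℤ.* c)) ℤ.+ (b ℤ.* (ℤ.- (a ℤ.* c) ℤ.+ b ℤ.* b ℤ.+ b ℤ.* c) ℤ.+ c ℤ.* (ℤ.- (a ℤ.* b) ℤ.+ ℤ.- (b ℤ.* b) ℤ.+ ℤ.- (b ℤ.* c) ℤ.+ c ℤ.* c)) ℤ.+ c ℤ.* (ℤ.- (a ℤ.* c) ℤ.+ b ℤ.* b ℤ.+ b ℤ.* c)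
          ≡ a ℤ.* a ℤ.* a ℤ.+ b ℤ.* b ℤ.* b ℤ.+ c ℤ.* c ℤ.* c ℤ.+ a ℤ.* a ℤ.* b ℤ.+ a ℤ.* a ℤ.* c ℤ.+ b ℤ.* b ℤ.* c ℤ.- + 3 ℤ.* (a ℤ.* b ℤ.* c) ℤ.- + 2 ℤ.* (a ℤ.* c ℤ.* c)
        e₀ = ℤsolve-∀
        e₁ : ∀ a b c → (a ℤ.* (ℤ.- (a ℤ.* b) ℤ.+ ℤ.- (b ℤ.* b) ℤ.+ ℤ.- (b ℤ.* c) ℤ.+ c ℤ.* c) ℤ.+ b ℤ.* (a ℤ.* a ℤ.+ a ℤ.* b ℤ.+ a ℤ.* c ℤ.+ ℤ.- (b ℤ.* c) ℤ.+ ℤ.- (c ℤ.* c))) ℤ.+ c ℤ.* (ℤ.- (a ℤ.* c) ℤ.+ b ℤ.* b ℤ.+ b ℤ.* c) ≡ + 0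
        e₁ = ℤsolve-∀
        e₂ : ∀ a b c → (a ℤ.* (ℤ.- (a ℤ.* c) ℤ.+ b ℤ.* b ℤ.+ b ℤ.* c) ℤ.+ b ℤ.* (ℤ.- (a ℤ.* b) ℤ.+ ℤ.- (b ℤ.* b) ℤ.+ ℤ.- (b ℤ.* c) ℤ.+ c ℤ.* c) ℤ.+ c ℤ.* (a ℤ.* a ℤ.+ a ℤ.* b ℤ.+ a ℤ.* c ℤ.+ ℤ.- (b ℤ.* c) ℤ.+ ℤ.- (c ℤ.* c))) ℤ.+ (b ℤ.* (ℤ.- (a ℤ.* c) ℤ.+ b ℤ.* b ℤ.+ b ℤ.* c) ℤ.+ c ℤ.* (ℤ.- (a ℤ.* b) ℤ.+ ℤ.- (b ℤ.* b) ℤ.+ ℤ.- (b ℤ.* c) ℤ.+ c ℤ.* c)) ℤ.+ c ℤ.* (ℤ.- (a ℤ.* c) ℤ.+ b ℤ.* b ℤ.+ b ℤ.* c) ≡ + 0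
        e₂ = ℤsolve-∀

  -- The norm is x times an adjoint of absolute value at most 2W², hence an integer of absolute
  -- value below 1. It is 0, and the form is anisotropic.
  liouville : ∀ {x W} → IsInt x W → ∀ b → x ∈± b → b * fromℕ (2 ℕ.* (W ℕ.* W)) < 1# → x ≡ 0#
  liouville {x} {W} (a , b , c , refl , p) d q small = split (norm a b c ℤP.≟ + 0)
    where
      open Norm a b c
      zero³ : ∀ {a b c} → a ≡ + 0 → b ≡ + 0 → c ≡ + 0 → embed a b c ≡ 0#
      zero³ refl refl refl = solve 1 (λ t → # 0 :+ # 0 :* t :+ # 0 :* (t :* t) := # 0) refl α
      nbound : ι (norm a b c) ∈± (d * fromℕ (2 ℕ.* (W ℕ.* W)))
      nbound = subst (_∈± d * fromℕ (2 ℕ.* (W ℕ.* W))) adj-product (±-* q (±-weaken (IsInt-∈± adj-IsInt) (fromℕ-mono-≤ (ℕP.*-monoʳ-≤ 2 (ℕP.*-mono-≤ p p)))))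
      contra : ∀ n → n ≢ + 0 → ¬ (ι n ∈± (d * fromℕ (2 ℕ.* (W ℕ.* W))))
      contra (+ zero) ne _ = ne refl
      contra (+ suc n) ne r = ≤⇒≯ (1≤fromℕ {suc n} (ℕ.s≤s ℕ.z≤n)) (≤-<-trans (±upper r) small)
      contra -[1+ n ] ne r = ≤⇒≯ (1≤fromℕ {suc n} (ℕ.s≤s ℕ.z≤n)) (≤-<-trans (subst (_≤ d * fromℕ (2 ℕ.* (W ℕ.* W))) (solve 1 (λ x → :- (:- x) := x) refl (fromℕ (suc n))) (±upper (±-neg r))) small)
      split : Dec (norm a b c ≡ + 0) → embed a b c ≡ 0#
      split (yes e) = zero³ {a} {b} {c} (ℤP.∣i∣≡0⇒i≡0 (ℕP.m+n≡0⇒m≡0 (∣ a ∣) {∣ b ∣} (ℕP.m+n≡0⇒m≡0 (∣ a ∣ ℕ.+ ∣ b ∣) {∣ c ∣} s)))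
          (ℤP.∣i∣≡0⇒i≡0 (ℕP.m+n≡0⇒n≡0 (∣ a ∣) {∣ b ∣} (ℕP.m+n≡0⇒m≡0 (∣ a ∣ ℕ.+ ∣ b ∣) {∣ c ∣} s))) (ℤP.∣i∣≡0⇒i≡0 (ℕP.m+n≡0⇒n≡0 (∣ a ∣ ℕ.+ ∣ b ∣) {∣ c ∣} s))
        where s = norm-anisotropic (size a b c) a b c ℕP.≤-refl e
      split (no ne) = ⊥-elim (contra (norm a b c) ne nbound)

-- The auxiliary function: two powers cannot be very close

module TwoLogEstimate (F : NarayanaField) where

  open import Data.Fin using (Fin; zero; suc; toℕ; combine; remQuot)
  import Data.Fin.Properties as FinP
  open import Function using (_∘_)
  open NarayanaField F using (orderedField)
  open OrderedFieldTheory orderedField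
  open ZeroEstimate orderedField
  open BinomialExpansion orderedField
  open Integrality F
  open Siegel

  P : ℕ → Carrier
  P n = two ^ n

  P-pos : ∀ n → Pos (P n)
  P-pos n = Pos-^ n (Pos-suc 1)

  P-nn : ∀ n → NonNeg (P n)
  P-nn n = inj₁ (P-pos n)

  1≤two : 1# ≤ two
  1≤two = fromℕ-mono-≤ {1} {2} (ℕ.s≤s ℕ.z≤n)

  P-mono : ∀ {m n} → m ℕ.≤ n → P m ≤ P n
  P-mono = ^-monoʳ-≤ 1≤two

  1≤P : ∀ n → 1# ≤ P n
  1≤P n = 1≤^ n 1≤two

  fromℕ-2^ : ∀ n → fromℕ (2 ℕ.^ n) ≡ P n
  fromℕ-2^ = fromℕ-^ 2

  fromℕ≤P : ∀ {m n} → m ℕ.≤ 2 ℕ.^ n → fromℕ m ≤ P n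
  fromℕ≤P {m} {n} p = ≤-trans (fromℕ-mono-≤ p) (≤-reflexive (fromℕ-2^ n))

  ±-scale : ∀ {a x b} → NonNeg a → x ∈± b → a * x ∈± a * b
  ±-scale p q = ±-* (±-of-nn p ≤-refl) q

  ±-cancel : ∀ {a x b} → Pos a → a * x ∈± a * b → x ∈± b
  ±-cancel {a} {x} {b} p q = *-cancelˡ-≤ p (±upper q) ,±
    subst NonNeg (solve 2 (λ x b → b :- (:- x) := b :+ x) refl x b)
      (*-cancelˡ-≤ p (subst (λ y → NonNeg (a * b - y)) (solve 2 (λ a x → :- (a :* x) := a :* (:- x)) refl a x) (±upper (±-neg q))))

  ±-shrink : ∀ {s t y b} → NonNeg s → s ≤ t → t * y ∈± b → s * y ∈± b
  ±-shrink {s} {t} {y} {b} ns st q = pick (≤-or-> 0# y)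
    where
      pick : (0# ≤ y) ⊎ (y < 0#) → s * y ∈± b
      pick (inj₁ p) = ±-of-nn (nn-* ns (0≤⇒nn p)) (≤-trans (*-monoʳ-≤ (0≤⇒nn p) st) (±upper q))
      pick (inj₂ p) = subst (_∈± b) (solve 2 (λ s y → :- (s :* (:- y)) := s :* y) refl s y)
        (±-neg (±-of-nn (nn-* ns ny) (≤-trans (*-monoʳ-≤ ny st) (±upper (subst (_∈± b) (solve 2 (λ t y → :- (t :* y) := t :* (:- y)) refl t y) (±-neg q))))))
        where ny = NonNeg-resp (solve 1 (λ y → # 0 :- y := :- y) refl y) (inj₁ p)

  P-cancel : ∀ a b {c x} → c ≡ a ℕ.+ b → P c * x ∈± P a → P b * x ∈± 1#
  P-cancel a b {c} {x} e q = ±-cancel (P-pos a) (subst₂ _∈±_ (trans (cong (_* x) (trans (cong P e) (^-+ two a b))) (*-assoc _ _ _)) (sym (*-identityʳ _)) q)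

  -- Telescoping with κ^(n+1) - 1 = (κ^n - 1) + κ^n (κ - 1). The condition 2n ≤ E keeps κ^n at most
  -- 2, so each step costs at most 2.
  power-close : ∀ {κ E} → NonNeg E → E * (κ - 1#) ∈± 1# → ∀ n → fromℕ (2 ℕ.* n) ≤ E → E * (κ ^ n - 1#) ∈± fromℕ (2 ℕ.* n)
  power-close {κ} {E} nE q zero p = subst (_∈± 0#) (solve 1 (λ E → # 0 := E :* (# 1 :- # 1)) refl E) (±-of-nn nn-0 ≤-refl)
  power-close {κ} {E} nE q (suc n) p = subst₂ _∈±_
      (solve 3 (λ E k t → E :* (t :- # 1) :+ t :* (E :* (k :- # 1)) := E :* (k :* t :- # 1)) refl E κ (κ ^ n))
      (trans (solve 1 (λ a → a :+ # 2 :* # 1 := # 2 :+ a) refl (fromℕ (2 ℕ.* n))) (trans (sym (fromℕ-+ 2 (2 ℕ.* n))) (cong fromℕ (ar n))))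
      (±-+ ih (±-* small q))
    where
      ar : ∀ n → 2 ℕ.+ 2 ℕ.* n ≡ 2 ℕ.* (1 ℕ.+ n)
      ar = ℕsolve-∀
      p' : fromℕ (2 ℕ.* n) ≤ E
      p' = ≤-trans (fromℕ-mono-≤ (ℕP.*-monoʳ-≤ 2 (ℕP.n≤1+n n))) p
      ih = power-close nE q n p'
      posE : Pos E
      posE = 1≤⇒Pos (≤-trans (fromℕ-mono-≤ {1} (ℕP.≤-trans (ℕ.s≤s ℕ.z≤n) (ℕP.m≤m*n 2 (suc n)))) p)
      small : κ ^ n ∈± two
      small = subst₂ _∈±_ (solve 1 (λ t → (t :- # 1) :+ # 1 := t) refl (κ ^ n)) refl
        (±-+ (±-cancel posE (±-weaken ih (≤-trans p' (≤-reflexive (sym (*-identityʳ E)))))) (±-of-nn nn-1 ≤-refl))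

  fromℕ-∑ : ∀ {n} (f : Fin n → ℕ) → fromℕ (∑ℕ f) ≡ ∑ (λ i → fromℕ (f i))
  fromℕ-∑ {zero} f = refl
  fromℕ-∑ {suc n} f = trans (fromℕ-+ (f zero) _) (cong (λ z → fromℕ (f zero) + z) (fromℕ-∑ (f ∘ suc)))

  IsInt-∑ : ∀ {n} (f : Fin n → Carrier) W → (∀ i → IsInt (f i) W) → IsInt (∑ f) (n ℕ.* W)
  IsInt-∑ {zero} f W p = IsInt-ℕ 0
  IsInt-∑ {suc n} f W p = IsInt-+ (p zero) (IsInt-∑ (f ∘ suc) W (p ∘ suc))

  IsInt-neg : ∀ {x W} → IsInt x W → IsInt (- x) W
  IsInt-neg {x} {W} p = IsInt-≡ (solve 1 (λ x → (:- # 1) :* x := :- x) refl x) (IsInt-weaken (ℕP.≤-reflexive (ℕP.*-identityˡ W)) (IsInt-* (IsInt-≡ refl (IsInt-ι (ℤ.- ℤ.+ 1))) p))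
    where import Data.Integer as ℤ

  -- The form in which the estimates arrive: |x| ≤ s / t, with a power of 2 kept on the left.
  liouville′ : ∀ {x W s t} → IsInt x W → Pos t → t * x ∈± s → s * fromℕ (2 ℕ.* (W ℕ.* W)) < t → x ≡ 0#
  liouville′ {x} {W} {s} {t} ix pt q small = liouville ix (t ⁻¹ * s)
    (subst (_∈± t ⁻¹ * s) (trans (solve 3 (λ i t x → i :* (t :* x) := (t :* i) :* x) refl (t ⁻¹) t x) (trans (cong (_* x) tt⁻¹) (*-identityˡ x))) (±-scale (inj₁ (Pos-⁻¹ pt)) q))
    (<-by (trans (solve 4 (λ i t s w → i :* (t :- s :* w) := (t :* i) :- i :* s :* w) refl (t ⁻¹) t s w) (cong (_- t ⁻¹ * s * w) tt⁻¹)) (Pos-* (Pos-⁻¹ pt) small))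
    where
      w = fromℕ (2 ℕ.* (W ℕ.* W))
      tt⁻¹ = *-⁻¹ (Pos⇒≢0 pt)

  expo : ∀ {E} → Fin E → ℕ
  expo {suc E} zero = E
  expo {suc E} (suc e) = expo e

  expo< : ∀ {E} (e : Fin E) → expo e ℕ.< E
  expo< {suc E} zero = ℕP.≤-refl
  expo< {suc E} (suc e) = ℕP.m≤n⇒m≤1+n (expo< e)

  monomial-expo : ∀ {E} (e : Fin E) x → monomial e x ≡ x ^ expo e
  monomial-expo {suc E} zero x = refl
  monomial-expo {suc E} (suc e) x = monomial-expo e x

  -- Sizes are bit lengths: `h₁` for μ and ν, `h₂` for G₀ and G₁, `ζ` for the integers z = i + r j.
  -- The auxiliary function has degree below `L` in X and below `K` in z. Of the range `I` for i,
  -- the part `I′` belongs to the points of the zero estimate and the remaining `L` to its shifts.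
  -- `M` is the length of the binomial head, `β` a common bit budget, and 2^-U the closeness.
  record Parameters : Set where
    field
      h₁ h₂ r ζ L K I′ J M β U : ℕ
    I = I′ ℕ.+ L
    Z = I ℕ.+ r ℕ.* J
    g = h₁ ℕ.* I ℕ.+ suc h₂ ℕ.* J
    e = g ℕ.* L
    field
      I≤r : I ℕ.≤ r
      Z≤ : Z ℕ.≤ 2 ℕ.^ ζ
      β≥ : ζ ℕ.* K ℕ.+ e ℕ.+ 4 ℕ.≤ β
      N≤ : L ℕ.* K ℕ.≤ 2 ℕ.^ β
      D≤ : K ℕ.+ M ℕ.≤ 2 ℕ.^ β
      JL≤ : 2 ℕ.* (J ℕ.* L) ℕ.≤ 2 ℕ.^ β
      M≥ : 8 ℕ.* β ℕ.≤ M
      unknowns : 15 ℕ.* (K ℕ.+ M) ℕ.< L ℕ.* K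
      points : L ℕ.* K ℕ.+ K ℕ.≤ I′ ℕ.* J
      U≥ : 12 ℕ.* β ℕ.≤ U

  module TwoLogarithms (params : Parameters) (μ ν G₀ G₁ : Carrier)
    (1≤ν : 1# ≤ ν) (ν<μ : ν < μ) (1≤G₀ : 1# ≤ G₀) (1≤G₁ : 1# ≤ G₁)
    (intμ : IsInt μ (2 ℕ.^ Parameters.h₁ params)) (intν : IsInt ν (2 ℕ.^ Parameters.h₁ params))
    (intG₀ : IsInt G₀ (2 ℕ.^ Parameters.h₂ params)) (intG₁ : IsInt G₁ (2 ℕ.^ Parameters.h₂ params))
    (close : P (Parameters.U params) * (G₀ * μ ^ Parameters.r params - G₁ * ν ^ Parameters.r params) ∈± G₁ * ν ^ Parameters.r params) where

    open Parameters params

    private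
      posν = 1≤⇒Pos 1≤ν
      posμ : Pos μ
      posμ = 1≤⇒Pos (≤-trans 1≤ν (<⇒≤ ν<μ))
      posG₀ = 1≤⇒Pos 1≤G₀
      posG₁ = 1≤⇒Pos 1≤G₁

      -- Closeness means that κ is almost 1. As ρ κ = η^r, the number X = η^i ρ^j is then almost
      -- η^(i + r j).
      η ρ κ : Carrier
      η = μ * ν ⁻¹
      ρ = G₁ * G₀ ⁻¹
      κ = η ^ r * (G₀ * G₁ ⁻¹)

      quotient : ∀ {a b} → Pos b → b * (a * b ⁻¹) ≡ a
      quotient {a} {b} p = trans (solve 3 (λ a b i → b :* (a :* i) := a :* (b :* i)) refl a b (b ⁻¹)) (trans (cong (λ z → a * z) (*-⁻¹ (Pos⇒≢0 p))) (*-identityʳ a))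

      νη : ν * η ≡ μ
      νη = quotient posν
      G₀ρ : G₀ * ρ ≡ G₁
      G₀ρ = quotient posG₀

      posη : Pos η
      posη = Pos-* posμ (Pos-⁻¹ posν)
      posρ : Pos ρ
      posρ = Pos-* posG₁ (Pos-⁻¹ posG₀)

      1<η : 1# < η
      1<η = <-by (trans (solve 3 (λ m n i → (m :- n) :* i := m :* i :- n :* i) refl μ ν (ν ⁻¹)) (cong (λ z → η - z) (*-⁻¹ (Pos⇒≢0 posν)))) (Pos-* ν<μ (Pos-⁻¹ posν))

      1≤η = <⇒≤ 1<η

      le-quotient : ∀ {a b c} → 1# ≤ b → NonNeg c → b * c ≡ a → c ≤ a
      le-quotient {a} {b} {c} p q e = ≤-trans (≤-reflexive (sym (*-identityˡ c))) (≤-trans (*-monoʳ-≤ q p) (≤-reflexive e))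

      η≤ : η ≤ P h₁
      η≤ = ≤-trans (le-quotient 1≤ν (inj₁ posη) νη) (≤-trans (±upper (IsInt-∈± intμ)) (≤-reflexive (fromℕ-2^ h₁)))
      ρ≤ : ρ ≤ P h₂
      ρ≤ = ≤-trans (le-quotient 1≤G₀ (inj₁ posρ) G₀ρ) (≤-trans (±upper (IsInt-∈± intG₁)) (≤-reflexive (fromℕ-2^ h₂)))

      κρ : ρ * κ ≡ η ^ r
      κρ = trans (solve 5 (λ a b c d t → (a :* b) :* (t :* (c :* d)) := t :* ((a :* d) :* (c :* b))) refl G₁ (G₀ ⁻¹) G₀ (G₁ ⁻¹) (η ^ r))
        (trans (cong₂ (λ u v → η ^ r * (u * v)) (*-⁻¹ (Pos⇒≢0 posG₁)) (*-⁻¹ (Pos⇒≢0 posG₀))) (trans (cong (λ z → η ^ r * z) (*-identityʳ 1#)) (*-identityʳ _)))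

      G₁κ : (G₁ * ν ^ r) * κ ≡ G₀ * μ ^ r
      G₁κ = trans (solve 5 (λ a n t c d → (a :* n) :* (t :* (c :* d)) := (a :* d) :* (c :* (n :* t))) refl G₁ (ν ^ r) (η ^ r) G₀ (G₁ ⁻¹))
        (trans (cong₂ (λ u v → u * (G₀ * v)) (*-⁻¹ (Pos⇒≢0 posG₁)) (trans (sym (^-*ˡ ν η r)) (cong (_^ r) νη))) (*-identityˡ _))

      κ-close : P U * (κ - 1#) ∈± 1#
      κ-close = ±-cancel (Pos-* posG₁ (Pos-^ r posν)) (subst₂ _∈±_
        (trans (cong (λ z → P U * (z - G₁ * ν ^ r)) (sym G₁κ)) (solve 3 (λ u b k → u :* (b :* k :- b) := b :* (u :* (k :- # 1))) refl (P U) (G₁ * ν ^ r) κ))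
        (sym (*-identityʳ _)) close)

      κ≤2 : κ ≤ two
      κ≤2 = ±upper (subst₂ _∈±_ (solve 1 (λ k → # 1 :* (k :- # 1) :+ # 1 := k) refl κ) refl (±-+ (±-shrink nn-1 (1≤P U) κ-close) (±-of-nn nn-1 ≤-refl)))

      -- Closeness forces η itself towards 1: η^r = ρ κ is at most 2ρ. Hence η^Z costs about `h₂` J
      -- bits instead of `h₁` r J.
      ηʳ≤ : η ^ r ≤ P (suc h₂)
      ηʳ≤ = ≤-trans (≤-reflexive (sym κρ)) (≤-trans (*-mono-≤ (inj₁ posρ) ρ≤ (nn-fromℕ 2) κ≤2) (≤-reflexive (*-comm _ _)))

      P-split : P (h₁ ℕ.* I) * P (suc h₂ ℕ.* J) ≡ P g
      P-split = sym (^-+ two (h₁ ℕ.* I) (suc h₂ ℕ.* J))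

      η^I≤ : η ^ I ≤ P (h₁ ℕ.* I)
      η^I≤ = ≤-trans (^-mono-≤ I (inj₁ posη) η≤) (≤-reflexive (sym (^-* two h₁ I)))

      η^≤ : ∀ {z} → z ℕ.≤ Z → η ^ z ≤ P g
      η^≤ p = ≤-trans (^-monoʳ-≤ 1≤η p) (≤-trans (≤-reflexive (trans (^-+ η I (r ℕ.* J)) (cong (λ z → η ^ I * z) (^-* η r J))))
        (≤-trans (*-mono-≤ (nn-^ I (inj₁ posη)) η^I≤ (P-nn (suc h₂ ℕ.* J)) (≤-trans (^-mono-≤ J (nn-^ r (inj₁ posη)) ηʳ≤) (≤-reflexive (sym (^-* two (suc h₂) J)))))
          (≤-reflexive P-split)))

      X : ℕ → ℕ → Carrier
      X i j = η ^ i * ρ ^ j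

      posX : ∀ i j → Pos (X i j)
      posX i j = Pos-* (Pos-^ i posη) (Pos-^ j posρ)

      X≤ : ∀ {i j} → i ℕ.≤ I → j ℕ.≤ J → X i j ≤ P g
      X≤ {i} {j} p q = ≤-trans (*-mono-≤ (nn-^ i (inj₁ posη)) (≤-trans (^-monoʳ-≤ 1≤η p) η^I≤) (P-nn (suc h₂ ℕ.* J))
          (≤-trans (^-mono-≤ j (inj₁ posρ) (≤-trans ρ≤ (P-mono (ℕP.n≤1+n h₂)))) (≤-trans (^-monoʳ-≤ (1≤P (suc h₂)) q) (≤-reflexive (sym (^-* two (suc h₂) J))))))
        (≤-reflexive P-split)

      ^L≤ : ∀ {x l} → NonNeg x → x ≤ P g → l ℕ.≤ L → x ^ l ≤ P e
      ^L≤ {x} {l} p q s = ≤-trans (^-mono-≤ l p q) (≤-trans (^-monoʳ-≤ (1≤P g) s) (≤-reflexive (sym (^-* two g L))))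

      Xκ : ∀ i j → X i j * κ ^ j ≡ η ^ (i ℕ.+ r ℕ.* j)
      Xκ i j = trans (*-assoc _ _ _) (trans (cong (λ z → η ^ i * z) (trans (sym (^-*ˡ ρ κ j)) (trans (cong (_^ j) κρ) (sym (^-* η r j))))) (sym (^-+ η i (r ℕ.* j))))

      N D : ℕ
      N = L ℕ.* K
      D = K ℕ.+ M

      ℓ κₑ : Fin N → ℕ
      ℓ v = toℕ (proj₁ (remQuot {L} K v))
      κₑ v = expo (proj₂ (remQuot {L} K v))

      ℓ≤ : ∀ v → ℓ v ℕ.≤ L
      ℓ≤ v = ℕP.<⇒≤ (FinP.toℕ<n _)

      δ : ℕ → Carrier
      δ l = η ^ l - 1#

      δ-nn : ∀ l → NonNeg (δ l)
      δ-nn l = 1≤^ l 1≤η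

      1+δ : ∀ l → 1# + δ l ≡ η ^ l
      1+δ l = solve 1 (λ t → # 1 :+ (t :- # 1) := t) refl (η ^ l)

      module Ex (l : ℕ) = Expansion (δ l) (δ-nn l)

      η^lz : ∀ l z → (η ^ l) ^ z ≡ (η ^ z) ^ l
      η^lz l z = trans (sym (^-* η l z)) (trans (cong (η ^_) (ℕP.*-comm l z)) (^-* η z l))

      z^≤ : ∀ {z k} → z ℕ.≤ Z → k ℕ.≤ K → fromℕ z ^ k ≤ P (ζ ℕ.* K)
      z^≤ {z} {k} p q = ≤-trans (^-mono-≤ k (nn-fromℕ z) (fromℕ≤P {z} {ζ} (ℕP.≤-trans p Z≤))) (≤-trans (^-monoʳ-≤ (1≤P ζ) q) (≤-reflexive (sym (^-* two ζ K))))

      κₑ≤ : ∀ v → κₑ v ℕ.≤ K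
      κₑ≤ v = ℕP.<⇒≤ (expo< (proj₂ (remQuot {L} K v)))

      Θ : Carrier
      Θ = P (11 ℕ.* β)

      -- Rows belong to binomials, not to grid points. The factor `bin Z u` measures a row at the
      -- largest argument, and Θ makes rounding to integers harmless.
      x : Fin D → Fin N → Carrier
      x u v = Θ * (Ex.coef (ℓ v) M (κₑ v) (toℕ u) * fromℕ (bin Z (toℕ u)))

      coef-nn : ∀ v u → NonNeg (Ex.coef (ℓ v) M (κₑ v) u)
      coef-nn v u = Ex.coef-nn (ℓ v) M (κₑ v) u

      x-nn : ∀ u v → NonNeg (x u v)
      x-nn u v = nn-* (P-nn (11 ℕ.* β)) (nn-* (coef-nn v (toℕ u)) (nn-fromℕ (bin Z (toℕ u))))

      expand-v : ∀ v z → fromℕ z ^ κₑ v * Ex.head (ℓ v) M z ≡ ∑ {D} (λ u → Ex.coef (ℓ v) M (κₑ v) (toℕ u) * fromℕ (bin z (toℕ u)))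
      expand-v v z = Ex.expansion-≤ (ℓ v) M (κₑ v) z D (ℕP.+-monoˡ-≤ M (κₑ≤ v))

      ζK+e≤β : ζ ℕ.* K ℕ.+ e ℕ.≤ β
      ζK+e≤β = ℕP.≤-trans (ℕP.m≤m+n _ 4) β≥

      -- The expansion at Z has no negative terms, so each is bounded by Z^k times the head.
      x≤ : ∀ u v → x u v ≤ P (12 ℕ.* β)
      x≤ u v = ≤-trans (*-monoˡ-≤ (P-nn (11 ℕ.* β)) inner)
          (≤-trans (≤-reflexive (sym (^-+ two (11 ℕ.* β) β))) (P-mono (ℕP.≤-reflexive (ar β))))
        where
          ar : ∀ b → 11 ℕ.* b ℕ.+ b ≡ 12 ℕ.* b
          ar = ℕsolve-∀
          inner : Ex.coef (ℓ v) M (κₑ v) (toℕ u) * fromℕ (bin Z (toℕ u)) ≤ P β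
          inner = ≤-trans (∑-term (λ u → Ex.coef (ℓ v) M (κₑ v) (toℕ u) * fromℕ (bin Z (toℕ u))) (λ u → nn-* (coef-nn v (toℕ u)) (nn-fromℕ (bin Z (toℕ u)))) u)
            (≤-trans (≤-reflexive (sym (expand-v v Z)))
            (≤-trans (*-mono-≤ (nn-^ (κₑ v) (nn-fromℕ Z)) (z^≤ ℕP.≤-refl (κₑ≤ v)) (P-nn e)
                (≤-trans (Ex.head≤ (ℓ v) M Z) (≤-trans (≤-reflexive (trans (cong (_^ Z) (1+δ (ℓ v))) (η^lz (ℓ v) Z))) (^L≤ (nn-^ Z (inj₁ posη)) (η^≤ ℕP.≤-refl) (ℓ≤ v)))))
            (≤-trans (≤-reflexive (sym (^-+ two (ζ ℕ.* K) e))) (P-mono ζK+e≤β))))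

      A : Fin D → Fin N → ℕ
      A u v = proj₁ (floor (x-nn u v))

      A≤ : ∀ u v → A u v ℕ.≤ 2 ℕ.^ (12 ℕ.* β)
      A≤ u v = fromℕ-cancel-≤ (≤-trans (proj₁ (proj₂ (floor (x-nn u v)))) (≤-trans (x≤ u v) (≤-reflexive (sym (fromℕ-2^ (12 ℕ.* β))))))

      x-A : ∀ u v → x u v - fromℕ (A u v) ∈± 1#
      x-A u v = ±-of-nn (proj₁ (proj₂ (floor (x-nn u v))))
        (inj₁ (Pos-resp (trans (cong (λ z → z - x u v) (fromℕ-suc (A u v))) (solve 2 (λ a x → (# 1 :+ a) :- x := # 1 :- (x :- a)) refl (fromℕ (A u v)) (x u v))) (proj₂ (proj₂ (floor (x-nn u v))))))

      1≤β : 1 ℕ.≤ β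
      1≤β = ℕP.≤-trans (ℕP.≤-trans (ℕ.s≤s ℕ.z≤n) (ℕP.m≤n+m 4 (ζ ℕ.* K ℕ.+ e))) β≥

      -- Coefficients below 2^β and entries up to 2^(12β) give values up to 2^(14β), below T =
      -- 2^(15β). The pigeonhole condition is then 15 D < N.
      solution = siegel {N} {D} {2 ℕ.^ β} {2 ℕ.^ (15 ℕ.* β)} {2 ℕ.^ (12 ℕ.* β)} A A≤ T-big count
        where
          open ℕP.≤-Reasoning
          ar₁ : ∀ b → b ℕ.+ (b ℕ.+ 12 ℕ.* b) ≡ 14 ℕ.* b
          ar₁ = ℕsolve-∀
          T-big : N ℕ.* (2 ℕ.^ β ℕ.* 2 ℕ.^ (12 ℕ.* β)) ℕ.< 2 ℕ.^ (15 ℕ.* β)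
          T-big = begin-strict
            N ℕ.* (2 ℕ.^ β ℕ.* 2 ℕ.^ (12 ℕ.* β)) ≤⟨ ℕP.*-monoˡ-≤ _ N≤ ⟩
            2 ℕ.^ β ℕ.* (2 ℕ.^ β ℕ.* 2 ℕ.^ (12 ℕ.* β)) ≡⟨ cong (2 ℕ.^ β ℕ.*_) (sym (ℕP.^-distribˡ-+-* 2 β (12 ℕ.* β))) ⟩
            2 ℕ.^ β ℕ.* 2 ℕ.^ (β ℕ.+ 12 ℕ.* β) ≡⟨ sym (ℕP.^-distribˡ-+-* 2 β (β ℕ.+ 12 ℕ.* β)) ⟩
            2 ℕ.^ (β ℕ.+ (β ℕ.+ 12 ℕ.* β)) ≡⟨ cong (2 ℕ.^_) (ar₁ β) ⟩
            2 ℕ.^ (14 ℕ.* β) <⟨ ℕP.^-monoʳ-< 2 (ℕ.s≤s (ℕ.s≤s ℕ.z≤n)) (ℕP.*-monoˡ-< β ⦃ ℕ.>-nonZero 1≤β ⦄ {14} {15} ℕP.≤-refl) ⟩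
            2 ℕ.^ (15 ℕ.* β) ∎
          ar₂ : ∀ b d → 15 ℕ.* b ℕ.* d ≡ b ℕ.* (15 ℕ.* d)
          ar₂ = ℕsolve-∀
          count : (2 ℕ.^ (15 ℕ.* β)) ℕ.^ D ℕ.< (2 ℕ.^ β) ℕ.^ N
          count = begin-strict
            (2 ℕ.^ (15 ℕ.* β)) ℕ.^ D ≡⟨ ℕP.^-*-assoc 2 (15 ℕ.* β) D ⟩
            2 ℕ.^ (15 ℕ.* β ℕ.* D) ≡⟨ cong (2 ℕ.^_) (ar₂ β D) ⟩
            2 ℕ.^ (β ℕ.* (15 ℕ.* D)) <⟨ ℕP.^-monoʳ-< 2 (ℕ.s≤s (ℕ.s≤s ℕ.z≤n)) (ℕP.*-monoʳ-< β ⦃ ℕ.>-nonZero 1≤β ⦄ unknowns) ⟩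
            2 ℕ.^ (β ℕ.* N) ≡⟨ sym (ℕP.^-*-assoc 2 β N) ⟩
            (2 ℕ.^ β) ℕ.^ N ∎

      p q : Fin N → Fin (2 ℕ.^ β)
      p = proj₁ solution
      q = proj₁ (proj₂ solution)

      c : Fin N → Carrier
      c v = fromℕ (toℕ (p v)) - fromℕ (toℕ (q v))

      c± : ∀ v → c v ∈± P β
      c± v = NonNeg-resp (solve 3 (λ P a b → (P :- a) :+ b := P :- (a :- b)) refl (P β) a b) (nn-+ (below (p v)) (nn-fromℕ (toℕ (q v)))) ,±
             NonNeg-resp (solve 3 (λ P a b → (P :- b) :+ a := P :+ (a :- b)) refl (P β) a b) (nn-+ (below (q v)) (nn-fromℕ (toℕ (p v))))
        where
          a = fromℕ (toℕ (p v))
          b = fromℕ (toℕ (q v))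
          below : (i : Fin (2 ℕ.^ β)) → fromℕ (toℕ i) ≤ P β
          below i = fromℕ≤P {toℕ i} {β} (ℕP.<⇒≤ (FinP.toℕ<n i))

      cA : ∀ u → ∑ (λ v → c v * fromℕ (A u v)) ≡ 0#
      cA u = trans (sum-cong-≗ {N} λ v → solve 3 (λ a b t → (a :- b) :* t := a :* t :+ :- (b :* t)) refl (fromℕ (toℕ (p v))) (fromℕ (toℕ (q v))) (fromℕ (A u v)))
        (trans (∑-distrib-+ {N} (λ v → fromℕ (toℕ (p v)) * fromℕ (A u v)) (λ v → - (fromℕ (toℕ (q v)) * fromℕ (A u v))))
        (trans (cong₂ _+_ (sym (lift p)) (trans (∑-neg {N} (λ v → fromℕ (toℕ (q v)) * fromℕ (A u v))) (cong -_ (trans (sym (lift q)) (cong fromℕ (sym (proj₂ (proj₂ (proj₂ solution)) u)))))))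
          (-‿inverseʳ _)))
        where
          lift : (p : Fin N → Fin (2 ℕ.^ β)) → fromℕ (∑ℕ (λ v → toℕ (p v) ℕ.* A u v)) ≡ ∑ (λ v → fromℕ (toℕ (p v)) * fromℕ (A u v))
          lift p = trans (fromℕ-∑ {N} λ v → toℕ (p v) ℕ.* A u v) (sum-cong-≗ {N} λ v → fromℕ-* (toℕ (p v)) (A u v))

      ∑±P : (f : Fin N → Carrier) → ∀ b {b'} → β ℕ.+ b ℕ.≤ b' → (∀ v → f v ∈± P b) → ∑ f ∈± P b'
      ∑±P f b w s = ±-weaken (∑-± f (P b) s) (≤-trans (*-monoʳ-≤ (P-nn b) (fromℕ≤P {N} {β} N≤)) (≤-trans (≤-reflexive (sym (^-+ two β b))) (P-mono w)))

      -- The rows cancel up to the rounding errors in `A`. At z the weights `bin z u` are at most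
      -- those at Z, so the same coefficients serve every z ≤ Z.
      headSum : ∀ z → z ℕ.≤ Z → P (8 ℕ.* β) * ∑ (λ v → c v * (fromℕ z ^ κₑ v * Ex.head (ℓ v) M z)) ∈± 1#
      headSum z z≤ = P-cancel (3 ℕ.* β) (8 ℕ.* β) {11 ℕ.* β} (ar β) (subst (_∈± P (3 ℕ.* β)) rearrange
          (±-weaken (∑-± (λ u → fromℕ (bin z (toℕ u)) * (Θ * y u)) (P (2 ℕ.* β)) each)
            (≤-trans (*-monoʳ-≤ (P-nn (2 ℕ.* β)) (fromℕ≤P {D} {β} D≤)) (≤-reflexive (trans (sym (^-+ two β (2 ℕ.* β))) (cong P (ar₃ β)))))))
        where
          ar : ∀ b → 11 ℕ.* b ≡ 3 ℕ.* b ℕ.+ 8 ℕ.* b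
          ar = ℕsolve-∀
          ar₃ : ∀ b → b ℕ.+ 2 ℕ.* b ≡ 3 ℕ.* b
          ar₃ = ℕsolve-∀
          ar₂ : ∀ b → b ℕ.+ b ≡ 2 ℕ.* b
          ar₂ = ℕsolve-∀
          y : Fin D → Carrier
          y u = ∑ (λ v → c v * Ex.coef (ℓ v) M (κₑ v) (toℕ u))
          scaledRow : ∀ u → fromℕ (bin Z (toℕ u)) * (Θ * y u) ≡ ∑ (λ v → c v * (x u v - fromℕ (A u v)))
          scaledRow u = trans (sym (*-assoc _ _ _)) (trans (*-distribˡ-sum {N} (fromℕ (bin Z (toℕ u)) * Θ) (λ v → c v * Ex.coef (ℓ v) M (κₑ v) (toℕ u)))
            (trans (sym (+-identityʳ _)) (trans (cong (λ z → ∑ (λ v → fromℕ (bin Z (toℕ u)) * Θ * (c v * Ex.coef (ℓ v) M (κₑ v) (toℕ u))) + z) (sym (trans (∑-neg {N} (λ v → c v * fromℕ (A u v))) (trans (cong -_ (cA u)) neg-zero))))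
            (trans (sym (∑-distrib-+ {N} (λ v → fromℕ (bin Z (toℕ u)) * Θ * (c v * Ex.coef (ℓ v) M (κₑ v) (toℕ u))) (λ v → - (c v * fromℕ (A u v)))))
              (sum-cong-≗ {N} λ v → solve 5 (λ b t c a n → b :* t :* (c :* a) :+ :- (c :* n) := c :* (t :* (a :* b) :- n)) refl (fromℕ (bin Z (toℕ u))) Θ (c v) (Ex.coef (ℓ v) M (κₑ v) (toℕ u)) (fromℕ (A u v)))))))
            where neg-zero : - 0# ≡ 0#
                  neg-zero = solve 0 (:- # 0 := # 0) refl
          each : ∀ u → fromℕ (bin z (toℕ u)) * (Θ * y u) ∈± P (2 ℕ.* β)
          each u = ±-shrink (nn-fromℕ (bin z (toℕ u))) (fromℕ-mono-≤ (bin-mono (toℕ u) z≤)) (subst (_∈± P (2 ℕ.* β)) (sym (scaledRow u))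
            (∑±P _ β (ℕP.≤-reflexive (ar₂ β)) λ v → subst (λ b → c v * (x u v - fromℕ (A u v)) ∈± b) (*-identityʳ (P β)) (±-* (c± v) (x-A u v))))
          rearrange : ∑ (λ u → fromℕ (bin z (toℕ u)) * (Θ * y u)) ≡ Θ * ∑ (λ v → c v * (fromℕ z ^ κₑ v * Ex.head (ℓ v) M z))
          rearrange = trans (sum-cong-≗ {D} λ u → trans (solve 3 (λ b t y → b :* (t :* y) := t :* (b :* y)) refl (fromℕ (bin z (toℕ u))) Θ (y u)) (cong (λ s → Θ * s) (*-distribˡ-sum {N} (fromℕ (bin z (toℕ u))) (λ v → c v * Ex.coef (ℓ v) M (κₑ v) (toℕ u)))))
            (trans (sym (*-distribˡ-sum {D} Θ _)) (cong (λ s → Θ * s)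
            (trans (∑-comm {D} {N} (λ u v → fromℕ (bin z (toℕ u)) * (c v * Ex.coef (ℓ v) M (κₑ v) (toℕ u)))) (sum-cong-≗ {N} λ v →
              trans (sum-cong-≗ {D} λ u → solve 3 (λ b c a → b :* (c :* a) := c :* (a :* b)) refl (fromℕ (bin z (toℕ u))) (c v) (Ex.coef (ℓ v) M (κₑ v) (toℕ u)))
                (trans (sym (*-distribˡ-sum {D} (c v) (λ u → Ex.coef (ℓ v) M (κₑ v) (toℕ u) * fromℕ (bin z (toℕ u))))) (cong (λ s → c v * s) (sym (expand-v v z))))))))

      ±-chain : ∀ {a b c} k l → a ∈± P β → b ∈± P (ζ ℕ.* K) → c ∈± P k → ζ ℕ.* K ℕ.+ k ℕ.≤ l → a * (b * c) ∈± P (β ℕ.+ l)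
      ±-chain k l pa pb pc w = ±-weaken (±-* pa (±-* pb pc)) (≤-trans (≤-reflexive (trans (cong (λ s → P β * s) (sym (^-+ two (ζ ℕ.* K) k))) (sym (^-+ two β (ζ ℕ.* K ℕ.+ k))))) (P-mono (ℕP.+-monoʳ-≤ β w)))

      z^± : ∀ v {z} → z ℕ.≤ Z → fromℕ z ^ κₑ v ∈± P (ζ ℕ.* K)
      z^± v {z} z≤ = ±-of-nn (nn-^ (κₑ v) (nn-fromℕ z)) (z^≤ z≤ (κₑ≤ v))

      4^ : fromℕ 4 ^ M ≡ P (2 ℕ.* M)
      4^ = trans (cong (_^ M) (solve 0 (# 4 := # 2 :* (# 2 :* # 1)) refl)) (sym (^-* two 2 M))

      -- The gain 4^M is at least 2^(16β), while coefficients, powers of z, fourth powers of η^(lz)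
      -- and the number of terms together stay within 2^(7β).
      tailSum : ∀ z → z ℕ.≤ Z → P (8 ℕ.* β) * ∑ (λ v → c v * (fromℕ z ^ κₑ v * Ex.tail (ℓ v) M z)) ∈± 1#
      tailSum z z≤ = P-cancel (2 ℕ.* M ℕ.∸ 8 ℕ.* β) (8 ℕ.* β) {2 ℕ.* M} (sym (ℕP.m∸n+n≡m 8β≤2M))
          (±-weaken (subst (_∈± P (7 ℕ.* β)) (sym (*-distribˡ-sum {N} (P (2 ℕ.* M)) _))
            (∑±P _ (6 ℕ.* β) (ℕP.≤-reflexive (ar β)) λ v → subst₂ _∈±_ (solve 4 (λ p c z t → c :* (z :* (p :* t)) := p :* (c :* (z :* t))) refl (P (2 ℕ.* M)) (c v) (fromℕ z ^ κₑ v) (Ex.tail (ℓ v) M z)) (cong P (ar₆ β))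
              (±-chain (e ℕ.* 4) (5 ℕ.* β) (c± v) (z^± v z≤) (tail± v) bound)))
            (P-mono (ℕP.≤-trans (ℕP.≤-trans (ℕP.≤-reflexive (sym (ℕP.m+n∸n≡m (7 ℕ.* β) (8 ℕ.* β)))) (ℕP.∸-monoˡ-≤ (8 ℕ.* β) (ℕP.≤-trans (ℕP.≤-trans (ℕP.m≤m+n _ β) (ℕP.≤-reflexive (ar₇ β))) (ℕP.*-monoʳ-≤ 2 M≥)))) ℕP.≤-refl)))
        where
          ar : ∀ b → b ℕ.+ 6 ℕ.* b ≡ 7 ℕ.* b
          ar = ℕsolve-∀
          ar₆ : ∀ b → b ℕ.+ 5 ℕ.* b ≡ 6 ℕ.* b
          ar₆ = ℕsolve-∀
          ar₇ : ∀ b → 7 ℕ.* b ℕ.+ 8 ℕ.* b ℕ.+ b ≡ 2 ℕ.* (8 ℕ.* b)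
          ar₇ = ℕsolve-∀
          ar₅ : ∀ s e → s ℕ.+ e ℕ.* 4 ℕ.+ (4 ℕ.* s ℕ.+ e) ≡ 5 ℕ.* (s ℕ.+ e)
          ar₅ = ℕsolve-∀
          bound : ζ ℕ.* K ℕ.+ e ℕ.* 4 ℕ.≤ 5 ℕ.* β
          bound = ℕP.≤-trans (ℕP.m≤m+n _ (4 ℕ.* (ζ ℕ.* K) ℕ.+ e)) (ℕP.≤-trans (ℕP.≤-reflexive (ar₅ (ζ ℕ.* K) e)) (ℕP.*-monoʳ-≤ 5 ζK+e≤β))
          8β≤2M : 8 ℕ.* β ℕ.≤ 2 ℕ.* M
          8β≤2M = ℕP.≤-trans M≥ (ℕP.m≤n*m M 2)
          tail± : ∀ v → P (2 ℕ.* M) * Ex.tail (ℓ v) M z ∈± P (e ℕ.* 4)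
          tail± v = ±-of-nn (nn-* (P-nn (2 ℕ.* M)) (Ex.tail-nn (ℓ v) M z))
            (≤-trans (≤-reflexive (cong (_* Ex.tail (ℓ v) M z) (sym 4^))) (≤-trans (Ex.tail-bound (ℓ v) M z)
              (≤-trans (≤-reflexive (trans (cong (λ s → (s ^ 4) ^ z) (1+δ (ℓ v))) (trans (sym (^-* (η ^ ℓ v) 4 z)) (trans (cong ((η ^ ℓ v) ^_) (ℕP.*-comm 4 z)) (trans (^-* (η ^ ℓ v) z 4) (cong (_^ 4) (η^lz (ℓ v) z)))))))
                (≤-trans (^-mono-≤ 4 (nn-^ (ℓ v) (nn-^ z (inj₁ posη))) (^L≤ (nn-^ z (inj₁ posη)) (η^≤ z≤) (ℓ≤ v))) (≤-reflexive (sym (^-* two e 4)))))))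

      -- The only place where values at (i, j) are compared with functions of z: η^(lz) is X^l
      -- κ^(jl), and `power-close` replaces κ^(jl) by 1 at the cost of 2^(β - U).
      moveSum : ∀ {i j} → i ℕ.≤ I → j ℕ.≤ J → let z = i ℕ.+ r ℕ.* j in
        P (8 ℕ.* β) * ∑ (λ v → c v * (fromℕ z ^ κₑ v * (X i j ^ ℓ v - (η ^ ℓ v) ^ z))) ∈± 1#
      moveSum {i} {j} i≤ j≤ = ±-shrink (P-nn (8 ℕ.* β)) (P-mono (ℕP.≤-trans (ℕP.≤-reflexive (ar₈ β)) (ℕP.∸-monoˡ-≤ (4 ℕ.* β) U≥)))
          (P-cancel (4 ℕ.* β) (U ℕ.∸ 4 ℕ.* β) {U} (sym (ℕP.m+[n∸m]≡n 4β≤U))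
            (subst (_∈± P (4 ℕ.* β)) (sym (*-distribˡ-sum {N} (P U) _)) (∑±P _ (3 ℕ.* β) (ℕP.≤-reflexive (ar₄ β)) λ v →
              subst₂ _∈±_ (solve 4 (λ p c z t → c :* (z :* (p :* t)) := p :* (c :* (z :* t))) refl (P U) (c v) (fromℕ z ^ κₑ v) (X i j ^ ℓ v - (η ^ ℓ v) ^ z)) (cong P (ar₃ β))
                (±-chain (e ℕ.+ β) (2 ℕ.* β) (c± v) (z^± v z≤) (moved v) bound))))
        where
          z = i ℕ.+ r ℕ.* j
          z≤ : z ℕ.≤ Z
          z≤ = ℕP.+-mono-≤ i≤ (ℕP.*-monoʳ-≤ r j≤)
          ar₈ : ∀ b → 8 ℕ.* b ≡ 12 ℕ.* b ℕ.∸ 4 ℕ.* b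
          ar₈ b = sym (trans (cong (ℕ._∸ 4 ℕ.* b) (split b)) (ℕP.m+n∸n≡m (8 ℕ.* b) (4 ℕ.* b)))
            where split : ∀ b → 12 ℕ.* b ≡ 8 ℕ.* b ℕ.+ 4 ℕ.* b
                  split = ℕsolve-∀
          ar₄ : ∀ b → b ℕ.+ 3 ℕ.* b ≡ 4 ℕ.* b
          ar₄ = ℕsolve-∀
          ar₃ : ∀ b → b ℕ.+ 2 ℕ.* b ≡ 3 ℕ.* b
          ar₃ = ℕsolve-∀
          4β≤U : 4 ℕ.* β ℕ.≤ U
          4β≤U = ℕP.≤-trans (ℕP.*-monoˡ-≤ β {4} {12} (ℕP.m≤m+n 4 8)) U≥
          bound : ζ ℕ.* K ℕ.+ (e ℕ.+ β) ℕ.≤ 2 ℕ.* β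
          bound = ℕP.≤-trans (ℕP.≤-reflexive (sym (ℕP.+-assoc (ζ ℕ.* K) e β))) (ℕP.≤-trans (ℕP.+-monoˡ-≤ β ζK+e≤β) (ℕP.≤-reflexive (dbl β)))
            where dbl : ∀ b → b ℕ.+ b ≡ 2 ℕ.* b
                  dbl = ℕsolve-∀
          β≤U : β ℕ.≤ U
          β≤U = ℕP.≤-trans (ℕP.m≤n*m β 12) U≥
          factored : ∀ l → (η ^ l) ^ z ≡ X i j ^ l * κ ^ (j ℕ.* l)
          factored l = trans (η^lz l z) (trans (cong (_^ l) (sym (Xκ i j))) (trans (^-*ˡ (X i j) (κ ^ j) l) (cong (λ s → X i j ^ l * s) (sym (^-* κ j l)))))
          n≤ : ∀ v → 2 ℕ.* (j ℕ.* ℓ v) ℕ.≤ 2 ℕ.^ β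
          n≤ v = ℕP.≤-trans (ℕP.*-monoʳ-≤ 2 (ℕP.*-mono-≤ j≤ (ℓ≤ v))) JL≤
          moved : ∀ v → P U * (X i j ^ ℓ v - (η ^ ℓ v) ^ z) ∈± P (e ℕ.+ β)
          moved v = subst₂ _∈±_ (trans (solve 3 (λ p x k → x :* (:- (p :* (k :- # 1))) := p :* (x :- x :* k)) refl (P U) (X i j ^ ℓ v) (κ ^ (j ℕ.* ℓ v)))
                (cong (λ s → P U * (X i j ^ ℓ v - s)) (sym (factored (ℓ v))))) (sym (^-+ two e β))
            (±-* (±-of-nn (nn-^ (ℓ v) (inj₁ (posX i j))) (^L≤ (inj₁ (posX i j)) (X≤ i≤ j≤) (ℓ≤ v)))
              (±-neg (±-weaken (power-close (P-nn U) κ-close (j ℕ.* ℓ v) (≤-trans (fromℕ≤P {2 ℕ.* (j ℕ.* ℓ v)} {β} (n≤ v)) (P-mono β≤U))) (fromℕ≤P {2 ℕ.* (j ℕ.* ℓ v)} {β} (n≤ v)))))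

      -- The auxiliary function at the grid point (i, j).
      Y : ℕ → ℕ → Carrier
      Y i j = ∑ (λ v → c v * (fromℕ (i ℕ.+ r ℕ.* j) ^ κₑ v * X i j ^ ℓ v))

      Y-small : ∀ {i j} → i ℕ.≤ I → j ℕ.≤ J → P (8 ℕ.* β) * Y i j ∈± fromℕ 3
      Y-small {i} {j} i≤ j≤ = subst₂ _∈±_ total (solve 0 (# 1 :+ (# 1 :+ # 1) := # 3) refl) (±-+ (moveSum i≤ j≤) (±-+ (headSum z z≤) (tailSum z z≤)))
        where
          z = i ℕ.+ r ℕ.* j
          z≤ : z ℕ.≤ Z
          z≤ = ℕP.+-mono-≤ i≤ (ℕP.*-monoʳ-≤ r j≤)
          f₁ f₂ f₃ : Fin N → Carrier
          f₁ v = c v * (fromℕ z ^ κₑ v * (X i j ^ ℓ v - (η ^ ℓ v) ^ z))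
          f₂ v = c v * (fromℕ z ^ κₑ v * Ex.head (ℓ v) M z)
          f₃ v = c v * (fromℕ z ^ κₑ v * Ex.tail (ℓ v) M z)
          total : P (8 ℕ.* β) * ∑ f₁ + (P (8 ℕ.* β) * ∑ f₂ + P (8 ℕ.* β) * ∑ f₃) ≡ P (8 ℕ.* β) * Y i j
          total = trans (solve 4 (λ p a b c → p :* a :+ (p :* b :+ p :* c) := p :* (a :+ (b :+ c))) refl (P (8 ℕ.* β)) (∑ f₁) (∑ f₂) (∑ f₃))
            (cong (λ s → P (8 ℕ.* β) * s) (trans (cong (λ s → ∑ f₁ + s) (sym (∑-distrib-+ {N} f₂ f₃))) (trans (sym (∑-distrib-+ {N} f₁ (λ v → f₂ v + f₃ v))) (sum-cong-≗ {N} each))))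
            where
              each : ∀ v → f₁ v + (f₂ v + f₃ v) ≡ c v * (fromℕ z ^ κₑ v * X i j ^ ℓ v)
              each v = trans (solve 6 (λ c z x y a b → c :* (z :* (x :- y)) :+ (c :* (z :* a) :+ c :* (z :* b)) := c :* (z :* ((x :- y) :+ (a :+ b)))) refl (c v) (fromℕ z ^ κₑ v) (X i j ^ ℓ v) ((η ^ ℓ v) ^ z) (Ex.head (ℓ v) M z) (Ex.tail (ℓ v) M z))
                (trans (cong (λ s → c v * (fromℕ z ^ κₑ v * ((X i j ^ ℓ v - (η ^ ℓ v) ^ z) + s))) (trans (Ex.head+tail (ℓ v) M z) (cong (_^ z) (1+δ (ℓ v)))))
                  (cong (λ s → c v * (fromℕ z ^ κₑ v * s)) (solve 2 (λ x y → (x :- y) :+ y := x) refl (X i j ^ ℓ v) ((η ^ ℓ v) ^ z))))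

      numer denom : ℕ → ℕ → Carrier
      numer i j = μ ^ i * G₁ ^ j
      denom i j = ν ^ i * G₀ ^ j

      denom-X : ∀ i j → denom i j * X i j ≡ numer i j
      denom-X i j = trans (solve 4 (λ a b c d → (a :* b) :* (c :* d) := (a :* c) :* (b :* d)) refl (ν ^ i) (G₀ ^ j) (η ^ i) (ρ ^ j))
        (cong₂ _*_ (trans (sym (^-*ˡ ν η i)) (cong (_^ i) νη)) (trans (sym (^-*ˡ G₀ ρ j)) (cong (_^ j) G₀ρ)))

      pos-denom : ∀ i j → Pos (denom i j)
      pos-denom i j = Pos-* (Pos-^ i posν) (Pos-^ j posG₀)

      int-product : ∀ {a b i j} → IsInt a (2 ℕ.^ h₁) → IsInt b (2 ℕ.^ h₂) → i ℕ.≤ I → j ℕ.≤ J → IsInt (a ^ i * b ^ j) (2 ℕ.^ g)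
      int-product {a} {b} {i} {j} pa pb i≤ j≤ = IsInt-weaken le (IsInt-* (IsInt-^ i pa) (IsInt-^ j pb))
        where
          open ℕP.≤-Reasoning
          le : (2 ℕ.^ h₁) ℕ.^ i ℕ.* (2 ℕ.^ h₂) ℕ.^ j ℕ.≤ 2 ℕ.^ g
          le = begin
            (2 ℕ.^ h₁) ℕ.^ i ℕ.* (2 ℕ.^ h₂) ℕ.^ j ≡⟨ cong₂ ℕ._*_ (ℕP.^-*-assoc 2 h₁ i) (ℕP.^-*-assoc 2 h₂ j) ⟩
            2 ℕ.^ (h₁ ℕ.* i) ℕ.* 2 ℕ.^ (h₂ ℕ.* j) ≡⟨ sym (ℕP.^-distribˡ-+-* 2 (h₁ ℕ.* i) (h₂ ℕ.* j)) ⟩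
            2 ℕ.^ (h₁ ℕ.* i ℕ.+ h₂ ℕ.* j) ≤⟨ ℕP.^-monoʳ-≤ 2 (ℕP.+-mono-≤ (ℕP.*-monoʳ-≤ h₁ i≤) (ℕP.*-mono-≤ (ℕP.n≤1+n h₂) j≤)) ⟩
            2 ℕ.^ g ∎

      cleared : ℕ → ℕ → Carrier
      cleared i j = denom i j ^ L * Y i j

      cleared-int : ∀ {i j} → i ℕ.≤ I → j ℕ.≤ J → IsInt (cleared i j) (2 ℕ.^ (3 ℕ.* β))
      cleared-int {i} {j} i≤ j≤ = IsInt-≡ (trans (sum-cong-≗ {N} rewriteTerm) (sym (*-distribˡ-sum {N} (denom i j ^ L) (λ v → c v * (fromℕ z ^ κₑ v * X i j ^ ℓ v)))))
          (IsInt-weaken weightBound (IsInt-∑ {N} _ (2 ℕ.^ (suc β ℕ.+ (ζ ℕ.* K ℕ.+ e))) termInt))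
        where
          open ℕP.≤-Reasoning
          z = i ℕ.+ r ℕ.* j
          Q R : Carrier
          Q = numer i j
          R = denom i j
          rewriteTerm : ∀ v → c v * (fromℕ z ^ κₑ v * (Q ^ ℓ v * R ^ (L ℕ.∸ ℓ v))) ≡ R ^ L * (c v * (fromℕ z ^ κₑ v * X i j ^ ℓ v))
          rewriteTerm v = trans (cong (λ s → c v * (fromℕ z ^ κₑ v * (s ^ ℓ v * R ^ (L ℕ.∸ ℓ v)))) (sym (denom-X i j)))
            (trans (cong (λ s → c v * (fromℕ z ^ κₑ v * (s * R ^ (L ℕ.∸ ℓ v)))) (^-*ˡ R (X i j) (ℓ v)))
            (trans (solve 5 (λ c z r x s → c :* (z :* ((r :* x) :* s)) := (r :* s) :* (c :* (z :* x))) refl (c v) (fromℕ z ^ κₑ v) (R ^ ℓ v) (X i j ^ ℓ v) (R ^ (L ℕ.∸ ℓ v)))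
              (cong (λ s → s * (c v * (fromℕ z ^ κₑ v * X i j ^ ℓ v))) (trans (sym (^-+ R (ℓ v) (L ℕ.∸ ℓ v))) (cong (R ^_) (ℕP.m+[n∸m]≡n (ℓ≤ v)))))))
          c-int : ∀ v → IsInt (c v) (2 ℕ.^ suc β)
          c-int v = IsInt-weaken (ℕP.+-mono-≤ (ℕP.<⇒≤ (FinP.toℕ<n (p v))) (ℕP.≤-trans (ℕP.<⇒≤ (FinP.toℕ<n (q v))) (ℕP.≤-reflexive (sym (ℕP.+-identityʳ _)))))
            (IsInt-+ (IsInt-ℕ (toℕ (p v))) (IsInt-neg (IsInt-ℕ (toℕ (q v)))))
          z-int : ∀ v → IsInt (fromℕ z ^ κₑ v) (2 ℕ.^ (ζ ℕ.* K))
          z-int v = IsInt-weaken (begin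
              z ℕ.^ κₑ v ≤⟨ ℕP.^-monoˡ-≤ (κₑ v) (ℕP.≤-trans (ℕP.+-mono-≤ i≤ (ℕP.*-monoʳ-≤ r j≤)) Z≤) ⟩
              (2 ℕ.^ ζ) ℕ.^ κₑ v ≡⟨ ℕP.^-*-assoc 2 ζ (κₑ v) ⟩
              2 ℕ.^ (ζ ℕ.* κₑ v) ≤⟨ ℕP.^-monoʳ-≤ 2 (ℕP.*-monoʳ-≤ ζ (κₑ≤ v)) ⟩
              2 ℕ.^ (ζ ℕ.* K) ∎) (IsInt-^ (κₑ v) (IsInt-ℕ z))
          pair-int : ∀ v → IsInt (Q ^ ℓ v * R ^ (L ℕ.∸ ℓ v)) (2 ℕ.^ e)
          pair-int v = IsInt-weaken (ℕP.≤-reflexive (begin-equality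
              (2 ℕ.^ g) ℕ.^ ℓ v ℕ.* (2 ℕ.^ g) ℕ.^ (L ℕ.∸ ℓ v) ≡⟨ sym (ℕP.^-distribˡ-+-* (2 ℕ.^ g) (ℓ v) (L ℕ.∸ ℓ v)) ⟩
              (2 ℕ.^ g) ℕ.^ (ℓ v ℕ.+ (L ℕ.∸ ℓ v)) ≡⟨ cong ((2 ℕ.^ g) ℕ.^_) (ℕP.m+[n∸m]≡n (ℓ≤ v)) ⟩
              (2 ℕ.^ g) ℕ.^ L ≡⟨ ℕP.^-*-assoc 2 g L ⟩
              2 ℕ.^ e ∎)) (IsInt-* (IsInt-^ (ℓ v) (int-product intμ intG₁ i≤ j≤)) (IsInt-^ (L ℕ.∸ ℓ v) (int-product intν intG₀ i≤ j≤)))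
          termInt : ∀ v → IsInt (c v * (fromℕ z ^ κₑ v * (Q ^ ℓ v * R ^ (L ℕ.∸ ℓ v)))) (2 ℕ.^ (suc β ℕ.+ (ζ ℕ.* K ℕ.+ e)))
          termInt v = IsInt-weaken (ℕP.≤-reflexive (begin-equality
              2 ℕ.^ suc β ℕ.* (2 ℕ.^ (ζ ℕ.* K) ℕ.* 2 ℕ.^ e) ≡⟨ cong (2 ℕ.^ suc β ℕ.*_) (sym (ℕP.^-distribˡ-+-* 2 (ζ ℕ.* K) e)) ⟩
              2 ℕ.^ suc β ℕ.* 2 ℕ.^ (ζ ℕ.* K ℕ.+ e) ≡⟨ sym (ℕP.^-distribˡ-+-* 2 (suc β) (ζ ℕ.* K ℕ.+ e)) ⟩
              2 ℕ.^ (suc β ℕ.+ (ζ ℕ.* K ℕ.+ e)) ∎)) (IsInt-* (c-int v) (IsInt-* (z-int v) (pair-int v)))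
          ar : ∀ b s → b ℕ.+ (1 ℕ.+ b ℕ.+ s) ≡ 2 ℕ.* b ℕ.+ (s ℕ.+ 1)
          ar = ℕsolve-∀
          ar′ : ∀ b → 2 ℕ.* b ℕ.+ b ≡ 3 ℕ.* b
          ar′ = ℕsolve-∀
          weightBound : N ℕ.* 2 ℕ.^ (suc β ℕ.+ (ζ ℕ.* K ℕ.+ e)) ℕ.≤ 2 ℕ.^ (3 ℕ.* β)
          weightBound = begin
            N ℕ.* 2 ℕ.^ (suc β ℕ.+ (ζ ℕ.* K ℕ.+ e)) ≤⟨ ℕP.*-monoˡ-≤ _ N≤ ⟩
            2 ℕ.^ β ℕ.* 2 ℕ.^ (suc β ℕ.+ (ζ ℕ.* K ℕ.+ e)) ≡⟨ sym (ℕP.^-distribˡ-+-* 2 β _) ⟩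
            2 ℕ.^ (β ℕ.+ (suc β ℕ.+ (ζ ℕ.* K ℕ.+ e))) ≡⟨ cong (2 ℕ.^_) (ar β (ζ ℕ.* K ℕ.+ e)) ⟩
            2 ℕ.^ (2 ℕ.* β ℕ.+ (ζ ℕ.* K ℕ.+ e ℕ.+ 1)) ≤⟨ ℕP.^-monoʳ-≤ 2 (ℕP.+-monoʳ-≤ (2 ℕ.* β) (ℕP.≤-trans (ℕP.+-monoʳ-≤ (ζ ℕ.* K ℕ.+ e) (ℕ.s≤s ℕ.z≤n)) β≥)) ⟩
            2 ℕ.^ (2 ℕ.* β ℕ.+ β) ≡⟨ cong (2 ℕ.^_) (ar′ β) ⟩
            2 ℕ.^ (3 ℕ.* β) ∎

      denom≤ : ∀ {i j} → i ℕ.≤ I → j ℕ.≤ J → denom i j ^ L ≤ P e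
      denom≤ {i} {j} i≤ j≤ = ^L≤ (inj₁ (pos-denom i j)) (≤-trans (±upper (IsInt-∈± (int-product intν intG₀ i≤ j≤))) (≤-reflexive (fromℕ-2^ g))) ℕP.≤-refl

      -- After clearing denominators the value has weight at most 2^(3β), so if nonzero it would be
      -- at least about 2^(-6β). It is at most 3 · 2^(e - 8β), and e + 4 ≤ β decides.
      Y-vanishes : ∀ {i j} → i ℕ.≤ I → j ℕ.≤ J → Y i j ≡ 0#
      Y-vanishes {i} {j} i≤ j≤ = *-cancel-0 (liouville′ (cleared-int i≤ j≤) (P-pos (8 ℕ.* β)) bounded small) (^-≢0 L (Pos⇒≢0 (pos-denom i j)))
        where
          bounded : P (8 ℕ.* β) * cleared i j ∈± P e * fromℕ 3
          bounded = subst (_∈± P e * fromℕ 3) (solve 3 (λ p d y → d :* (p :* y) := p :* (d :* y)) refl (P (8 ℕ.* β)) (denom i j ^ L) (Y i j))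
            (±-* (±-of-nn (nn-^ L (inj₁ (pos-denom i j))) (denom≤ i≤ j≤)) (Y-small i≤ j≤))
          W = 2 ℕ.^ (3 ℕ.* β)
          w≡ : fromℕ (2 ℕ.* (W ℕ.* W)) ≡ P (1 ℕ.+ (3 ℕ.* β ℕ.+ 3 ℕ.* β))
          w≡ = trans (cong (λ s → fromℕ (2 ℕ.* s)) (sym (ℕP.^-distribˡ-+-* 2 (3 ℕ.* β) (3 ℕ.* β)))) (fromℕ-2^ (1 ℕ.+ (3 ℕ.* β ℕ.+ 3 ℕ.* β)))
          e+4≤β : e ℕ.+ 4 ℕ.≤ β
          e+4≤β = ℕP.≤-trans (ℕP.m≤n+m (e ℕ.+ 4) (ζ ℕ.* K)) (ℕP.≤-trans (ℕP.≤-reflexive (sym (ℕP.+-assoc (ζ ℕ.* K) e 4))) β≥)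
          ar : ∀ e b → e ℕ.+ 2 ℕ.+ (1 ℕ.+ (3 ℕ.* b ℕ.+ 3 ℕ.* b)) ℕ.+ 1 ≡ 6 ℕ.* b ℕ.+ (e ℕ.+ 4)
          ar = ℕsolve-∀
          ar′ : ∀ b → 6 ℕ.* b ℕ.+ b ℕ.+ b ≡ 8 ℕ.* b
          ar′ = ℕsolve-∀
          exps : e ℕ.+ 2 ℕ.+ (1 ℕ.+ (3 ℕ.* β ℕ.+ 3 ℕ.* β)) ℕ.+ 1 ℕ.≤ 8 ℕ.* β
          exps = ℕP.≤-trans (ℕP.≤-reflexive (ar e β)) (ℕP.≤-trans (ℕP.+-monoʳ-≤ (6 ℕ.* β) e+4≤β) (ℕP.≤-trans (ℕP.m≤m+n _ β) (ℕP.≤-reflexive (ar′ β))))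
          small : P e * fromℕ 3 * fromℕ (2 ℕ.* (W ℕ.* W)) < P (8 ℕ.* β)
          small = <-≤-trans (≤-<-trans (≤-trans (≤-reflexive (cong (λ s → P e * fromℕ 3 * s) w≡))
                (≤-trans (*-monoʳ-≤ (P-nn (1 ℕ.+ (3 ℕ.* β ℕ.+ 3 ℕ.* β))) (*-monoˡ-≤ (P-nn e) (fromℕ≤P {3} {2} (ℕP.n≤1+n 3))))
                  (≤-reflexive (trans (cong (λ s → s * P (1 ℕ.+ (3 ℕ.* β ℕ.+ 3 ℕ.* β))) (sym (^-+ two e 2))) (sym (^-+ two (e ℕ.+ 2) (1 ℕ.+ (3 ℕ.* β ℕ.+ 3 ℕ.* β))))))))
              (<-by (solve 1 (λ t → t := t :* (# 2 :* # 1) :- t) refl (P (e ℕ.+ 2 ℕ.+ (1 ℕ.+ (3 ℕ.* β ℕ.+ 3 ℕ.* β))))) (P-pos (e ℕ.+ 2 ℕ.+ (1 ℕ.+ (3 ℕ.* β ℕ.+ 3 ℕ.* β))))))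
            (≤-trans (≤-reflexive (sym (^-+ two (e ℕ.+ 2 ℕ.+ (1 ℕ.+ (3 ℕ.* β ℕ.+ 3 ℕ.* β))) 1))) (P-mono exps))

      iₜ jₜ : Fin (I′ ℕ.* J) → ℕ
      iₜ t = toℕ (proj₁ (remQuot {I′} J t))
      jₜ t = toℕ (proj₂ (remQuot {I′} J t))

      point : Fin (I′ ℕ.* J) → Carrier
      point t = fromℕ (iₜ t ℕ.+ r ℕ.* jₜ t)

      iₜ<r : ∀ t → iₜ t ℕ.< r
      iₜ<r t = ℕP.<-≤-trans (FinP.toℕ<n (proj₁ (remQuot {I′} J t))) (ℕP.≤-trans (ℕP.m≤m+n I′ L) I≤r)

      digits-unique : ∀ {a b c d} → a ℕ.< r → b ℕ.< r → a ℕ.+ r ℕ.* c ≡ b ℕ.+ r ℕ.* d → a ≡ b × c ≡ d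
      digits-unique {a} {b} {zero} {zero} p q s = trans (trans (sym (ℕP.+-identityʳ a)) (cong (a ℕ.+_) (sym (ℕP.*-zeroʳ r)))) (trans s (trans (cong (b ℕ.+_) (ℕP.*-zeroʳ r)) (ℕP.+-identityʳ b))) , refl
      digits-unique {a} {b} {zero} {suc d} p q s = ⊥-elim (ℕP.<⇒≱ p (ℕP.≤-trans (ℕP.m≤m+n r (b ℕ.+ r ℕ.* d)) (ℕP.≤-reflexive (trans (mv r b d) (trans (sym s) (trans (cong (a ℕ.+_) (ℕP.*-zeroʳ r)) (ℕP.+-identityʳ a)))))))
        where mv : ∀ r b d → r ℕ.+ (b ℕ.+ r ℕ.* d) ≡ b ℕ.+ r ℕ.* (1 ℕ.+ d)
              mv = ℕsolve-∀
      digits-unique {a} {b} {suc c} {zero} p q s = ⊥-elim (ℕP.<⇒≱ q (ℕP.≤-trans (ℕP.m≤m+n r (a ℕ.+ r ℕ.* c)) (ℕP.≤-reflexive (trans (mv r a c) (trans s (trans (cong (b ℕ.+_) (ℕP.*-zeroʳ r)) (ℕP.+-identityʳ b)))))))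
        where mv : ∀ r b d → r ℕ.+ (b ℕ.+ r ℕ.* d) ≡ b ℕ.+ r ℕ.* (1 ℕ.+ d)
              mv = ℕsolve-∀
      digits-unique {a} {b} {suc c} {suc d} p q s = proj₁ rec , cong suc (proj₂ rec)
        where mv : ∀ r b d → b ℕ.+ r ℕ.* (1 ℕ.+ d) ≡ r ℕ.+ (b ℕ.+ r ℕ.* d)
              mv = ℕsolve-∀
              rec = digits-unique {a} {b} {c} {d} p q (ℕP.+-cancelˡ-≡ r _ _ (trans (sym (mv r a c)) (trans s (mv r b d))))

      -- By I ≤ r, the pair (i, j) can be recovered from i + r j as digits to base r.
      point-injective : Injective point
      point-injective {s} {t} eq = trans (sym (FinP.combine-remQuot {I′} J s)) (trans (cong₂ combine (FinP.toℕ-injective (proj₁ d)) (FinP.toℕ-injective (proj₂ d))) (FinP.combine-remQuot {I′} J t))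
        where d = digits-unique (iₜ<r s) (iₜ<r t) (fromℕ-injective eq)

      Λ : Fin L → Carrier
      Λ l = η ^ toℕ l

      η^-strict : ∀ {m n} → m ℕ.< n → η ^ m < η ^ n
      η^-strict {m} {n} m<n = <-≤-trans (<-by (solve 2 (λ h t → (h :- # 1) :* t := h :* t :- t) refl η (η ^ m)) (Pos-* 1<η (Pos-^ m posη))) (^-monoʳ-≤ 1≤η m<n)

      Λ-injective : Injective Λ
      Λ-injective {a} {b} eq = FinP.toℕ-injective (compare (ℕP.<-cmp (toℕ a) (toℕ b)))
        where
          open import Relation.Binary.Definitions using (Tri; tri<; tri≈; tri>)
          compare : Tri (toℕ a ℕ.< toℕ b) (toℕ a ≡ toℕ b) (toℕ b ℕ.< toℕ a) → toℕ a ≡ toℕ b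
          compare (tri≈ _ e _) = e
          compare (tri< l _ _) = ⊥-elim (<-irrefl (subst (η ^ toℕ a <_) (sym eq) (η^-strict l)))
          compare (tri> _ _ l) = ⊥-elim (<-irrefl (subst (η ^ toℕ b <_) eq (η^-strict l)))

      coefficients : Fin L → Fin K → Carrier
      coefficients l k = c (combine l k)

      weights : Fin (I′ ℕ.* J) → Fin L → Carrier
      weights t l = X (iₜ t) (jₜ t) ^ toℕ l

      -- Raising i by s adds s to z and multiplies X by η^s: exactly the shifts of the zero
      -- estimate, with Λ_l = η^l and the powers of X as weights.
      grid-vanish : ∀ t i → ∑ (λ l → weights t l * (Λ l ^ toℕ i * poly (coefficients l) (point t + fromℕ (toℕ {L} i)))) ≡ 0#
      grid-vanish t s = trans (sum-cong-≗ {L} inner) (trans (sym (∑-combine L K _)) (Y-vanishes {i₀ ℕ.+ a} {j₀} i≤ j≤))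
        where
          i₀ = iₜ t
          j₀ = jₜ t
          a = toℕ s
          i≤ : i₀ ℕ.+ a ℕ.≤ I
          i≤ = ℕP.+-mono-≤ (ℕP.<⇒≤ (FinP.toℕ<n (proj₁ (remQuot {I′} J t)))) (ℕP.<⇒≤ (FinP.toℕ<n s))
          j≤ : j₀ ℕ.≤ J
          j≤ = ℕP.<⇒≤ (FinP.toℕ<n (proj₂ (remQuot {I′} J t)))
          z = i₀ ℕ.+ a ℕ.+ r ℕ.* j₀
          arg : point t + fromℕ a ≡ fromℕ z
          arg = trans (sym (fromℕ-+ (i₀ ℕ.+ r ℕ.* j₀) a)) (cong fromℕ (ar i₀ (r ℕ.* j₀) a))
            where ar : ∀ i m a → i ℕ.+ m ℕ.+ a ≡ i ℕ.+ a ℕ.+ m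
                  ar = ℕsolve-∀
          shifted : ∀ l → weights t l * Λ l ^ a ≡ X (i₀ ℕ.+ a) j₀ ^ toℕ l
          shifted l = trans (cong (λ s → X i₀ j₀ ^ toℕ l * s) (η^lz (toℕ l) a)) (trans (sym (^-*ˡ (X i₀ j₀) (η ^ a) (toℕ l)))
            (cong (_^ toℕ l) (trans (solve 3 (λ x y z → x :* y :* z := x :* z :* y) refl (η ^ i₀) (ρ ^ j₀) (η ^ a)) (cong (_* ρ ^ j₀) (sym (^-+ η i₀ a))))))
          inner : ∀ l → weights t l * (Λ l ^ a * poly (coefficients l) (point t + fromℕ a))
            ≡ ∑ {K} (λ k → c (combine l k) * (fromℕ z ^ κₑ (combine l k) * X (i₀ ℕ.+ a) j₀ ^ ℓ (combine l k)))
          inner l = trans (sym (*-assoc _ _ _)) (trans (cong₂ (λ u v → u * poly (coefficients l) v) (shifted l) arg)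
            (trans (*-distribˡ-sum {K} (X (i₀ ℕ.+ a) j₀ ^ toℕ l) (λ k → c (combine l k) * monomial k (fromℕ z))) (sum-cong-≗ {K} λ k →
              trans (cong (λ s → X (i₀ ℕ.+ a) j₀ ^ toℕ l * (c (combine l k) * s)) (monomial-expo k (fromℕ z)))
              (trans (solve 3 (λ x c z → x :* (c :* z) := c :* (z :* x)) refl (X (i₀ ℕ.+ a) j₀ ^ toℕ l) (c (combine l k)) (fromℕ z ^ expo k))
                (cong (λ w → c (combine l k) * (fromℕ z ^ expo (proj₂ w) * X (i₀ ℕ.+ a) j₀ ^ toℕ (proj₁ w))) (sym (FinP.remQuot-combine {L} l k)))))))

      c≡0 : ∀ v → c v ≡ 0#
      c≡0 v = trans (cong c (sym (FinP.combine-remQuot {L} K v)))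
        (zero-estimate Λ Λ-injective coefficients point point-injective weights (λ t l → ^-≢0 (toℕ l) (Pos⇒≢0 (posX (iₜ t) (jₜ t)))) points grid-vanish
          (proj₁ (remQuot {L} K v)) (proj₂ (remQuot {L} K v)))

    impossible : ⊥
    impossible = pick (proj₁ (proj₂ (proj₂ solution)))
      where
        pick : ∃ (λ v → p v ≢ q v) → ⊥
        pick (v , ne) = ne (FinP.toℕ-injective (fromℕ-injective (trans (solve 2 (λ a b → a := (a :- b) :+ b) refl (fromℕ (toℕ (p v))) (fromℕ (toℕ (q v)))) (trans (cong (_+ fromℕ (toℕ (q v))) (c≡0 v)) (+-identityˡ _)))))

-- Choice of the parameters

module TwoLogParameters (F : NarayanaField) where

  open import Data.Integer using (+_)
  open NarayanaField F using (orderedField)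
  open OrderedFieldTheory orderedField
  open TwoLogEstimate F

  n<2^n : ∀ n → n ℕ.< 2 ℕ.^ n
  n<2^n zero = ℕ.s≤s ℕ.z≤n
  n<2^n (suc n) = ℕP.≤-trans (ℕ.s≤s (n<2^n n)) (ℕP.≤-trans (ℕP.+-monoˡ-≤ (2 ℕ.^ n) (ℕP.m^n>0 2 n)) (ℕP.≤-reflexive (cong (2 ℕ.^ n ℕ.+_) (sym (ℕP.+-identityʳ _)))))

  times-power : ∀ {c k x β} → c ℕ.≤ 2 ℕ.^ k → k ℕ.+ x ℕ.≤ β → c ℕ.* x ℕ.≤ 2 ℕ.^ β
  times-power {c} {k} {x} {β} p q = ℕP.≤-trans (ℕP.*-mono-≤ p (ℕP.<⇒≤ (n<2^n x))) (ℕP.≤-trans (ℕP.≤-reflexive (sym (ℕP.^-distribˡ-+-* 2 k x))) (ℕP.^-monoʳ-≤ 2 q))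

  -- The numerical constants are variables, so that products with them do not unfold.
  module Choice (c d C : ℕ) (270<c : 270 ℕ.< c) (c≤512 : c ℕ.≤ 2 ℕ.^ 9) (points-const : suc c ℕ.* suc (d ℕ.+ d) ℕ.≤ d ℕ.* d)
    (U-const : 25 ℕ.* (c ℕ.* c) ℕ.* suc (d ℕ.+ d) ℕ.≤ C)
    (h₁ h₂ r ζ U : ℕ) (1≤h₁ : 1 ℕ.≤ h₁) (1≤ζ : 1 ℕ.≤ ζ)
    (U-big : C ℕ.* (ζ ℕ.* ζ ℕ.* (h₁ ℕ.* suc h₂)) ℕ.≤ U)
    (r-big : (suc d ℕ.* c) ℕ.* (ζ ℕ.* suc h₂) ℕ.≤ r)
    (r-small : r ℕ.* (1 ℕ.+ (d ℕ.* c) ℕ.* (ζ ℕ.* h₁)) ℕ.≤ 2 ℕ.^ ζ) where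

    private
      H = suc h₂
      -- The choices balance the costs: ζ K equals e = g L, and `h₁` I′ equals H J.
      L = c ℕ.* ζ
      J = d ℕ.* (L ℕ.* h₁)
      I′ = d ℕ.* (L ℕ.* H)
      I = I′ ℕ.+ L
      g = h₁ ℕ.* I ℕ.+ H ℕ.* J
      K = c ℕ.* g
      e = g ℕ.* L
      x = ζ ℕ.* K
      β = x ℕ.+ e ℕ.+ 4
      M = 8 ℕ.* β

      e≡x : e ≡ x
      e≡x = lem c g ζ
        where lem : ∀ c g z → g ℕ.* (c ℕ.* z) ≡ z ℕ.* (c ℕ.* g)
              lem = ℕsolve-∀

      β≡ : β ≡ 2 ℕ.* x ℕ.+ 4
      β≡ = trans (cong (λ s → x ℕ.+ s ℕ.+ 4) e≡x) (lem x)
        where lem : ∀ x → x ℕ.+ x ℕ.+ 4 ≡ 2 ℕ.* x ℕ.+ 4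
              lem = ℕsolve-∀

      1≤c : 1 ℕ.≤ c
      1≤c = ℕP.≤-trans (ℕ.s≤s ℕ.z≤n) 270<c

      1≤L : 1 ℕ.≤ L
      1≤L = ℕP.*-mono-≤ 1≤c 1≤ζ

      1≤g : 1 ℕ.≤ g
      1≤g = ℕP.≤-trans (ℕP.*-mono-≤ 1≤h₁ (ℕP.≤-trans 1≤L (ℕP.m≤n+m L I′))) (ℕP.m≤m+n _ _)

      K≤x : K ℕ.≤ x
      K≤x = ℕP.≤-trans (ℕP.≤-reflexive (sym (ℕP.*-identityˡ K))) (ℕP.*-monoˡ-≤ K 1≤ζ)

      270≤x : 270 ℕ.≤ x
      270≤x = ℕP.≤-trans (ℕP.≤-trans (ℕP.<⇒≤ 270<c) (ℕP.≤-trans (ℕP.≤-reflexive (sym (ℕP.*-identityʳ c))) (ℕP.*-monoʳ-≤ c 1≤g))) K≤x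

      within : ∀ k → k ℕ.≤ 270 → k ℕ.+ x ℕ.≤ β
      within k p = ℕP.≤-trans (ℕP.+-monoˡ-≤ x (ℕP.≤-trans p 270≤x)) (ℕP.≤-trans (ℕP.≤-trans (ℕP.≤-reflexive (lem x)) (ℕP.m≤m+n _ 4)) (ℕP.≤-reflexive (sym β≡)))
        where lem : ∀ x → x ℕ.+ x ≡ 2 ℕ.* x
              lem = ℕsolve-∀

      N≤ : L ℕ.* K ℕ.≤ 2 ℕ.^ β
      N≤ = ℕP.≤-trans (ℕP.≤-reflexive (ℕP.*-assoc c ζ K)) (times-power {c} {9} {x} c≤512 (within 9 (ℕP.≤ᵇ⇒≤ 9 270 tt)))

      β≤3x : β ℕ.≤ 3 ℕ.* x
      β≤3x = ℕP.≤-trans (ℕP.≤-reflexive β≡) (ℕP.≤-trans (ℕP.+-monoʳ-≤ (2 ℕ.* x) (ℕP.≤-trans (ℕP.≤ᵇ⇒≤ 4 270 tt) 270≤x)) (ℕP.≤-reflexive (lem x)))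
        where lem : ∀ x → 2 ℕ.* x ℕ.+ x ≡ 3 ℕ.* x
              lem = ℕsolve-∀

      D≤25x : K ℕ.+ M ℕ.≤ 25 ℕ.* x
      D≤25x = ℕP.≤-trans (ℕP.+-mono-≤ K≤x (ℕP.*-monoʳ-≤ 8 β≤3x)) (ℕP.≤-reflexive (lem x))
        where lem : ∀ x → x ℕ.+ 8 ℕ.* (3 ℕ.* x) ≡ 25 ℕ.* x
              lem = ℕsolve-∀

      D≤ : K ℕ.+ M ℕ.≤ 2 ℕ.^ β
      D≤ = ℕP.≤-trans D≤25x (times-power {25} {5} {x} (ℕP.≤ᵇ⇒≤ 25 32 tt) (within 5 (ℕP.≤ᵇ⇒≤ 5 270 tt)))

      J≤K : J ℕ.≤ K
      J≤K = ℕP.≤-trans (ℕP.≤-trans (ℕP.m≤n*m J H) (ℕP.m≤n+m (H ℕ.* J) (h₁ ℕ.* I))) (ℕP.m≤n*m g c ⦃ ℕ.>-nonZero 1≤c ⦄)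

      JL≤ : 2 ℕ.* (J ℕ.* L) ℕ.≤ 2 ℕ.^ β
      JL≤ = ℕP.≤-trans (ℕP.*-monoʳ-≤ 2 (ℕP.*-monoˡ-≤ L J≤K)) (ℕP.≤-trans (ℕP.≤-reflexive (trans (cong (2 ℕ.*_) (lem c ζ K)) (sym (ℕP.*-assoc 2 c x))))
          (times-power {2 ℕ.* c} {10} {x} (ℕP.*-monoʳ-≤ 2 c≤512) (within 10 (ℕP.≤ᵇ⇒≤ 10 270 tt))))
        where lem : ∀ c z k → k ℕ.* (c ℕ.* z) ≡ c ℕ.* (z ℕ.* k)
              lem = ℕsolve-∀

      -- Here K + M ≤ 18 ζ K and L K = c ζ K, and 15 · 18 = 270 explains the condition on `c`.
      unknowns : 15 ℕ.* (K ℕ.+ M) ℕ.< L ℕ.* K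
      unknowns = ℕP.≤-<-trans (ℕP.≤-trans (ℕP.*-monoʳ-≤ 15 D′) (ℕP.≤-reflexive (sym (ℕP.*-assoc 15 18 x)))) (ℕP.<-≤-trans (ℕP.*-monoˡ-< x ⦃ ℕ.>-nonZero (ℕP.≤-trans (ℕ.s≤s ℕ.z≤n) 270≤x) ⦄ {270} {c} 270<c) (ℕP.≤-reflexive (sym (ℕP.*-assoc c ζ K))))
        where
          lem : ∀ x → x ℕ.+ 8 ℕ.* (2 ℕ.* x ℕ.+ 4) ≡ 17 ℕ.* x ℕ.+ 32
          lem = ℕsolve-∀
          lem′ : ∀ x → 17 ℕ.* x ℕ.+ x ≡ 18 ℕ.* x
          lem′ = ℕsolve-∀
          D′ : K ℕ.+ M ℕ.≤ 18 ℕ.* x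
          D′ = ℕP.≤-trans (ℕP.+-mono-≤ K≤x (ℕP.*-monoʳ-≤ 8 (ℕP.≤-reflexive β≡))) (ℕP.≤-trans (ℕP.≤-reflexive (lem x)) (ℕP.≤-trans (ℕP.+-monoʳ-≤ (17 ℕ.* x) (ℕP.≤-trans (ℕP.≤ᵇ⇒≤ 32 270 tt) 270≤x)) (ℕP.≤-reflexive (lem′ x))))

      g≤ : g ℕ.≤ suc (d ℕ.+ d) ℕ.* (L ℕ.* (h₁ ℕ.* H))
      g≤ = ℕP.≤-trans (ℕP.≤-reflexive (lem d h₁ L H)) (ℕP.≤-trans (ℕP.+-monoʳ-≤ ((d ℕ.+ d) ℕ.* (L ℕ.* (h₁ ℕ.* H))) (ℕP.*-monoʳ-≤ L (ℕP.m≤m*n h₁ H))) (ℕP.≤-reflexive (ℕP.+-comm ((d ℕ.+ d) ℕ.* (L ℕ.* (h₁ ℕ.* H))) _)))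
        where lem : ∀ c h l H → h ℕ.* (c ℕ.* (l ℕ.* H) ℕ.+ l) ℕ.+ H ℕ.* (c ℕ.* (l ℕ.* h)) ≡ (c ℕ.+ c) ℕ.* (l ℕ.* (h ℕ.* H)) ℕ.+ l ℕ.* h
              lem = ℕsolve-∀

      points : L ℕ.* K ℕ.+ K ℕ.≤ I′ ℕ.* J
      points = begin
        L ℕ.* K ℕ.+ K ≡⟨ cong (ℕ._+ K) (ℕP.*-assoc c ζ K) ⟩
        c ℕ.* x ℕ.+ K ≤⟨ ℕP.+-monoʳ-≤ (c ℕ.* x) K≤x ⟩
        c ℕ.* x ℕ.+ x ≡⟨ ℕP.+-comm (c ℕ.* x) x ⟩
        suc c ℕ.* (ζ ℕ.* (c ℕ.* g)) ≤⟨ ℕP.*-monoʳ-≤ (suc c) (ℕP.*-monoʳ-≤ ζ (ℕP.*-monoʳ-≤ c g≤)) ⟩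
        suc c ℕ.* (ζ ℕ.* (c ℕ.* (suc (d ℕ.+ d) ℕ.* (L ℕ.* (h₁ ℕ.* H))))) ≡⟨ lem (suc c) c (suc (d ℕ.+ d)) ζ L (h₁ ℕ.* H) ⟩
        (suc c ℕ.* suc (d ℕ.+ d)) ℕ.* (c ℕ.* ζ ℕ.* L ℕ.* (h₁ ℕ.* H)) ≤⟨ ℕP.*-monoˡ-≤ (c ℕ.* ζ ℕ.* L ℕ.* (h₁ ℕ.* H)) points-const ⟩
        (d ℕ.* d) ℕ.* (L ℕ.* L ℕ.* (h₁ ℕ.* H)) ≡⟨ lem′ d L h₁ H ⟩
        I′ ℕ.* J ∎
        where
          open ℕP.≤-Reasoning
          lem : ∀ a b c z l h → a ℕ.* (z ℕ.* (b ℕ.* (c ℕ.* (l ℕ.* h)))) ≡ (a ℕ.* c) ℕ.* (b ℕ.* z ℕ.* l ℕ.* h)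
          lem = ℕsolve-∀
          lem′ : ∀ c l h H → (c ℕ.* c) ℕ.* (l ℕ.* l ℕ.* (h ℕ.* H)) ≡ (c ℕ.* (l ℕ.* H)) ℕ.* (c ℕ.* (l ℕ.* h))
          lem′ = ℕsolve-∀

      U≥ : 12 ℕ.* β ℕ.≤ U
      U≥ = ℕP.≤-trans chain U-big
        where
          open ℕP.≤-Reasoning
          lem : ∀ x → 12 ℕ.* (2 ℕ.* x ℕ.+ 4) ≡ 24 ℕ.* x ℕ.+ 48
          lem = ℕsolve-∀
          lem′ : ∀ x → 24 ℕ.* x ℕ.+ x ≡ 25 ℕ.* x
          lem′ = ℕsolve-∀
          lem″ : ∀ a b c z h → a ℕ.* (z ℕ.* (b ℕ.* (c ℕ.* (b ℕ.* z ℕ.* h)))) ≡ (a ℕ.* (b ℕ.* b) ℕ.* c) ℕ.* (z ℕ.* z ℕ.* h)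
          lem″ = ℕsolve-∀
          chain : 12 ℕ.* β ℕ.≤ C ℕ.* (ζ ℕ.* ζ ℕ.* (h₁ ℕ.* H))
          chain = begin
            12 ℕ.* β ≡⟨ cong (12 ℕ.*_) β≡ ⟩
            12 ℕ.* (2 ℕ.* x ℕ.+ 4) ≡⟨ lem x ⟩
            24 ℕ.* x ℕ.+ 48 ≤⟨ ℕP.+-monoʳ-≤ (24 ℕ.* x) (ℕP.≤-trans (ℕP.≤ᵇ⇒≤ 48 270 tt) 270≤x) ⟩
            24 ℕ.* x ℕ.+ x ≡⟨ lem′ x ⟩
            25 ℕ.* (ζ ℕ.* (c ℕ.* g)) ≤⟨ ℕP.*-monoʳ-≤ 25 (ℕP.*-monoʳ-≤ ζ (ℕP.*-monoʳ-≤ c g≤)) ⟩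
            25 ℕ.* (ζ ℕ.* (c ℕ.* (suc (d ℕ.+ d) ℕ.* (c ℕ.* ζ ℕ.* (h₁ ℕ.* H))))) ≡⟨ lem″ 25 c (suc (d ℕ.+ d)) ζ (h₁ ℕ.* H) ⟩
            (25 ℕ.* (c ℕ.* c) ℕ.* suc (d ℕ.+ d)) ℕ.* (ζ ℕ.* ζ ℕ.* (h₁ ℕ.* H)) ≤⟨ ℕP.*-monoˡ-≤ (ζ ℕ.* ζ ℕ.* (h₁ ℕ.* H)) U-const ⟩
            C ℕ.* (ζ ℕ.* ζ ℕ.* (h₁ ℕ.* H)) ∎

      I≤r : I ℕ.≤ r
      I≤r = ℕP.≤-trans chain r-big
        where
          open ℕP.≤-Reasoning
          lem : ∀ c d z h → d ℕ.* (c ℕ.* z ℕ.* h) ≡ (d ℕ.* c) ℕ.* (z ℕ.* h)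
          lem = ℕsolve-∀
          chain : I ℕ.≤ (suc d ℕ.* c) ℕ.* (ζ ℕ.* H)
          chain = begin
            d ℕ.* (L ℕ.* H) ℕ.+ L ≤⟨ ℕP.+-monoʳ-≤ (d ℕ.* (L ℕ.* H)) (ℕP.m≤m*n L H) ⟩
            d ℕ.* (L ℕ.* H) ℕ.+ L ℕ.* H ≡⟨ ℕP.+-comm (d ℕ.* (L ℕ.* H)) (L ℕ.* H) ⟩
            suc d ℕ.* (L ℕ.* H) ≡⟨ lem c (suc d) ζ H ⟩
            (suc d ℕ.* c) ℕ.* (ζ ℕ.* H) ∎

      Z≤ : I ℕ.+ r ℕ.* J ℕ.≤ 2 ℕ.^ ζ
      Z≤ = ℕP.≤-trans (ℕP.+-monoˡ-≤ (r ℕ.* J) I≤r) (ℕP.≤-trans (ℕP.≤-reflexive (lem d c ζ h₁ r)) r-small)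
        where lem : ∀ c d z h r → r ℕ.+ r ℕ.* (c ℕ.* (d ℕ.* z ℕ.* h)) ≡ r ℕ.* (1 ℕ.+ (c ℕ.* d) ℕ.* (z ℕ.* h))
              lem = ℕsolve-∀

    parameters : Parameters
    parameters = record { h₁ = h₁ ; h₂ = h₂ ; r = r ; ζ = ζ ; L = L ; K = K ; I′ = I′ ; J = J ; M = M ; β = β ; U = U
      ; I≤r = I≤r ; Z≤ = Z≤ ; β≥ = ℕP.≤-refl ; N≤ = N≤ ; D≤ = D≤ ; JL≤ = JL≤ ; M≥ = ℕP.≤-refl ; unknowns = unknowns ; points = points ; U≥ = U≥ }

  -- c = 400 exceeds 270, and d = 1000 satisfies (c + 1)(2d + 1) ≤ d². The other constants are
  -- 400400 = (d + 1) c, 400000 = d c, and 2³³ as a power of 2 above 25 c² (2d + 1).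
  choose : ∀ h₁ h₂ r ζ U → 1 ℕ.≤ h₁ → 1 ℕ.≤ ζ → 2 ℕ.^ 33 ℕ.* (ζ ℕ.* ζ ℕ.* (h₁ ℕ.* suc h₂)) ℕ.≤ U →
    400400 ℕ.* (ζ ℕ.* suc h₂) ℕ.≤ r → r ℕ.* (1 ℕ.+ 400000 ℕ.* (ζ ℕ.* h₁)) ℕ.≤ 2 ℕ.^ ζ → Parameters
  choose = Choice.parameters 400 1000 (2 ℕ.^ 33) (ℕP.<ᵇ⇒< 270 400 tt) (ℕP.≤ᵇ⇒≤ 400 512 tt) (ℕP.≤ᵇ⇒≤ (401 ℕ.* 2001) 1000000 tt) (ℕP.≤ᵇ⇒≤ (25 ℕ.* 160000 ℕ.* 2001) (2 ℕ.^ 33) tt)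

-- Dirichlet's theorem and the passage from three logarithms to two

module ThreeLogEstimate (F : NarayanaField) where

  open import Data.Integer using (+_; -[1+_]; ∣_∣)
  open import Data.Fin as Fin using (Fin; zero; suc; toℕ; fromℕ<)
  import Data.Fin.Properties as FinP
  open NarayanaField F using (α; α-root; orderedField)
  open OrderedFieldTheory orderedField
  open NormForm
  open Integrality F
  open TwoLogEstimate F

  m*n≤o⇒m≤o/n : ∀ m n o .⦃ _ : ℕ.NonZero n ⦄ → m ℕ.* n ℕ.≤ o → m ℕ.≤ o ℕ./ n
  m*n≤o⇒m≤o/n m n o p = ℕP.≤-trans (ℕP.≤-reflexive (sym (DM.m*n/n≡m m n))) (DM./-monoˡ-≤ n p)

  private
    gap : ∀ n X u v .⦃ _ : ℕ.NonZero n ⦄ → u ℕ.≤ v → (u ℕ.* X) ℕ./ n ≡ (v ℕ.* X) ℕ./ n → (v ℕ.∸ u) ℕ.* X ℕ.≤ n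
    gap n X u v u≤v e = begin
      (v ℕ.∸ u) ℕ.* X ≡⟨ ℕP.*-distribʳ-∸ X v u ⟩
      v ℕ.* X ℕ.∸ u ℕ.* X ≤⟨ ℕP.∸-monoʳ-≤ (v ℕ.* X) (DM.m/n*n≤m (u ℕ.* X) n) ⟩
      v ℕ.* X ℕ.∸ (u ℕ.* X) ℕ./ n ℕ.* n ≡⟨ cong (λ k → v ℕ.* X ℕ.∸ k ℕ.* n) e ⟩
      v ℕ.* X ℕ.∸ (v ℕ.* X) ℕ./ n ℕ.* n ≡⟨ sym (DM.m%n≡m∸m/n*n (v ℕ.* X) n) ⟩
      (v ℕ.* X) ℕ.% n ≤⟨ ℕP.<⇒≤ (DM.m%n<n (v ℕ.* X) n) ⟩
      n ∎
      where open ℕP.≤-Reasoning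

  record Approximation (n ℓ X : ℕ) : Set where
    field
      s t δ : ℕ
      1≤s : 1 ℕ.≤ s
      s≤X : s ℕ.≤ X
      δX≤n : δ ℕ.* X ℕ.≤ n
      near : s ℕ.* ℓ ≡ n ℕ.* t ℕ.+ δ ⊎ n ℕ.* t ≡ s ℕ.* ℓ ℕ.+ δ

  -- Pigeonhole for the residues of iℓ modulo n, with X + 1 values of i and X classes of length n /
  -- X.
  dirichlet : ∀ n ℓ X → 1 ℕ.≤ n → 1 ℕ.≤ X → Approximation n ℓ X
  dirichlet n@(suc _) ℓ X _ 1≤X = conclude (FinP.pigeonhole (ℕP.n<1+n X) class)
    where
      res quo : ℕ → ℕ
      res i = (i ℕ.* ℓ) ℕ.% n
      quo i = (i ℕ.* ℓ) ℕ./ n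
      class< : ∀ i → (res i ℕ.* X) ℕ./ n ℕ.< X
      class< i = DM.m<n*o⇒m/o<n (ℕP.<-≤-trans (ℕP.*-monoˡ-< X ⦃ ℕ.>-nonZero 1≤X ⦄ (DM.m%n<n (i ℕ.* ℓ) n)) (ℕP.≤-reflexive (ℕP.*-comm n X)))
      class : Fin (suc X) → Fin X
      class i = fromℕ< (class< (toℕ i))
      conclude : ∃₂ (λ i j → i Fin.< j × class i ≡ class j) → Approximation n ℓ X
      conclude (i , j , i<j , e) = pick (ℕP.≤-total (res a) (res b))
        where
          a = toℕ i
          b = toℕ j
          s = b ℕ.∸ a
          t = quo b ℕ.∸ quo a
          same : (res a ℕ.* X) ℕ./ n ≡ (res b ℕ.* X) ℕ./ n
          same = trans (sym (FinP.toℕ-fromℕ< (class< a))) (trans (cong toℕ e) (FinP.toℕ-fromℕ< (class< b)))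
          quo≤ : quo a ℕ.≤ quo b
          quo≤ = DM./-monoˡ-≤ n (ℕP.*-monoˡ-≤ ℓ (ℕP.<⇒≤ i<j))
          balance : s ℕ.* ℓ ℕ.+ res a ≡ n ℕ.* t ℕ.+ res b
          balance = ℕP.+-cancelʳ-≡ (quo a ℕ.* n) _ _ (begin
            s ℕ.* ℓ ℕ.+ res a ℕ.+ quo a ℕ.* n ≡⟨ ℕP.+-assoc (s ℕ.* ℓ) (res a) _ ⟩
            s ℕ.* ℓ ℕ.+ (res a ℕ.+ quo a ℕ.* n) ≡⟨ cong (s ℕ.* ℓ ℕ.+_) (sym (DM.m≡m%n+[m/n]*n (a ℕ.* ℓ) n)) ⟩
            s ℕ.* ℓ ℕ.+ a ℕ.* ℓ ≡⟨ sym (ℕP.*-distribʳ-+ ℓ s a) ⟩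
            (s ℕ.+ a) ℕ.* ℓ ≡⟨ cong (ℕ._* ℓ) (ℕP.m∸n+n≡m (ℕP.<⇒≤ i<j)) ⟩
            b ℕ.* ℓ ≡⟨ DM.m≡m%n+[m/n]*n (b ℕ.* ℓ) n ⟩
            res b ℕ.+ quo b ℕ.* n ≡⟨ cong (λ q → res b ℕ.+ q ℕ.* n) (sym (ℕP.m∸n+n≡m quo≤)) ⟩
            res b ℕ.+ (t ℕ.+ quo a) ℕ.* n ≡⟨ lem (res b) t (quo a) n ⟩
            n ℕ.* t ℕ.+ res b ℕ.+ quo a ℕ.* n ∎)
            where
              open ≡-Reasoning
              lem : ∀ r t q n → r ℕ.+ (t ℕ.+ q) ℕ.* n ≡ n ℕ.* t ℕ.+ r ℕ.+ q ℕ.* n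
              lem = ℕsolve-∀
          pick : res a ℕ.≤ res b ⊎ res b ℕ.≤ res a → Approximation n ℓ X
          pick (inj₁ le) = record { s = s ; t = t ; δ = res b ℕ.∸ res a ; 1≤s = ℕP.m<n⇒0<n∸m i<j
            ; s≤X = ℕP.≤-trans (ℕP.m∸n≤m b a) (ℕP.≤-pred (FinP.toℕ<n j)) ; δX≤n = gap n X (res a) (res b) le same
            ; near = inj₁ (ℕP.+-cancelʳ-≡ (res a) _ _ (trans balance (trans (cong (n ℕ.* t ℕ.+_) (sym (ℕP.m∸n+n≡m le))) (sym (ℕP.+-assoc (n ℕ.* t) _ _))))) }
          pick (inj₂ le) = record { s = s ; t = t ; δ = res a ℕ.∸ res b ; 1≤s = ℕP.m<n⇒0<n∸m i<j
            ; s≤X = ℕP.≤-trans (ℕP.m∸n≤m b a) (ℕP.≤-pred (FinP.toℕ<n j)) ; δX≤n = gap n X (res b) (res a) le (sym same)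
            ; near = inj₂ (ℕP.+-cancelʳ-≡ (res b) _ _ (trans (sym balance) (trans (cong (s ℕ.* ℓ ℕ.+_) (sym (ℕP.m∸n+n≡m le))) (sym (ℕP.+-assoc (s ℕ.* ℓ) _ _))))) }

  -- Multiplication by α sends natural coordinates to natural coordinates and never makes both upper
  -- ones vanish, so no positive power of α is an integer.
  α-power : ∀ s → ∃ λ u → ∃ λ v → ∃ λ w → α ^ suc s ≡ embed (+ u) (+ v) (+ w) × 1 ℕ.≤ v ℕ.+ w
  α-power zero = 0 , 1 , 0 , solve 1 (λ a → a :* # 1 := # 0 :+ # 1 :* a :+ # 0 :* (a :* a)) refl α , ℕP.≤-refl
  α-power (suc s) with α-power s
  ... | u , v , w , e , p = w , u , v ℕ.+ w ,
    trans (cong (λ z → α * z) e) (trans (solve 4 (λ u v w a → a :* (u :+ v :* a :+ w :* (a :* a)) := (u :* a :+ v :* (a :* a)) :+ w :* (a :* a :* a)) refl (fromℕ u) (fromℕ v) (fromℕ w) α)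
      (trans (cong (λ z → (fromℕ u * α + fromℕ v * (α * α)) + fromℕ w * z) α-root)
      (trans (solve 4 (λ u v w a → (u :* a :+ v :* (a :* a)) :+ w :* (a :* a :+ # 1) := w :+ u :* a :+ (v :+ w) :* (a :* a)) refl (fromℕ u) (fromℕ v) (fromℕ w) α)
        (cong (λ z → fromℕ w + fromℕ u * α + z * (α * α)) (sym (fromℕ-+ v w)))))) ,
    ℕP.≤-trans p (ℕP.m≤n+m (v ℕ.+ w) u)

  embed-zero : ∀ a b c → embed a b c ≡ 0# → size a b c ≡ 0
  embed-zero a b c e = norm-anisotropic (size a b c) a b c ℕP.≤-refl (ι-zero (norm a b c) (trans (sym (Norm.adj-product a b c)) (trans (cong (_* embed (Norm.adj₀ a b c) (Norm.adj₁ a b c) (Norm.adj₂ a b c)) e) (zeroˡ _))))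
    where
      ι-zero : ∀ z → ι z ≡ 0# → z ≡ + 0
      ι-zero (+ zero) _ = refl
      ι-zero (+ suc n) e = ⊥-elim (Pos⇒≢0 (Pos-suc n) e)
      ι-zero -[1+ n ] e = ⊥-elim (Pos⇒≢0 (Pos-suc n) (trans (solve 1 (λ x → x := :- (:- x)) refl (fromℕ (suc n))) (trans (cong -_ e) (solve 0 (:- # 0 := # 0) refl))))

  α-power-irrational : ∀ s m → 1 ℕ.≤ s → α ^ s ≢ fromℕ m
  α-power-irrational (suc s) m _ e = finish (α-power s)
    where
      finish : (∃ λ u → ∃ λ v → ∃ λ w → α ^ suc s ≡ embed (+ u) (+ v) (+ w) × 1 ℕ.≤ v ℕ.+ w) → ⊥
      finish (u , v , w , eq , p) = ℕP.<⇒≢ p (sym (cong₂ ℕ._+_ (ℕP.m+n≡0⇒n≡0 ∣ + u ℤ.- + m ∣ (ℕP.m+n≡0⇒m≡0 _ z)) (ℕP.m+n≡0⇒n≡0 (∣ + u ℤ.- + m ∣ ℕ.+ v) z)))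
        where
          z : ∣ + u ℤ.- + m ∣ ℕ.+ v ℕ.+ w ≡ 0
          z = embed-zero (+ u ℤ.- + m) (+ v) (+ w) (trans (cong (λ q → q + fromℕ v * α + fromℕ w * (α * α)) (trans (ι-+ (+ u) (ℤ.- + m)) (cong (λ q → fromℕ u + q) (ι-neg (+ m)))))
            (trans (solve 5 (λ u m v w a → (u :- m) :+ v :* a :+ w :* (a :* a) := (u :+ v :* a :+ w :* (a :* a)) :- m) refl (fromℕ u) (fromℕ m) (fromℕ v) (fromℕ w) α)
              (trans (cong (_- fromℕ m) (trans (sym eq) e)) (-‿inverseʳ _))))

  half : ∀ {A B} U → P (suc U) * (A - B) ∈± B → B ≤ two * A
  half {A} {B} U q = ≤-by (solve 2 (λ A B → B :+ # 2 :* (A :- B) := # 2 :* A :- B) refl A B)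
    (±lower (±-shrink (nn-fromℕ 2) (≤-trans (≤-reflexive (sym (*-identityʳ two))) (P-mono {1} {suc U} (ℕ.s≤s ℕ.z≤n))) q))

  -- The two-logarithm estimate as a type with its constants as parameters, so that what follows
  -- never computes with them.
  TwoLog : ℕ → ℕ → ℕ → Set
  TwoLog C a d = ∀ h₁ h₂ r ζ U μ ν G₀ G₁ → 1 ℕ.≤ h₁ → 1 ℕ.≤ ζ → C ℕ.* (ζ ℕ.* ζ ℕ.* (h₁ ℕ.* suc h₂)) ℕ.≤ U →
    a ℕ.* (ζ ℕ.* suc h₂) ℕ.≤ r → r ℕ.* (1 ℕ.+ d ℕ.* (ζ ℕ.* h₁)) ℕ.≤ 2 ℕ.^ ζ →
    1# ≤ ν → ν < μ → 1# ≤ G₀ → 1# ≤ G₁ →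
    IsInt μ (2 ℕ.^ h₁) → IsInt ν (2 ℕ.^ h₁) → IsInt G₀ (2 ℕ.^ h₂) → IsInt G₁ (2 ℕ.^ h₂) →
    P U * (G₀ * μ ^ r - G₁ * ν ^ r) ∈± G₁ * ν ^ r → ⊥

  -- A bound for h₁ (h₂ + 1), the product of heights after the reduction: from the given height H,
  -- from powers with exponents of order s ≤ X, and from the defect δ of the approximation.
  cost : ℕ → ℕ → ℕ → ℕ
  cost X H Δ = 3 ℕ.* (X ℕ.* H) ℕ.+ 15 ℕ.* (X ℕ.* X) ℕ.+ 21 ℕ.* Δ

  -- Writing n = n₀ + s r and ℓ = r t + ℓ⁺ - ℓ⁻ turns both sides, up to a common power of b, into
  -- r-th powers of μ = α^s and ν = b^t. The leftover exponents are short by the choice of s and t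
  -- and are absorbed in G₀ and G₁.
  module ThreeLogarithms (C a d : ℕ) (two-log : TwoLog C a d)
    (b n ℓ X H U ζ Δ : ℕ) (2≤b : 2 ℕ.≤ b) (b≤ : b ℕ.≤ 2 ℕ.^ 7) (7≤X : 7 ℕ.≤ X) (H<n : H ℕ.< n) (1≤ζ : 1 ℕ.≤ ζ)
    (Δ-bound : ∀ δ → δ ℕ.* X ℕ.≤ n → δ ℕ.≤ Δ)
    (U-big : C ℕ.* (ζ ℕ.* ζ ℕ.* cost X H Δ) ℕ.≤ U)
    (n-big : a ℕ.* (ζ ℕ.* cost X H Δ) ℕ.≤ n)
    (n-small : n ℕ.* (1 ℕ.+ d ℕ.* (ζ ℕ.* 3)) ℕ.≤ 2 ℕ.^ ζ)
    (g₀ g₁ : Carrier) (1≤g₀ : 1# ≤ g₀) (1≤g₁ : 1# ≤ g₁) (intg₀ : IsInt g₀ (2 ℕ.^ H)) (intg₁ : IsInt g₁ (2 ℕ.^ H))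
    (close : P (suc U) * (g₀ * α ^ n - g₁ * fromℕ b ^ ℓ) ∈± g₁ * fromℕ b ^ ℓ) where

    E : ℕ
    E = cost X H Δ

    1≤n : 1 ℕ.≤ n
    1≤n = ℕP.≤-trans (ℕ.s≤s ℕ.z≤n) H<n

    approximation = dirichlet n ℓ X 1≤n (ℕP.≤-trans (ℕ.s≤s ℕ.z≤n) 7≤X)
    open Approximation approximation

    instance
      s≢0 : ℕ.NonZero s
      s≢0 = ℕ.>-nonZero 1≤s

    B = fromℕ b
    r = n ℕ./ s
    n₀ = n ℕ.% s
    w = δ ℕ./ s
    ℓ⁺ = ℓ ℕ.∸ r ℕ.* t
    ℓ⁻ = r ℕ.* t ℕ.∸ ℓ
    h₁ = 3 ℕ.* s
    h₂ = H ℕ.+ (s ℕ.+ (3 ℕ.* s ℕ.+ 7 ℕ.* w))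

    1≤B : 1# ≤ B
    1≤B = fromℕ-mono-≤ {1} {b} (ℕP.≤-trans (ℕ.s≤s ℕ.z≤n) 2≤b)

    1≤α = <⇒≤ α>1

    n≡ : n ≡ n₀ ℕ.+ s ℕ.* r
    n≡ = trans (DM.m≡m%n+[m/n]*n n s) (cong (n₀ ℕ.+_) (ℕP.*-comm r s))

    n₀≤s : n₀ ℕ.≤ s
    n₀≤s = ℕP.<⇒≤ (DM.m%n<n n s)

    -- b^ℓ ≤ 2 g₀ αⁿ
    bˡ≤ : b ℕ.^ ℓ ℕ.≤ 2 ℕ.^ (suc H ℕ.+ n)
    bˡ≤ = fromℕ-cancel-≤ (≤-trans (≤-reflexive (fromℕ-^ b ℓ)) (≤-trans (≤-trans (≤-reflexive (sym (*-identityˡ _))) (*-monoʳ-≤ (inj₁ (Pos-^ ℓ (1≤⇒Pos 1≤B))) 1≤g₁))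
      (≤-trans (half U close) (≤-trans (*-monoˡ-≤ (nn-fromℕ 2) (*-mono-≤ (inj₁ (1≤⇒Pos 1≤g₀)) (≤-trans (±upper (IsInt-∈± intg₀)) (≤-reflexive (fromℕ-2^ H))) (P-nn n) (^-mono-≤ n α-nn (<⇒≤ α<2))))
        (≤-reflexive (trans (cong (λ z → two * z) (sym (^-+ two H n))) (sym (fromℕ-2^ (suc H ℕ.+ n)))))))))

    7δ≤n : 7 ℕ.* δ ℕ.≤ n
    7δ≤n = ℕP.≤-trans (ℕP.≤-trans (ℕP.≤-reflexive (ℕP.*-comm 7 δ)) (ℕP.*-monoʳ-≤ δ 7≤X)) δX≤n

    nt≤ : n ℕ.* t ℕ.≤ s ℕ.* ℓ ℕ.+ δ
    nt≤ with near
    ... | inj₁ e = ℕP.≤-trans (ℕP.m≤m+n _ (δ ℕ.+ δ)) (ℕP.≤-reflexive (trans (sym (ℕP.+-assoc (n ℕ.* t) δ δ)) (cong (ℕ._+ δ) (sym e))))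
    ... | inj₂ e = ℕP.≤-reflexive e

    sℓ≤ : s ℕ.* ℓ ℕ.≤ n ℕ.* t ℕ.+ δ
    sℓ≤ with near
    ... | inj₁ e = ℕP.≤-reflexive e
    ... | inj₂ e = ℕP.≤-trans (ℕP.m≤m+n _ (δ ℕ.+ δ)) (ℕP.≤-reflexive (trans (sym (ℕP.+-assoc (s ℕ.* ℓ) δ δ)) (cong (ℕ._+ δ) (sym e))))

    1≤b : 1 ℕ.≤ b
    1≤b = ℕP.≤-trans (ℕ.s≤s ℕ.z≤n) 2≤b

    b^-mono : ∀ {i j} → i ℕ.≤ j → b ℕ.^ i ℕ.≤ b ℕ.^ j
    b^-mono p = ℕP.^-monoʳ-≤ b ⦃ ℕ.>-nonZero 1≤b ⦄ p

    b^≤ : ∀ i → b ℕ.^ i ℕ.≤ 2 ℕ.^ (7 ℕ.* i)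
    b^≤ i = ℕP.≤-trans (ℕP.^-monoˡ-≤ i b≤) (ℕP.≤-reflexive (ℕP.^-*-assoc 2 7 i))

    -- Compare n-th powers: t n is at most s ℓ + δ, and b^ℓ ≤ 2^(H + 1 + n). The three terms, from
    -- n, from H < n and from 7δ ≤ n, each contribute at most s n bits.
    bᵗ≤ : b ℕ.^ t ℕ.≤ 2 ℕ.^ h₁
    bᵗ≤ = ℕP.≮⇒≥ λ lt → ℕP.<⇒≱ (ℕP.^-monoˡ-< n ⦃ ℕ.>-nonZero 1≤n ⦄ lt) powered
      where
        open ℕP.≤-Reasoning
        lem : ∀ n s → (n ℕ.+ n) ℕ.* s ℕ.+ n ℕ.* s ≡ 3 ℕ.* s ℕ.* n
        lem = ℕsolve-∀
        powered : (b ℕ.^ t) ℕ.^ n ℕ.≤ (2 ℕ.^ h₁) ℕ.^ n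
        powered = begin
          (b ℕ.^ t) ℕ.^ n ≡⟨ ℕP.^-*-assoc b t n ⟩
          b ℕ.^ (t ℕ.* n) ≤⟨ b^-mono (ℕP.≤-trans (ℕP.≤-reflexive (ℕP.*-comm t n)) nt≤) ⟩
          b ℕ.^ (s ℕ.* ℓ ℕ.+ δ) ≡⟨ ℕP.^-distribˡ-+-* b (s ℕ.* ℓ) δ ⟩
          b ℕ.^ (s ℕ.* ℓ) ℕ.* b ℕ.^ δ ≡⟨ cong (λ k → b ℕ.^ k ℕ.* b ℕ.^ δ) (ℕP.*-comm s ℓ) ⟩
          b ℕ.^ (ℓ ℕ.* s) ℕ.* b ℕ.^ δ ≡⟨ cong (ℕ._* b ℕ.^ δ) (sym (ℕP.^-*-assoc b ℓ s)) ⟩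
          (b ℕ.^ ℓ) ℕ.^ s ℕ.* b ℕ.^ δ ≤⟨ ℕP.*-mono-≤ (ℕP.^-monoˡ-≤ s bˡ≤) (b^≤ δ) ⟩
          (2 ℕ.^ (suc H ℕ.+ n)) ℕ.^ s ℕ.* 2 ℕ.^ (7 ℕ.* δ) ≡⟨ cong (ℕ._* 2 ℕ.^ (7 ℕ.* δ)) (ℕP.^-*-assoc 2 (suc H ℕ.+ n) s) ⟩
          2 ℕ.^ ((suc H ℕ.+ n) ℕ.* s) ℕ.* 2 ℕ.^ (7 ℕ.* δ) ≡⟨ sym (ℕP.^-distribˡ-+-* 2 ((suc H ℕ.+ n) ℕ.* s) (7 ℕ.* δ)) ⟩
          2 ℕ.^ ((suc H ℕ.+ n) ℕ.* s ℕ.+ 7 ℕ.* δ) ≤⟨ ℕP.^-monoʳ-≤ 2 (ℕP.+-mono-≤ (ℕP.*-monoˡ-≤ s (ℕP.+-monoˡ-≤ n H<n)) (ℕP.≤-trans 7δ≤n (ℕP.m≤m*n n s))) ⟩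
          2 ℕ.^ ((n ℕ.+ n) ℕ.* s ℕ.+ n ℕ.* s) ≡⟨ cong (2 ℕ.^_) (lem n s) ⟩
          2 ℕ.^ (3 ℕ.* s ℕ.* n) ≡⟨ sym (ℕP.^-*-assoc 2 h₁ n) ⟩
          (2 ℕ.^ h₁) ℕ.^ n ∎

    -- Multiplied by s, the excess of ℓ over r t is at most n₀ t + δ, and n₀ ≤ s.
    ℓ⁺≤ : ℓ⁺ ℕ.≤ t ℕ.+ w
    ℓ⁺≤ = ℕP.≤-trans (ℕP.m≤n+m∸n ℓ⁺ t) (ℕP.+-monoʳ-≤ t (m*n≤o⇒m≤o/n (ℓ⁺ ℕ.∸ t) s δ chain))
      where
        open ℕP.≤-Reasoning
        lem : ∀ n₀ s r t δ → (n₀ ℕ.+ s ℕ.* r) ℕ.* t ℕ.+ δ ≡ n₀ ℕ.* t ℕ.+ (δ ℕ.+ s ℕ.* (r ℕ.* t))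
        lem = ℕsolve-∀
        lem′ : ∀ s r t δ → s ℕ.* t ℕ.+ (δ ℕ.+ s ℕ.* (r ℕ.* t)) ≡ δ ℕ.+ s ℕ.* (r ℕ.* t ℕ.+ t)
        lem′ = ℕsolve-∀
        chain : (ℓ⁺ ℕ.∸ t) ℕ.* s ℕ.≤ δ
        chain = begin
          (ℓ⁺ ℕ.∸ t) ℕ.* s ≡⟨ ℕP.*-comm (ℓ⁺ ℕ.∸ t) s ⟩
          s ℕ.* (ℓ⁺ ℕ.∸ t) ≡⟨ cong (s ℕ.*_) (ℕP.∸-+-assoc ℓ (r ℕ.* t) t) ⟩
          s ℕ.* (ℓ ℕ.∸ (r ℕ.* t ℕ.+ t)) ≡⟨ ℕP.*-distribˡ-∸ s ℓ (r ℕ.* t ℕ.+ t) ⟩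
          s ℕ.* ℓ ℕ.∸ s ℕ.* (r ℕ.* t ℕ.+ t) ≤⟨ ℕP.∸-monoˡ-≤ (s ℕ.* (r ℕ.* t ℕ.+ t)) sℓ≤ ⟩
          n ℕ.* t ℕ.+ δ ℕ.∸ s ℕ.* (r ℕ.* t ℕ.+ t) ≡⟨ cong (λ k → k ℕ.* t ℕ.+ δ ℕ.∸ s ℕ.* (r ℕ.* t ℕ.+ t)) n≡ ⟩
          (n₀ ℕ.+ s ℕ.* r) ℕ.* t ℕ.+ δ ℕ.∸ s ℕ.* (r ℕ.* t ℕ.+ t) ≡⟨ cong (ℕ._∸ s ℕ.* (r ℕ.* t ℕ.+ t)) (lem n₀ s r t δ) ⟩
          n₀ ℕ.* t ℕ.+ (δ ℕ.+ s ℕ.* (r ℕ.* t)) ℕ.∸ s ℕ.* (r ℕ.* t ℕ.+ t) ≤⟨ ℕP.∸-monoˡ-≤ (s ℕ.* (r ℕ.* t ℕ.+ t)) (ℕP.+-monoˡ-≤ (δ ℕ.+ s ℕ.* (r ℕ.* t)) (ℕP.*-monoˡ-≤ t n₀≤s)) ⟩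
          s ℕ.* t ℕ.+ (δ ℕ.+ s ℕ.* (r ℕ.* t)) ℕ.∸ s ℕ.* (r ℕ.* t ℕ.+ t) ≡⟨ cong (ℕ._∸ s ℕ.* (r ℕ.* t ℕ.+ t)) (lem′ s r t δ) ⟩
          δ ℕ.+ s ℕ.* (r ℕ.* t ℕ.+ t) ℕ.∸ s ℕ.* (r ℕ.* t ℕ.+ t) ≡⟨ ℕP.m+n∸n≡m δ (s ℕ.* (r ℕ.* t ℕ.+ t)) ⟩
          δ ∎

    ℓ⁻≤ : ℓ⁻ ℕ.≤ t ℕ.+ w
    ℓ⁻≤ = ℕP.≤-trans (m*n≤o⇒m≤o/n ℓ⁻ s δ chain) (ℕP.m≤n+m w t)
      where
        open ℕP.≤-Reasoning
        lem : ∀ s r t → s ℕ.* (r ℕ.* t) ≡ s ℕ.* r ℕ.* t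
        lem = ℕsolve-∀
        chain : ℓ⁻ ℕ.* s ℕ.≤ δ
        chain = begin
          ℓ⁻ ℕ.* s ≡⟨ ℕP.*-comm ℓ⁻ s ⟩
          s ℕ.* ℓ⁻ ≡⟨ ℕP.*-distribˡ-∸ s (r ℕ.* t) ℓ ⟩
          s ℕ.* (r ℕ.* t) ℕ.∸ s ℕ.* ℓ ≡⟨ cong (ℕ._∸ s ℕ.* ℓ) (lem s r t) ⟩
          s ℕ.* r ℕ.* t ℕ.∸ s ℕ.* ℓ ≤⟨ ℕP.∸-monoˡ-≤ (s ℕ.* ℓ) (ℕP.*-monoˡ-≤ t (ℕP.≤-trans (ℕP.m≤n+m (s ℕ.* r) n₀) (ℕP.≤-reflexive (sym n≡)))) ⟩
          n ℕ.* t ℕ.∸ s ℕ.* ℓ ≤⟨ ℕP.∸-monoˡ-≤ (s ℕ.* ℓ) nt≤ ⟩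
          s ℕ.* ℓ ℕ.+ δ ℕ.∸ s ℕ.* ℓ ≡⟨ ℕP.m+n∸m≡n (s ℕ.* ℓ) δ ⟩
          δ ∎

    b-small : ∀ {i} → i ℕ.≤ t ℕ.+ w → b ℕ.^ i ℕ.≤ 2 ℕ.^ (3 ℕ.* s ℕ.+ 7 ℕ.* w)
    b-small {i} p = ℕP.≤-trans (b^-mono p) (ℕP.≤-trans (ℕP.≤-reflexive (ℕP.^-distribˡ-+-* b t w)) (ℕP.≤-trans (ℕP.*-mono-≤ bᵗ≤ (b^≤ w)) (ℕP.≤-reflexive (sym (ℕP.^-distribˡ-+-* 2 h₁ (7 ℕ.* w))))))

    μ ν G₀ G₁ : Carrier
    μ = α ^ s
    ν = B ^ t
    G₀ = g₀ * (α ^ n₀ * B ^ ℓ⁻)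
    G₁ = g₁ * (1# * B ^ ℓ⁺)

    1≤* : ∀ {x y} → 1# ≤ x → 1# ≤ y → 1# ≤ x * y
    1≤* p q = ≤-trans (≤-reflexive (sym (*-identityˡ 1#))) (*-mono-≤ nn-1 p (inj₁ (1≤⇒Pos q)) q)

    1≤G₀ : 1# ≤ G₀
    1≤G₀ = 1≤* 1≤g₀ (1≤* (1≤^ n₀ 1≤α) (1≤^ ℓ⁻ 1≤B))
    1≤G₁ : 1# ≤ G₁
    1≤G₁ = 1≤* 1≤g₁ (1≤* ≤-refl (1≤^ ℓ⁺ 1≤B))

    intB : ∀ {i j} → b ℕ.^ i ℕ.≤ 2 ℕ.^ j → IsInt (B ^ i) (2 ℕ.^ j)
    intB {i} p = IsInt-≡ (fromℕ-^ b i) (IsInt-weaken p (IsInt-ℕ (b ℕ.^ i)))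

    intG : ∀ {g x i} → IsInt g (2 ℕ.^ H) → IsInt x (2 ℕ.^ s) → i ℕ.≤ t ℕ.+ w → IsInt (g * (x * B ^ i)) (2 ℕ.^ h₂)
    intG {i = i} ig ix p = IsInt-weaken (ℕP.≤-reflexive (trans (cong (2 ℕ.^ H ℕ.*_) (sym (ℕP.^-distribˡ-+-* 2 s (3 ℕ.* s ℕ.+ 7 ℕ.* w)))) (sym (ℕP.^-distribˡ-+-* 2 H (s ℕ.+ (3 ℕ.* s ℕ.+ 7 ℕ.* w))))))
      (IsInt-* ig (IsInt-* ix (intB {i} {3 ℕ.* s ℕ.+ 7 ℕ.* w} (b-small p))))

    intμ : IsInt μ (2 ℕ.^ h₁)
    intμ = IsInt-weaken (ℕP.^-monoʳ-≤ 2 (ℕP.m≤n*m s 3)) (IsInt-^ s IsInt-α)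

    ℓ-balance : ℓ ℕ.+ ℓ⁻ ≡ ℓ⁺ ℕ.+ t ℕ.* r
    ℓ-balance with ℕP.≤-total ℓ (r ℕ.* t)
    ... | inj₁ p = trans (ℕP.m+[n∸m]≡n p) (trans (ℕP.*-comm r t) (cong (ℕ._+ t ℕ.* r) (sym (ℕP.m≤n⇒m∸n≡0 p))))
    ... | inj₂ p = trans (cong (ℓ ℕ.+_) (ℕP.m≤n⇒m∸n≡0 p)) (trans (ℕP.+-identityʳ ℓ) (trans (sym (ℕP.m∸n+n≡m p)) (cong (ℓ⁺ ℕ.+_) (ℕP.*-comm r t))))

    left : G₀ * μ ^ r ≡ B ^ ℓ⁻ * (g₀ * α ^ n)
    left = trans (cong (λ z → G₀ * z) (sym (^-* α s r))) (trans (solve 4 (λ g a b c → g :* (a :* b) :* c := b :* (g :* (a :* c))) refl g₀ (α ^ n₀) (B ^ ℓ⁻) (α ^ (s ℕ.* r)))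
      (cong (λ z → B ^ ℓ⁻ * (g₀ * z)) (trans (sym (^-+ α n₀ (s ℕ.* r))) (cong (α ^_) (sym n≡)))))

    right : G₁ * ν ^ r ≡ B ^ ℓ⁻ * (g₁ * B ^ ℓ)
    right = trans (cong (λ z → G₁ * z) (sym (^-* B t r))) (trans (solve 3 (λ g b c → g :* (# 1 :* b) :* c := g :* (b :* c)) refl g₁ (B ^ ℓ⁺) (B ^ (t ℕ.* r)))
      (trans (cong (λ z → g₁ * z) (trans (sym (^-+ B ℓ⁺ (t ℕ.* r))) (trans (cong (B ^_) (sym ℓ-balance)) (^-+ B ℓ ℓ⁻))))
        (solve 3 (λ g x y → g :* (x :* y) := y :* (g :* x)) refl g₁ (B ^ ℓ) (B ^ ℓ⁻))))

    scaled : P (suc U) * (G₀ * μ ^ r - G₁ * ν ^ r) ∈± G₁ * ν ^ r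
    scaled = subst₂ _∈±_ (trans (solve 4 (λ k p x y → k :* (p :* (x :- y)) := p :* (k :* x :- k :* y)) refl (B ^ ℓ⁻) (P (suc U)) (g₀ * α ^ n) (g₁ * B ^ ℓ)) (cong₂ (λ x y → P (suc U) * (x - y)) (sym left) (sym right))) (sym right)
      (±-scale (nn-^ ℓ⁻ (nn-fromℕ b)) close)

    forwards : P U * (G₀ * μ ^ r - G₁ * ν ^ r) ∈± G₁ * ν ^ r
    forwards = ±-shrink (P-nn U) (P-mono (ℕP.n≤1+n U)) scaled

    -- Exchanging the two sides costs a factor 2; the hypothesis has `suc U` for this reason.
    backwards : P U * (G₁ * ν ^ r - G₀ * μ ^ r) ∈± G₀ * μ ^ r
    backwards = ±-cancel (Pos-suc 1) (subst (_∈± two * (G₀ * μ ^ r)) (solve 3 (λ p x y → :- ((# 2 :* p) :* (x :- y)) := # 2 :* (p :* (y :- x))) refl (P U) (G₀ * μ ^ r) (G₁ * ν ^ r))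
      (±-neg (±-weaken scaled (half U scaled))))

    s·w≤Δ : s ℕ.* w ℕ.≤ Δ
    s·w≤Δ = ℕP.≤-trans (ℕP.≤-reflexive (ℕP.*-comm s w)) (ℕP.≤-trans (DM.m/n*n≤m δ s) (Δ-bound δ δX≤n))

    h₁H≤E : h₁ ℕ.* suc h₂ ℕ.≤ E
    h₁H≤E = begin
      3 ℕ.* s ℕ.* suc (H ℕ.+ (s ℕ.+ (3 ℕ.* s ℕ.+ 7 ℕ.* w))) ≡⟨ lem s H w ⟩
      3 ℕ.* (s ℕ.* H) ℕ.+ (3 ℕ.* s ℕ.+ 12 ℕ.* (s ℕ.* s)) ℕ.+ 21 ℕ.* (s ℕ.* w) ≤⟨ ℕP.+-mono-≤ (ℕP.+-mono-≤ (ℕP.*-monoʳ-≤ 3 (ℕP.*-monoˡ-≤ H s≤X)) mid) (ℕP.*-monoʳ-≤ 21 s·w≤Δ) ⟩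
      E ∎
      where
        open ℕP.≤-Reasoning
        lem : ∀ s H w → 3 ℕ.* s ℕ.* (1 ℕ.+ (H ℕ.+ (s ℕ.+ (3 ℕ.* s ℕ.+ 7 ℕ.* w)))) ≡ 3 ℕ.* (s ℕ.* H) ℕ.+ (3 ℕ.* s ℕ.+ 12 ℕ.* (s ℕ.* s)) ℕ.+ 21 ℕ.* (s ℕ.* w)
        lem = ℕsolve-∀
        lem′ : ∀ s → 3 ℕ.* s ℕ.+ 12 ℕ.* s ≡ 15 ℕ.* s
        lem′ = ℕsolve-∀
        mid : 3 ℕ.* s ℕ.+ 12 ℕ.* (s ℕ.* s) ℕ.≤ 15 ℕ.* (X ℕ.* X)
        mid = ℕP.≤-trans (ℕP.+-monoˡ-≤ (12 ℕ.* (s ℕ.* s)) (ℕP.*-monoʳ-≤ 3 (ℕP.m≤m*n s s))) (ℕP.≤-trans (ℕP.≤-reflexive (lem′ (s ℕ.* s))) (ℕP.*-monoʳ-≤ 15 (ℕP.*-mono-≤ s≤X s≤X)))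

    r-big : a ℕ.* (ζ ℕ.* suc h₂) ℕ.≤ r
    r-big = m*n≤o⇒m≤o/n (a ℕ.* (ζ ℕ.* suc h₂)) s n (ℕP.≤-trans (ℕP.≤-reflexive (lem a ζ (suc h₂) s)) (ℕP.≤-trans (ℕP.*-monoʳ-≤ a (ℕP.*-monoʳ-≤ ζ (ℕP.≤-trans (ℕP.*-monoˡ-≤ (suc h₂) (ℕP.m≤n*m s 3)) h₁H≤E))) n-big))
      where lem : ∀ a z h s → a ℕ.* (z ℕ.* h) ℕ.* s ≡ a ℕ.* (z ℕ.* (s ℕ.* h))
            lem = ℕsolve-∀

    r-small : r ℕ.* (1 ℕ.+ d ℕ.* (ζ ℕ.* h₁)) ℕ.≤ 2 ℕ.^ ζ
    r-small = begin
      r ℕ.* (1 ℕ.+ d ℕ.* (ζ ℕ.* (3 ℕ.* s))) ≡⟨ lem r d ζ s ⟩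
      r ℕ.+ r ℕ.* s ℕ.* (d ℕ.* (ζ ℕ.* 3)) ≤⟨ ℕP.+-mono-≤ (DM.m/n≤m n s) (ℕP.*-monoˡ-≤ (d ℕ.* (ζ ℕ.* 3)) (DM.m/n*n≤m n s)) ⟩
      n ℕ.+ n ℕ.* (d ℕ.* (ζ ℕ.* 3)) ≡⟨ lem′ n (d ℕ.* (ζ ℕ.* 3)) ⟩
      n ℕ.* (1 ℕ.+ d ℕ.* (ζ ℕ.* 3)) ≤⟨ n-small ⟩
      2 ℕ.^ ζ ∎
      where
        open ℕP.≤-Reasoning
        lem : ∀ r d z s → r ℕ.* (1 ℕ.+ d ℕ.* (z ℕ.* (3 ℕ.* s))) ≡ r ℕ.+ r ℕ.* s ℕ.* (d ℕ.* (z ℕ.* 3))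
        lem = ℕsolve-∀
        lem′ : ∀ n k → n ℕ.+ n ℕ.* k ≡ n ℕ.* (1 ℕ.+ k)
        lem′ = ℕsolve-∀

    U-big′ : C ℕ.* (ζ ℕ.* ζ ℕ.* (h₁ ℕ.* suc h₂)) ℕ.≤ U
    U-big′ = ℕP.≤-trans (ℕP.*-monoʳ-≤ C (ℕP.*-monoʳ-≤ (ζ ℕ.* ζ) h₁H≤E)) U-big

    1≤h₁ : 1 ℕ.≤ h₁
    1≤h₁ = ℕP.≤-trans 1≤s (ℕP.m≤n*m s 3)

    intα₀ : IsInt (α ^ n₀) (2 ℕ.^ s)
    intα₀ = IsInt-weaken (ℕP.^-monoʳ-≤ 2 n₀≤s) (IsInt-^ n₀ IsInt-α)

    int1 : IsInt 1# (2 ℕ.^ s)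
    int1 = IsInt-weaken (ℕP.m^n>0 2 s) (IsInt-ℕ 1)

    impossible : ⊥
    impossible = pick (≤-or-> ν μ)
      where
        swapped : μ < ν → ⊥
        swapped lt = two-log h₁ h₂ r ζ U ν μ G₁ G₀ 1≤h₁ 1≤ζ U-big′ r-big r-small (1≤^ s 1≤α) lt 1≤G₁ 1≤G₀
          (intB {t} {h₁} bᵗ≤) intμ (intG intg₁ int1 ℓ⁺≤) (intG intg₀ intα₀ ℓ⁻≤) backwards
        pick : ν ≤ μ ⊎ μ < ν → ⊥
        pick (inj₂ lt) = swapped lt
        pick (inj₁ (inj₁ lt)) = two-log h₁ h₂ r ζ U μ ν G₀ G₁ 1≤h₁ 1≤ζ U-big′ r-big r-small (1≤^ t 1≤B) lt 1≤G₀ 1≤G₁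
          intμ (intB {t} {h₁} bᵗ≤) (intG intg₀ intα₀ ℓ⁻≤) (intG intg₁ int1 ℓ⁺≤) forwards
        -- μ = ν escapes the two-logarithm estimate, but then a power of α would be an integer.
        pick (inj₁ (inj₂ eq)) = α-power-irrational s (b ℕ.^ t) 1≤s (trans (trans (solve 2 (λ m n → m := (m :- n) :+ n) refl μ ν) (trans (cong (_+ ν) eq) (+-identityˡ ν))) (sym (fromℕ-^ b t)))

-- Binet's formula and the two small forms

module LinearForms (F : NarayanaField) where

  open NarayanaField F using (α; α-root; orderedField)
  open OrderedFieldTheory orderedField
  open Defs using (N)
  open Equation
  open Integrality F
  open TwoLogEstimate F
  open TwoLogParameters F
  open ThreeLogEstimate F

  two-log : TwoLog (2 ℕ.^ 33) 400400 400000
  two-log h₁ h₂ r ζ U μ ν G₀ G₁ 1≤h₁ 1≤ζ U-big r-big r-small 1≤ν ν<μ 1≤G₀ 1≤G₁ iμ iν iG₀ iG₁ close =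
    TwoLogarithms.impossible (choose h₁ h₂ r ζ U 1≤h₁ 1≤ζ U-big r-big r-small) μ ν G₀ G₁ 1≤ν ν<μ 1≤G₀ 1≤G₁ iμ iν iG₀ iG₁ close

  -- 1/α
  p : Carrier
  p = α * α - α

  αp : α * p ≡ 1#
  αp = trans (solve 1 (λ a → a :* (a :* a :- a) := a :* a :* a :- a :* a) refl α) (trans (cong (_- α * α) α-root) (solve 1 (λ a → (a :* a :+ # 1) :- a :* a := # 1) refl α))

  p-nn : NonNeg p
  p-nn = NonNeg-resp (solve 1 (λ a → a :* (a :- # 1) := a :* a :- a) refl α) (nn-* α-nn (<⇒≤ α>1))

  p≤1 : p ≤ 1#
  p≤1 = *-cancelˡ-≤ (1≤⇒Pos (<⇒≤ α>1)) (≤-trans (≤-reflexive αp) (≤-trans (<⇒≤ α>1) (≤-reflexive (sym (*-identityʳ α)))))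

  2≤α² : two ≤ α * α
  2≤α² = pick (≤-or-> two (α * α))
    where
      pick : two ≤ α * α ⊎ α * α < two → two ≤ α * α
      pick (inj₁ q) = q
      -- 1 = α²(α - 1) < 2(α - 1), so 9 < 4α² < 8
      pick (inj₂ q) = ⊥-elim (≤⇒≯ {fromℕ 9} {fromℕ 8} nine≤eight (fromℕ-mono-< {8} {9} ℕP.≤-refl))
        where
          three< : fromℕ 3 < two * α
          three< = <-by (trans (solve 1 (λ a → (# 2 :- a :* a) :* (a :- # 1) := # 2 :* a :- # 2 :- (a :* a :* a :- a :* a)) refl α) (trans (cong (λ z → two * α - two - (z - α * α)) α-root) (solve 1 (λ a → # 2 :* a :- # 2 :- ((a :* a :+ # 1) :- a :* a) := # 2 :* a :- # 3) refl α))) (Pos-* q α>1)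
          nine≤eight : fromℕ 9 ≤ fromℕ 8
          nine≤eight = ≤-by (solve 1 (λ a → (((# 2 :* a :- # 3) :* (# 2 :* a :- # 3) :+ # 6 :* (# 2 :* a :- # 3)) :+ # 4 :* (# 2 :- a :* a)) := # 8 :- # 9) refl α)
            (nn-+ (nn-+ (nn-sq (two * α - fromℕ 3)) (nn-* (nn-fromℕ 6) (inj₁ three<))) (nn-* (nn-fromℕ 4) (inj₁ q)))

  P≤α^ : ∀ k → P k ≤ α ^ (2 ℕ.* k)
  P≤α^ k = ≤-trans (^-mono-≤ k (nn-fromℕ 2) (≤-trans 2≤α² (≤-reflexive (cong (λ z → α * z) (sym (*-identityʳ α)))))) (≤-reflexive (sym (^-* α 2 k)))

  ν : ℕ → Carrier
  ν n = fromℕ (N n)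

  ν-rec : ∀ n → ν (suc (suc (suc n))) ≡ ν (suc (suc n)) + ν n
  ν-rec n = fromℕ-+ (N (suc (suc n))) (N n)

  -- The coefficients are fitted to the initial terms 0, 1, 1, and multiplication by α shifts the
  -- index because of the recurrence.
  α^-narayana : ∀ n → α ^ n ≡ (α - 1#) * ν n + (1# - p) * ν (suc n) + p * ν (suc (suc n))
  α^-narayana zero = solve 2 (λ a p → # 1 := (a :- # 1) :* # 0 :+ (# 1 :- p) :* # 1 :+ p :* # 1) refl α p
  α^-narayana (suc n) = trans (cong (λ z → α * z) (α^-narayana n))
    (trans (solve 5 (λ a p x y z → a :* ((a :- # 1) :* x :+ (# 1 :- p) :* y :+ p :* z) := (a :* a :- a) :* x :+ (a :- a :* p) :* y :+ (a :* p) :* z) refl α p (ν n) (ν (suc n)) (ν (suc (suc n))))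
    (trans (cong (λ t → p * ν n + (α - t) * ν (suc n) + t * ν (suc (suc n))) αp)
    (trans (solve 5 (λ a p x y z → p :* x :+ (a :- # 1) :* y :+ # 1 :* z := (a :- # 1) :* y :+ (# 1 :- p) :* z :+ p :* (z :+ x)) refl α p (ν n) (ν (suc n)) (ν (suc (suc n))))
      (cong (λ t → (α - 1#) * ν (suc n) + (1# - p) * ν (suc (suc n)) + p * t) (sym (ν-rec n))))))

  -- Removes the part of the sequence proportional to α^n. The rest follows the quadratic recurrence
  -- of the two complex roots, with sum 1 - α and product `p`.
  δ : ℕ → Carrier
  δ n = ν (suc n) - α * ν n

  δ-rec : ∀ n → δ (suc (suc n)) ≡ (1# - α) * δ (suc n) - p * δ n
  δ-rec n = trans (cong (λ z → z - α * ν (suc (suc n))) (ν-rec n))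
    (trans (solve 5 (λ a x y z e → (z :+ x) :- a :* z := (# 1 :- a) :* (z :- a :* y) :- (a :* a :- a) :* (y :- a :* x) :+ (# 1 :- a :* (a :* a :- a)) :* x) refl α (ν n) (ν (suc n)) (ν (suc (suc n))) 0#)
      (trans (cong (λ t → (1# - α) * δ (suc n) - p * δ n + (1# - t) * ν n) αp) (solve 2 (λ u x → u :+ (# 1 :- # 1) :* x := u) refl ((1# - α) * δ (suc n) - p * δ n) (ν n))))

  -- The norm form of the two complex conjugates, which contracts by p at every step.
  energy : ℕ → Carrier
  energy n = δ (suc n) * δ (suc n) - (1# - α) * (δ n * δ (suc n)) + p * (δ n * δ n)

  energy≡ : ∀ n → energy n ≡ p ^ suc n
  energy≡ zero = solve 2 (λ a p → (# 1 :- a :* # 1) :* (# 1 :- a :* # 1) :- (# 1 :- a) :* ((# 1 :- a :* # 0) :* (# 1 :- a :* # 1)) :+ p :* ((# 1 :- a :* # 0) :* (# 1 :- a :* # 0)) := p :* # 1) refl α p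
  energy≡ (suc n) = trans (cong (λ z → z * z - (1# - α) * (δ (suc n) * z) + p * (δ (suc n) * δ (suc n))) (δ-rec n))
    (trans (solve 4 (λ a p x y → ((# 1 :- a) :* y :- p :* x) :* ((# 1 :- a) :* y :- p :* x) :- (# 1 :- a) :* (y :* ((# 1 :- a) :* y :- p :* x)) :+ p :* (y :* y)
        := p :* (y :* y :- (# 1 :- a) :* (x :* y) :+ p :* (x :* x))) refl α p (δ n) (δ (suc n))) (cong (λ z → p * z) (energy≡ n)))

  p^≤1 : ∀ n → p ^ n ≤ 1#
  p^≤1 n = ≤-trans (^-mono-≤ n p-nn p≤1) (≤-reflexive (1^ n))

  square-bound : ∀ {x} → x * x ≤ fromℕ 4 → x ≤ two
  square-bound {x} q = pick (≤-or-> x two)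
    where
      pick : x ≤ two ⊎ two < x → x ≤ two
      pick (inj₁ r) = r
      pick (inj₂ r) = ⊥-elim (≤⇒≯ q (<-by (solve 1 (λ x → (x :- # 2) :* (x :- # 2) :+ # 4 :* (x :- # 2) := x :* x :- # 4) refl x) (Pos-+ (Pos-* r r) (Pos-* (Pos-suc 3) r))))

  -- The expression is 4p - (1 - α)², minus the discriminant of the complex roots, and makes the
  -- energy control δ².
  1≤discriminant : 1# ≤ (α - 1#) * (fromℕ 3 * α + 1#)
  1≤discriminant = *-cancelˡ-≤ (Pos-* posα posα) (≤-by
      (trans (solve 2 (λ a u → a :* (# 2 :- a) :+ (a :+ # 1) := (# 3 :* a :+ # 1) :- a :* a :* # 1) refl α 0#)
        (trans (cong (_- α * α * 1#) (trans (sym (*-identityˡ _)) (cong (_* (fromℕ 3 * α + 1#)) (sym αp)))) (solve 2 (λ a u → a :* (a :* a :- a) :* (# 3 :* a :+ # 1) :- a :* a :* # 1 := a :* a :* ((a :- # 1) :* (# 3 :* a :+ # 1)) :- a :* a :* # 1) refl α 0#)))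
      (nn-+ (nn-* α-nn (<⇒≤ α<2)) (nn-+ α-nn nn-1)))
    where posα = 1≤⇒Pos (<⇒≤ α>1)

  δ² : ∀ n → δ n * δ n ≤ fromℕ 4
  δ² n = ≤-trans (≤-by (solve 3 (λ a x y → (# 2 :* y :- (# 1 :- a) :* x) :* (# 2 :* y :- (# 1 :- a) :* x) :+ ((a :- # 1) :* (# 3 :* a :+ # 1) :- # 1) :* (x :* x)
          := # 4 :* (y :* y :- (# 1 :- a) :* (x :* y) :+ (a :* a :- a) :* (x :* x)) :- x :* x) refl α (δ n) (δ (suc n)))
        (nn-+ (nn-sq _) (nn-* 1≤discriminant (nn-sq _))))
      (≤-trans (*-monoˡ-≤ (nn-fromℕ 4) (≤-trans (≤-reflexive (energy≡ n)) (p^≤1 (suc n)))) (≤-reflexive (*-identityʳ _)))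

  δ± : ∀ n → δ n ∈± two
  δ± n = square-bound (δ² n) ,± NonNeg-resp (solve 1 (λ x → # 2 :- (:- x) := # 2 :+ x) refl (δ n)) (square-bound (≤-trans (≤-reflexive (solve 1 (λ x → (:- x) :* (:- x) := x :* x) refl (δ n))) (δ² n)))

  -- The derivative of x³ - x² - 1 at α divided by α, which is the denominator in Binet's formula.
  c : Carrier
  c = fromℕ 3 * α - two

  -- The difference is (p - 2) δ n - p δ (n + 1), so with |δ| ≤ 2 the error is at most 2 (2 - p) +
  -- 2p = 4.
  binet : ∀ n → c * ν n - α ^ n ∈± fromℕ 4
  binet n = subst₂ _∈±_ eq (solve 1 (λ p → (# 2 :- p) :* # 2 :+ p :* # 2 := # 4) refl p) (±-+ (±-* p-2 (δ± n)) (±-neg (±-* (±-of-nn p-nn ≤-refl) (δ± (suc n)))))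
    where
      p-2 : p - two ∈± two - p
      p-2 = NonNeg-resp (solve 1 (λ p → (# 1 :- p) :+ ((# 1 :- p) :+ # 2) := (# 2 :- p) :- (p :- # 2)) refl p) (nn-+ p≤1 (nn-+ p≤1 (nn-fromℕ 2))) ,± inj₂ (solve 1 (λ p → (# 2 :- p) :+ (p :- # 2) := # 0) refl p)
      eq : (p - two) * δ n + - (p * δ (suc n)) ≡ c * ν n - α ^ n
      eq = trans (solve 5 (λ a p x y z → (p :- # 2) :* (y :- a :* x) :+ :- (p :* (z :- a :* y)) := ((a :* p) :* y :- (a :* p) :* x) :+ (p :* y :- # 2 :* y :+ # 2 :* a :* x :- p :* z)) refl α p (ν n) (ν (suc n)) (ν (suc (suc n))))
        (trans (cong (λ t → (t * ν (suc n) - t * ν n) + (p * ν (suc n) - two * ν (suc n) + two * α * ν n - p * ν (suc (suc n)))) αp)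
        (trans (solve 5 (λ a p x y z → (# 1 :* y :- # 1 :* x) :+ (p :* y :- # 2 :* y :+ # 2 :* a :* x :- p :* z) := (# 3 :* a :- # 2) :* x :- ((a :- # 1) :* x :+ (# 1 :- p) :* y :+ p :* z)) refl α p (ν n) (ν (suc n)) (ν (suc (suc n))))
          (cong (λ t → c * ν n - t) (sym (α^-narayana n)))))

  1≤c : 1# ≤ c
  1≤c = ≤-by (solve 1 (λ a → # 3 :* (a :- # 1) := (# 3 :* a :- # 2) :- # 1) refl α) (nn-* (nn-fromℕ 3) (<⇒≤ α>1))

  c≤4 : c ≤ fromℕ 4
  c≤4 = ≤-by (solve 1 (λ a → # 3 :* (# 2 :- a) := # 4 :- (# 3 :* a :- # 2)) refl α) (nn-* (nn-fromℕ 3) (<⇒≤ α<2))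

  c-int : IsInt c 8
  c-int = IsInt-+ (IsInt-* (IsInt-ℕ 3) IsInt-α) (IsInt-neg (IsInt-ℕ 2))

  module Forms {n m ℓ a b′ : ℕ} (solution : Solution n m ℓ a b′) where
    open Solution solution

    d = n ℕ.∸ m
    B g₁ : Carrier
    B = fromℕ b′
    g₁ = fromℕ a * c

    value : Carrier
    value = g₁ * fromℕ (suc b′) ^ ℓ

    1≤B : 1# ≤ B
    1≤B = fromℕ-mono-≤ {1} 1≤b′

    1≤g₁ : 1# ≤ g₁
    1≤g₁ = ≤-trans (≤-reflexive (sym (*-identityˡ 1#))) (*-mono-≤ nn-1 (fromℕ-mono-≤ {1} 1≤a) (inj₁ (1≤⇒Pos 1≤c)) 1≤c)

    int-g₁ : IsInt g₁ (2 ℕ.^ 10)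
    int-g₁ = IsInt-weaken (ℕP.*-monoˡ-≤ 8 (ℕP.≤-trans a≤b′ (ℕP.≤-trans b′≤99 (ℕP.≤ᵇ⇒≤ 99 128 tt)))) (IsInt-* (IsInt-ℕ a) c-int)

    identity : value ≡ B * (c * ν n + c * ν m) + g₁
    identity = trans (trans (cong (λ z → fromℕ a * c * z) (sym (fromℕ-^ (suc b′) ℓ))) (trans (solve 3 (λ a c y → a :* c :* y := c :* (a :* y)) refl (fromℕ a) c (fromℕ (suc b′ ℕ.^ ℓ)))
        (cong (λ z → c * z) (trans (sym (fromℕ-* a (suc b′ ℕ.^ ℓ))) (trans (cong fromℕ (sym equation)) (trans (fromℕ-+ (b′ ℕ.* (N n ℕ.+ N m)) a) (cong (_+ fromℕ a) (trans (fromℕ-* b′ _) (cong (λ z → B * z) (fromℕ-+ (N n) (N m)))))))))))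
      (solve 5 (λ c b x y a → c :* (b :* (x :+ y) :+ a) := b :* (c :* x :+ c :* y) :+ a :* c) refl c B (ν n) (ν m) (fromℕ a))

    sum-close : B * (α ^ n + α ^ m) - value ∈± B * fromℕ 12
    sum-close = subst₂ _∈±_ (trans (solve 6 (λ b x y s t g → :- (b :* ((x :- s) :+ (y :- t)) :+ g) := b :* (s :+ t) :- (b :* (x :+ y) :+ g)) refl B (c * ν n) (c * ν m) (α ^ n) (α ^ m) g₁) (cong (λ z → B * (α ^ n + α ^ m) - z) (sym identity)))
        (solve 1 (λ b → b :* (# 4 :+ # 4) :+ b :* # 4 := b :* # 12) refl B)
        (±-neg (±-+ (±-scale (nn-fromℕ b′) (±-+ (binet n) (binet m))) (±-of-nn (inj₁ (1≤⇒Pos 1≤g₁)) (*-mono-≤ (nn-fromℕ a) (fromℕ-mono-≤ a≤b′) (nn-fromℕ 4) c≤4))))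

    -- The value is at least B (Q - 13 T), so Q ≥ 13 T (2^(U+1) + 1) suffices; 2^(6+U) is 32 ·
    -- 2^(U+1), which is more than enough.
    relative : ∀ {A T Q} U → 1# ≤ T → B * Q ≡ A → A - value ∈± B * (fromℕ 13 * T) → P (6 ℕ.+ U) * T ≤ Q → P (suc U) * (A - value) ∈± value
    relative {A} {T} {Q} U 1≤T refl q big = ±-weaken (±-scale (P-nn (suc U)) q) main
      where
        u = P (suc U)
        nnT = inj₁ (1≤⇒Pos 1≤T)
        Q-big : fromℕ 13 * T * (u + 1#) ≤ Q
        Q-big = ≤-trans (≤-by (solve 2 (λ T u → # 6 :* (u :* T) :+ # 13 :* (T :* (u :- # 1)) := (# 32 :* u) :* T :- # 13 :* T :* (u :+ # 1)) refl T u)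
            (nn-+ (nn-* (nn-fromℕ 6) (nn-* (P-nn (suc U)) nnT)) (nn-* (nn-fromℕ 13) (nn-* nnT (1≤P (suc U))))))
          (≤-trans (≤-reflexive (cong (_* T) (solve 1 (λ x → # 32 :* (# 2 :* x) := # 2 :* (# 2 :* (# 2 :* (# 2 :* (# 2 :* (# 2 :* x)))))) refl (P U)))) big)
        main : u * (B * (fromℕ 13 * T)) ≤ value
        main = ≤-by (solve 5 (λ b q t u v → (b :* (# 13 :* t) :- (b :* q :- v)) :+ b :* (q :- # 13 :* t :* (u :+ # 1)) := v :- u :* (b :* (# 13 :* t))) refl B Q T u value)
          (nn-+ (±upper q) (nn-* (nn-fromℕ b′) Q-big))

    n≡m+d : n ≡ m ℕ.+ d
    n≡m+d = sym (ℕP.m+[n∸m]≡n m≤n)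

    αⁿ : α ^ n ≡ α ^ m * α ^ d
    αⁿ = trans (cong (α ^_) n≡m+d) (^-+ α m d)

    1≤α^ : ∀ k → 1# ≤ α ^ k
    1≤α^ k = 1≤^ k (<⇒≤ α>1)

    P≤ : ∀ {U k} → 2 ℕ.* (6 ℕ.+ U) ℕ.≤ k → P (6 ℕ.+ U) ≤ α ^ k
    P≤ {U} q = ≤-trans (P≤α^ (6 ℕ.+ U)) (^-monoʳ-≤ (<⇒≤ α>1) q)

    -- The term B α^m counts as error, of relative size about α^-d. What remains has coefficients of
    -- bounded weight.
    gap-close : ∀ U → 2 ℕ.* (6 ℕ.+ U) ℕ.≤ d → P (suc U) * (B * α ^ n - value) ∈± value
    gap-close U q = relative {T = α ^ m} {Q = α ^ n} U (1≤α^ m) refl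
      (±-weaken (subst (_∈± B * fromℕ 12 + B * α ^ m) (solve 4 (λ b x y v → (b :* (x :+ y) :- v) :+ :- (b :* y) := b :* x :- v) refl B (α ^ n) (α ^ m) value)
          (±-+ sum-close (±-neg (±-of-nn (nn-* (nn-fromℕ b′) (nn-^ m α-nn)) ≤-refl))))
        (≤-by (solve 2 (λ b t → # 12 :* (b :* (t :- # 1)) := b :* (# 13 :* t) :- (b :* # 12 :+ b :* t)) refl B (α ^ m)) (nn-* (nn-fromℕ 12) (nn-* (nn-fromℕ b′) (1≤α^ m)))))
      (≤-trans (≤-reflexive (*-comm (P (6 ℕ.+ U)) (α ^ m))) (≤-trans (*-monoˡ-≤ (nn-^ m α-nn) (P≤ q)) (≤-reflexive (sym αⁿ))))

    g₀ : Carrier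
    g₀ = B * (1# + α ^ d)

    1≤g₀ : 1# ≤ g₀
    1≤g₀ = ≤-trans (≤-reflexive (sym (*-identityˡ 1#))) (*-mono-≤ nn-1 1≤B (nn-+ nn-1 (nn-^ d α-nn)) (≤-by (solve 1 (λ t → t := (# 1 :+ t) :- # 1) refl (α ^ d)) (nn-^ d α-nn)))

    int-B : IsInt B (2 ℕ.^ 7)
    int-B = IsInt-weaken (ℕP.≤-trans b′≤99 (ℕP.≤ᵇ⇒≤ 99 128 tt)) (IsInt-ℕ b′)

    int-g₀ : IsInt g₀ (2 ℕ.^ (10 ℕ.+ d))
    int-g₀ = IsInt-weaken (ℕP.≤-trans (ℕP.*-monoʳ-≤ 128 (ℕP.≤-trans (ℕP.+-monoˡ-≤ (2 ℕ.^ d) (ℕP.m^n>0 2 d)) (ℕP.≤-reflexive (cong (2 ℕ.^ d ℕ.+_) (sym (ℕP.+-identityʳ _))))))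
        (ℕP.≤-trans (ℕP.≤-reflexive (sym (ℕP.^-distribˡ-+-* 2 7 (suc d)))) (ℕP.^-monoʳ-≤ 2 (ℕP.≤-trans (ℕP.≤-reflexive (ℕP.+-suc 7 d)) (ℕP.+-monoˡ-≤ d (ℕP.≤ᵇ⇒≤ 8 10 tt))))))
      (IsInt-* int-B (IsInt-+ (IsInt-ℕ 1) (IsInt-^ d IsInt-α)))

    sum-form : g₀ * α ^ m ≡ B * (α ^ n + α ^ m)
    sum-form = trans (solve 3 (λ b x y → b :* (# 1 :+ x) :* y := b :* (y :* x :+ y)) refl B (α ^ d) (α ^ m)) (cong (λ z → B * (z + α ^ m)) (sym αⁿ))

    -- Both powers are kept as g₀ α^m. The error is now relative to α^n, at the price of a
    -- coefficient of about d bits, so a bound for d must be known.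
    size-close : ∀ U → 2 ℕ.* (6 ℕ.+ U) ℕ.≤ n → P (suc U) * (g₀ * α ^ m - value) ∈± value
    size-close U q = relative {T = 1#} {Q = α ^ n + α ^ m} U ≤-refl (sym sum-form)
      (subst (λ z → z - value ∈± B * (fromℕ 13 * 1#)) (sym sum-form) (±-weaken sum-close (≤-by (solve 1 (λ b → b := b :* (# 13 :* # 1) :- b :* # 12) refl B) (nn-fromℕ b′))))
      (≤-trans (≤-reflexive (*-identityʳ _)) (≤-trans (P≤ q) (≤-by (solve 2 (λ x y → y := (x :+ y) :- x) refl (α ^ n) (α ^ m)) (nn-^ m α-nn))))

-- The initial bound for n

module InitialBound (F : NarayanaField) where

  open NarayanaField F using (orderedField)
  open OrderedFieldTheory orderedField
  open Equation
  open Integrality F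
  open TwoLogParameters F
  open ThreeLogEstimate F
  open LinearForms F

  -- Let y = 2^j, so that n is about y⁹. Denominators up to y³ cost about y⁶ + y⁹/y³ and bound d by
  -- 3κ y⁶, at most y⁷. With height y⁷ and denominators up to y the cost is about y · y⁷ + y⁹/y,
  -- that is y⁸ and below n. Constants and the square of `ζ` are collected in κ = c₁ j², for which
  -- 4κ ≤ y leaves room.
  module Descent (C a₁ d₁ c₁ : ℕ) (two-log : TwoLog C a₁ d₁) (C≤ : C ℕ.* 100 ℕ.* 16384 ℕ.≤ c₁) (a≤ : a₁ ℕ.* 10 ℕ.* 16384 ℕ.≤ c₁)
    (d≤ : 512 ℕ.* (1 ℕ.+ d₁ ℕ.* 30) ℕ.≤ c₁)
    {n m ℓ a b′ : ℕ} (solution : Solution n m ℓ a b′) (j : ℕ) (3≤j : 3 ℕ.≤ j) (12≤c₁ : 12 ℕ.≤ c₁)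
    (j-big : 4 ℕ.* (c₁ ℕ.* (j ℕ.* j)) ℕ.≤ 2 ℕ.^ j) (n-lower : 2 ℕ.^ (9 ℕ.* j) ℕ.≤ n) (n-upper : n ℕ.≤ 512 ℕ.* 2 ℕ.^ (9 ℕ.* j)) where

    open Solution solution
    open Forms solution

    private
      κ = c₁ ℕ.* (j ℕ.* j)
      y = 2 ℕ.^ j
      X = 2 ℕ.^ (3 ℕ.* j)
      Y₆ = 2 ℕ.^ (6 ℕ.* j)
      Y₈ = 2 ℕ.^ (8 ℕ.* j)
      -- The exponent times a polynomial factor below y = 2^j fits into 10 j bits.
      ζ = 10 ℕ.* j

      pw : ∀ {i k l} → i ℕ.+ k ≡ l → 2 ℕ.^ i ℕ.* 2 ℕ.^ k ≡ 2 ℕ.^ l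
      pw {i} {k} e = trans (sym (ℕP.^-distribˡ-+-* 2 i k)) (cong (2 ℕ.^_) e)

      XX : X ℕ.* X ≡ Y₆
      XX = pw {3 ℕ.* j} {3 ℕ.* j} (lem j)
        where lem : ∀ j → 3 ℕ.* j ℕ.+ 3 ℕ.* j ≡ 6 ℕ.* j
              lem = ℕsolve-∀
      XY₆ : X ℕ.* Y₆ ≡ 2 ℕ.^ (9 ℕ.* j)
      XY₆ = pw {3 ℕ.* j} {6 ℕ.* j} (lem j)
        where lem : ∀ j → 3 ℕ.* j ℕ.+ 6 ℕ.* j ≡ 9 ℕ.* j
              lem = ℕsolve-∀
      yY₈ : y ℕ.* Y₈ ≡ 2 ℕ.^ (9 ℕ.* j)
      yY₈ = pw {j} {8 ℕ.* j} (lem j)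
        where lem : ∀ j → j ℕ.+ 8 ℕ.* j ≡ 9 ℕ.* j
              lem = ℕsolve-∀
      yyY₆ : y ℕ.* (y ℕ.* Y₆) ≡ Y₈
      yyY₆ = trans (cong (y ℕ.*_) (pw {j} {6 ℕ.* j} {7 ℕ.* j} (lem j))) (pw {j} {7 ℕ.* j} (lem′ j))
        where lem : ∀ j → j ℕ.+ 6 ℕ.* j ≡ 7 ℕ.* j
              lem = ℕsolve-∀
              lem′ : ∀ j → j ℕ.+ 7 ℕ.* j ≡ 8 ℕ.* j
              lem′ = ℕsolve-∀

      1≤j : 1 ℕ.≤ j
      1≤j = ℕP.≤-trans (ℕ.s≤s ℕ.z≤n) 3≤j

      1≤jj : 1 ℕ.≤ j ℕ.* j
      1≤jj = ℕP.*-mono-≤ 1≤j 1≤j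

      12≤κ : 12 ℕ.≤ κ
      12≤κ = ℕP.*-mono-≤ 12≤c₁ 1≤jj

      mono : ∀ {i k} → i ℕ.≤ k → 2 ℕ.^ (i ℕ.* j) ℕ.≤ 2 ℕ.^ (k ℕ.* j)
      mono p = ℕP.^-monoʳ-≤ 2 (ℕP.*-monoˡ-≤ j p)

      1≤Y₆ : 1 ℕ.≤ Y₆
      1≤Y₆ = ℕP.m^n>0 2 (6 ℕ.* j)
      1≤Y₈ : 1 ℕ.≤ Y₈
      1≤Y₈ = ℕP.m^n>0 2 (8 ℕ.* j)

      8≤y : 8 ℕ.≤ y
      8≤y = ℕP.^-monoʳ-≤ 2 {3} {j} 3≤j

      U-condition : ∀ {E Y} → E ℕ.≤ 16384 ℕ.* Y → C ℕ.* (ζ ℕ.* ζ ℕ.* E) ℕ.≤ κ ℕ.* Y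
      U-condition {E} {Y} p = ℕP.≤-trans (ℕP.*-monoʳ-≤ C (ℕP.*-monoʳ-≤ (ζ ℕ.* ζ) p)) (ℕP.≤-trans (ℕP.≤-reflexive (lem C 10 16384 j Y))
          (ℕP.≤-trans (ℕP.*-monoˡ-≤ (j ℕ.* j ℕ.* Y) C≤) (ℕP.≤-reflexive (sym (ℕP.*-assoc c₁ (j ℕ.* j) Y)))))
        where lem : ∀ C t s j Y → C ℕ.* (t ℕ.* j ℕ.* (t ℕ.* j) ℕ.* (s ℕ.* Y)) ≡ C ℕ.* (t ℕ.* t) ℕ.* s ℕ.* (j ℕ.* j ℕ.* Y)
              lem = ℕsolve-∀

      n-condition : ∀ {E Y} → E ℕ.≤ 16384 ℕ.* Y → a₁ ℕ.* (ζ ℕ.* E) ℕ.≤ κ ℕ.* Y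
      n-condition {E} {Y} p = ℕP.≤-trans (ℕP.*-monoʳ-≤ a₁ (ℕP.*-monoʳ-≤ ζ p)) (ℕP.≤-trans (ℕP.≤-reflexive (lem a₁ 10 16384 j Y))
          (ℕP.≤-trans (ℕP.*-mono-≤ a≤ (ℕP.*-monoˡ-≤ Y (ℕP.≤-trans (ℕP.≤-reflexive (sym (ℕP.*-identityʳ j))) (ℕP.*-monoʳ-≤ j 1≤j)))) (ℕP.≤-reflexive (sym (ℕP.*-assoc c₁ (j ℕ.* j) Y)))))
        where lem : ∀ C t s j Y → C ℕ.* (t ℕ.* j ℕ.* (s ℕ.* Y)) ≡ C ℕ.* t ℕ.* s ℕ.* (j ℕ.* Y)
              lem = ℕsolve-∀

      κ≤y : κ ℕ.≤ y
      κ≤y = ℕP.≤-trans (ℕP.m≤n*m κ 4) j-big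

      ζ-condition : ∀ {k} → k ℕ.≤ n → k ℕ.* (1 ℕ.+ d₁ ℕ.* (ζ ℕ.* 3)) ℕ.≤ 2 ℕ.^ ζ
      ζ-condition {k} p = begin
        k ℕ.* (1 ℕ.+ d₁ ℕ.* (10 ℕ.* j ℕ.* 3)) ≤⟨ ℕP.*-mono-≤ (ℕP.≤-trans p n-upper) (ℕP.+-mono-≤ 1≤jj (ℕP.≤-trans (ℕP.≤-reflexive (lem d₁ j)) (ℕP.*-monoʳ-≤ (d₁ ℕ.* 30) (ℕP.≤-trans (ℕP.≤-reflexive (sym (ℕP.*-identityʳ j))) (ℕP.*-monoʳ-≤ j 1≤j))))) ⟩
        512 ℕ.* 2 ℕ.^ (9 ℕ.* j) ℕ.* (j ℕ.* j ℕ.+ d₁ ℕ.* 30 ℕ.* (j ℕ.* j)) ≡⟨ lem′ 512 (2 ℕ.^ (9 ℕ.* j)) (j ℕ.* j) (d₁ ℕ.* 30) ⟩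
        (512 ℕ.* (1 ℕ.+ d₁ ℕ.* 30)) ℕ.* (j ℕ.* j) ℕ.* 2 ℕ.^ (9 ℕ.* j) ≤⟨ ℕP.*-monoˡ-≤ (2 ℕ.^ (9 ℕ.* j)) (ℕP.≤-trans (ℕP.*-monoˡ-≤ (j ℕ.* j) d≤) κ≤y) ⟩
        y ℕ.* 2 ℕ.^ (9 ℕ.* j) ≡⟨ pw {j} {9 ℕ.* j} (lem″ j) ⟩
        2 ℕ.^ (10 ℕ.* j) ∎
        where
          open ℕP.≤-Reasoning
          lem : ∀ d j → d ℕ.* (10 ℕ.* j ℕ.* 3) ≡ d ℕ.* 30 ℕ.* j
          lem = ℕsolve-∀
          lem′ : ∀ c t j d → c ℕ.* t ℕ.* (j ℕ.+ d ℕ.* j) ≡ (c ℕ.* (1 ℕ.+ d)) ℕ.* j ℕ.* t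
          lem′ = ℕsolve-∀
          lem″ : ∀ j → j ℕ.+ 9 ℕ.* j ≡ 10 ℕ.* j
          lem″ = ℕsolve-∀

      1≤ζ : 1 ℕ.≤ ζ
      1≤ζ = ℕP.≤-trans 1≤j (ℕP.m≤n*m j 10)

      2≤b : 2 ℕ.≤ suc b′
      2≤b = ℕ.s≤s 1≤b′
      b≤ : suc b′ ℕ.≤ 2 ℕ.^ 7
      b≤ = ℕP.≤-trans (ℕ.s≤s b′≤99) (ℕP.≤ᵇ⇒≤ 100 128 tt)

      U₁ = κ ℕ.* Y₆
      U₂ = κ ℕ.* Y₈

      12≤U₁ : 12 ℕ.≤ U₁
      12≤U₁ = ℕP.*-mono-≤ 12≤κ 1≤Y₆

      weigh : ∀ {u v w Y p q r} → p ℕ.≤ u ℕ.* Y → q ℕ.≤ v ℕ.* Y → r ℕ.≤ w ℕ.* Y → u ℕ.+ v ℕ.+ w ℕ.≤ 16384 → p ℕ.+ q ℕ.+ r ℕ.≤ 16384 ℕ.* Y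
      weigh {u} {v} {w} {Y} s t x le = ℕP.≤-trans (ℕP.+-mono-≤ (ℕP.+-mono-≤ s t) x) (ℕP.≤-trans (ℕP.≤-reflexive (lem u v w Y)) (ℕP.*-monoˡ-≤ Y le))
        where lem : ∀ u v w Y → u ℕ.* Y ℕ.+ v ℕ.* Y ℕ.+ w ℕ.* Y ≡ (u ℕ.+ v ℕ.+ w) ℕ.* Y
              lem = ℕsolve-∀

      quotient-bound : ∀ {δ Z Y k} → 1 ℕ.≤ Z → Z ℕ.* Y ≡ 2 ℕ.^ (9 ℕ.* j) → k ℕ.≤ n → δ ℕ.* Z ℕ.≤ k → δ ℕ.≤ 512 ℕ.* Y
      quotient-bound {δ} {Z} {Y} 1≤Z e k≤n p = ℕP.*-cancelʳ-≤ δ (512 ℕ.* Y) Z ⦃ ℕ.>-nonZero 1≤Z ⦄ (ℕP.≤-trans p (ℕP.≤-trans k≤n (ℕP.≤-trans n-upper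
          (ℕP.≤-reflexive (trans (cong (512 ℕ.*_) (trans (sym e) (ℕP.*-comm Z Y))) (sym (ℕP.*-assoc 512 Y Z)))))))

      -- The defect contributes 21 · 512 = 10752, where 512 is the freedom in n for a given j; 16384
      -- is the power of 2 above the total.
      E₁≤ : 3 ℕ.* (X ℕ.* 10) ℕ.+ 15 ℕ.* (X ℕ.* X) ℕ.+ 21 ℕ.* (512 ℕ.* Y₆) ℕ.≤ 16384 ℕ.* Y₆
      E₁≤ = weigh {30} {15} {10752} {Y₆} (ℕP.≤-trans (ℕP.≤-reflexive (trans (cong (3 ℕ.*_) (ℕP.*-comm X 10)) (sym (ℕP.*-assoc 3 10 X)))) (ℕP.*-monoʳ-≤ 30 (mono {3} {6} (ℕP.≤ᵇ⇒≤ 3 6 tt))))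
        (ℕP.*-monoʳ-≤ 15 (ℕP.≤-reflexive XX)) (ℕP.≤-reflexive (sym (ℕP.*-assoc 21 512 Y₆))) (ℕP.≤ᵇ⇒≤ (30 ℕ.+ 15 ℕ.+ 10752) 16384 tt)

      κY₆≤n : κ ℕ.* Y₆ ℕ.≤ n
      κY₆≤n = ℕP.≤-trans (ℕP.*-mono-≤ κ≤y (mono {6} {8} (ℕP.≤ᵇ⇒≤ 6 8 tt))) (ℕP.≤-trans (ℕP.≤-reflexive yY₈) n-lower)

      10<n : 10 ℕ.< n
      10<n = ℕP.≤-trans (ℕP.≤-trans (ℕP.n≤1+n 11) 12≤U₁) κY₆≤n

      gap-bounded : d ℕ.< 2 ℕ.* (6 ℕ.+ U₁)
      gap-bounded = ℕP.≰⇒> λ q → ThreeLogarithms.impossible C a₁ d₁ two-log (suc b′) n ℓ X 10 U₁ ζ (512 ℕ.* Y₆) 2≤b b≤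
        (ℕP.≤-trans (ℕP.≤-trans (ℕP.n≤1+n 7) 8≤y) (ℕP.^-monoʳ-≤ 2 (ℕP.m≤n*m j 3))) 10<n 1≤ζ
        (λ δ → quotient-bound {δ} {X} {Y₆} (ℕP.m^n>0 2 (3 ℕ.* j)) XY₆ ℕP.≤-refl) (U-condition E₁≤)
        (ℕP.≤-trans (n-condition {Y = Y₆} E₁≤) κY₆≤n) (ζ-condition ℕP.≤-refl)
        B g₁ 1≤B 1≤g₁ (IsInt-weaken (ℕP.≤ᵇ⇒≤ 128 1024 tt) int-B) int-g₁ (gap-close U₁ q)

      d≤3U₁ : d ℕ.≤ 3 ℕ.* U₁
      d≤3U₁ = ℕP.≤-trans (ℕP.<⇒≤ gap-bounded) (ℕP.≤-trans (ℕP.≤-reflexive (lem U₁)) (ℕP.≤-trans (ℕP.+-monoˡ-≤ (2 ℕ.* U₁) 12≤U₁) (ℕP.≤-reflexive (lem′ U₁))))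
        where lem : ∀ u → 2 ℕ.* (6 ℕ.+ u) ≡ 12 ℕ.+ 2 ℕ.* u
              lem = ℕsolve-∀
              lem′ : ∀ u → u ℕ.+ 2 ℕ.* u ≡ 3 ℕ.* u
              lem′ = ℕsolve-∀

      H = 10 ℕ.+ d

      H≤yY₆ : H ℕ.≤ y ℕ.* Y₆
      H≤yY₆ = ℕP.≤-trans (ℕP.+-mono-≤ (ℕP.≤-trans (ℕP.≤ᵇ⇒≤ 10 12 tt) 12≤U₁) d≤3U₁) (ℕP.≤-trans (ℕP.≤-reflexive (lem κ Y₆)) (ℕP.*-monoˡ-≤ Y₆ j-big))
        where lem : ∀ k Y → k ℕ.* Y ℕ.+ 3 ℕ.* (k ℕ.* Y) ≡ 4 ℕ.* k ℕ.* Y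
              lem = ℕsolve-∀

      E₂≤ : 3 ℕ.* (y ℕ.* H) ℕ.+ 15 ℕ.* (y ℕ.* y) ℕ.+ 21 ℕ.* (512 ℕ.* Y₈) ℕ.≤ 16384 ℕ.* Y₈
      E₂≤ = weigh {3} {15} {10752} {Y₈} (ℕP.*-monoʳ-≤ 3 (ℕP.≤-trans (ℕP.*-monoʳ-≤ y H≤yY₆) (ℕP.≤-reflexive yyY₆)))
        (ℕP.*-monoʳ-≤ 15 (ℕP.≤-trans (ℕP.*-monoʳ-≤ y (ℕP.≤-trans (ℕP.≤-reflexive (sym (ℕP.*-identityʳ y))) (ℕP.*-monoʳ-≤ y 1≤Y₆))) (ℕP.≤-reflexive yyY₆)))
        (ℕP.≤-reflexive (sym (ℕP.*-assoc 21 512 Y₈))) (ℕP.≤ᵇ⇒≤ (3 ℕ.+ 15 ℕ.+ 10752) 16384 tt)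

      m-lower : κ ℕ.* Y₈ ℕ.≤ m
      m-lower = ℕP.+-cancelʳ-≤ d (κ ℕ.* Y₈) m (begin
        κ ℕ.* Y₈ ℕ.+ d ≤⟨ ℕP.+-monoʳ-≤ (κ ℕ.* Y₈) (ℕP.≤-trans d≤3U₁ (ℕP.*-monoʳ-≤ 3 (ℕP.*-monoʳ-≤ κ (mono {6} {8} (ℕP.≤ᵇ⇒≤ 6 8 tt))))) ⟩
        κ ℕ.* Y₈ ℕ.+ 3 ℕ.* (κ ℕ.* Y₈) ≡⟨ lem κ Y₈ ⟩
        4 ℕ.* κ ℕ.* Y₈ ≤⟨ ℕP.*-monoˡ-≤ Y₈ j-big ⟩
        y ℕ.* Y₈ ≡⟨ yY₈ ⟩
        2 ℕ.^ (9 ℕ.* j) ≤⟨ n-lower ⟩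
        n ≡⟨ n≡m+d ⟩
        m ℕ.+ d ∎)
        where
          open ℕP.≤-Reasoning
          lem : ∀ k Y → k ℕ.* Y ℕ.+ 3 ℕ.* (k ℕ.* Y) ≡ 4 ℕ.* k ℕ.* Y
          lem = ℕsolve-∀

      H<m : H ℕ.< m
      H<m = ℕP.<-≤-trans (ℕP.≤-<-trans H≤yY₆ (ℕP.<-≤-trans (ℕP.m<m*n (y ℕ.* Y₆) y ⦃ ℕ.>-nonZero (ℕP.*-mono-≤ (ℕP.m^n>0 2 j) 1≤Y₆) ⦄ (ℕP.≤-trans (ℕP.≤ᵇ⇒≤ 2 8 tt) 8≤y)) (ℕP.≤-reflexive (trans (ℕP.*-comm (y ℕ.* Y₆) y) yyY₆))))
        (ℕP.≤-trans (ℕP.m≤n*m Y₈ κ ⦃ ℕ.>-nonZero (ℕP.≤-trans (ℕ.s≤s ℕ.z≤n) 12≤κ) ⦄) m-lower)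

      size-enough : 2 ℕ.* (6 ℕ.+ U₂) ℕ.≤ n
      size-enough = begin
        2 ℕ.* (6 ℕ.+ U₂) ≡⟨ lem U₂ ⟩
        12 ℕ.+ 2 ℕ.* U₂ ≤⟨ ℕP.+-monoˡ-≤ (2 ℕ.* U₂) (ℕP.≤-trans (ℕP.*-mono-≤ 12≤κ 1≤Y₈) (ℕP.m≤n*m U₂ 2)) ⟩
        2 ℕ.* (κ ℕ.* Y₈) ℕ.+ 2 ℕ.* (κ ℕ.* Y₈) ≡⟨ lem′ κ Y₈ ⟩
        4 ℕ.* κ ℕ.* Y₈ ≤⟨ ℕP.*-monoˡ-≤ Y₈ j-big ⟩
        y ℕ.* Y₈ ≡⟨ yY₈ ⟩
        2 ℕ.^ (9 ℕ.* j) ≤⟨ n-lower ⟩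
        n ∎
        where
          open ℕP.≤-Reasoning
          lem : ∀ u → 2 ℕ.* (6 ℕ.+ u) ≡ 12 ℕ.+ 2 ℕ.* u
          lem = ℕsolve-∀
          lem′ : ∀ k Y → 2 ℕ.* (k ℕ.* Y) ℕ.+ 2 ℕ.* (k ℕ.* Y) ≡ 4 ℕ.* k ℕ.* Y
          lem′ = ℕsolve-∀

    impossible : ⊥
    impossible = ThreeLogarithms.impossible C a₁ d₁ two-log (suc b′) m ℓ y H U₂ ζ (512 ℕ.* Y₈) 2≤b b≤ (ℕP.≤-trans (ℕP.n≤1+n 7) 8≤y) H<m 1≤ζ
      (λ δ → quotient-bound {δ} {y} {Y₈} (ℕP.m^n>0 2 j) yY₈ m≤n) (U-condition E₂≤) (ℕP.≤-trans (n-condition {Y = Y₈} E₂≤) m-lower) (ζ-condition m≤n)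
      g₀ g₁ 1≤g₀ 1≤g₁ int-g₀ (IsInt-weaken (ℕP.^-monoʳ-≤ 2 (ℕP.m≤m+n 10 d)) int-g₁) (size-close U₂ size-enough)

  private
    square : ∀ x → 3 ℕ.≤ x → suc x ℕ.* suc x ℕ.≤ 2 ℕ.* (x ℕ.* x)
    square x q = ℕP.≤-trans (ℕP.≤-reflexive (lem₁ x)) (ℕP.≤-trans (ℕP.+-monoˡ-≤ (x ℕ.* x) (ℕP.+-monoˡ-≤ (2 ℕ.* x) (ℕP.≤-trans (ℕ.s≤s ℕ.z≤n) q)))
        (ℕP.≤-trans (ℕP.≤-reflexive (lem₂ x)) (ℕP.≤-trans (ℕP.+-monoˡ-≤ (x ℕ.* x) (ℕP.*-monoˡ-≤ x q)) (ℕP.≤-reflexive (cong (x ℕ.* x ℕ.+_) (sym (ℕP.+-identityʳ _)))))))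
      where
        lem₁ : ∀ x → (1 ℕ.+ x) ℕ.* (1 ℕ.+ x) ≡ 1 ℕ.+ 2 ℕ.* x ℕ.+ x ℕ.* x
        lem₁ = ℕsolve-∀
        lem₂ : ∀ x → x ℕ.+ 2 ℕ.* x ℕ.+ x ℕ.* x ≡ 3 ℕ.* x ℕ.+ x ℕ.* x
        lem₂ = ℕsolve-∀

  growth : ∀ c k → 3 ℕ.≤ k → 4 ℕ.* (c ℕ.* (k ℕ.* k)) ℕ.≤ 2 ℕ.^ k → ∀ i → 4 ℕ.* (c ℕ.* ((i ℕ.+ k) ℕ.* (i ℕ.+ k))) ℕ.≤ 2 ℕ.^ (i ℕ.+ k)
  growth c k 3≤k base zero = base
  growth c k 3≤k base (suc i) = ℕP.≤-trans (ℕP.*-monoʳ-≤ 4 (ℕP.*-monoʳ-≤ c (square (i ℕ.+ k) (ℕP.≤-trans 3≤k (ℕP.m≤n+m k i)))))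
      (ℕP.≤-trans (ℕP.≤-reflexive (lem c ((i ℕ.+ k) ℕ.* (i ℕ.+ k)))) (ℕP.*-monoʳ-≤ 2 (growth c k 3≤k base i)))
    where
      lem : ∀ c s → 4 ℕ.* (c ℕ.* (2 ℕ.* s)) ≡ 2 ℕ.* (4 ℕ.* (c ℕ.* s))
      lem = ℕsolve-∀

  bracket : ∀ f k₀ n k → 2 ℕ.^ (f ℕ.* k₀) ℕ.≤ n → n ℕ.< 2 ℕ.^ (f ℕ.* (k ℕ.+ k₀)) → ∃ λ i → 2 ℕ.^ (f ℕ.* (i ℕ.+ k₀)) ℕ.≤ n × n ℕ.≤ 2 ℕ.^ f ℕ.* 2 ℕ.^ (f ℕ.* (i ℕ.+ k₀))
  bracket f k₀ n zero lo hi = ⊥-elim (ℕP.<⇒≱ hi lo)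
  bracket f k₀ n (suc k) lo hi = split (2 ℕ.^ (f ℕ.* (k ℕ.+ k₀)) ℕP.≤? n)
    where
      split : Dec (2 ℕ.^ (f ℕ.* (k ℕ.+ k₀)) ℕ.≤ n) → _
      split (yes q) = k , q , ℕP.≤-trans (ℕP.<⇒≤ hi) (ℕP.≤-reflexive (trans (cong (2 ℕ.^_) (ℕP.*-suc f (k ℕ.+ k₀))) (ℕP.^-distribˡ-+-* 2 f (f ℕ.* (k ℕ.+ k₀)))))
      split (no q) = bracket f k₀ n k lo (ℕP.≰⇒> q)

  module Bounded (C a₁ d₁ c₁ k₀ : ℕ) (two-log : TwoLog C a₁ d₁) (C≤ : C ℕ.* 100 ℕ.* 16384 ℕ.≤ c₁) (a≤ : a₁ ℕ.* 10 ℕ.* 16384 ℕ.≤ c₁)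
    (d≤ : 512 ℕ.* (1 ℕ.+ d₁ ℕ.* 30) ℕ.≤ c₁) (12≤c₁ : 12 ℕ.≤ c₁) (3≤k₀ : 3 ℕ.≤ k₀) (base : 4 ℕ.* (c₁ ℕ.* (k₀ ℕ.* k₀)) ℕ.≤ 2 ℕ.^ k₀) where

    bounded : ∀ {n m ℓ a b′} → Solution n m ℓ a b′ → n ℕ.< 2 ℕ.^ (9 ℕ.* k₀)
    bounded {n} sol = ℕP.≰⇒> λ lo → contradict (bracket 9 k₀ n n lo (ℕP.<-≤-trans (n<2^n n) (ℕP.^-monoʳ-≤ 2 (ℕP.≤-trans (ℕP.m≤m+n n k₀) (ℕP.m≤n*m (n ℕ.+ k₀) 9)))))
      where
        contradict : (∃ λ i → 2 ℕ.^ (9 ℕ.* (i ℕ.+ k₀)) ℕ.≤ n × n ℕ.≤ 2 ℕ.^ 9 ℕ.* 2 ℕ.^ (9 ℕ.* (i ℕ.+ k₀))) → ⊥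
        contradict (i , lo , hi) = Descent.impossible C a₁ d₁ c₁ two-log C≤ a≤ d≤ sol (i ℕ.+ k₀) (ℕP.≤-trans 3≤k₀ (ℕP.m≤n+m k₀ i)) 12≤c₁ (growth c₁ k₀ 3≤k₀ base i) lo hi

  -- 2⁵⁴ is above 2³³ · 100 · 2¹⁴, the largest of the three requirements on c₁, and j = 72 satisfies
  -- 4 · 2⁵⁴ j² ≤ 2^j.
  n-bounded : ∀ {n m ℓ a b′} → Solution n m ℓ a b′ → n ℕ.< 2 ℕ.^ (9 ℕ.* 72)
  n-bounded = Bounded.bounded (2 ℕ.^ 33) 400400 400000 (2 ℕ.^ 54) 72 two-log
        (ℕP.≤ᵇ⇒≤ (2 ℕ.^ 33 ℕ.* 100 ℕ.* 16384) (2 ℕ.^ 54) tt) (ℕP.≤ᵇ⇒≤ (400400 ℕ.* 10 ℕ.* 16384) (2 ℕ.^ 54) tt) (ℕP.≤ᵇ⇒≤ (512 ℕ.* (1 ℕ.+ 400000 ℕ.* 30)) (2 ℕ.^ 54) tt)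
        (ℕP.≤ᵇ⇒≤ 12 (2 ℕ.^ 54) tt) (ℕP.≤ᵇ⇒≤ 3 72 tt) (ℕP.≤ᵇ⇒≤ (4 ℕ.* (2 ℕ.^ 54 ℕ.* (72 ℕ.* 72))) (2 ℕ.^ 72) tt)

-- Computation of binary logarithms and of the reduction tables

module CertifiedLogs where

  open import Data.Nat using (_+_; _*_; _∸_; _^_; _/_; _%_; _<ᵇ_; _≤ᵇ_; NonZero)
  open import Data.Bool using (Bool; true; if_then_else_; _∧_)
  open import Data.List using (List; []; _∷_; map)

  -- Fixed-point arithmetic with unit one: if 2ᵉ l / one ≤ y ≤ 2ᵉ h / one, then low k e l and high k e h
  -- enclose log₂ of y to the power 2ᵏ.
  module Logs (one : ℕ) .⦃ _ : NonZero one ⦄ where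

    low high : ℕ → ℕ → ℕ → ℕ
    -- The default 0 is a valid lower bound because y ≥ 1.
    low zero e l = if one ≤ᵇ l then e else 0
    low (suc k) e l = halve (l * l / one)
      where halve : ℕ → ℕ
            halve l′ = if 2 * one ≤ᵇ l′ then low k (suc (e + e)) (l′ / 2) else low k (e + e) l′
    -- The default is crude but valid, since h < 2^h.
    high zero e h = if h ≤ᵇ 2 * one then suc e else e + h
    high (suc k) e h = halve (suc (h * h / one))
      where halve : ℕ → ℕ
            halve h′ = if 2 * one ≤ᵇ h′ then high k (suc (e + e)) (suc (h′ / 2)) else high k (e + e) h′

    -- Brings the mantissa below 2 before the squarings start. Eight halvings are enough for the
    -- integers up to 100, and two for a sum of two mantissas.
    lowest highest : ℕ → ℕ → ℕ → ℕ → ℕ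
    lowest k zero e l = low k e l
    lowest k (suc fuel) e l = if 2 * one ≤ᵇ l then lowest k fuel (suc e) (l / 2) else low k e l
    highest k zero e h = high k e h
    highest k (suc fuel) e h = if 2 * one ≤ᵇ h then highest k fuel (suc e) (suc (h / 2)) else high k e h

  -- For a power x of α, the numbers 2ᵉ l / one and 2ᵉ r / one approximate x and 1.
  record State : Set where
    constructor state
    field
      e l r : ℕ

  module Powers (one T : ℕ) .⦃ _ : NonZero one ⦄ where

    -- Both mantissas are halved together, so that their sum always represents 1 + x with the same
    -- exponent.
    next : State → State
    next (state e l r) = halve (l * T / one)
      where halve : ℕ → State
            halve l′ = if 2 * one ≤ᵇ l′ then state (suc e) (l′ / 2) (r / 2) else state e l′ r

    nextʰ : State → State
    nextʰ (state e h r) = halve (suc (h * suc T / one))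
      where halve : ℕ → State
            halve h′ = if 2 * one ≤ᵇ h′ then state (suc e) (suc (h′ / 2)) (suc (r / 2)) else state e h′ r

  -- Bisection for α in units of 1/one; the result is certified afterwards by two inequalities
  -- between cubes.
  root : ℕ → ℕ → ℕ → ℕ → ℕ
  root one zero lo w = lo
  root one (suc k) lo w = test (lo + w / 2)
    where test : ℕ → ℕ
          test m = if m * m * m ≤ᵇ m * m * one + one * one * one then root one k m (w / 2) else root one k lo (w / 2)

  -- x - y is further than W from every multiple of Λ; x and y are residues modulo Λ.
  far : ℕ → ℕ → ℕ → ℕ → Bool
  far Λ W x y = if y ≤ᵇ x then inside (x ∸ y) else inside ((x + Λ) ∸ y)
    where inside : ℕ → Bool
          inside z = (W <ᵇ z) ∧ (z + W <ᵇ Λ)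

  allᵇ : {A : Set} → (A → Bool) → List A → Bool
  allᵇ f [] = true
  allᵇ f (x ∷ xs) = f x ∧ allᵇ f xs

  record Row : Set where
    constructor row
    field
      Λ q W base : ℕ
      targets : List ℕ

  -- The denominator of the first convergent of a / c whose denominator reaches the bound; x and y are the last two denominators.
  convergent : ℕ → ℕ → ℕ → ℕ → ℕ → ℕ → ℕ
  convergent zero bound a c x y = y
  convergent (suc fuel) bound a zero x y = y
  convergent (suc fuel) bound a c@(suc _) x y = if bound ≤ᵇ y then y else convergent fuel bound c (a % c) y (x + (a / c) * y)

  residue : ℕ → ℕ → ℕ
  -- An arbitrary value: modulo 0 the test `far` always fails.
  residue x zero = 0
  residue x Λ@(suc _) = x % Λ

  distance : ℕ → ℕ → ℕ
  distance r Λ = if r + r ≤ᵇ Λ then r else Λ ∸ r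

  -- Logarithms have the unit 2^-k, `Nmax` bounds n, 2^-U is the closeness to be refuted and `qmin`
  -- the least useful denominator. Intermediate results are handed to local functions as arguments,
  -- so that each is computed once.
  module Pass (one k T : ℕ) .⦃ _ : NonZero one ⦄ (Nmax U qmin bases : ℕ) where

    open Logs one
    open Powers one T

    loN hiN : ℕ → ℕ
    loN n = lowest k 8 0 (n * one)
    hiN n = highest k 8 0 (n * one)

    loα hiα loC hiC : ℕ
    loα = low k 0 T
    hiα = high k 0 (suc T)
    loC = lowest k 8 0 (3 * T ∸ 2 * one)
    hiC = highest k 8 0 (3 * suc T ∸ 2 * one)

    -- Closeness 2^-U is an error of 2^(k - U) units; the other terms cover the inexact logarithms,
    -- of which about Nmax are added on each side.
    Δ : ℕ
    Δ = 2 ^ (k ∸ U) + 4 * Nmax + 26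

    -- For a fixed base, multiplication by the denominator q of a convergent of α/Λ makes the
    -- multiple of α almost vanish modulo Λ. Only the gap and the digit a remain, and these are
    -- finitely many; the table holds the residues for all a.
    makeRow : ℕ → ℕ → ℕ → List ℕ → ℕ → Row
    makeRow α C Λ logs base = go (convergent (2 * k) qmin α Λ 1 0)
      where go : ℕ → Row
            go q = row Λ q (Nmax * distance (residue (q * α) Λ) Λ + q * Δ) base (map (λ l → residue (q * (l + C)) Λ) logs)

    natlogs : ℕ → ℕ → List ℕ
    natlogs start zero = []
    natlogs start (suc n) = loN start ∷ natlogs (suc start) n

    -- The digits allowed in a base are those below it, so their logarithms accumulate in `seen` as
    -- the base grows.
    rows : ℕ → ℕ → List ℕ → ℕ → List ℕ → List Row
    rows α C seen current [] = []
    rows α C seen current (next ∷ rest) = makeRow α C next (current ∷ seen) current ∷ rows α C (current ∷ seen) next rest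

    rowOK : ℕ → Row → Bool
    rowOK λd (row Λ q W base targets) = test (residue (q * (base + λd)) Λ)
      where test : ℕ → Bool
            test x = allᵇ (far Λ W x) targets

    -- Visits the gaps d = 0, 1, 2, ...; the two states enclose α^d from below and above, and `λd`
    -- is the logarithm of 1 + α^d.
    walk : List Row → ℕ → State → State → Bool
    walk table zero s t = true
    walk table (suc n) s@(state e l r) t@(state e′ h r′) = test (lowest k 2 e (l + r))
      where test : ℕ → Bool
            test λd = (highest k 2 e′ (h + r′) ≤ᵇ λd + 2) ∧ (allᵇ (rowOK λd) table ∧ walk table n (next s) (nextʰ t))

    table : List Row
    table = rows loα loC [] (loN 1) (natlogs 2 bases)

    widthsN : ℕ → ℕ → Bool
    widthsN start zero = true
    widthsN start (suc n) = (hiN start ≤ᵇ loN start + 2) ∧ widthsN (suc start) n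

    check : ℕ → Bool
    check depth = withTable table
      where withTable : List Row → Bool
            withTable t = allᵇ (rowOK 0) t ∧ walk t depth (state 0 one one) (state 0 one one)

-- Correctness of the Baker-Davenport tests

module BakerDavenport where

  open import Data.Nat using (_+_; _*_; _∸_; _/_; _≤_; _<_; _<ᵇ_; _≤ᵇ_; NonZero; s≤s)
  open import Data.Bool using (Bool; true; false; if_then_else_; _∧_; T)
  open import Data.List using ([]; _∷_)
  open import Data.List.Membership.Propositional using (_∈_)
  open import Data.List.Membership.Propositional.Properties using (∈-map⁺)
  open import Data.List.Relation.Unary.Any using (here; there)
  open CertifiedLogs

  if-elim : ∀ {A : Set} (Q : A → Set) b {x y} → (T b → Q x) → (¬ T b → Q y) → Q (if b then x else y)
  if-elim Q true p q = p tt
  if-elim Q false p q = q λ ()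

  ∧-elim : ∀ {a b} → a ∧ b ≡ true → a ≡ true × b ≡ true
  ∧-elim {true} {true} e = refl , refl

  true⇒T : ∀ {b} → b ≡ true → T b
  true⇒T refl = tt

  allᵇ-∈ : ∀ {A : Set} (f : A → Bool) {x xs} → allᵇ f xs ≡ true → x ∈ xs → f x ≡ true
  allᵇ-∈ f e (here refl) = proj₁ (∧-elim e)
  allᵇ-∈ f e (there p) = allᵇ-∈ f (proj₂ (∧-elim e)) p

  private
    separated : ∀ {Λ W z i j} → z + i * Λ ≤ W + j * Λ → j * Λ ≤ z + i * Λ + W → W < z → z + W < Λ → ⊥
    separated {Λ} {W} {z} {i} {j} p q W<z z+W<Λ = split (j ℕP.≤? i)
      where
        split : Dec (j ≤ i) → ⊥
        split (yes j≤i) = ℕP.<⇒≱ W<z (ℕP.+-cancelʳ-≤ (j * Λ) z W (ℕP.≤-trans (ℕP.+-monoʳ-≤ z (ℕP.*-monoˡ-≤ Λ j≤i)) p))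
        split (no j≰i) = ℕP.<⇒≱ z+W<Λ (ℕP.+-cancelʳ-≤ (i * Λ) Λ (z + W) (ℕP.≤-trans (ℕP.*-monoˡ-≤ Λ (ℕP.≰⇒> j≰i)) (ℕP.≤-trans q (ℕP.≤-reflexive (lem z (i * Λ) W)))))
          where
            lem : ∀ z s W → z + s + W ≡ z + W + s
            lem = ℕsolve-∀

    Separated : ℕ → ℕ → ℕ → ℕ → Set
    Separated Λ W x y = ∃₂ λ z t → z + y ≡ x + t * Λ × W < z × z + W < Λ

    far-elim : ∀ Λ W x y → y ≤ x + Λ → far Λ W x y ≡ true → Separated Λ W x y
    far-elim Λ W x y y≤ = if-elim (λ b → b ≡ true → Separated Λ W x y) (y ≤ᵇ x)
      (λ p e → x ∸ y , 0 , trans (ℕP.m∸n+n≡m (ℕP.≤ᵇ⇒≤ y x p)) (sym (ℕP.+-identityʳ x)) , bounds (x ∸ y) e)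
      (λ _ e → (x + Λ) ∸ y , 1 , trans (ℕP.m∸n+n≡m y≤) (cong (x +_) (sym (ℕP.+-identityʳ Λ))) , bounds ((x + Λ) ∸ y) e)
      where
        bounds : ∀ z → (W <ᵇ z) ∧ (z + W <ᵇ Λ) ≡ true → W < z × z + W < Λ
        bounds z e = ℕP.<ᵇ⇒< W z (true⇒T (proj₁ (∧-elim e))) , ℕP.<ᵇ⇒< (z + W) Λ (true⇒T (proj₂ (∧-elim e)))

    residue-+ : ∀ x Λ .⦃ _ : NonZero Λ ⦄ → ∃ λ t → x ≡ residue x Λ + t * Λ
    residue-+ x Λ@(suc _) = x / Λ , DM.m≡m%n+[m/n]*n x Λ

    residue< : ∀ x Λ .⦃ _ : NonZero Λ ⦄ → residue x Λ < Λ
    residue< x Λ@(suc _) = DM.m%n<n x Λ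

    distance-cases : ∀ r Λ → r < Λ → distance r Λ ≡ r ⊎ r + distance r Λ ≡ Λ
    distance-cases r Λ r< = if-elim (λ e → e ≡ r ⊎ r + e ≡ Λ) (r + r ≤ᵇ Λ) (λ _ → inj₁ refl) (λ _ → inj₂ (ℕP.m+[n∸m]≡n (ℕP.<⇒≤ r<)))

    -- The common core of both signs of the distance: `s₁` and `s₂` are the shares of m‖qλ‖ put on
    -- either side, and their sum with qΔ must fit into W.
    move : ∀ {Λ q Δ W X L₁ ℓ z s₁ s₂ a b} → X ≤ L₁ + ℓ * Λ + Δ → L₁ + ℓ * Λ ≤ X + Δ →
      q * X + s₁ + a * Λ ≡ z + q * L₁ + s₂ + b * Λ → s₁ + s₂ + q * Δ ≤ W → W < z → z + W < Λ → ⊥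
    move {Λ} {q} {Δ} {W} {X} {L₁} {ℓ} {z} {s₁} {s₂} {a} {b} up lo e small = separated {i = b} {j = q * ℓ + a} below above
      where
        open ℕP.≤-Reasoning
        c₁ : ∀ q L₁ ℓ Λ Δ s₁ a → q * (L₁ + ℓ * Λ + Δ) + s₁ + a * Λ ≡ q * L₁ + (s₁ + q * Δ + (q * ℓ + a) * Λ)
        c₁ = ℕsolve-∀
        c₂ : ∀ z L s b → z + L + s + b ≡ L + (z + s + b)
        c₂ = ℕsolve-∀
        c₃ : ∀ q L₁ ℓ Λ a → q * L₁ + (q * ℓ + a) * Λ ≡ q * (L₁ + ℓ * Λ) + a * Λ
        c₃ = ℕsolve-∀
        c₄ : ∀ q X Δ s₁ a → q * (X + Δ) + a ≡ q * X + a + q * Δ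
        c₄ = ℕsolve-∀
        c₅ : ∀ z L s b d → z + L + s + b + d ≡ L + (z + b + (s + d))
        c₅ = ℕsolve-∀
        s₂≤ : s₂ + q * Δ ≤ W
        s₂≤ = ℕP.≤-trans (ℕP.+-monoˡ-≤ (q * Δ) (ℕP.m≤n+m s₂ s₁)) small
        s₁≤ : s₁ + q * Δ ≤ W
        s₁≤ = ℕP.≤-trans (ℕP.+-monoˡ-≤ (q * Δ) (ℕP.m≤m+n s₁ s₂)) small
        below : z + b * Λ ≤ W + (q * ℓ + a) * Λ
        below = ℕP.≤-trans (ℕP.+-monoˡ-≤ (b * Λ) (ℕP.m≤m+n z s₂)) (ℕP.≤-trans (ℕP.+-cancelˡ-≤ (q * L₁) _ _ (begin
          q * L₁ + (z + s₂ + b * Λ) ≡⟨ c₂ z (q * L₁) s₂ (b * Λ) ⟨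
          z + q * L₁ + s₂ + b * Λ ≡⟨ e ⟨
          q * X + s₁ + a * Λ ≤⟨ ℕP.+-monoˡ-≤ (a * Λ) (ℕP.+-monoˡ-≤ s₁ (ℕP.*-monoʳ-≤ q up)) ⟩
          q * (L₁ + ℓ * Λ + Δ) + s₁ + a * Λ ≡⟨ c₁ q L₁ ℓ Λ Δ s₁ a ⟩
          q * L₁ + (s₁ + q * Δ + (q * ℓ + a) * Λ) ∎)) (ℕP.+-monoˡ-≤ ((q * ℓ + a) * Λ) s₁≤))
        above : (q * ℓ + a) * Λ ≤ z + b * Λ + W
        above = ℕP.≤-trans (ℕP.+-cancelˡ-≤ (q * L₁) _ _ (begin
          q * L₁ + (q * ℓ + a) * Λ ≡⟨ c₃ q L₁ ℓ Λ a ⟩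
          q * (L₁ + ℓ * Λ) + a * Λ ≤⟨ ℕP.+-monoˡ-≤ (a * Λ) (ℕP.*-monoʳ-≤ q lo) ⟩
          q * (X + Δ) + a * Λ ≡⟨ c₄ q X Δ s₁ (a * Λ) ⟩
          q * X + a * Λ + q * Δ ≤⟨ ℕP.+-monoˡ-≤ (q * Δ) (ℕP.+-monoˡ-≤ (a * Λ) (ℕP.m≤m+n (q * X) s₁)) ⟩
          q * X + s₁ + a * Λ + q * Δ ≡⟨ cong (_+ q * Δ) e ⟩
          z + q * L₁ + s₂ + b * Λ + q * Δ ≡⟨ c₅ z (q * L₁) s₂ (b * Λ) (q * Δ) ⟩
          q * L₁ + (z + b * Λ + (s₂ + q * Δ)) ∎)) (ℕP.+-monoʳ-≤ (z + b * Λ) s₂≤)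

  -- If L₀ + mλ and L₁ + ℓΛ agree up to Δ, then modulo Λ the number q(L₀ - L₁) is as close to 0 as m‖qλ‖ + qΔ.
  baker-davenport : ∀ {Λ} .⦃ _ : NonZero Λ ⦄ q {λα L₀ L₁ m ℓ Δ Nmax} → m ≤ Nmax →
    L₀ + m * λα ≤ L₁ + ℓ * Λ + Δ → L₁ + ℓ * Λ ≤ L₀ + m * λα + Δ →
    far Λ (Nmax * distance (residue (q * λα) Λ) Λ + q * Δ) (residue (q * L₀) Λ) (residue (q * L₁) Λ) ≡ true → ⊥
  baker-davenport {Λ} q {λα} {L₀} {L₁} {m} {ℓ} {Δ} {Nmax} m≤ up lo check =
    conclude (far-elim Λ _ x₀ x₁ (ℕP.≤-trans (ℕP.<⇒≤ (residue< (q * L₁) Λ)) (ℕP.m≤n+m Λ x₀)) check) (distance-cases r Λ (residue< (q * λα) Λ))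
    where
      x₀ x₁ r e W A B S : ℕ
      x₀ = residue (q * L₀) Λ
      x₁ = residue (q * L₁) Λ
      r = residue (q * λα) Λ
      e = distance r Λ
      W = Nmax * e + q * Δ
      A = proj₁ (residue-+ (q * L₀) Λ)
      B = proj₁ (residue-+ (q * L₁) Λ)
      S = proj₁ (residue-+ (q * λα) Λ)
      open ≡-Reasoning
      e₀ : ∀ q L₀ m λα → q * (L₀ + m * λα) ≡ q * L₀ + m * (q * λα)
      e₀ = ℕsolve-∀
      e₁ : ∀ x₀ A B S m r s t Λ → (x₀ + A * Λ) + m * (r + S * Λ) + s + (t + B) * Λ ≡ (x₀ + t * Λ) + B * Λ + (m * r + s) + (A + m * S) * Λ
      e₁ = ℕsolve-∀
      e₂ : ∀ z x₁ y s u → (z + x₁) + y + s + u ≡ z + (x₁ + y) + s + u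
      e₂ = ℕsolve-∀
      shifted : ∀ {z t} s → z + x₁ ≡ x₀ + t * Λ → q * (L₀ + m * λα) + s + (t + B) * Λ ≡ z + q * L₁ + (m * r + s) + (A + m * S) * Λ
      shifted {z} {t} s eq = begin
        q * (L₀ + m * λα) + s + (t + B) * Λ ≡⟨ cong (λ w → w + s + (t + B) * Λ) (e₀ q L₀ m λα) ⟩
        q * L₀ + m * (q * λα) + s + (t + B) * Λ ≡⟨ cong₂ (λ u v → u + m * v + s + (t + B) * Λ) (proj₂ (residue-+ (q * L₀) Λ)) (proj₂ (residue-+ (q * λα) Λ)) ⟩
        (x₀ + A * Λ) + m * (r + S * Λ) + s + (t + B) * Λ ≡⟨ e₁ x₀ A B S m r s t Λ ⟩
        (x₀ + t * Λ) + B * Λ + (m * r + s) + (A + m * S) * Λ ≡⟨ cong (λ w → w + B * Λ + (m * r + s) + (A + m * S) * Λ) eq ⟨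
        (z + x₁) + B * Λ + (m * r + s) + (A + m * S) * Λ ≡⟨ e₂ z x₁ (B * Λ) (m * r + s) ((A + m * S) * Λ) ⟩
        z + (x₁ + B * Λ) + (m * r + s) + (A + m * S) * Λ ≡⟨ cong (λ w → z + w + (m * r + s) + (A + m * S) * Λ) (proj₂ (residue-+ (q * L₁) Λ)) ⟨
        z + q * L₁ + (m * r + s) + (A + m * S) * Λ ∎
      me≤ : m * e ≤ Nmax * e
      me≤ = ℕP.*-monoˡ-≤ e m≤
      conclude : Separated Λ W x₀ x₁ → e ≡ r ⊎ r + e ≡ Λ → ⊥
      conclude (z , t , eq , W< , <Λ) (inj₁ e≡r) =
        move {q = q} {ℓ = ℓ} {s₁ = 0} {s₂ = m * r + 0} {a = t + B} {b = A + m * S} up lo (shifted {t = t} 0 eq)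
          (ℕP.+-monoˡ-≤ (q * Δ) (ℕP.≤-trans (ℕP.≤-reflexive (trans (ℕP.+-identityʳ (m * r)) (cong (m *_) (sym e≡r)))) me≤)) W< <Λ
      -- If the distance is Λ - r, adding m (Λ - r) on both sides turns m r into a multiple of Λ.
      conclude (z , t , eq , W< , <Λ) (inj₂ r+e) =
        move {q = q} {ℓ = ℓ} {s₁ = m * e} {s₂ = 0} {a = t + B} {b = m + (A + m * S)} up lo
          (trans (shifted {t = t} (m * e) eq) (trans (cong (λ w → z + q * L₁ + w + (A + m * S) * Λ) (trans (sym (ℕP.*-distribˡ-+ m r e)) (cong (m *_) r+e))) (last z (q * L₁) m (A + m * S) Λ)))
          (ℕP.+-monoˡ-≤ (q * Δ) (ℕP.≤-trans (ℕP.≤-reflexive (ℕP.+-identityʳ (m * e))) me≤)) W< <Λ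
        where
          last : ∀ z y m t Λ → z + y + m * Λ + t * Λ ≡ z + y + 0 + (m + t) * Λ
          last = ℕsolve-∀

  baker-davenport₀ : ∀ Λ q {λα L₀ L₁ m ℓ Δ Nmax} → m ≤ Nmax →
    L₀ + m * λα ≤ L₁ + ℓ * Λ + Δ → L₁ + ℓ * Λ ≤ L₀ + m * λα + Δ →
    far Λ (Nmax * distance (residue (q * λα) Λ) Λ + q * Δ) (residue (q * L₀) Λ) (residue (q * L₁) Λ) ≡ true → ⊥
  baker-davenport₀ zero q m≤ up lo ()
  baker-davenport₀ Λ@(suc _) q {ℓ = ℓ} m≤ up lo check = baker-davenport q {ℓ = ℓ} m≤ up lo check

  orbit : {A : Set} → (A → A) → A → ℕ → A
  orbit f x zero = x
  orbit f x (suc n) = orbit f (f x) n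

  module Checks (one k T : ℕ) .⦃ _ : NonZero one ⦄ (Nmax U qmin bases : ℕ) where
    open Pass one k T Nmax U qmin bases
    open Logs one
    open Powers one T

    widthN : ∀ start n → widthsN start n ≡ true → ∀ b → start ≤ b → b < start + n → hiN b ≤ loN b + 2
    widthN start zero e b s≤b b< = ⊥-elim (ℕP.<⇒≱ b< (ℕP.≤-trans (ℕP.≤-reflexive (ℕP.+-identityʳ start)) s≤b))
    widthN start (suc n) e b s≤b b< = split (ℕP.m≤n⇒m<n∨m≡n s≤b)
      where
        split : start < b ⊎ start ≡ b → hiN b ≤ loN b + 2
        split (inj₂ refl) = ℕP.≤ᵇ⇒≤ _ _ (true⇒T (proj₁ (∧-elim e)))
        split (inj₁ s<b) = widthN (suc start) n (proj₂ (∧-elim e)) b s<b (ℕP.<-≤-trans b< (ℕP.≤-reflexive (ℕP.+-suc start n)))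

    -- The invariant is that `seen` contains the logarithms of all a < s. The row of `b′` is reached
    -- at s = b′, where its own logarithm is added, so digits up to `b′` are covered.
    row-∈ : ∀ α C (f : Row → Bool) n s seen → (∀ a → 1 ≤ a → a < s → loN a ∈ seen) →
      allᵇ f (rows α C seen (loN s) (natlogs (suc s) n)) ≡ true → ∀ b′ → s ≤ b′ → b′ < s + n →
      ∃ λ logs → (∀ a → 1 ≤ a → a ≤ b′ → loN a ∈ logs) × f (makeRow α C (loN (suc b′)) logs (loN b′)) ≡ true
    row-∈ α C f zero s seen inv e b′ s≤ b′< = ⊥-elim (ℕP.<⇒≱ b′< (ℕP.≤-trans (ℕP.≤-reflexive (ℕP.+-identityʳ s)) s≤))
    row-∈ α C f (suc n) s seen inv e b′ s≤ b′< = split (ℕP.m≤n⇒m<n∨m≡n s≤)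
      where
        extended : ∀ a → 1 ≤ a → a < suc s → loN a ∈ loN s ∷ seen
        extended a 1≤a (s≤s a≤s) = pick (ℕP.m≤n⇒m<n∨m≡n a≤s)
          where
            pick : a < s ⊎ a ≡ s → loN a ∈ loN s ∷ seen
            pick (inj₁ a<s) = there (inv a 1≤a a<s)
            pick (inj₂ refl) = here refl
        split : s < b′ ⊎ s ≡ b′ → ∃ λ logs → (∀ a → 1 ≤ a → a ≤ b′ → loN a ∈ logs) × f (makeRow α C (loN (suc b′)) logs (loN b′)) ≡ true
        split (inj₁ s<) = row-∈ α C f n (suc s) (loN s ∷ seen) extended (proj₂ (∧-elim e)) b′ s< (ℕP.<-≤-trans b′< (ℕP.≤-reflexive (ℕP.+-suc s n)))
        split (inj₂ refl) = loN s ∷ seen , (λ a 1≤a a≤s → extended a 1≤a (s≤s a≤s)) , proj₁ (∧-elim e)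

    walk-at : ∀ rs n s t → walk rs n s t ≡ true → ∀ i → i < n → let s′ = orbit next s i ; t′ = orbit nextʰ t i in
      (highest k 2 (State.e t′) (State.l t′ + State.r t′) ≤ lowest k 2 (State.e s′) (State.l s′ + State.r s′) + 2) ×
      allᵇ (rowOK (lowest k 2 (State.e s′) (State.l s′ + State.r s′))) rs ≡ true
    walk-at rs (suc n) s t e i i< = pick i i<
      where
        lo hi : ℕ
        lo = lowest k 2 (State.e s) (State.l s + State.r s)
        hi = highest k 2 (State.e t) (State.l t + State.r t)
        here-and-there : (hi ≤ᵇ lo + 2) ≡ true × (allᵇ (rowOK lo) rs ∧ walk rs n (next s) (nextʰ t)) ≡ true
        here-and-there = ∧-elim {hi ≤ᵇ lo + 2} e
        rest : allᵇ (rowOK lo) rs ≡ true × walk rs n (next s) (nextʰ t) ≡ true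
        rest = ∧-elim {allᵇ (rowOK lo) rs} (proj₂ here-and-there)
        pick : ∀ i → i < suc n → let s′ = orbit next s i ; t′ = orbit nextʰ t i in
          (highest k 2 (State.e t′) (State.l t′ + State.r t′) ≤ lowest k 2 (State.e s′) (State.l s′ + State.r s′) + 2) ×
          allᵇ (rowOK (lowest k 2 (State.e s′) (State.l s′ + State.r s′))) rs ≡ true
        pick zero _ = ℕP.≤ᵇ⇒≤ hi (lo + 2) (true⇒T (proj₁ here-and-there)) , proj₁ rest
        pick (suc i) (s≤s i<n) = walk-at rs n (next s) (nextʰ t) (proj₂ rest) i i<n

    makeRow-sound : ∀ α C Λ logs base λd → rowOK λd (makeRow α C Λ logs base) ≡ true → ∀ l → l ∈ logs → ∀ {m ℓ} → m ≤ Nmax →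
      (base + λd) + m * α ≤ (l + C) + ℓ * Λ + Δ → (l + C) + ℓ * Λ ≤ (base + λd) + m * α + Δ → ⊥
    makeRow-sound α C Λ logs base λd ok l l∈ {m} {ℓ} m≤ up lo = baker-davenport₀ Λ q {ℓ = ℓ} m≤ up lo
        (allᵇ-∈ (far Λ (Nmax * distance (residue (q * α) Λ) Λ + q * Δ) (residue (q * (base + λd)) Λ)) ok (∈-map⁺ (λ l → residue (q * (l + C)) Λ) l∈))
      where
        q : ℕ
        q = convergent (2 * k) qmin α Λ 1 0

    -- λd is the logarithm of the extra factor of the left-hand side.
    row-sound : ∀ λd → allᵇ (rowOK λd) table ≡ true →
      ∀ {b′ a m ℓ} → 1 ≤ b′ → b′ ≤ bases → 1 ≤ a → a ≤ b′ → m ≤ Nmax →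
      (loN b′ + λd) + m * loα ≤ (loN a + loC) + ℓ * loN (suc b′) + Δ → (loN a + loC) + ℓ * loN (suc b′) ≤ (loN b′ + λd) + m * loα + Δ → ⊥
    row-sound λd e {b′} {a} {m} {ℓ} 1≤b′ b′≤bases 1≤a a≤b′ m≤ up lo = conclude (row-∈ loα loC (rowOK λd) bases 1 [] (λ a 1≤a a<1 → ⊥-elim (ℕP.<⇒≱ a<1 1≤a)) e b′ 1≤b′ (s≤s b′≤bases))
      where
        Λ : ℕ
        Λ = loN (suc b′)
        conclude : (∃ λ logs → (∀ a → 1 ≤ a → a ≤ b′ → loN a ∈ logs) × rowOK λd (makeRow loα loC Λ logs (loN b′)) ≡ true) → ⊥
        conclude (logs , mem , ok) = makeRow-sound loα loC Λ logs (loN b′) λd ok (loN a) (mem a 1≤a a≤b′) {m} {ℓ} m≤ up lo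

-- Soundness of the computed logarithms

module LogSoundness (F : NarayanaField) where

  open import Data.Nat using (NonZero; _≤ᵇ_)
  open import Data.Bool using (T)
  open NarayanaField F using (α; α-root; orderedField)
  open OrderedFieldTheory orderedField
  open CertifiedLogs
  open BakerDavenport
  open Integrality F
  open TwoLogEstimate F
  open TwoLogParameters F using (n<2^n)

  m/n*n≤m : ∀ m n .⦃ _ : NonZero n ⦄ → (m ℕ./ n) ℕ.* n ℕ.≤ m
  m/n*n≤m m n = DM.m/n*n≤m m n

  m≤[1+m/n]*n : ∀ m n .⦃ _ : NonZero n ⦄ → m ℕ.≤ suc (m ℕ./ n) ℕ.* n
  m≤[1+m/n]*n m n = ℕP.≤-trans (ℕP.≤-reflexive (DM.m≡m%n+[m/n]*n m n)) (ℕP.+-monoˡ-≤ ((m ℕ./ n) ℕ.* n) (ℕP.<⇒≤ (DM.m%n<n m n)))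

  module Certified (one : ℕ) ⦃ nz : NonZero one ⦄ where
    open Logs one

    o : Carrier
    o = fromℕ one

    1≤one : 1 ℕ.≤ one
    1≤one = ℕ.>-nonZero⁻¹ one

    o-pos : Pos o
    o-pos = Pos-fromℕ 1≤one

    o-nn : NonNeg o
    o-nn = inj₁ o-pos

    mul-low : ∀ {A B y z} l m → NonNeg A → NonNeg B → A * fromℕ l ≤ y * o → B * fromℕ m ≤ z * o → A * B * fromℕ (l ℕ.* m ℕ./ one) ≤ y * z * o
    mul-low {A} {B} {y} {z} l m nA nB p q = *-cancelˡ-≤ o-pos (≤-trans
      (≤-reflexive (solve 4 (λ o a b x → o :* (a :* b :* x) := a :* b :* (x :* o)) refl o A B (fromℕ (l ℕ.* m ℕ./ one))))
      (≤-trans (*-monoˡ-≤ (nn-* nA nB) (≤-trans (≤-reflexive (sym (fromℕ-* (l ℕ.* m ℕ./ one) one))) (≤-trans (fromℕ-mono-≤ (m/n*n≤m (l ℕ.* m) one)) (≤-reflexive (fromℕ-* l m)))))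
      (≤-trans (≤-reflexive (solve 4 (λ a b l m → a :* b :* (l :* m) := (a :* l) :* (b :* m)) refl A B (fromℕ l) (fromℕ m)))
      (≤-trans (*-mono-≤ (nn-* nA (nn-fromℕ l)) p (≤⇒nn (nn-* nB (nn-fromℕ m)) q) q)
        (≤-reflexive (solve 3 (λ o y z → (y :* o) :* (z :* o) := o :* (y :* z :* o)) refl o y z))))))

    mul-high : ∀ {A B y z} l m → NonNeg A → NonNeg B → NonNeg y → NonNeg z → y * o ≤ A * fromℕ l → z * o ≤ B * fromℕ m → y * z * o ≤ A * B * fromℕ (suc (l ℕ.* m ℕ./ one))
    mul-high {A} {B} {y} {z} l m nA nB ny nz p q = *-cancelˡ-≤ o-pos (≤-trans
      (≤-reflexive (solve 3 (λ o y z → o :* (y :* z :* o) := (y :* o) :* (z :* o)) refl o y z))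
      (≤-trans (*-mono-≤ (nn-* ny o-nn) p (nn-* nB (nn-fromℕ m)) q)
      (≤-trans (≤-reflexive (solve 4 (λ a b l m → (a :* l) :* (b :* m) := a :* b :* (l :* m)) refl A B (fromℕ l) (fromℕ m)))
      (≤-trans (*-monoˡ-≤ (nn-* nA nB) (≤-trans (≤-reflexive (sym (fromℕ-* l m))) (≤-trans (fromℕ-mono-≤ (m≤[1+m/n]*n (l ℕ.* m) one)) (≤-reflexive (fromℕ-* (suc (l ℕ.* m ℕ./ one)) one)))))
        (≤-reflexive (solve 4 (λ o a b x → a :* b :* (x :* o) := o :* (a :* b :* x)) refl o A B (fromℕ (suc (l ℕ.* m ℕ./ one)))))))))

    halve-low : ∀ e l → P (suc e) * fromℕ (l ℕ./ 2) ≤ P e * fromℕ l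
    halve-low e l = ≤-trans (≤-reflexive (trans (solve 3 (λ t p x → (t :* p) :* x := p :* (x :* t)) refl two (P e) (fromℕ (l ℕ./ 2))) (cong (P e *_) (sym (fromℕ-* (l ℕ./ 2) 2)))))
      (*-monoˡ-≤ (P-nn e) (fromℕ-mono-≤ (m/n*n≤m l 2)))

    halve-high : ∀ e h → P e * fromℕ h ≤ P (suc e) * fromℕ (suc (h ℕ./ 2))
    halve-high e h = ≤-trans (*-monoˡ-≤ (P-nn e) (fromℕ-mono-≤ (m≤[1+m/n]*n h 2)))
      (≤-reflexive (trans (cong (P e *_) (fromℕ-* (suc (h ℕ./ 2)) 2)) (solve 3 (λ t p x → p :* (x :* t) := (t :* p) :* x) refl two (P e) (fromℕ (suc (h ℕ./ 2))))))

    Low High : Carrier → ℕ → ℕ → Set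
    Low y e l = P e * fromℕ l ≤ y * o
    High y e h = y * o ≤ P e * fromℕ h

    ^2 : ∀ y k → (y * y) ^ (2 ℕ.^ k) ≡ y ^ (2 ℕ.^ suc k)
    ^2 y k = sym (trans (^-* y 2 (2 ℕ.^ k)) (cong (_^ (2 ℕ.^ k)) (cong (y *_) (*-identityʳ y))))

    square-low : ∀ {y} e l → Low y e l → Low (y * y) (e ℕ.+ e) (l ℕ.* l ℕ./ one)
    square-low {y} e l p = ≤-trans (≤-reflexive (cong (_* fromℕ (l ℕ.* l ℕ./ one)) (^-+ two e e))) (mul-low l l (P-nn e) (P-nn e) p p)

    square-high : ∀ {y} e h → NonNeg y → High y e h → High (y * y) (e ℕ.+ e) (suc (h ℕ.* h ℕ./ one))
    square-high {y} e h ny p = ≤-trans (mul-high h h (P-nn e) (P-nn e) ny ny p p) (≤-reflexive (cong (_* fromℕ (suc (h ℕ.* h ℕ./ one))) (sym (^-+ two e e))))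

    1≤square : ∀ {y} → 1# ≤ y → 1# ≤ y * y
    1≤square {y} p = ≤-trans p (≤-trans (≤-reflexive (sym (*-identityʳ y))) (*-monoˡ-≤ (inj₁ (1≤⇒Pos p)) p))

    low-sound : ∀ k {y} e l → 1# ≤ y → Low y e l → P (low k e l) ≤ y ^ (2 ℕ.^ k)
    low-sound zero {y} e l 1≤y p = if-elim (λ x → P x ≤ y ^ 1) (one ≤ᵇ l)
      (λ b → *-cancelˡ-≤ o-pos (≤-trans (≤-reflexive (*-comm o (P e))) (≤-trans (*-monoˡ-≤ (P-nn e) (fromℕ-mono-≤ (ℕP.≤ᵇ⇒≤ one l b))) (≤-trans p (≤-reflexive (solve 2 (λ y o → y :* o := o :* (y :* # 1)) refl y o))))))
      (λ _ → ≤-trans 1≤y (≤-reflexive (sym (*-identityʳ y))))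
    low-sound (suc k) {y} e l 1≤y p = if-elim (λ x → P x ≤ y ^ (2 ℕ.^ suc k)) (2 ℕ.* one ≤ᵇ l′)
      (λ _ → ≤-trans (low-sound k (suc (e ℕ.+ e)) (l′ ℕ./ 2) (1≤square 1≤y) (≤-trans (halve-low (e ℕ.+ e) l′) (square-low e l p))) (≤-reflexive (^2 y k)))
      (λ _ → ≤-trans (low-sound k (e ℕ.+ e) l′ (1≤square 1≤y) (square-low e l p)) (≤-reflexive (^2 y k)))
      where
        l′ : ℕ
        l′ = l ℕ.* l ℕ./ one

    high-sound : ∀ k {y} e h → NonNeg y → High y e h → y ^ (2 ℕ.^ k) ≤ P (high k e h)
    high-sound zero {y} e h ny p = if-elim (λ x → y ^ 1 ≤ P x) (h ≤ᵇ 2 ℕ.* one)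
      (λ b → bound {fromℕ 2} (≤-trans (*-monoˡ-≤ (P-nn e) (≤-trans (fromℕ-mono-≤ (ℕP.≤ᵇ⇒≤ h (2 ℕ.* one) b)) (≤-reflexive (fromℕ-* 2 one)))) (≤-reflexive (solve 3 (λ p t o → p :* (t :* o) := t :* p :* o) refl (P e) two o))))
      (λ _ → ≤-trans (bound {P h} (≤-trans (*-monoˡ-≤ (P-nn e) (≤-trans (fromℕ≤P {h} {h} (ℕP.<⇒≤ (n<2^n h))) (≤-trans (≤-reflexive (sym (*-identityʳ (P h)))) (*-monoˡ-≤ (P-nn h) (fromℕ-mono-≤ {1} 1≤one)))))
        (≤-reflexive (solve 3 (λ p t o → p :* (t :* o) := t :* p :* o) refl (P e) (P h) o)))) (≤-reflexive (trans (*-comm (P h) (P e)) (sym (^-+ two e h)))))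
      where
        bound : ∀ {t} → P e * fromℕ h ≤ t * P e * o → y ^ 1 ≤ t * P e
        bound {t} q = *-cancelˡ-≤ o-pos (≤-trans (≤-reflexive (solve 2 (λ y o → o :* (y :* # 1) := y :* o) refl y o)) (≤-trans p (≤-trans q (≤-reflexive (*-comm (t * P e) o)))))
    high-sound (suc k) {y} e h ny p = if-elim (λ x → y ^ (2 ℕ.^ suc k) ≤ P x) (2 ℕ.* one ≤ᵇ h′)
      (λ _ → ≤-trans (≤-reflexive (sym (^2 y k))) (high-sound k (suc (e ℕ.+ e)) (suc (h′ ℕ./ 2)) (nn-* ny ny) (≤-trans (square-high e h ny p) (halve-high (e ℕ.+ e) h′))))
      (λ _ → ≤-trans (≤-reflexive (sym (^2 y k))) (high-sound k (e ℕ.+ e) h′ (nn-* ny ny) (square-high e h ny p)))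
      where
        h′ : ℕ
        h′ = suc (h ℕ.* h ℕ./ one)

    lowest-sound : ∀ k fuel {y} e l → 1# ≤ y → Low y e l → P (lowest k fuel e l) ≤ y ^ (2 ℕ.^ k)
    lowest-sound k zero e l 1≤y p = low-sound k e l 1≤y p
    lowest-sound k (suc fuel) {y} e l 1≤y p = if-elim (λ x → P x ≤ y ^ (2 ℕ.^ k)) (2 ℕ.* one ≤ᵇ l)
      (λ _ → lowest-sound k fuel (suc e) (l ℕ./ 2) 1≤y (≤-trans (halve-low e l) p)) (λ _ → low-sound k e l 1≤y p)

    highest-sound : ∀ k fuel {y} e h → NonNeg y → High y e h → y ^ (2 ℕ.^ k) ≤ P (highest k fuel e h)
    highest-sound k zero e h ny p = high-sound k e h ny p
    highest-sound k (suc fuel) {y} e h ny p = if-elim (λ x → y ^ (2 ℕ.^ k) ≤ P x) (2 ℕ.* one ≤ᵇ h)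
      (λ _ → highest-sound k fuel (suc e) (suc (h ℕ./ 2)) ny (≤-trans p (halve-high e h))) (λ _ → high-sound k e h ny p)

    natural : ∀ n → P 0 * fromℕ (n ℕ.* one) ≡ fromℕ n * o
    natural n = trans (*-identityˡ _) (fromℕ-* n one)

    module Root (T : ℕ) (below : T ℕ.* T ℕ.* T ℕ.≤ T ℕ.* T ℕ.* one ℕ.+ one ℕ.* one ℕ.* one)
      (above : suc T ℕ.* suc T ℕ.* one ℕ.+ one ℕ.* one ℕ.* one ℕ.≤ suc T ℕ.* suc T ℕ.* suc T) where
      open Powers one T

      cube : ∀ x → fromℕ (x ℕ.* x ℕ.* x) ≡ fromℕ x * fromℕ x * fromℕ x
      cube x = trans (fromℕ-* (x ℕ.* x) x) (cong (_* fromℕ x) (fromℕ-* x x))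

      right : ∀ x → fromℕ (x ℕ.* x ℕ.* one ℕ.+ one ℕ.* one ℕ.* one) ≡ fromℕ x * fromℕ x * o + o * o * o
      right x = trans (fromℕ-+ (x ℕ.* x ℕ.* one) (one ℕ.* one ℕ.* one)) (cong₂ _+_ (trans (fromℕ-* (x ℕ.* x) one) (cong (_* o) (fromℕ-* x x))) (cube one))

      a : Carrier
      a = α * o

      a-root : a * a * a ≡ a * a * o + o * o * o
      a-root = trans (solve 2 (λ α o → α :* o :* (α :* o) :* (α :* o) := (α :* α :* α) :* (o :* o :* o)) refl α o)
        (trans (cong (_* (o * o * o)) α-root) (solve 2 (λ α o → (α :* α :+ # 1) :* (o :* o :* o) := α :* o :* (α :* o) :* o :+ o :* o :* o) refl α o))

      o≤a : o ≤ a
      o≤a = ≤-trans (≤-reflexive (sym (*-identityˡ o))) (*-monoʳ-≤ o-nn (<⇒≤ α>1))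

      -- It suffices that the larger argument is at least `o`. Comparing values of x³ - o x² then
      -- locates the scaled root between T and T + 1.
      increasing : ∀ {x y} → Pos x → o ≤ y → x < y → x * x * x - x * x * o < y * y * y - y * y * o
      increasing {x} {y} px o≤y x<y = <-by (solve 3 (λ x y o → (y :- x) :* ((y :+ x) :* (y :- o)) :+ (y :- x) :* (x :* x) := (y :* y :* y :- y :* y :* o) :- (x :* x :* x :- x :* x :* o)) refl x y o)
        (np-+ (nn-* (inj₁ x<y) (nn-* (nn-+ (≤⇒nn o-nn o≤y) (inj₁ px)) o≤y)) (Pos-* x<y (Pos-* px px)))

      o³ : Carrier
      o³ = o * o * o

      a-value : a * a * a - a * a * o ≡ o³
      a-value = trans (cong (_- a * a * o) a-root) (solve 2 (λ u v → (u :+ v) :- u := v) refl (a * a * o) o³)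

      a-pos : Pos a
      a-pos = Pos-* (1≤⇒Pos (<⇒≤ α>1)) o-pos

      T≤a : fromℕ T ≤ a
      T≤a = pick (≤-or-> (fromℕ T) a)
        where
          t : Carrier
          t = fromℕ T
          small : t * t * t - t * t * o ≤ a * a * a - a * a * o
          small = ≤-trans (≤-by (solve 3 (λ x y z → (y :+ z) :- x := z :- (x :- y)) refl (t * t * t) (t * t * o) o³)
            (subst₂ _≤_ (cube T) (right T) (fromℕ-mono-≤ below))) (≤-reflexive (sym a-value))
          pick : t ≤ a ⊎ a < t → t ≤ a
          pick (inj₁ q) = q
          pick (inj₂ q) = ⊥-elim (≤⇒≯ small (increasing a-pos (≤-trans o≤a (<⇒≤ q)) q))

      a≤T : a ≤ fromℕ (suc T)
      a≤T = pick (≤-or-> a (fromℕ (suc T)))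
        where
          t : Carrier
          t = fromℕ (suc T)
          large : a * a * a - a * a * o ≤ t * t * t - t * t * o
          large = ≤-trans (≤-reflexive a-value) (≤-by (solve 3 (λ x y z → x :- (y :+ z) := (x :- y) :- z) refl (t * t * t) (t * t * o) o³)
            (subst₂ _≤_ (right (suc T)) (cube (suc T)) (fromℕ-mono-≤ above)))
          pick : a ≤ t ⊎ t < a → a ≤ t
          pick (inj₁ q) = q
          pick (inj₂ q) = ⊥-elim (≤⇒≯ large (increasing (Pos-suc T) o≤a q))

      StateLow StateHigh : Carrier → State → Set
      StateLow x (state e l r) = Low x e l × P e * fromℕ r ≤ o
      StateHigh x (state e h r) = High x e h × o ≤ P e * fromℕ r

      next-low : ∀ {x} s → StateLow x s → StateLow (x * α) (next s)
      next-low {x} (state e l r) (p , q) = if-elim (StateLow (x * α)) (2 ℕ.* one ≤ᵇ l′)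
        (λ _ → ≤-trans (halve-low e l′) stepped , ≤-trans (halve-low e r) q) (λ _ → stepped , q)
        where
          l′ : ℕ
          l′ = l ℕ.* T ℕ./ one
          stepped : Low (x * α) e l′
          stepped = ≤-trans (≤-reflexive (cong (_* fromℕ l′) (sym (*-identityʳ (P e))))) (mul-low l T (P-nn e) nn-1 p (≤-trans (≤-reflexive (*-identityˡ (fromℕ T))) T≤a))

      next-high : ∀ {x} s → NonNeg x → StateHigh x s → StateHigh (x * α) (nextʰ s)
      next-high {x} (state e h r) nx (p , q) = if-elim (StateHigh (x * α)) (2 ℕ.* one ≤ᵇ h′)
        (λ _ → ≤-trans stepped (halve-high e h′) , ≤-trans q (halve-high e r)) (λ _ → stepped , q)
        where
          h′ : ℕ
          h′ = suc (h ℕ.* suc T ℕ./ one)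
          stepped : High (x * α) e h′
          stepped = ≤-trans (mul-high h (suc T) (P-nn e) nn-1 nx α-nn p (≤-trans a≤T (≤-reflexive (sym (*-identityˡ (fromℕ (suc T))))))) (≤-reflexive (cong (_* fromℕ h′) (*-identityʳ (P e))))

      shift : ∀ x i → x * α * α ^ i ≡ x * α ^ suc i
      shift x i = *-assoc x α (α ^ i)

      orbit-low : ∀ i {x} s → StateLow x s → StateLow (x * α ^ i) (orbit next s i)
      orbit-low zero {x} s p = subst (λ z → StateLow z s) (sym (*-identityʳ x)) p
      orbit-low (suc i) {x} s p = subst (λ z → StateLow z (orbit next (next s) i)) (shift x i) (orbit-low i (next s) (next-low s p))

      orbit-high : ∀ i {x} s → NonNeg x → StateHigh x s → StateHigh (x * α ^ i) (orbit nextʰ s i)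
      orbit-high zero {x} s nx p = subst (λ z → StateHigh z s) (sym (*-identityʳ x)) p
      orbit-high (suc i) {x} s nx p = subst (λ z → StateHigh z (orbit nextʰ (nextʰ s) i)) (shift x i) (orbit-high i (nextʰ s) (nn-* nx α-nn) (next-high s nx p))

      sum-low : ∀ {x} s → StateLow x s → Low (1# + x) (State.e s) (State.l s ℕ.+ State.r s)
      sum-low {x} (state e l r) (p , q) = ≤-trans (≤-reflexive (trans (cong (P e *_) (fromℕ-+ l r)) (distribˡ (P e) (fromℕ l) (fromℕ r))))
        (≤-trans (+-mono-≤ p q) (≤-reflexive (solve 2 (λ x o → x :* o :+ o := (# 1 :+ x) :* o) refl x o)))

      sum-high : ∀ {x} s → StateHigh x s → High (1# + x) (State.e s) (State.l s ℕ.+ State.r s)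
      sum-high {x} (state e l r) (p , q) = ≤-trans (≤-reflexive (solve 2 (λ x o → (# 1 :+ x) :* o := x :* o :+ o) refl x o))
        (≤-trans (+-mono-≤ p q) (≤-reflexive (sym (trans (cong (P e *_) (fromℕ-+ l r)) (distribˡ (P e) (fromℕ l) (fromℕ r))))))

      start-low : StateLow 1# (state 0 one one)
      start-low = ≤-refl , ≤-reflexive (*-identityˡ o)

      start-high : StateHigh 1# (state 0 one one)
      start-high = ≤-refl , ≤-reflexive (sym (*-identityˡ o))

      gap-low : ∀ k d → let s = orbit next (state 0 one one) d in P (lowest k 2 (State.e s) (State.l s ℕ.+ State.r s)) ≤ (1# + α ^ d) ^ (2 ℕ.^ k)
      gap-low k d = lowest-sound k 2 (State.e s) (State.l s ℕ.+ State.r s) (≤-by (solve 1 (λ x → x := (# 1 :+ x) :- # 1) refl (α ^ d)) (nn-^ d α-nn))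
        (subst (λ z → Low (1# + z) (State.e s) (State.l s ℕ.+ State.r s)) (*-identityˡ (α ^ d)) (sum-low s (orbit-low d (state 0 one one) start-low)))
        where
          s : State
          s = orbit next (state 0 one one) d

      gap-high : ∀ k d → let s = orbit nextʰ (state 0 one one) d in (1# + α ^ d) ^ (2 ℕ.^ k) ≤ P (highest k 2 (State.e s) (State.l s ℕ.+ State.r s))
      gap-high k d = highest-sound k 2 (State.e s) (State.l s ℕ.+ State.r s) (nn-+ nn-1 (nn-^ d α-nn))
        (subst (λ z → High (1# + z) (State.e s) (State.l s ℕ.+ State.r s)) (*-identityˡ (α ^ d)) (sum-high s (orbit-high d (state 0 one one) nn-1 start-high)))
        where
          s : State
          s = orbit nextʰ (state 0 one one) d

-- From closeness to inequalities between integer logarithms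

module Reductions (F : NarayanaField) where

  open import Data.Nat using (NonZero)
  open import Data.Bool using (true)
  open NarayanaField F using (α; orderedField)
  open OrderedFieldTheory orderedField
  open Defs using (N)
  open CertifiedLogs
  open BakerDavenport
  open Equation
  open Integrality F
  open TwoLogEstimate F
  open LinearForms F using (c; 1≤c; module Forms)
  open LogSoundness F

  2^-cancel-≤ : ∀ {a b} → 2 ℕ.^ a ℕ.≤ 2 ℕ.^ b → a ℕ.≤ b
  2^-cancel-≤ {a} {b} p = ℕP.≮⇒≥ λ q → ℕP.<⇒≱ (ℕP.^-monoʳ-< 2 (ℕP.≤ᵇ⇒≤ 2 2 tt) q) p

  P-cancel-≤ : ∀ {a b} → P a ≤ P b → a ℕ.≤ b
  P-cancel-≤ {a} {b} p = 2^-cancel-≤ (fromℕ-cancel-≤ (subst₂ _≤_ (sym (fromℕ-2^ a)) (sym (fromℕ-2^ b)) p))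

  -- The inequality (1 - 1/u)^n ≥ 1 - n/u multiplied by u^(n+1).
  bernoulli : ∀ {u} → 1# ≤ u → ∀ n → u ^ n * (u - fromℕ n) ≤ u * (u - 1#) ^ n
  bernoulli {u} 1≤u zero = ≤-reflexive (solve 1 (λ u → # 1 :* (u :- # 0) := u :* # 1) refl u)
  bernoulli {u} 1≤u (suc n) = ≤-trans (≤-by (trans (solve 3 (λ u p n → p :* n := (u :- # 1) :* (p :* (u :- n)) :- u :* p :* (u :- (# 1 :+ n))) refl u (u ^ n) (fromℕ n)) (cong (λ z → (u - 1#) * (u ^ n * (u - fromℕ n)) - u * u ^ n * (u - z)) (sym (fromℕ-suc n)))) (nn-* (nn-^ n (inj₁ (1≤⇒Pos 1≤u))) (nn-fromℕ n)))
    (≤-trans (*-monoˡ-≤ 1≤u (bernoulli 1≤u n)) (≤-reflexive (solve 3 (λ u v p → v :* (u :* p) := u :* (v :* p)) refl u (u - 1#) ((u - 1#) ^ n))))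

  -- With u = 2^(U+1) and 2^U factors, `bernoulli` gives (1 - 1/u)^(2^U) ≥ 1/2.
  power-half : ∀ {X Y} U → NonNeg X → (P (suc U) - 1#) * X ≤ P (suc U) * Y → X ^ (2 ℕ.^ U) ≤ two * Y ^ (2 ℕ.^ U)
  power-half {X} {Y} U nX p = *-cancelˡ-≤ (Pos-* (Pos-^ M (P-pos (suc U))) (P-pos U)) (≤-trans
      (≤-reflexive (trans (solve 3 (λ a b x → a :* b :* x := (a :* (# 2 :* b :- b)) :* x) refl (u ^ M) (P U) (X ^ M)) (cong (λ z → (u ^ M * (u - z)) * X ^ M) (sym (fromℕ-2^ U)))))
      (≤-trans (*-monoʳ-≤ (nn-^ M nX) (bernoulli (1≤P (suc U)) M))
      (≤-trans (≤-reflexive (trans (*-assoc u ((u - 1#) ^ M) (X ^ M)) (cong (u *_) (sym (^-*ˡ (u - 1#) X M)))))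
      (≤-trans (*-monoˡ-≤ (P-nn (suc U)) (^-mono-≤ M (nn-* (1≤P (suc U)) nX) p))
        (≤-reflexive (trans (cong (u *_) (^-*ˡ u Y M)) (solve 3 (λ a b y → (# 2 :* b) :* (a :* y) := a :* b :* (# 2 :* y)) refl (u ^ M) (P U) (Y ^ M))))))))
    where
      u : Carrier
      u = P (suc U)
      M : ℕ
      M = 2 ℕ.^ U

  -- The factor 2 of `power-half` is raised to the power 2^(k - U). A relative error thus becomes an
  -- additive one in units of 2^-k, without any real logarithm.
  close-powers : ∀ {X Y} k U → U ℕ.≤ k → NonNeg X → NonNeg Y → (P (suc U) - 1#) * X ≤ P (suc U) * Y → X ^ (2 ℕ.^ k) ≤ P (2 ℕ.^ (k ℕ.∸ U)) * Y ^ (2 ℕ.^ k)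
  close-powers {X} {Y} k U U≤k nX nY p = ≤-trans (≤-reflexive (split X)) (≤-trans (^-mono-≤ R (nn-^ (2 ℕ.^ U) nX) (power-half U nX p))
      (≤-reflexive (trans (^-*ˡ two (Y ^ (2 ℕ.^ U)) R) (cong (P R *_) (sym (split Y))))))
    where
      R : ℕ
      R = 2 ℕ.^ (k ℕ.∸ U)
      split : ∀ x → x ^ (2 ℕ.^ k) ≡ (x ^ (2 ℕ.^ U)) ^ R
      split x = trans (cong (x ^_) (trans (cong (2 ℕ.^_) (sym (ℕP.m+[n∸m]≡n U≤k))) (ℕP.^-distribˡ-+-* 2 U (k ℕ.∸ U)))) (^-* x (2 ℕ.^ U) R)

  module _ {A B : Carrier} (U : ℕ) (close : P (suc U) * (A - B) ∈± B) where
    private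
      u : Carrier
      u = P (suc U)

    close-below : (u - 1#) * B ≤ u * A
    close-below = ≤-by (solve 3 (λ u A B → B :+ u :* (A :- B) := u :* A :- (u :- # 1) :* B) refl u A B) (±lower close)

    close-above : (u - 1#) * A ≤ u * B
    close-above = *-cancelˡ-≤ (P-pos (suc U)) (≤-by (solve 3 (λ u A B → (u :- # 1) :* (B :- u :* (A :- B)) :+ B := u :* (u :* B) :- u :* ((u :- # 1) :* A)) refl u A B)
      (nn-+ (nn-* (1≤P (suc U)) (±upper close)) (±-nn close)))

  -- The integers `lo` and `hi` enclose 2^k log₂ y.
  record Log (k : ℕ) (y : Carrier) (lo hi : ℕ) : Set where
    constructor _⊑_
    field
      lower : P lo ≤ y ^ (2 ℕ.^ k)
      upper : y ^ (2 ℕ.^ k) ≤ P hi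
  open Log

  Log-* : ∀ {k y z lo hi lo′ hi′} → NonNeg y → NonNeg z → Log k y lo hi → Log k z lo′ hi′ → Log k (y * z) (lo ℕ.+ lo′) (hi ℕ.+ hi′)
  Log-* {k} {y} {z} {lo} {hi} {lo′} {hi′} ny nz p q =
    ≤-trans (≤-reflexive (^-+ two lo lo′)) (≤-trans (*-mono-≤ (P-nn lo) (lower p) (nn-^ (2 ℕ.^ k) nz) (lower q)) (≤-reflexive (sym (^-*ˡ y z (2 ℕ.^ k)))))
    ⊑ ≤-trans (≤-reflexive (^-*ˡ y z (2 ℕ.^ k))) (≤-trans (*-mono-≤ (nn-^ (2 ℕ.^ k) ny) (upper p) (P-nn hi′) (upper q)) (≤-reflexive (sym (^-+ two hi hi′))))

  Log-^ : ∀ {k y lo hi} n → NonNeg y → Log k y lo hi → Log k (y ^ n) (n ℕ.* lo) (n ℕ.* hi)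
  Log-^ {k} zero ny p = ≤-reflexive (sym (1^ (2 ℕ.^ k))) ⊑ ≤-reflexive (1^ (2 ℕ.^ k))
  Log-^ (suc n) ny p = Log-* ny (nn-^ n ny) p (Log-^ n ny p)

  compare : ∀ {k U A B lA hA lB hB} → U ℕ.≤ k → NonNeg A → NonNeg B → Log k A lA hA → Log k B lB hB → P (suc U) * (A - B) ∈± B →
    lA ℕ.≤ 2 ℕ.^ (k ℕ.∸ U) ℕ.+ hB × lB ℕ.≤ 2 ℕ.^ (k ℕ.∸ U) ℕ.+ hA
  compare {k} {U} {A} {B} U≤k nA nB p q close = one-way p q nA nB (close-above U close) , one-way q p nB nA (close-below U close)
    where
      one-way : ∀ {X Y lX hX lY hY} → Log k X lX hX → Log k Y lY hY → NonNeg X → NonNeg Y → (P (suc U) - 1#) * X ≤ P (suc U) * Y → lX ℕ.≤ 2 ℕ.^ (k ℕ.∸ U) ℕ.+ hY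
      one-way {hY = hY} r s nX nY t = P-cancel-≤ (≤-trans (lower r) (≤-trans (close-powers k U U≤k nX nY t)
        (≤-trans (*-monoˡ-≤ (P-nn (2 ℕ.^ (k ℕ.∸ U))) (upper s)) (≤-reflexive (sym (^-+ two (2 ℕ.^ (k ℕ.∸ U)) hY))))))

  N<2^ : ∀ n → N n ℕ.< 2 ℕ.^ n
  N<2^ zero = ℕP.≤ᵇ⇒≤ 1 1 tt
  N<2^ (suc zero) = ℕP.≤ᵇ⇒≤ 2 2 tt
  N<2^ (suc (suc zero)) = ℕP.≤ᵇ⇒≤ 2 4 tt
  N<2^ (suc (suc (suc n))) = ℕP.≤-trans (ℕP.+-mono-≤ (N<2^ (suc (suc n))) (ℕP.≤-trans (ℕP.<⇒≤ (N<2^ n)) (ℕP.^-monoʳ-≤ 2 (ℕP.m≤n+m n 2))))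
    (ℕP.≤-reflexive (cong (2 ℕ.^ suc (suc n) ℕ.+_) (sym (ℕP.+-identityʳ (2 ℕ.^ suc (suc n))))))

  -- From b ≥ 2 and N n < 2^n; the 8 bits pay for b - 1 ≤ 2⁷ and for the two summands.
  ℓ-bounded : ∀ {n m ℓ a b′} → Solution n m ℓ a b′ → ℓ ℕ.≤ n ℕ.+ 8
  ℓ-bounded {n} {m} {ℓ} {a} {b′} sol = 2^-cancel-≤ (begin
      2 ℕ.^ ℓ ≤⟨ ℕP.^-monoˡ-≤ ℓ (ℕ.s≤s 1≤b′) ⟩
      suc b′ ℕ.^ ℓ ≤⟨ ℕP.m≤n*m (suc b′ ℕ.^ ℓ) a ⦃ ℕ.>-nonZero 1≤a ⦄ ⟩
      a ℕ.* suc b′ ℕ.^ ℓ ≡⟨ equation ⟨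
      b′ ℕ.* (N n ℕ.+ N m) ℕ.+ a ≤⟨ ℕP.+-monoʳ-≤ (b′ ℕ.* (N n ℕ.+ N m)) a≤b′ ⟩
      b′ ℕ.* (N n ℕ.+ N m) ℕ.+ b′ ≡⟨ trans (ℕP.+-comm (b′ ℕ.* (N n ℕ.+ N m)) b′) (sym (ℕP.*-suc b′ (N n ℕ.+ N m))) ⟩
      b′ ℕ.* suc (N n ℕ.+ N m) ≤⟨ ℕP.*-mono-≤ (ℕP.≤-trans b′≤99 (ℕP.≤ᵇ⇒≤ 99 128 tt)) (ℕP.+-mono-≤ (N<2^ n) (ℕP.≤-trans (ℕP.<⇒≤ (N<2^ m)) (ℕP.^-monoʳ-≤ 2 m≤n))) ⟩
      128 ℕ.* (2 ℕ.^ n ℕ.+ 2 ℕ.^ n) ≡⟨ lem (2 ℕ.^ n) ⟩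
      2 ℕ.^ n ℕ.* 2 ℕ.^ 8 ≡⟨ ℕP.^-distribˡ-+-* 2 n 8 ⟨
      2 ℕ.^ (n ℕ.+ 8) ∎)
    where
      open Solution sol
      open ℕP.≤-Reasoning
      lem : ∀ x → 128 ℕ.* (x ℕ.+ x) ≡ x ℕ.* 256
      lem = ℕsolve-∀

  -- The certified logarithms are exact up to 2, which costs 2 per factor.
  slack : ∀ {L₀ H₀ L₁ H₁ m ℓ lα hα lb hb D Nmax} → L₀ ℕ.+ m ℕ.* lα ℕ.≤ D ℕ.+ (H₁ ℕ.+ ℓ ℕ.* hb) → L₁ ℕ.+ ℓ ℕ.* lb ℕ.≤ D ℕ.+ (H₀ ℕ.+ m ℕ.* hα) →
    H₀ ℕ.≤ L₀ ℕ.+ 4 → H₁ ℕ.≤ L₁ ℕ.+ 4 → hα ℕ.≤ lα ℕ.+ 2 → hb ℕ.≤ lb ℕ.+ 2 → m ℕ.≤ Nmax → ℓ ℕ.≤ Nmax ℕ.+ 8 →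
    let Δ = D ℕ.+ 4 ℕ.* Nmax ℕ.+ 26 in L₀ ℕ.+ m ℕ.* lα ℕ.≤ L₁ ℕ.+ ℓ ℕ.* lb ℕ.+ Δ × L₁ ℕ.+ ℓ ℕ.* lb ℕ.≤ L₀ ℕ.+ m ℕ.* lα ℕ.+ Δ
  slack {m = m} {ℓ = ℓ} {D = D} {Nmax = M} p q w₀ w₁ wα wb m≤ ℓ≤ = half-slack {r = ℓ} {D = D} p w₁ wb ℓ≤ , half-slack {r = m} {D = D} q w₀ wα (ℕP.≤-trans m≤ (ℕP.m≤m+n M 8))
    where
      open ℕP.≤-Reasoning
      lem₁ : ∀ D L r l M → D ℕ.+ (L ℕ.+ 4 ℕ.+ (r ℕ.* l ℕ.+ 2 ℕ.* (M ℕ.+ 8))) ≡ L ℕ.+ r ℕ.* l ℕ.+ (D ℕ.+ 2 ℕ.* M ℕ.+ 20)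
      lem₁ = ℕsolve-∀
      lem₂ : ∀ r l → r ℕ.* (l ℕ.+ 2) ≡ r ℕ.* l ℕ.+ 2 ℕ.* r
      lem₂ = ℕsolve-∀
      half-slack : ∀ {X L H r l h D} → X ℕ.≤ D ℕ.+ (H ℕ.+ r ℕ.* h) → H ℕ.≤ L ℕ.+ 4 → h ℕ.≤ l ℕ.+ 2 → r ℕ.≤ M ℕ.+ 8 → X ℕ.≤ L ℕ.+ r ℕ.* l ℕ.+ (D ℕ.+ 4 ℕ.* M ℕ.+ 26)
      half-slack {X} {L} {H} {r} {l} {h} {D} p w v r≤ = begin
        X ≤⟨ p ⟩
        D ℕ.+ (H ℕ.+ r ℕ.* h) ≤⟨ ℕP.+-monoʳ-≤ D (ℕP.+-mono-≤ w (ℕP.≤-trans (ℕP.*-monoʳ-≤ r v) (ℕP.≤-trans (ℕP.≤-reflexive (lem₂ r l)) (ℕP.+-monoʳ-≤ (r ℕ.* l) (ℕP.*-monoʳ-≤ 2 r≤))))) ⟩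
        D ℕ.+ (L ℕ.+ 4 ℕ.+ (r ℕ.* l ℕ.+ 2 ℕ.* (M ℕ.+ 8))) ≡⟨ lem₁ D L r l M ⟩
        L ℕ.+ r ℕ.* l ℕ.+ (D ℕ.+ 2 ℕ.* M ℕ.+ 20) ≤⟨ ℕP.+-monoʳ-≤ (L ℕ.+ r ℕ.* l) (ℕP.+-mono-≤ (ℕP.+-monoʳ-≤ D (ℕP.*-monoˡ-≤ M (ℕP.≤ᵇ⇒≤ 2 4 tt))) (ℕP.≤ᵇ⇒≤ 20 26 tt)) ⟩
        L ℕ.+ r ℕ.* l ℕ.+ (D ℕ.+ 4 ℕ.* M ℕ.+ 26) ∎

  module Reduction (one k T : ℕ) ⦃ nonZero : NonZero one ⦄ (Nmax U qmin bases depth : ℕ)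
    (below : T ℕ.* T ℕ.* T ℕ.≤ T ℕ.* T ℕ.* one ℕ.+ one ℕ.* one ℕ.* one)
    (above : suc T ℕ.* suc T ℕ.* one ℕ.+ one ℕ.* one ℕ.* one ℕ.≤ suc T ℕ.* suc T ℕ.* suc T)
    (U≤k : U ℕ.≤ k) (99≤bases : 99 ℕ.≤ bases) (deep : 2 ℕ.* (6 ℕ.+ U) ℕ.≤ depth)
    (width-α : Pass.hiα one k T Nmax U qmin bases ℕ.≤ Pass.loα one k T Nmax U qmin bases ℕ.+ 2)
    (width-C : Pass.hiC one k T Nmax U qmin bases ℕ.≤ Pass.loC one k T Nmax U qmin bases ℕ.+ 2)
    (widths-N : Pass.widthsN one k T Nmax U qmin bases 1 (suc bases) ≡ true)
    (checked : Pass.check one k T Nmax U qmin bases depth ≡ true) where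

    open Pass one k T Nmax U qmin bases
    open Checks one k T Nmax U qmin bases
    open Logs one
    open Powers one T
    open Certified one
    open Root T below above

    both : allᵇ (rowOK 0) table ≡ true × walk table depth (state 0 one one) (state 0 one one) ≡ true
    both = ∧-elim {allᵇ (rowOK 0) table} checked

    log-N : ∀ n → 1 ℕ.≤ n → Log k (fromℕ n) (loN n) (hiN n)
    log-N n 1≤n = lowest-sound k 8 0 (n ℕ.* one) (fromℕ-mono-≤ {1} 1≤n) (≤-reflexive (natural n)) ⊑ highest-sound k 8 0 (n ℕ.* one) (nn-fromℕ n) (≤-reflexive (sym (natural n)))

    log-α : Log k α loα hiα
    log-α = low-sound k 0 T (<⇒≤ α>1) (≤-trans (≤-reflexive (*-identityˡ (fromℕ T))) T≤a) ⊑ high-sound k 0 (suc T) α-nn (≤-trans a≤T (≤-reflexive (sym (*-identityˡ (fromℕ (suc T))))))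

    c-scaled : c * o ≡ fromℕ 3 * a - fromℕ 2 * o
    c-scaled = solve 2 (λ x o → (# 3 :* x :- # 2) :* o := # 3 :* (x :* o) :- # 2 :* o) refl α o

    log-C : Log k c loC hiC
    log-C = lowest-sound k 8 0 (3 ℕ.* T ℕ.∸ 2 ℕ.* one) 1≤c below-c ⊑ highest-sound k 8 0 (3 ℕ.* suc T ℕ.∸ 2 ℕ.* one) (inj₁ (1≤⇒Pos 1≤c)) above-c
      where
        below-c : Low c 0 (3 ℕ.* T ℕ.∸ 2 ℕ.* one)
        below-c = pick (ℕP.≤-total (2 ℕ.* one) (3 ℕ.* T))
          where
            pick : 2 ℕ.* one ℕ.≤ 3 ℕ.* T ⊎ 3 ℕ.* T ℕ.≤ 2 ℕ.* one → Low c 0 (3 ℕ.* T ℕ.∸ 2 ℕ.* one)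
            pick (inj₁ p) = ≤-by (trans (solve 5 (λ a t o y s → s :+ # 3 :* (a :- t) := ((# 3 :* a :- # 2 :* o) :- # 1 :* y) :+ (s :+ (y :- (# 3 :* t :- # 2 :* o)))) refl a (fromℕ T) o y 0#)
                (trans (cong (λ z → ((fromℕ 3 * a - fromℕ 2 * o) - 1# * y) + (0# + (z - (fromℕ 3 * fromℕ T - fromℕ 2 * o)))) y≡)
                  (trans (solve 2 (λ u v → u :+ (# 0 :+ (v :- v)) := u) refl ((fromℕ 3 * a - fromℕ 2 * o) - 1# * y) (fromℕ 3 * fromℕ T - fromℕ 2 * o)) (cong (_- 1# * y) (sym c-scaled)))))
                (nn-+ nn-0 (nn-* (nn-fromℕ 3) T≤a))
              where
                y : Carrier
                y = fromℕ (3 ℕ.* T ℕ.∸ 2 ℕ.* one)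
                y≡ : y ≡ fromℕ 3 * fromℕ T - fromℕ 2 * o
                y≡ = trans (solve 2 (λ y z → y := (y :+ z) :- z) refl y (fromℕ 2 * o))
                  (cong (_- fromℕ 2 * o) (trans (cong (y +_) (sym (fromℕ-* 2 one))) (trans (sym (fromℕ-+ (3 ℕ.* T ℕ.∸ 2 ℕ.* one) (2 ℕ.* one))) (trans (cong fromℕ (ℕP.m∸n+n≡m p)) (fromℕ-* 3 T)))))
            pick (inj₂ p) = ≤-trans (≤-reflexive (trans (*-identityˡ _) (cong fromℕ (ℕP.m≤n⇒m∸n≡0 p)))) (nn⇒0≤ (nn-* (inj₁ (1≤⇒Pos 1≤c)) o-nn))
        above-c : High c 0 (3 ℕ.* suc T ℕ.∸ 2 ℕ.* one)
        above-c = ≤-trans (≤-reflexive c-scaled) (≤-by (solve 4 (λ a t o y → # 3 :* (t :- a) :+ ((# 2 :* o :+ y) :- # 3 :* t) := # 1 :* y :- (# 3 :* a :- # 2 :* o)) refl a (fromℕ (suc T)) o y)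
            (nn-+ (nn-* (nn-fromℕ 3) a≤T) (subst₂ _≤_ (fromℕ-* 3 (suc T)) (trans (fromℕ-+ (2 ℕ.* one) (3 ℕ.* suc T ℕ.∸ 2 ℕ.* one)) (cong (_+ y) (fromℕ-* 2 one))) (fromℕ-mono-≤ (ℕP.m≤n+m∸n (3 ℕ.* suc T) (2 ℕ.* one))))))
          where
            y : Carrier
            y = fromℕ (3 ℕ.* suc T ℕ.∸ 2 ℕ.* one)

    width : ∀ b → 1 ℕ.≤ b → b ℕ.≤ suc bases → hiN b ℕ.≤ loN b ℕ.+ 2
    width b 1≤b b≤ = widthN 1 (suc bases) widths-N b 1≤b (ℕ.s≤s b≤)

    2+2 : ∀ {h l h′ l′} → h ℕ.≤ l ℕ.+ 2 → h′ ℕ.≤ l′ ℕ.+ 2 → h ℕ.+ h′ ℕ.≤ (l ℕ.+ l′) ℕ.+ 4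
    2+2 {l = l} {l′ = l′} p q = ℕP.≤-trans (ℕP.+-mono-≤ p q) (ℕP.≤-reflexive (lem l l′))
      where
        lem : ∀ x y → x ℕ.+ 2 ℕ.+ (y ℕ.+ 2) ≡ x ℕ.+ y ℕ.+ 4
        lem = ℕsolve-∀

    module _ {n m ℓ a b′ : ℕ} (sol : Solution n m ℓ a b′) (n≤Nmax : n ℕ.≤ Nmax) where
      open Solution sol
      open Forms sol using (d; B; g₁; value; 1≤B; 1≤g₁; gap-close; size-close; g₀)

      b′≤bases : b′ ℕ.≤ bases
      b′≤bases = ℕP.≤-trans b′≤99 99≤bases

      nn-value : NonNeg value
      nn-value = nn-* (inj₁ (1≤⇒Pos 1≤g₁)) (nn-^ ℓ (nn-fromℕ (suc b′)))

      log-value : Log k value ((loN a ℕ.+ loC) ℕ.+ ℓ ℕ.* loN (suc b′)) ((hiN a ℕ.+ hiC) ℕ.+ ℓ ℕ.* hiN (suc b′))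
      log-value = Log-* (inj₁ (1≤⇒Pos 1≤g₁)) (nn-^ ℓ (nn-fromℕ (suc b′))) (Log-* (nn-fromℕ a) (inj₁ (1≤⇒Pos 1≤c)) (log-N a 1≤a) log-C)
        (Log-^ ℓ (nn-fromℕ (suc b′)) (log-N (suc b′) (ℕ.s≤s ℕ.z≤n)))

      -- Both forms have the shape B f α^e: for the gap f = 1 and e = n, for the size f = 1 + α^d
      -- and e = m.
      refute : ∀ {e f lf hf} → NonNeg f → Log k f lf hf → hf ℕ.≤ lf ℕ.+ 2 → allᵇ (rowOK lf) table ≡ true → e ℕ.≤ Nmax → P (suc U) * ((B * f) * α ^ e - value) ∈± value → ⊥
      refute {e} {f} {lf} {hf} nf log-f width-f ok e≤ close = row-sound lf ok {m = e} {ℓ = ℓ} 1≤b′ b′≤bases 1≤a a≤b′ e≤ (proj₁ near) (proj₂ near)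
        where
          nn-g : NonNeg (B * f)
          nn-g = nn-* (nn-fromℕ b′) nf
          inequalities : ((loN b′ ℕ.+ lf) ℕ.+ e ℕ.* loα ℕ.≤ 2 ℕ.^ (k ℕ.∸ U) ℕ.+ ((hiN a ℕ.+ hiC) ℕ.+ ℓ ℕ.* hiN (suc b′))) × ((loN a ℕ.+ loC) ℕ.+ ℓ ℕ.* loN (suc b′) ℕ.≤ 2 ℕ.^ (k ℕ.∸ U) ℕ.+ ((hiN b′ ℕ.+ hf) ℕ.+ e ℕ.* hiα))
          inequalities = compare {k} {U} U≤k (nn-* nn-g (nn-^ e α-nn)) nn-value (Log-* nn-g (nn-^ e α-nn) (Log-* (nn-fromℕ b′) nf (log-N b′ 1≤b′) log-f) (Log-^ e α-nn log-α)) log-value close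
          near : ((loN b′ ℕ.+ lf) ℕ.+ e ℕ.* loα ℕ.≤ (loN a ℕ.+ loC) ℕ.+ ℓ ℕ.* loN (suc b′) ℕ.+ Δ) × ((loN a ℕ.+ loC) ℕ.+ ℓ ℕ.* loN (suc b′) ℕ.≤ (loN b′ ℕ.+ lf) ℕ.+ e ℕ.* loα ℕ.+ Δ)
          near = slack {m = e} {ℓ = ℓ} {D = 2 ℕ.^ (k ℕ.∸ U)} (proj₁ inequalities) (proj₂ inequalities)
            (2+2 (width b′ 1≤b′ (ℕP.≤-trans b′≤bases (ℕP.n≤1+n bases))) width-f)
            (2+2 (width a 1≤a (ℕP.≤-trans a≤b′ (ℕP.≤-trans b′≤bases (ℕP.n≤1+n bases)))) width-C)
            width-α (width (suc b′) (ℕ.s≤s ℕ.z≤n) (ℕ.s≤s b′≤bases)) e≤ (ℕP.≤-trans (ℓ-bounded sol) (ℕP.+-monoˡ-≤ 8 n≤Nmax))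

      gap-bounded : d ℕ.< 2 ℕ.* (6 ℕ.+ U)
      gap-bounded = ℕP.≰⇒> λ q → refute {e = n} nn-1 (≤-reflexive (sym (1^ (2 ℕ.^ k))) ⊑ ≤-reflexive (1^ (2 ℕ.^ k))) ℕ.z≤n (proj₁ both) n≤Nmax
        (subst (λ z → P (suc U) * (z * α ^ n - value) ∈± value) (sym (*-identityʳ B)) (gap-close U q))

      -- The factor 1 + α^d has been tabulated only for d below `depth`; `gap-bounded` places the
      -- actual gap there.
      size-bounded : n ℕ.< 2 ℕ.* (6 ℕ.+ U)
      size-bounded = ℕP.≰⇒> λ q → refute {e = m} (nn-+ nn-1 (nn-^ d α-nn)) (gap-low k d ⊑ gap-high k d) (proj₁ entry) (proj₂ entry) (ℕP.≤-trans m≤n n≤Nmax) (size-close U q)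
        where
          s t : State
          s = orbit next (state 0 one one) d
          t = orbit nextʰ (state 0 one one) d
          entry : (highest k 2 (State.e t) (State.l t ℕ.+ State.r t) ℕ.≤ lowest k 2 (State.e s) (State.l s ℕ.+ State.r s) ℕ.+ 2) ×
            allᵇ (rowOK (lowest k 2 (State.e s) (State.l s ℕ.+ State.r s))) table ≡ true
          entry = walk-at table depth (state 0 one one) (state 0 one one) (proj₂ both) d (ℕP.<-≤-trans gap-bounded deep)

-- The cubic field and its order

module CubicField (Q : OrderedField) (clear : ClearsDenominators Q) where

  open import Data.Integer using (+_; -[1+_]; ∣_∣)
  open OrderedFieldTheory Q
  open NormForm using (norm; norm-anisotropic; size)

  -- Coordinates with respect to 1, α, α²; products are reduced by α³ = α² + 1 and α⁴ = α² + α + 1.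
  record K : Set where
    constructor ⟨_,_,_⟩
    field
      c₀ c₁ c₂ : Carrier
  open K

  private
    cong₃ : ∀ {a b c a' b' c'} → a ≡ a' → b ≡ b' → c ≡ c' → ⟨ a , b , c ⟩ ≡ ⟨ a' , b' , c' ⟩
    cong₃ refl refl refl = refl

  infixl 6 _⊕_
  infixl 7 _⊗_

  _⊕_ _⊗_ : K → K → K
  ⟨ a , b , c ⟩ ⊕ ⟨ a' , b' , c' ⟩ = ⟨ a + a' , b + b' , c + c' ⟩
  ⟨ a , b , c ⟩ ⊗ ⟨ a' , b' , c' ⟩ = ⟨ a * a' + (b * c' + c * b') + c * c' , (a * b' + b * a') + c * c' , (a * c' + b * b' + c * a') + (b * c' + c * b') + c * c' ⟩

  ⊝_ : K → K
  ⊝ ⟨ a , b , c ⟩ = ⟨ - a , - b , - c ⟩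

  0K 1K αK : K
  0K = ⟨ 0# , 0# , 0# ⟩
  1K = ⟨ 1# , 0# , 0# ⟩
  αK = ⟨ 0# , 1# , 0# ⟩

  ⊕-assoc : ∀ x y z → (x ⊕ y) ⊕ z ≡ x ⊕ (y ⊕ z)
  ⊕-assoc x y z = cong₃ (+-assoc _ _ _) (+-assoc _ _ _) (+-assoc _ _ _)

  ⊕-comm : ∀ x y → x ⊕ y ≡ y ⊕ x
  ⊕-comm x y = cong₃ (+-comm _ _) (+-comm _ _) (+-comm _ _)

  ⊗-comm : ∀ x y → x ⊗ y ≡ y ⊗ x
  ⊗-comm ⟨ a , b , c ⟩ ⟨ a' , b' , c' ⟩ = cong₃
    (solve 6 (λ a b c a' b' c' → a :* a' :+ (b :* c' :+ c :* b') :+ c :* c' := a' :* a :+ (b' :* c :+ c' :* b) :+ c' :* c) refl a b c a' b' c')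
    (solve 6 (λ a b c a' b' c' → (a :* b' :+ b :* a') :+ c :* c' := (a' :* b :+ b' :* a) :+ c' :* c) refl a b c a' b' c')
    (solve 6 (λ a b c a' b' c' → (a :* c' :+ b :* b' :+ c :* a') :+ (b :* c' :+ c :* b') :+ c :* c' := (a' :* c :+ b' :* b :+ c' :* a) :+ (b' :* c :+ c' :* b) :+ c' :* c) refl a b c a' b' c')

  -- The operations of `K` repeated on solver expressions, so that its laws become polynomial
  -- identities in the coordinates.
  module Poly where
    record T (n : ℕ) : Set where
      constructor tri
      field
        p₀ p₁ p₂ : Polynomial n

    infixl 6 _⊞_
    infixl 7 _⊠_
    _⊞_ _⊠_ : ∀ {n} → T n → T n → T n
    tri a b c ⊞ tri a' b' c' = tri (a :+ a') (b :+ b') (c :+ c')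
    tri a b c ⊠ tri a' b' c' = tri (a :* a' :+ (b :* c' :+ c :* b') :+ c :* c') ((a :* b' :+ b :* a') :+ c :* c') ((a :* c' :+ b :* b' :+ c :* a') :+ (b :* c' :+ c :* b') :+ c :* c')

    adjP : ∀ {n} → T n → T n
    adjP (tri a b c) = tri (a :* a :+ a :* b :+ a :* c :- b :* c :- c :* c) (c :* c :- a :* b :- b :* b :- b :* c) (b :* b :- a :* c :+ b :* c)

    normP : ∀ {n} → T n → Polynomial n
    normP (tri a b c) = a :* a :* a :+ b :* b :* b :+ c :* c :* c :+ a :* a :* b :+ a :* a :* c :+ b :* b :* c :- # 3 :* (a :* b :* c) :- # 2 :* (a :* c :* c)

  open Poly using (tri; _⊞_; _⊠_; adjP; normP)
  open Poly.T

  ⊗-assoc : ∀ x y z → (x ⊗ y) ⊗ z ≡ x ⊗ (y ⊗ z)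
  ⊗-assoc ⟨ a , b , c ⟩ ⟨ d , e , f ⟩ ⟨ g , h , i ⟩ = cong₃
    (solve 9 (λ a b c d e f g h i → p₀ ((tri a b c ⊠ tri d e f) ⊠ tri g h i) := p₀ (tri a b c ⊠ (tri d e f ⊠ tri g h i))) refl a b c d e f g h i)
    (solve 9 (λ a b c d e f g h i → p₁ ((tri a b c ⊠ tri d e f) ⊠ tri g h i) := p₁ (tri a b c ⊠ (tri d e f ⊠ tri g h i))) refl a b c d e f g h i)
    (solve 9 (λ a b c d e f g h i → p₂ ((tri a b c ⊠ tri d e f) ⊠ tri g h i) := p₂ (tri a b c ⊠ (tri d e f ⊠ tri g h i))) refl a b c d e f g h i)

  ⊗-identityˡ : ∀ x → 1K ⊗ x ≡ x
  ⊗-identityˡ ⟨ a , b , c ⟩ = cong₃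
    (solve 3 (λ a b c → p₀ (tri (# 1) (# 0) (# 0) ⊠ tri a b c) := a) refl a b c)
    (solve 3 (λ a b c → p₁ (tri (# 1) (# 0) (# 0) ⊠ tri a b c) := b) refl a b c)
    (solve 3 (λ a b c → p₂ (tri (# 1) (# 0) (# 0) ⊠ tri a b c) := c) refl a b c)

  ⊗-distribˡ : ∀ x y z → x ⊗ (y ⊕ z) ≡ (x ⊗ y) ⊕ (x ⊗ z)
  ⊗-distribˡ ⟨ a , b , c ⟩ ⟨ d , e , f ⟩ ⟨ g , h , i ⟩ = cong₃
    (solve 9 (λ a b c d e f g h i → p₀ (tri a b c ⊠ (tri d e f ⊞ tri g h i)) := p₀ ((tri a b c ⊠ tri d e f) ⊞ (tri a b c ⊠ tri g h i))) refl a b c d e f g h i)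
    (solve 9 (λ a b c d e f g h i → p₁ (tri a b c ⊠ (tri d e f ⊞ tri g h i)) := p₁ ((tri a b c ⊠ tri d e f) ⊞ (tri a b c ⊠ tri g h i))) refl a b c d e f g h i)
    (solve 9 (λ a b c d e f g h i → p₂ (tri a b c ⊠ (tri d e f ⊞ tri g h i)) := p₂ ((tri a b c ⊠ tri d e f) ⊞ (tri a b c ⊠ tri g h i))) refl a b c d e f g h i)

  isCommutativeRingK : IsCommutativeRing _≡_ _⊕_ _⊗_ ⊝_ 0K 1K
  isCommutativeRingK = record
    { isRing = record
      { +-isAbelianGroup = record
        { isGroup = record
          { isMonoid = record
            { isSemigroup = record { isMagma = record { isEquivalence = isEquivalence ; ∙-cong = cong₂ _⊕_ } ; assoc = ⊕-assoc }
            ; identity = (λ x → cong₃ (+-identityˡ _) (+-identityˡ _) (+-identityˡ _)) , (λ x → cong₃ (+-identityʳ _) (+-identityʳ _) (+-identityʳ _)) }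
          ; inverse = (λ x → cong₃ (-‿inverseˡ _) (-‿inverseˡ _) (-‿inverseˡ _)) , (λ x → cong₃ (-‿inverseʳ _) (-‿inverseʳ _) (-‿inverseʳ _))
          ; ⁻¹-cong = cong ⊝_ }
        ; comm = ⊕-comm }
      ; *-cong = cong₂ _⊗_
      ; *-assoc = ⊗-assoc
      ; *-identity = ⊗-identityˡ , λ x → trans (⊗-comm x 1K) (⊗-identityˡ x)
      ; distrib = ⊗-distribˡ , λ x y z → trans (⊗-comm (y ⊕ z) x) (trans (⊗-distribˡ x y z) (cong₂ _⊕_ (⊗-comm x y) (⊗-comm x z))) }
    ; *-comm = ⊗-comm }

  nm : K → Carrier
  nm ⟨ a , b , c ⟩ = a * a * a + b * b * b + c * c * c + a * a * b + a * a * c + b * b * c - fromℕ 3 * (a * b * c) - fromℕ 2 * (a * c * c)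

  adj : K → K
  adj ⟨ a , b , c ⟩ = ⟨ a * a + a * b + a * c - b * c - c * c , c * c - a * b - b * b - b * c , b * b - a * c + b * c ⟩

  scalar : Carrier → K
  scalar x = ⟨ x , 0# , 0# ⟩

  adj-norm : ∀ x → x ⊗ adj x ≡ scalar (nm x)
  adj-norm ⟨ a , b , c ⟩ = cong₃
    (solve 3 (λ a b c → p₀ (tri a b c ⊠ adjP (tri a b c)) := normP (tri a b c)) refl a b c)
    (solve 3 (λ a b c → p₁ (tri a b c ⊠ adjP (tri a b c)) := # 0) refl a b c)
    (solve 3 (λ a b c → p₂ (tri a b c ⊠ adjP (tri a b c)) := # 0) refl a b c)

  adj-⊗ : ∀ x y → adj (x ⊗ y) ≡ adj x ⊗ adj y
  adj-⊗ ⟨ a , b , c ⟩ ⟨ d , e , f ⟩ = cong₃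
    (solve 6 (λ a b c d e f → p₀ (adjP (tri a b c ⊠ tri d e f)) := p₀ (adjP (tri a b c) ⊠ adjP (tri d e f))) refl a b c d e f)
    (solve 6 (λ a b c d e f → p₁ (adjP (tri a b c ⊠ tri d e f)) := p₁ (adjP (tri a b c) ⊠ adjP (tri d e f))) refl a b c d e f)
    (solve 6 (λ a b c d e f → p₂ (adjP (tri a b c ⊠ tri d e f)) := p₂ (adjP (tri a b c) ⊠ adjP (tri d e f))) refl a b c d e f)

  scalar-⊗ : ∀ x y → scalar x ⊗ scalar y ≡ scalar (x * y)
  scalar-⊗ x y = cong₃
    (solve 2 (λ x y → p₀ (tri x (# 0) (# 0) ⊠ tri y (# 0) (# 0)) := x :* y) refl x y)
    (solve 2 (λ x y → p₁ (tri x (# 0) (# 0) ⊠ tri y (# 0) (# 0)) := # 0) refl x y)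
    (solve 2 (λ x y → p₂ (tri x (# 0) (# 0) ⊠ tri y (# 0) (# 0)) := # 0) refl x y)

  -- Obtained from the multiplicativity of `adj`, whose coordinate identities have lower degree than
  -- the one for the norm.
  nm-⊗ : ∀ x y → nm (x ⊗ y) ≡ nm x * nm y
  nm-⊗ x y = cong c₀ (trans (sym (adj-norm (x ⊗ y))) (trans (cong ((x ⊗ y) ⊗_) (adj-⊗ x y)) (trans (rearrange x y (adj x) (adj y))
      (trans (cong₂ _⊗_ (adj-norm x) (adj-norm y)) (scalar-⊗ (nm x) (nm y))))))
    where
      rearrange : ∀ x y u v → (x ⊗ y) ⊗ (u ⊗ v) ≡ (x ⊗ u) ⊗ (y ⊗ v)
      rearrange x y u v = trans (⊗-assoc x y (u ⊗ v)) (trans (cong (x ⊗_) (trans (sym (⊗-assoc y u v)) (trans (cong (_⊗ v) (⊗-comm y u)) (⊗-assoc u y v)))) (sym (⊗-assoc x u (y ⊗ v))))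

  nm-⊝ : ∀ x → nm (⊝ x) ≡ - nm x
  nm-⊝ ⟨ a , b , c ⟩ = solve 3 (λ a b c → normP (tri (:- a) (:- b) (:- c)) := :- normP (tri a b c)) refl a b c

  private
    ι-nm : ∀ a b c → ι (norm a b c) ≡ nm ⟨ ι a , ι b , ι c ⟩
    ι-nm a b c = trans (sub (S ℤ.- + 3 ℤ.* (a ℤ.* b ℤ.* c)) (+ 2 ℤ.* (a ℤ.* c ℤ.* c))) (cong₂ _-_ (trans (sub S (+ 3 ℤ.* (a ℤ.* b ℤ.* c))) (cong₂ _-_
        (trans (ι-+ (a ℤ.* a ℤ.* a ℤ.+ b ℤ.* b ℤ.* b ℤ.+ c ℤ.* c ℤ.* c ℤ.+ a ℤ.* a ℤ.* b ℤ.+ a ℤ.* a ℤ.* c) (b ℤ.* b ℤ.* c)) (cong₂ _+_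
          (trans (ι-+ (a ℤ.* a ℤ.* a ℤ.+ b ℤ.* b ℤ.* b ℤ.+ c ℤ.* c ℤ.* c ℤ.+ a ℤ.* a ℤ.* b) (a ℤ.* a ℤ.* c)) (cong₂ _+_
            (trans (ι-+ (a ℤ.* a ℤ.* a ℤ.+ b ℤ.* b ℤ.* b ℤ.+ c ℤ.* c ℤ.* c) (a ℤ.* a ℤ.* b)) (cong₂ _+_
              (trans (ι-+ (a ℤ.* a ℤ.* a ℤ.+ b ℤ.* b ℤ.* b) (c ℤ.* c ℤ.* c)) (cong₂ _+_
                (trans (ι-+ (a ℤ.* a ℤ.* a) (b ℤ.* b ℤ.* b)) (cong₂ _+_ (cube a a a) (cube b b b))) (cube c c c))) (cube a a b))) (cube a a c))) (cube b b c)))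
        (trans (ι-* (+ 3) (a ℤ.* b ℤ.* c)) (cong (λ z → fromℕ 3 * z) (cube a b c)))))
      (trans (ι-* (+ 2) (a ℤ.* c ℤ.* c)) (cong (λ z → fromℕ 2 * z) (cube a c c))))
      where
        S = a ℤ.* a ℤ.* a ℤ.+ b ℤ.* b ℤ.* b ℤ.+ c ℤ.* c ℤ.* c ℤ.+ a ℤ.* a ℤ.* b ℤ.+ a ℤ.* a ℤ.* c ℤ.+ b ℤ.* b ℤ.* c
        cube : ∀ x y z → ι (x ℤ.* y ℤ.* z) ≡ ι x * ι y * ι z
        cube x y z = trans (ι-* (x ℤ.* y) z) (cong (_* ι z) (ι-* x y))
        sub : ∀ x y → ι (x ℤ.- y) ≡ ι x - ι y
        sub x y = trans (ι-+ x (ℤ.- y)) (cong (λ z → ι x + z) (ι-neg y))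

    ι-zero : ∀ z → ι z ≡ 0# → z ≡ + 0
    ι-zero (+ zero) _ = refl
    ι-zero (+ suc n) e = ⊥-elim (Pos⇒≢0 (Pos-suc n) e)
    ι-zero -[1+ n ] e = ⊥-elim (Pos⇒≢0 (Pos-suc n) (trans (solve 1 (λ x → x := :- (:- x)) refl (fromℕ (suc n))) (trans (cong -_ e) (solve 0 (:- # 0 := # 0) refl))))

  -- The norm is homogeneous, so a common denominator reduces the claim to integers, where the form
  -- is anisotropic.
  nm-zero : ∀ x → nm x ≡ 0# → x ≡ 0K
  nm-zero ⟨ a , b , c ⟩ e = cong₃ (zero-of (proj₁ (clear a)) p 1≤p s≢ ea za) (zero-of (proj₁ (clear b)) q 1≤q s≢ eb zb) (zero-of (proj₁ (clear c)) r 1≤r s≢ ec zc)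
    where
      p = proj₁ (clear a)
      q = proj₁ (clear b)
      r = proj₁ (clear c)
      x = proj₁ (proj₂ (clear a))
      y = proj₁ (proj₂ (clear b))
      z = proj₁ (proj₂ (clear c))
      1≤p = proj₁ (proj₂ (proj₂ (clear a)))
      1≤q = proj₁ (proj₂ (proj₂ (clear b)))
      1≤r = proj₁ (proj₂ (proj₂ (clear c)))
      s = fromℕ p * fromℕ q * fromℕ r
      s≢ : s ≢ 0#
      s≢ = Pos⇒≢0 (Pos-* (Pos-* (Pos-fromℕ 1≤p) (Pos-fromℕ 1≤q)) (Pos-fromℕ 1≤r))
      X = x ℤ.* (+ q ℤ.* + r)
      Y = y ℤ.* (+ p ℤ.* + r)
      Z = z ℤ.* (+ p ℤ.* + q)
      ιX : ∀ u v w → ι (u ℤ.* (v ℤ.* w)) ≡ ι u * (ι v * ι w)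
      ιX u v w = trans (ι-* u (v ℤ.* w)) (cong (λ t → ι u * t) (ι-* v w))
      ea : a * s ≡ ι X
      ea = trans (solve 4 (λ a p q r → a :* (p :* q :* r) := (a :* p) :* (q :* r)) refl a (fromℕ p) (fromℕ q) (fromℕ r)) (trans (cong (_* (fromℕ q * fromℕ r)) (proj₂ (proj₂ (proj₂ (clear a))))) (sym (ιX x (+ q) (+ r))))
      eb : b * s ≡ ι Y
      eb = trans (solve 4 (λ a p q r → a :* (p :* q :* r) := (a :* q) :* (p :* r)) refl b (fromℕ p) (fromℕ q) (fromℕ r)) (trans (cong (_* (fromℕ p * fromℕ r)) (proj₂ (proj₂ (proj₂ (clear b))))) (sym (ιX y (+ p) (+ r))))
      ec : c * s ≡ ι Z
      ec = trans (solve 4 (λ a p q r → a :* (p :* q :* r) := (a :* r) :* (p :* q)) refl c (fromℕ p) (fromℕ q) (fromℕ r)) (trans (cong (_* (fromℕ p * fromℕ q)) (proj₂ (proj₂ (proj₂ (clear c))))) (sym (ιX z (+ p) (+ q))))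
      scaled : nm ⟨ a * s , b * s , c * s ⟩ ≡ s * s * s * nm ⟨ a , b , c ⟩
      scaled = solve 4 (λ a b c s → normP (tri (a :* s) (b :* s) (c :* s)) := s :* s :* s :* normP (tri a b c)) refl a b c s
      integral : norm X Y Z ≡ + 0
      integral = ι-zero (norm X Y Z) (trans (ι-nm X Y Z) (trans (sym (cong nm (cong₃ ea eb ec))) (trans scaled (trans (cong (λ t → s * s * s * t) e) (zeroʳ _)))))
      sz = norm-anisotropic (size X Y Z) X Y Z ℕP.≤-refl integral
      za : X ≡ + 0
      za = ℤP.∣i∣≡0⇒i≡0 (ℕP.m+n≡0⇒m≡0 (∣ X ∣) {∣ Y ∣} (ℕP.m+n≡0⇒m≡0 (∣ X ∣ ℕ.+ ∣ Y ∣) {∣ Z ∣} sz))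
      zb : Y ≡ + 0
      zb = ℤP.∣i∣≡0⇒i≡0 (ℕP.m+n≡0⇒n≡0 (∣ X ∣) {∣ Y ∣} (ℕP.m+n≡0⇒m≡0 (∣ X ∣ ℕ.+ ∣ Y ∣) {∣ Z ∣} sz))
      zc : Z ≡ + 0
      zc = ℤP.∣i∣≡0⇒i≡0 (ℕP.m+n≡0⇒n≡0 (∣ X ∣ ℕ.+ ∣ Y ∣) {∣ Z ∣} sz)
      zero-of : ∀ {u W} → (n m : ℕ) → 1 ℕ.≤ m → s ≢ 0# → u * s ≡ ι W → W ≡ + 0 → u ≡ 0#
      zero-of _ _ _ ne eu refl = *-cancel-0 (trans (*-comm _ _) eu) ne

  f : Carrier → Carrier
  f t = t * t * t - t * t - 1#

  ev : Carrier → K → Carrier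
  ev t ⟨ a , b , c ⟩ = a + b * t + c * (t * t)

  private
    -- At the real root, `quad t x` is the product of the two complex conjugates of x; for an
    -- approximate root, f t times `rest t x` is the correction.
    quad rest : Carrier → K → Carrier
    quad t ⟨ a , b , c ⟩ = let A = a - c * (t * t - t) ; B = b + c * (1# - t) in A * A + A * B * (1# - t) + B * B * (t * t - t)
    rest t ⟨ a , b , c ⟩ = (b * b * c + b * b * b + c * c * c - fromℕ 2 * (a * c * c) - fromℕ 3 * (a * b * c)) + c * c * c * (t * t * (t - 1#))

    ev-quad : ∀ t x → ev t x * quad t x ≡ nm x + f t * rest t x
    ev-quad t ⟨ a , b , c ⟩ = solve 4 (λ a b c t → (a :+ b :* t :+ c :* (t :* t)) :*
         ((a :- c :* (t :* t :- t)) :* (a :- c :* (t :* t :- t)) :+ (a :- c :* (t :* t :- t)) :* (b :+ c :* (# 1 :- t)) :* (# 1 :- t) :+ (b :+ c :* (# 1 :- t)) :* (b :+ c :* (# 1 :- t)) :* (t :* t :- t))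
        := normP (tri a b c) :+ (t :* t :* t :- t :* t :- # 1) :* ((b :* b :* c :+ b :* b :* b :+ c :* c :* c :- # 2 :* (a :* c :* c) :- # 3 :* (a :* b :* c)) :+ c :* c :* c :* (t :* t :* (t :- # 1)))) refl a b c t

    -- 4 quad = (2A + B(1 - t))² + B²(t - 1)(3t + 1)
    quad-nn : ∀ {t} x → 1# ≤ t → NonNeg (quad t x)
    quad-nn {t} ⟨ a , b , c ⟩ p = 0≤⇒nn (*-cancelˡ-≤ {fromℕ 4} (Pos-suc 3) (≤-by (solve 3 (λ A B t → (# 2 :* A :+ B :* (# 1 :- t)) :* (# 2 :* A :+ B :* (# 1 :- t)) :+ B :* B :* ((t :- # 1) :* (# 3 :* t :+ # 1))
          := # 4 :* (A :* A :+ A :* B :* (# 1 :- t) :+ B :* B :* (t :* t :- t)) :- # 4 :* # 0) refl (a - c * (t * t - t)) (b + c * (1# - t)) t)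
        (nn-+ (nn-sq _) (nn-* (nn-sq _) (nn-* p (nn-+ (nn-* (nn-fromℕ 3) (inj₁ (1≤⇒Pos p))) nn-1))))))

    some-bound : ∀ x → ∃ λ n → x ∈± fromℕ n
    some-bound x = let (m , p) = archimedean x ; (n , q) = archimedean (- x) in m ℕ.+ n ,
      (NonNeg-resp (trans (solve 3 (λ x m n → (m :- x) :+ n := (m :+ n) :- x) refl x (fromℕ m) (fromℕ n)) (cong (_- x) (sym (fromℕ-+ m n)))) (nn-+ (inj₁ p) (nn-fromℕ n)) ,±
       NonNeg-resp (trans (solve 3 (λ x m n → (n :- (:- x)) :+ m := (m :+ n) :+ x) refl x (fromℕ m) (fromℕ n)) (cong (_+ x) (sym (fromℕ-+ m n)))) (nn-+ (inj₁ q) (nn-fromℕ m)))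

  -- t approximates the real root: 1 ≤ t ≤ 2 and |f t| ≤ 12 / M.
  record Near (M : ℕ) (t : Carrier) : Set where
    field
      1≤t : 1# ≤ t
      t≤2 : t ≤ two
      f-small : fromℕ M * f t ∈± fromℕ 12

  ±-cancelˡ : ∀ {a x b} → NonNeg a → ∀ {c} → a ≤ c → c * x ∈± b → a * x ∈± b
  ±-cancelˡ {a} {x} {b} na {c} ac q = pick (≤-or-> 0# x)
    where
      pick : (0# ≤ x) ⊎ (x < 0#) → a * x ∈± b
      pick (inj₁ p) = ±-of-nn (nn-* na (0≤⇒nn p)) (≤-trans (*-monoʳ-≤ (0≤⇒nn p) ac) (±upper q))
      pick (inj₂ p) = subst (_∈± b) (solve 2 (λ s y → :- (s :* (:- y)) := s :* y) refl a x)
        (±-neg (±-of-nn (nn-* na ny) (≤-trans (*-monoʳ-≤ ny ac) (±upper (subst (_∈± b) (solve 2 (λ t y → :- (t :* y) := t :* (:- y)) refl c x) (±-neg q))))))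
        where ny = NonNeg-resp (solve 1 (λ y → # 0 :- y := :- y) refl x) (inj₁ p)

  Near-mono : ∀ {M M' t} → M ℕ.≤ M' → Near M' t → Near M t
  Near-mono {M} p N = record { 1≤t = Near.1≤t N ; t≤2 = Near.t≤2 N ; f-small = ±-cancelˡ (nn-fromℕ M) (fromℕ-mono-≤ p) (Near.f-small N) }

  private
    record Bracket (k : ℕ) : Set where
      field
        lo w : Carrier
        1≤lo : 1# ≤ lo
        nn-w : NonNeg w
        hi≤2 : lo + w ≤ two
        width : fromℕ (2 ℕ.^ k) * w ≡ 1#
        f-lo : f lo ≤ 0#
        f-hi : 0# ≤ f (lo + w)

    bisect : ∀ k → Bracket k
    bisect zero = record { lo = 1# ; w = 1# ; 1≤lo = ≤-refl ; nn-w = nn-1 ; hi≤2 = ≤-refl ; width = *-identityˡ 1#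
      ; f-lo = ≤-by (solve 0 (# 1 := # 0 :- (# 1 :* # 1 :* # 1 :- # 1 :* # 1 :- # 1)) refl) nn-1
      ; f-hi = ≤-by (solve 0 (# 3 := ((# 1 :+ # 1) :* (# 1 :+ # 1) :* (# 1 :+ # 1) :- (# 1 :+ # 1) :* (# 1 :+ # 1) :- # 1) :- # 0) refl) (nn-fromℕ 3) }
    bisect (suc k) = pick (≤-or-> (f mid) 0#)
      where
        open Bracket (bisect k)
        h = two ⁻¹
        2h : two * h ≡ 1#
        2h = *-⁻¹ (Pos⇒≢0 (Pos-suc 1))
        v = w * h
        vv : v + v ≡ w
        vv = trans (solve 2 (λ w h → w :* h :+ w :* h := w :* (# 2 :* h)) refl w h) (trans (cong (λ z → w * z) 2h) (*-identityʳ w))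
        mid = lo + v
        nn-v : NonNeg v
        nn-v = nn-* nn-w (inj₁ (Pos-⁻¹ (Pos-suc 1)))
        end : mid + v ≡ lo + w
        end = trans (+-assoc lo v v) (cong (λ z → lo + z) vv)
        width' : fromℕ (2 ℕ.^ suc k) * v ≡ 1#
        width' = trans (cong (_* v) (fromℕ-* 2 (2 ℕ.^ k))) (trans (solve 2 (λ n v → # 2 :* n :* v := n :* (v :+ v)) refl (fromℕ (2 ℕ.^ k)) v) (trans (cong (λ z → fromℕ (2 ℕ.^ k) * z) vv) width))
        pick : (f mid ≤ 0#) ⊎ (0# < f mid) → Bracket (suc k)
        pick (inj₁ p) = record { lo = mid ; w = v ; 1≤lo = ≤-trans 1≤lo (≤-by (solve 2 (λ l v → v := (l :+ v) :- l) refl lo v) nn-v) ; nn-w = nn-v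
          ; hi≤2 = subst (_≤ two) (sym end) hi≤2 ; width = width' ; f-lo = p ; f-hi = subst (λ z → 0# ≤ f z) (sym end) f-hi }
        pick (inj₂ p) = record { lo = lo ; w = v ; 1≤lo = 1≤lo ; nn-w = nn-v
          ; hi≤2 = ≤-trans (≤-by (trans (solve 2 (λ m v → v := (m :+ v) :- m) refl mid v) (cong (_- mid) end)) nn-v) hi≤2 ; width = width' ; f-lo = f-lo ; f-hi = <⇒≤ p }

    n≤2^n : ∀ n → n ℕ.≤ 2 ℕ.^ n
    n≤2^n zero = ℕ.z≤n
    n≤2^n (suc n) = ℕP.≤-trans (ℕP.+-mono-≤ (ℕP.m^n>0 2 n) (n≤2^n n)) (ℕP.≤-reflexive (cong (2 ℕ.^ n ℕ.+_) (sym (ℕP.+-identityʳ _))))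

  near-exists : ∀ M → ∃ (Near M)
  near-exists M = lo , record { 1≤t = 1≤lo ; t≤2 = ≤-trans lo≤ hi≤2
      ; f-small = ±-cancelˡ (nn-fromℕ M) (fromℕ-mono-≤ (n≤2^n M)) small }
    where
      open Bracket (bisect M)
      lo≤ : lo ≤ lo + w
      lo≤ = ≤-by (solve 2 (λ l v → v := (l :+ v) :- l) refl lo w) nn-w
      hi = lo + w
      nn-lo = inj₁ (1≤⇒Pos 1≤lo)
      -- On [1, 2] the derivative of f is at most 3t² ≤ 12, and f is nonnegative at the right end of
      -- the bracket.
      -f≤ : - f lo ≤ fromℕ 12 * w
      -f≤ = ≤-by (solve 2 (λ l w → (((l :+ w) :* (l :+ w) :* (l :+ w) :- (l :+ w) :* (l :+ w) :- # 1) :- # 0)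
                   :+ w :* (# 3 :* ((# 2 :- (l :+ w)) :* (# 2 :+ (l :+ w))) :+ (# 3 :* (l :* w) :+ # 2 :* (w :* w) :+ # 2 :* l :+ w))
                := # 12 :* w :- (:- (l :* l :* l :- l :* l :- # 1))) refl lo w)
        (nn-+ f-hi (nn-* nn-w (nn-+ (nn-* (nn-fromℕ 3) (nn-* hi≤2 (nn-+ (nn-fromℕ 2) (nn-+ nn-lo nn-w)))) (nn-+ (nn-+ (nn-+ (nn-* (nn-fromℕ 3) (nn-* nn-lo nn-w)) (nn-* (nn-fromℕ 2) (nn-* nn-w nn-w))) (nn-* (nn-fromℕ 2) nn-lo)) nn-w))))
      small : fromℕ (2 ℕ.^ M) * f lo ∈± fromℕ 12
      small = subst₂ _∈±_ (solve 2 (λ n x → :- (n :* (:- x)) := n :* x) refl (fromℕ (2 ℕ.^ M)) (f lo)) refl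
        (±-neg (±-of-nn (nn-* (nn-fromℕ (2 ℕ.^ M)) (NonNeg-resp (solve 1 (λ x → # 0 :- x := :- x) refl (f lo)) f-lo))
          (≤-trans (*-monoˡ-≤ (nn-fromℕ (2 ℕ.^ M)) -f≤) (≤-reflexive (trans (solve 2 (λ n w → n :* (# 12 :* w) := # 12 :* (n :* w)) refl (fromℕ (2 ℕ.^ M)) w) (trans (cong (λ z → fromℕ 12 * z) width) (*-identityʳ _)))))))

  -- The sign of the norm is the sign of the real embedding.
  norm-sign : ∀ x → Pos (nm x) → ∃ λ M → ∀ t → Near M t → Pos (ev t x)
  norm-sign x@(⟨ a , b , c ⟩) pos = M , sign
    where
      i = nm x ⁻¹
      k₁ = b * b * c + b * b * b + c * c * c - fromℕ 2 * (a * c * c) - fromℕ 3 * (a * b * c)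
      n₁ = proj₁ (some-bound k₁)
      n₂ = proj₁ (some-bound (c * c * c))
      C = fromℕ n₁ + fromℕ n₂ * (fromℕ 4 * fromℕ 1)
      M = proj₁ (archimedean (fromℕ 12 * C * i))
      M-big : fromℕ 12 * C < fromℕ M * nm x
      M-big = <-by (trans (solve 4 (λ m c i n → (m :- c :* i) :* n := m :* n :- c :* (n :* i)) refl (fromℕ M) (fromℕ 12 * C) i (nm x)) (cong (λ z → fromℕ M * nm x - z) (trans (cong (λ z → fromℕ 12 * C * z) (*-⁻¹ (Pos⇒≢0 pos))) (*-identityʳ _))))
        (Pos-* (proj₂ (archimedean (fromℕ 12 * C * i))) pos)
      sign : ∀ t → Near M t → Pos (ev t x)
      sign t N = pick (trichotomy (ev t x))
        where
          open Near N
          t-1 : t - 1# ∈± 1#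
          t-1 = ±-of-nn 1≤t (≤-by (solve 1 (λ t → # 2 :- t := # 1 :- (t :- # 1)) refl t) t≤2)
          t± : t ∈± two
          t± = ±-of-nn (inj₁ (1≤⇒Pos 1≤t)) t≤2
          rest± : rest t x ∈± C
          rest± = ±-+ (proj₂ (some-bound k₁)) (±-* (proj₂ (some-bound (c * c * c))) (subst (t * t * (t - 1#) ∈±_) (solve 0 (# 2 :* # 2 :* # 1 := # 4 :* # 1) refl) (±-* (±-* t± t±) t-1)))
          M·product : fromℕ M * (ev t x * quad t x) ≡ fromℕ M * nm x + (fromℕ M * f t) * rest t x
          M·product = trans (cong (λ z → fromℕ M * z) (ev-quad t x)) (solve 4 (λ m n f r → m :* (n :+ f :* r) := m :* n :+ m :* f :* r) refl (fromℕ M) (nm x) (f t) (rest t x))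
          positive : Pos (fromℕ M * (ev t x * quad t x))
          positive = Pos-resp (trans (solve 3 (λ n e c → (n :- c) :+ (c :+ e) := n :+ e) refl (fromℕ M * nm x) ((fromℕ M * f t) * rest t x) (fromℕ 12 * C)) (sym M·product))
            (pn-+ M-big (±lower (±-* f-small rest±)))
          pick : Pos (ev t x) ⊎ (ev t x ≡ 0# ⊎ Pos (- ev t x)) → Pos (ev t x)
          pick (inj₁ p) = p
          pick (inj₂ (inj₁ z)) = ⊥-elim (Pos⇒≢0 positive (trans (cong (λ e → fromℕ M * (e * quad t x)) z) (solve 2 (λ m q → m :* (# 0 :* q) := # 0) refl (fromℕ M) (quad t x))))
          pick (inj₂ (inj₂ n)) = ⊥-elim (¬Pos-neg (nn-* (nn-fromℕ M) (nn-* (inj₁ n) (quad-nn x 1≤t))) (Pos-resp (solve 3 (λ m e q → m :* (e :* q) := :- (m :* ((:- e) :* q))) refl (fromℕ M) (ev t x) (quad t x)) positive))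

  PosK : K → Set
  PosK x = Pos (nm x)

  trichotomyK : ∀ x → PosK x ⊎ (x ≡ 0K ⊎ PosK (⊝ x))
  trichotomyK x with trichotomy (nm x)
  ... | inj₁ p = inj₁ p
  ... | inj₂ (inj₁ z) = inj₂ (inj₁ (nm-zero x z))
  ... | inj₂ (inj₂ n) = inj₂ (inj₂ (Pos-resp (sym (nm-⊝ x)) n))

  ev-⊕ : ∀ t x y → ev t (x ⊕ y) ≡ ev t x + ev t y
  ev-⊕ t ⟨ a , b , c ⟩ ⟨ d , e , g ⟩ = solve 7 (λ a b c d e g t → (a :+ d) :+ (b :+ e) :* t :+ (c :+ g) :* (t :* t) := (a :+ b :* t :+ c :* (t :* t)) :+ (d :+ e :* t :+ g :* (t :* t))) refl a b c d e g t

  ev-⊝ : ∀ t x → ev t (⊝ x) ≡ - ev t x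
  ev-⊝ t ⟨ a , b , c ⟩ = solve 4 (λ a b c t → (:- a) :+ (:- b) :* t :+ (:- c) :* (t :* t) := :- (a :+ b :* t :+ c :* (t :* t))) refl a b c t

  -- A single good approximation decides the sign.
  PosK-by-ev : ∀ x → (∀ M → ∃ λ t → Near M t × Pos (ev t x)) → PosK x
  PosK-by-ev x h = pick (trichotomyK x)
    where
      pick : PosK x ⊎ (x ≡ 0K ⊎ PosK (⊝ x)) → PosK x
      pick (inj₁ p) = p
      pick (inj₂ (inj₁ z)) = let (t , _ , p) = h 0 in ⊥-elim (Pos⇒≢0 p (trans (cong (ev t) z) (solve 1 (λ t → # 0 :+ # 0 :* t :+ # 0 :* (t :* t) := # 0) refl t)))
      pick (inj₂ (inj₂ n)) = let (M , s) = norm-sign (⊝ x) n ; (t , N , p) = h M in ⊥-elim (¬Pos-neg (inj₁ p) (Pos-resp (ev-⊝ t x) (s t N)))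

  -- The norm is not additive, so the sum is evaluated at one approximate root that is good enough
  -- for both summands.
  PosK-⊕ : ∀ {x y} → PosK x → PosK y → PosK (x ⊕ y)
  PosK-⊕ {x} {y} p q = PosK-by-ev (x ⊕ y) λ M →
    let (M₁ , s₁) = norm-sign x p ; (M₂ , s₂) = norm-sign y q ; (t , N) = near-exists (M ℕ.+ (M₁ ℕ.+ M₂)) in
    t , Near-mono (ℕP.m≤m+n M _) N , Pos-resp (sym (ev-⊕ t x y))
      (Pos-+ (s₁ t (Near-mono (ℕP.≤-trans (ℕP.m≤m+n M₁ M₂) (ℕP.m≤n+m _ M)) N)) (s₂ t (Near-mono (ℕP.≤-trans (ℕP.m≤n+m M₂ M₁) (ℕP.m≤n+m _ M)) N)))

  inverseK : ∀ x → x ≢ 0K → ∃ λ y → x ⊗ y ≡ 1K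
  inverseK x ne = adj x ⊗ scalar (nm x ⁻¹) , trans (sym (⊗-assoc x (adj x) _)) (trans (cong (_⊗ scalar (nm x ⁻¹)) (adj-norm x)) (trans (scalar-⊗ (nm x) (nm x ⁻¹)) (cong scalar (*-⁻¹ (λ e → ne (nm-zero x e))))))

  numeralK : ∀ n → numeral _⊕_ 0K 1K n ≡ scalar (fromℕ n)
  numeralK zero = refl
  numeralK (suc zero) = refl
  numeralK (suc (suc n)) = trans (cong (1K ⊕_) (numeralK (suc n))) (cong₃ refl (+-identityˡ 0#) (+-identityˡ 0#))

  archimedeanK : ∀ x → ∃ λ n → PosK (numeral _⊕_ 0K 1K n ⊕ ⊝ x)
  archimedeanK x@(⟨ a , b , c ⟩) = k , PosK-by-ev (numeral _⊕_ 0K 1K k ⊕ ⊝ x) λ M → let (t , N) = near-exists M in t , N , positive t N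
    where
      n₀ = proj₁ (some-bound a)
      n₁ = proj₁ (some-bound b)
      n₂ = proj₁ (some-bound c)
      S = fromℕ n₀ + fromℕ n₁ * two + fromℕ n₂ * (two * two)
      k = proj₁ (archimedean S)
      positive : ∀ {M} t → Near M t → Pos (ev t (numeral _⊕_ 0K 1K k ⊕ ⊝ x))
      positive t N = Pos-resp (sym (trans (cong (λ z → ev t (z ⊕ ⊝ x)) (numeralK k)) (solve 5 (λ k a b c t → (k :+ :- a) :+ (# 0 :+ :- b) :* t :+ (# 0 :+ :- c) :* (t :* t) := (k :- (a :+ b :* t :+ c :* (t :* t)))) refl (fromℕ k) a b c t)))
          (Pos-resp (solve 3 (λ k s e → (k :- s) :+ (s :- e) := k :- e) refl (fromℕ k) S (a + b * t + c * (t * t))) (pn-+ (proj₂ (archimedean S)) (±upper bound)))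
        where
          t± : t ∈± two
          t± = ±-of-nn (inj₁ (1≤⇒Pos (Near.1≤t N))) (Near.t≤2 N)
          bound : a + b * t + c * (t * t) ∈± S
          bound = ±-+ (±-+ (proj₂ (some-bound a)) (±-* (proj₂ (some-bound b)) t±)) (±-* (proj₂ (some-bound c)) (±-* t± t±))

  field-K : NarayanaField
  field-K = record
    { orderedField = record
      { Carrier = K ; _+_ = _⊕_ ; _*_ = _⊗_ ; -_ = ⊝_ ; 0# = 0K ; 1# = 1K ; isCommutativeRing = isCommutativeRingK
      ; Pos = PosK
      ; ¬Pos0 = λ p → ¬Pos0 (Pos-resp (solve 0 (normP (tri (# 0) (# 0) (# 0)) := # 0) refl) p)
      ; Pos-1 = Pos-resp (solve 0 (# 1 := normP (tri (# 1) (# 0) (# 0))) refl) Pos-1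
      ; Pos-+ = λ {x} {y} → PosK-⊕ {x} {y}
      ; Pos-* = λ {x} {y} p q → Pos-resp (sym (nm-⊗ x y)) (Pos-* p q)
      ; trichotomy = trichotomyK
      ; inverse = inverseK
      ; archimedean = archimedeanK }
    ; α = αK
    ; α-root = cong₃ (solve 0 (p₀ (tri (# 0) (# 1) (# 0) ⊠ tri (# 0) (# 1) (# 0) ⊠ tri (# 0) (# 1) (# 0)) := p₀ ((tri (# 0) (# 1) (# 0) ⊠ tri (# 0) (# 1) (# 0)) ⊞ tri (# 1) (# 0) (# 0))) refl)
        (solve 0 (p₁ (tri (# 0) (# 1) (# 0) ⊠ tri (# 0) (# 1) (# 0) ⊠ tri (# 0) (# 1) (# 0)) := p₁ ((tri (# 0) (# 1) (# 0) ⊠ tri (# 0) (# 1) (# 0)) ⊞ tri (# 1) (# 0) (# 0))) refl)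
        (solve 0 (p₂ (tri (# 0) (# 1) (# 0) ⊠ tri (# 0) (# 1) (# 0) ⊠ tri (# 0) (# 1) (# 0)) := p₂ ((tri (# 0) (# 1) (# 0) ⊠ tri (# 0) (# 1) (# 0)) ⊞ tri (# 1) (# 0) (# 0))) refl) }

-- The rational numbers as an ordered field

module RationalField where

  open import Data.Integer using (+_; -[1+_])
  open import Data.Rational as ℚ using (ℚ; mkℚ; 0ℚ; 1ℚ)
  import Data.Rational.Properties as ℚP
  import Data.Rational.Unnormalised as ℚᵘ
  import Data.Rational.Unnormalised.Properties as ℚᵘP
  open import Relation.Binary.Definitions using (tri<; tri≈; tri>)

  private
    inverseℚ : ∀ x → x ≢ 0ℚ → ∃ λ y → x ℚ.* y ≡ 1ℚ
    inverseℚ x ne = ℚ.1/_ x ⦃ ℚ.≢-nonZero ne ⦄ , ℚP.*-inverseʳ x ⦃ ℚ.≢-nonZero ne ⦄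

    trichotomyℚ : ∀ x → 0ℚ ℚ.< x ⊎ (x ≡ 0ℚ ⊎ 0ℚ ℚ.< ℚ.- x)
    trichotomyℚ x with ℚP.<-cmp 0ℚ x
    ... | tri< p _ _ = inj₁ p
    ... | tri≈ _ e _ = inj₂ (inj₁ (sym e))
    ... | tri> _ _ p = inj₂ (inj₂ (ℚP.neg-antimono-< p))

    numeral-ℚ : ∀ n → ℚ.toℚᵘ (numeral ℚ._+_ 0ℚ 1ℚ n) ℚᵘ.≃ ℚᵘ.mkℚᵘ (+ n) 0
    numeral-ℚ zero = ℚᵘ.*≡* refl
    numeral-ℚ (suc zero) = ℚᵘ.*≡* refl
    numeral-ℚ (suc (suc n)) = ℚᵘP.≃-trans (ℚP.toℚᵘ-homo-+ 1ℚ (numeral ℚ._+_ 0ℚ 1ℚ (suc n)))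
      (ℚᵘP.≃-trans (ℚᵘP.+-congʳ (ℚ.toℚᵘ 1ℚ) (numeral-ℚ (suc n))) (ℚᵘ.*≡* (cong (ℤ._* + 1) (cong (λ z → + 1 ℤ.* + 1 ℤ.+ z) (ℤP.*-identityʳ (+ suc n))))))

    clear : ∀ x → ∃₂ λ n z → 1 ℕ.≤ n × ℚ.toℚᵘ x ℚᵘ.* ℚᵘ.mkℚᵘ (+ n) 0 ℚᵘ.≃ ℚᵘ.mkℚᵘ z 0
    clear x@(mkℚ p q _) = suc q , p , ℕ.s≤s ℕ.z≤n , ℚᵘ.*≡* (trans (ℤP.*-identityʳ _) (cong (p ℤ.*_) (sym (trans (cong +_ (ℕP.*-identityʳ (suc q))) refl))))

    archimedeanℚ : ∀ x → ∃ λ n → 0ℚ ℚ.< numeral ℚ._+_ 0ℚ 1ℚ n ℚ.+ ℚ.- x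
    archimedeanℚ x@(mkℚ p q _) = n , subst (ℚ._< numeral ℚ._+_ 0ℚ 1ℚ n ℚ.+ ℚ.- x) (ℚP.+-inverseʳ x) (ℚP.+-monoˡ-< (ℚ.- x) below)
      where
        n = suc ℤ.∣ p ∣
        p<nq : p ℤ.* + 1 ℤ.< + n ℤ.* + suc q
        p<nq = subst₂ ℤ._<_ (sym (ℤP.*-identityʳ p)) (ℤP.pos-* n (suc q)) (ℤP.≤-<-trans (p≤ p) (ℤ.+<+ (ℕP.m≤m*n n (suc q))))
          where p≤ : ∀ p → p ℤ.≤ + ℤ.∣ p ∣
                p≤ (+ _) = ℤP.≤-refl
                p≤ -[1+ _ ] = ℤ.-≤+
        below : x ℚ.< numeral ℚ._+_ 0ℚ 1ℚ n
        below = ℚP.toℚᵘ-cancel-< (ℚᵘP.<-respʳ-≃ (ℚᵘP.≃-sym (numeral-ℚ n)) (ℚᵘ.*<* p<nq))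

  rationals : OrderedField
  rationals = record
    { Carrier = ℚ ; _+_ = ℚ._+_ ; _*_ = ℚ._*_ ; -_ = ℚ.-_ ; 0# = 0ℚ ; 1# = 1ℚ
    ; isCommutativeRing = ℚP.+-*-isCommutativeRing
    ; Pos = 0ℚ ℚ.<_
    ; ¬Pos0 = ℚP.<-irrefl refl
    ; Pos-1 = ℚP.positive⁻¹ 1ℚ
    ; Pos-+ = λ p q → ℚP.+-mono-< p q
    ; Pos-* = λ {x} {y} p q → ℚP.positive⁻¹ (x ℚ.* y) ⦃ ℚP.pos*pos⇒pos x ⦃ ℚ.positive p ⦄ y ⦃ ℚ.positive q ⦄ ⦄
    ; trichotomy = trichotomyℚ
    ; inverse = inverseℚ
    ; archimedean = archimedeanℚ }

  open OrderedFieldTheory rationals using (ι)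
  open OrderedField rationals using (fromℕ)

  clear-denominator : ∀ x → ∃₂ λ n z → 1 ℕ.≤ n × x ℚ.* fromℕ n ≡ ι z
  clear-denominator x = let (n , z , p , e) = clear x in n , z , p ,
    ℚP.toℚᵘ-injective (ℚᵘP.≃-trans (ℚP.toℚᵘ-homo-* x (fromℕ n)) (ℚᵘP.≃-trans (ℚᵘP.*-congˡ {ℚ.toℚᵘ x} (numeral-ℚ n)) (ℚᵘP.≃-trans e (ℚᵘP.≃-sym (ι-ℚ z)))))
    where
      ι-ℚ : ∀ z → ℚ.toℚᵘ (ι z) ℚᵘ.≃ ℚᵘ.mkℚᵘ z 0
      ι-ℚ (+ n) = numeral-ℚ n
      ι-ℚ -[1+ n ] = ℚᵘP.≃-trans (ℚP.toℚᵘ-homo‿- (fromℕ (suc n))) (ℚᵘP.-‿cong (numeral-ℚ (suc n)))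

-- Enumeration of the small cases

module Search where

  open import Data.Nat using (_+_; _*_; _^_; _/_; _%_; _≤_; _<_; _≡ᵇ_; _≤ᵇ_; NonZero; z≤n; s≤s)
  open import Data.Nat.Divisibility using (n∣m*n)
  open import Data.Bool using (Bool; true; false; if_then_else_; _∧_; T)
  open import Data.List using (List; []; _∷_)
  open import Data.List.Membership.Propositional using (_∈_)
  open import Data.List.Relation.Unary.Any using (here; there)
  open Defs
  open CertifiedLogs
  open BakerDavenport

  digits : ℕ → ℕ → ℕ → ℕ
  digits a b zero = 0
  digits a b (suc ℓ) = a + digits a b ℓ * b

  digits-* : ∀ a b′ ℓ → b′ * digits a (suc b′) ℓ + a ≡ a * suc b′ ^ ℓ
  digits-* a b′ zero = trans (cong (_+ a) (ℕP.*-zeroʳ b′)) (sym (ℕP.*-identityʳ a))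
  digits-* a b′ (suc ℓ) = trans (lem b′ a (digits a (suc b′) ℓ)) (trans (cong (suc b′ *_) (digits-* a b′ ℓ)) (swap (suc b′) a (suc b′ ^ ℓ)))
    where
      lem : ∀ b′ a d → b′ * (a + d * (1 + b′)) + a ≡ (1 + b′) * (b′ * d + a)
      lem = ℕsolve-∀
      swap : ∀ b a p → b * (a * p) ≡ a * (b * p)
      swap = ℕsolve-∀

  same : Tuple → Tuple → Bool
  same (n , m , ℓ , a , b) (n′ , m′ , ℓ′ , a′ , b′) = (n ≡ᵇ n′) ∧ ((m ≡ᵇ m′) ∧ ((ℓ ≡ᵇ ℓ′) ∧ ((a ≡ᵇ a′) ∧ (b ≡ᵇ b′))))

  member : Tuple → List Tuple → Bool
  member t [] = false
  member t (s ∷ ts) = if same t s then true else member t ts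

  ≡ᵇ-elim : ∀ {x y} → (x ≡ᵇ y) ≡ true → x ≡ y
  ≡ᵇ-elim {x} {y} e = ℕP.≡ᵇ⇒≡ x y (true⇒T e)

  T⇒true : ∀ {b} → T b → b ≡ true
  T⇒true {true} _ = refl

  same-sound : ∀ s t → same s t ≡ true → s ≡ t
  same-sound (n , m , ℓ , a , b) (n′ , m′ , ℓ′ , a′ , b′) e =
    cong₂ _,_ (≡ᵇ-elim (proj₁ e₁)) (cong₂ _,_ (≡ᵇ-elim (proj₁ e₂)) (cong₂ _,_ (≡ᵇ-elim (proj₁ e₃)) (cong₂ _,_ (≡ᵇ-elim (proj₁ e₄)) (≡ᵇ-elim (proj₂ e₄)))))
    where
      e₁ : (n ≡ᵇ n′) ≡ true × ((m ≡ᵇ m′) ∧ ((ℓ ≡ᵇ ℓ′) ∧ ((a ≡ᵇ a′) ∧ (b ≡ᵇ b′)))) ≡ true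
      e₁ = ∧-elim e
      e₂ : (m ≡ᵇ m′) ≡ true × ((ℓ ≡ᵇ ℓ′) ∧ ((a ≡ᵇ a′) ∧ (b ≡ᵇ b′))) ≡ true
      e₂ = ∧-elim (proj₂ e₁)
      e₃ : (ℓ ≡ᵇ ℓ′) ≡ true × ((a ≡ᵇ a′) ∧ (b ≡ᵇ b′)) ≡ true
      e₃ = ∧-elim (proj₂ e₂)
      e₄ : (a ≡ᵇ a′) ≡ true × (b ≡ᵇ b′) ≡ true
      e₄ = ∧-elim (proj₂ e₃)

  member-sound : ∀ t ts → member t ts ≡ true → t ∈ ts
  member-sound t (s ∷ ts) = if-elim (λ b → b ≡ true → t ∈ s ∷ ts) (same t s) (λ p _ → here (same-sound t s (T⇒true p))) (λ _ e → there (member-sound t ts e))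

  -- Removes trailing digits equal to `a` and counts them in `ℓ`. Running out of fuel answers
  -- `false`, which keeps the test sound; 100 digits suffice for the sums in question.
  strip : ℕ → (a b : ℕ) .⦃ _ : NonZero b ⦄ → (n m : ℕ) → ℕ → ℕ → Bool
  strip zero a b n m ℓ x = false
  strip (suc fuel) a b n m ℓ zero = if ℓ ≤ᵇ 2 then true else if a ≡ᵇ 0 then true else member (n , m , ℓ , a , b) solutions
  strip (suc fuel) a b n m ℓ x@(suc _) = if x % b ≡ᵇ a then strip fuel a b n m (suc ℓ) (x / b) else true

  strip-sound : ∀ fuel a b .⦃ _ : NonZero b ⦄ n m i j → 1 ≤ a → a < b → 3 ≤ i + j → strip fuel a b n m i (digits a b j) ≡ true → (n , m , i + j , a , b) ∈ solutions
  strip-sound (suc fuel) a b n m i zero 1≤a a<b 3≤ = if-elim (λ x → x ≡ true → (n , m , i + 0 , a , b) ∈ solutions) (i ≤ᵇ 2)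
    (λ p _ → ⊥-elim (ℕP.<⇒≱ (ℕP.≤-trans 3≤ (ℕP.≤-reflexive (ℕP.+-identityʳ i))) (ℕP.≤ᵇ⇒≤ i 2 p)))
    (λ _ → if-elim (λ x → x ≡ true → (n , m , i + 0 , a , b) ∈ solutions) (a ≡ᵇ 0) (λ p _ → ⊥-elim (ℕP.<⇒≢ 1≤a (sym (ℕP.≡ᵇ⇒≡ a 0 p))))
      (λ _ e → subst (λ ℓ → (n , m , ℓ , a , b) ∈ solutions) (sym (ℕP.+-identityʳ i)) (member-sound (n , m , i , a , b) solutions e)))
  strip-sound (suc fuel) a@(suc _) b n m i (suc j) 1≤a a<b 3≤ = if-elim (λ x → x ≡ true → (n , m , i + suc j , a , b) ∈ solutions) (x % b ≡ᵇ a)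
    (λ _ e → subst (λ ℓ → (n , m , ℓ , a , b) ∈ solutions) (sym (ℕP.+-suc i j)) (strip-sound fuel a b n m (suc i) j 1≤a a<b (ℕP.≤-trans 3≤ (ℕP.≤-reflexive (ℕP.+-suc i j)))
      (subst (λ y → strip fuel a b n m (suc i) y ≡ true) quotient e)))
    (λ ¬p _ → ⊥-elim (¬p (ℕP.≡⇒≡ᵇ (x % b) a remainder)))
    where
      x : ℕ
      x = digits a b (suc j)
      remainder : x % b ≡ a
      remainder = trans (DM.[m+kn]%n≡m%n a (digits a b j) b) (DM.m<n⇒m%n≡m a<b)
      quotient : x / b ≡ digits a b j
      quotient = trans (DM.+-distrib-/-∣ʳ a (n∣m*n (digits a b j))) (cong₂ _+_ (DM.m<n⇒m/n≡0 a<b) (DM.m*n/n≡m (digits a b j) b))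

  -- A repdigit determines its digit as the residue modulo the base, so there is no loop over a.
  bases : ℕ → (n m x : ℕ) → Bool
  bases zero n m x = true
  bases (suc i) n m x = strip 100 (x % suc (suc i)) (suc (suc i)) n m 0 x ∧ bases i n m x

  bases-sound : ∀ i n m a ℓ b′ → bases i n m (digits a (suc b′) ℓ) ≡ true → 1 ≤ b′ → b′ ≤ i → 1 ≤ a → a ≤ b′ → 3 ≤ ℓ → (n , m , ℓ , a , suc b′) ∈ solutions
  bases-sound zero n m a ℓ b′ e 1≤b′ b′≤ = ⊥-elim (ℕP.<⇒≱ 1≤b′ b′≤)
  bases-sound (suc i) n m a ℓ b′ e 1≤b′ b′≤ 1≤a a≤b′ 3≤ℓ = pick (ℕP.m≤n⇒m<n∨m≡n b′≤)
    where
      x : ℕ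
      x = digits a (suc b′) ℓ
      both : strip 100 (x % suc (suc i)) (suc (suc i)) n m 0 x ≡ true × bases i n m x ≡ true
      both = ∧-elim {strip 100 (x % suc (suc i)) (suc (suc i)) n m 0 x} e
      last-digit : ∀ ℓ → 3 ≤ ℓ → digits a (suc b′) ℓ % suc b′ ≡ a
      last-digit (suc ℓ) _ = trans (DM.[m+kn]%n≡m%n a (digits a (suc b′) ℓ) (suc b′)) (DM.m<n⇒m%n≡m (s≤s a≤b′))
      pick : b′ < suc i ⊎ b′ ≡ suc i → (n , m , ℓ , a , suc b′) ∈ solutions
      pick (inj₁ (s≤s b′≤i)) = bases-sound i n m a ℓ b′ (proj₂ both) 1≤b′ b′≤i 1≤a a≤b′ 3≤ℓ
      pick (inj₂ refl) = strip-sound 100 a (suc b′) n m 0 ℓ 1≤a (s≤s a≤b′) 3≤ℓ (subst (λ y → strip 100 y (suc b′) n m 0 x ≡ true) (last-digit ℓ 3≤ℓ) (proj₁ both))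

  -- x, y, z are three consecutive terms from the n-th on, and seen lists the earlier indices and terms.
  search : ℕ → (n x y z : ℕ) → List (ℕ × ℕ) → Bool
  search zero n x y z seen = true
  search (suc fuel) n x y z seen = allᵇ (λ p → bases 99 n (proj₁ p) (x + proj₂ p)) ((n , x) ∷ seen) ∧ search fuel (suc n) y z (z + x) ((n , x) ∷ seen)

  search-sound : ∀ fuel s seen → (∀ m → m < s → (m , N m) ∈ seen) → search fuel s (N s) (N (suc s)) (N (suc (suc s))) seen ≡ true →
    ∀ n m → s ≤ n → n < s + fuel → m ≤ n → bases 99 n m (N n + N m) ≡ true
  search-sound zero s seen inv e n m s≤ n< = ⊥-elim (ℕP.<⇒≱ n< (ℕP.≤-trans (ℕP.≤-reflexive (ℕP.+-identityʳ s)) s≤))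
  search-sound (suc fuel) s seen inv e n m s≤ n< m≤n = pick (ℕP.m≤n⇒m<n∨m≡n s≤)
    where
      here-ok : Bool
      here-ok = allᵇ (λ p → bases 99 s (proj₁ p) (N s + proj₂ p)) ((s , N s) ∷ seen)
      both : here-ok ≡ true × search fuel (suc s) (N (suc s)) (N (suc (suc s))) (N (suc (suc (suc s)))) ((s , N s) ∷ seen) ≡ true
      both = ∧-elim {here-ok} e
      extended : ∀ m → m < suc s → (m , N m) ∈ (s , N s) ∷ seen
      extended m (s≤s m≤s) = split (ℕP.m≤n⇒m<n∨m≡n m≤s)
        where
          split : m < s ⊎ m ≡ s → (m , N m) ∈ (s , N s) ∷ seen
          split (inj₁ p) = there (inv m p)
          split (inj₂ refl) = here refl
      pick : s < n ⊎ s ≡ n → bases 99 n m (N n + N m) ≡ true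
      pick (inj₁ s<n) = search-sound fuel (suc s) ((s , N s) ∷ seen) extended (proj₂ both) n m s<n (ℕP.<-≤-trans n< (ℕP.≤-reflexive (ℕP.+-suc s fuel))) m≤n
      pick (inj₂ refl) = allᵇ-∈ (λ p → bases 99 s (proj₁ p) (N s + proj₂ p)) (proj₁ both) (extended m (s≤s m≤n))

  small-search : search 140 0 0 1 1 [] ≡ true
  small-search = refl

  small-solutions : ∀ {n m ℓ a b′} → n < 140 → m ≤ n → 1 ≤ b′ → b′ ≤ 99 → 1 ≤ a → a ≤ b′ → 3 ≤ ℓ → b′ * (N n + N m) + a ≡ a * suc b′ ^ ℓ → (n , m , ℓ , a , suc b′) ∈ solutions
  small-solutions {n} {m} {ℓ} {a} {b′} n< m≤n 1≤b′ b′≤99 1≤a a≤b′ 3≤ℓ equation =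
    bases-sound 99 n m a ℓ b′ (subst (λ x → bases 99 n m x ≡ true) sum≡digits (search-sound 140 0 [] (λ m ()) small-search n m z≤n n< m≤n)) 1≤b′ b′≤99 1≤a a≤b′ 3≤ℓ
    where
      sum≡digits : N n + N m ≡ digits a (suc b′) ℓ
      sum≡digits = ℕP.*-cancelˡ-≡ (N n + N m) (digits a (suc b′) ℓ) b′ ⦃ Data.Nat.>-nonZero 1≤b′ ⦄ (ℕP.+-cancelʳ-≡ a (b′ * (N n + N m)) (b′ * digits a (suc b′) ℓ) (trans equation (sym (digits-* a b′ ℓ))))

-- The two passes and both directions of the theorem

open import Data.Nat using (_+_; _*_; _∸_; _^_; _/_; _≤_; _<_; _≡ᵇ_; _≤ᵇ_; NonZero; z≤n; s≤s)
open import Data.Bool using (Bool; true; false; _∧_)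
open import Data.List.Membership.Propositional using (_∈_)
open import Function.Bundles using (_⇔_; mk⇔)
open Defs
open CertifiedLogs
open BakerDavenport
open Equation
open RationalField
open Search

field-K : NarayanaField
field-K = CubicField.field-K rationals clear-denominator

-- All numerical conditions of a pass in one boolean, so that a single evaluation to `true`
-- certifies the pass.
module Certificate (one k root : ℕ) (Nmax U qmin bases depth : ℕ) where

  valid : .⦃ _ : NonZero one ⦄ → Bool
  valid = (root * root * root ≤ᵇ root * root * one + one * one * one) ∧ ((suc root * suc root * one + one * one * one ≤ᵇ suc root * suc root * suc root) ∧
    ((U ≤ᵇ k) ∧ ((99 ≤ᵇ bases) ∧ ((2 * (6 + U) ≤ᵇ depth) ∧ ((hiα ≤ᵇ loα + 2) ∧ ((hiC ≤ᵇ loC + 2) ∧ (widthsN 1 (suc bases) ∧ check depth)))))))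
    where open Pass one k root Nmax U qmin bases

  reduce : ⦃ nonZero : NonZero one ⦄ → valid ≡ true → ∀ {n m ℓ a b′} → Solution n m ℓ a b′ → n ≤ Nmax → n < 2 * (6 + U)
  reduce e = Reductions.Reduction.size-bounded field-K one k root Nmax U qmin bases depth (le (proj₁ e₁)) (le (proj₁ e₂)) (le (proj₁ e₃)) (le (proj₁ e₄)) (le (proj₁ e₅))
      (le (proj₁ e₆)) (le (proj₁ e₇)) (proj₁ e₈) (proj₂ e₈)
    where
      open Pass one k root Nmax U qmin bases
      le : ∀ {x y} → (x ≤ᵇ y) ≡ true → x ≤ y
      le {x} {y} p = ℕP.≤ᵇ⇒≤ x y (true⇒T p)
      e₁ : _ × _
      e₁ = ∧-elim {root * root * root ≤ᵇ root * root * one + one * one * one} e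
      e₂ : _ × _
      e₂ = ∧-elim {suc root * suc root * one + one * one * one ≤ᵇ suc root * suc root * suc root} (proj₂ e₁)
      e₃ : _ × _
      e₃ = ∧-elim {U ≤ᵇ k} (proj₂ e₂)
      e₄ : _ × _
      e₄ = ∧-elim {99 ≤ᵇ bases} (proj₂ e₃)
      e₅ : _ × _
      e₅ = ∧-elim {2 * (6 + U) ≤ᵇ depth} (proj₂ e₄)
      e₆ : _ × _
      e₆ = ∧-elim {hiα ≤ᵇ loα + 2} (proj₂ e₅)
      e₇ : _ × _
      e₇ = ∧-elim {hiC ≤ᵇ loC + 2} (proj₂ e₆)
      e₈ : _ × _
      e₈ = ∧-elim {widthsN 1 (suc bases)} (proj₂ e₇)

-- Every squaring doubles the relative error. The 60 and 50 bits beyond the 1400 and 150 squarings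
-- keep the enclosures within the width 2 that `valid` checks.
one₁ one₂ root₁ root₂ : ℕ
one₁ = 2 ^ 1460
one₂ = 2 ^ 200
root₁ = root one₁ 1460 one₁ one₁
root₂ = root one₂ 200 one₂ one₂

-- In each pass the ratios q / Nmax and 2^U / q must exceed the number of targets tested, about 2²³ and 2²⁰.
first-pass : ∀ {n m ℓ a b′} → Solution n m ℓ a b′ → n ≤ 2 ^ 648 → n < 1482
first-pass = Certificate.reduce one₁ 1400 root₁ (2 ^ 648) 735 (2 ^ 688) 99 1482 refl

second-pass : ∀ {n m ℓ a b′} → Solution n m ℓ a b′ → n ≤ 1500 → n < 140
second-pass = Certificate.reduce one₂ 150 root₂ 1500 64 (2 ^ 36) 99 140 refl

bounded : ∀ {n m ℓ a b′} → Solution n m ℓ a b′ → n < 140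
bounded sol = second-pass sol (ℕP.≤-trans (ℕP.<⇒≤ (first-pass sol (ℕP.<⇒≤ (InitialBound.n-bounded field-K sol)))) (ℕP.≤ᵇ⇒≤ 1482 1500 tt))

repdigit-equation : ∀ a b′ ℓ .⦃ _ : NonZero b′ ⦄ → b′ * (a * ((suc b′ ^ ℓ ∸ 1) / b′)) + a ≡ a * suc b′ ^ ℓ
repdigit-equation a b′ ℓ = trans (cong (λ x → b′ * (a * x) + a) quotient) (trans (lem b′ a (digits 1 (suc b′) ℓ)) (cong (a *_) power))
  where
    power : b′ * digits 1 (suc b′) ℓ + 1 ≡ suc b′ ^ ℓ
    power = trans (digits-* 1 b′ ℓ) (ℕP.*-identityˡ (suc b′ ^ ℓ))
    quotient : (suc b′ ^ ℓ ∸ 1) / b′ ≡ digits 1 (suc b′) ℓ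
    quotient = trans (cong (λ x → (x ∸ 1) / b′) (trans (sym power) (cong (_+ 1) (ℕP.*-comm b′ (digits 1 (suc b′) ℓ))))) (trans (cong (_/ b′) (ℕP.m+n∸n≡m (digits 1 (suc b′) ℓ * b′) 1)) (DM.m*n/n≡m (digits 1 (suc b′) ℓ) b′))
    lem : ∀ b a d → b * (a * d) + a ≡ a * (b * d + 1)
    lem = ℕsolve-∀

verify : Tuple → Bool
verify (n , m , ℓ , a , suc (suc b)) = (m ≤ᵇ n) ∧ ((b ≤ᵇ 98) ∧ ((1 ≤ᵇ a) ∧ ((a ≤ᵇ suc b) ∧ ((3 ≤ᵇ ℓ) ∧ (N n + N m ≡ᵇ repdigit a (suc (suc b)) ℓ)))))
verify _ = false

verified : allᵇ verify solutions ≡ true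
verified = refl

verify-sound : ∀ t → verify t ≡ true → IsSolution t
verify-sound (n , m , ℓ , a , suc (suc b)) e = le {m} {n} (proj₁ e₁) , s≤s (s≤s z≤n) , s≤s (s≤s (le {b} {98} (proj₁ e₂))) , le {1} {a} (proj₁ e₃) , le {a} {suc b} (proj₁ e₄) , le {3} {ℓ} (proj₁ e₅) , λ _ → ≡ᵇ-elim (proj₂ e₅)
  where
    le : ∀ {x y} → (x ≤ᵇ y) ≡ true → x ≤ y
    le {x} {y} p = ℕP.≤ᵇ⇒≤ x y (true⇒T p)
    e₁ : _ × _
    e₁ = ∧-elim {m ≤ᵇ n} e
    e₂ : _ × _
    e₂ = ∧-elim {b ≤ᵇ 98} (proj₂ e₁)
    e₃ : _ × _
    e₃ = ∧-elim {1 ≤ᵇ a} (proj₂ e₂)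
    e₄ : _ × _
    e₄ = ∧-elim {a ≤ᵇ suc b} (proj₂ e₃)
    e₅ : _ × _
    e₅ = ∧-elim {3 ≤ᵇ ℓ} (proj₂ e₄)

complete : ∀ t → IsSolution t → t ∈ solutions
complete (n , m , ℓ , a , suc b′@(suc _)) (m≤n , _ , s≤s b′≤99 , 1≤a , a≤b′ , 3≤ℓ , equation) =
  small-solutions (bounded solution) m≤n (s≤s z≤n) b′≤99 1≤a a≤b′ 3≤ℓ (Solution.equation solution)
  where
    solution : Solution n m ℓ a b′
    solution = record { m≤n = m≤n ; 1≤b′ = s≤s z≤n ; b′≤99 = b′≤99 ; 1≤a = 1≤a ; a≤b′ = a≤b′
      ; equation = trans (cong (λ x → b′ * x + a) (equation _)) (repdigit-equation a b′ ℓ) }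
complete (n , m , ℓ , a , 0) (_ , () , _)
complete (n , m , ℓ , a , 1) (_ , s≤s () , _)

theorem1 : (t : Tuple) → IsSolution t ⇔ t ∈ solutions
theorem1 t = mk⇔ (complete t) λ t∈ → verify-sound t (allᵇ-∈ verify verified t∈)
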